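{- Let $n$ be a positive integer and write $8n+9=3^{\beta}n_1$ with $n_1$ a positive integer and $3\nmid n_1$. Then $$t(1,1,3,4;n)=\frac 12\Big(3^{\beta+1}\Big(\frac 3{n_1}\Big)-1\Big)\sum_{d\mid n_1}d\Big(\frac 3d\Big)-\sum_{\substack{a,b\in\mathbb N,\ 2\nmid a\\ 4(8n+9)=a^2+3b^2}}(-1)^{\frac{a-1}2}a,$$ where $d$ runs over positive divisors of $n_1$.
   Context: $\mathbb N$ is the set of positive integers and $\left(\frac{a}{m}\right)$ is the Legendre–Jacobi–Kronecker symbol. For positive integers $a,b,c,d$ and a nonnegative integer $n$, $t(a,b,c,d;n)$ denotes the number of $(x,y,z,w)\in\mathbb Z^4$ with $n=a\frac{x(x-1)}2+b\frac{y(y-1)}2+c\frac{z(z-1)}2+d\frac{w(w-1)}2$. -}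

module Defs where

open import Data.Nat as ℕ using (ℕ; zero; suc; _∸_; _^_; _≡ᵇ_; _%_)
open import Data.Nat.Divisibility using (_∣_; _∣?_)
open import Data.Integer as ℤ using (ℤ; +_; -_; _-_)
open import Data.Integer.DivMod using (_/_)
open import Data.Bool using (Bool; true; false; if_then_else_; _∨_; _∧_)
open import Data.List as List using (List; []; _∷_; map; filter; applyUpTo; foldr; length; concatMap)
open import Data.List.Membership.Propositional using (_∈_)
open import Data.List.Relation.Unary.Unique.Propositional using (Unique)
open import Data.Product using (Σ; _×_; _,_)
open import Relation.Binary.PropositionalEquality using (_≡_)
open import Function.Bundles using (_⇔_)
open import Relation.Nullary using (¬_)
open import Relation.Nullary.Decidable using (⌊_⌋; _×-dec_)
open import Data.Nat using (_≟_)

HasCount : {A : Set} → (A → Set) → ℤ → Set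
HasCount {A} P N =
  Σ (List A) λ L → Unique L × ((q : A) → (q ∈ L) ⇔ P q) × (+ length L ≡ N)

tri : ℤ → ℤ
tri x = (x ℤ.* (x - + 1)) / (+ 2)

TSol : ℕ → ℕ → ℕ → ℕ → ℕ → ℤ × ℤ × ℤ × ℤ → Set
TSol a b c d n (x , y , z , w) =
  + n ≡ + a ℤ.* tri x ℤ.+ + b ℤ.* tri y ℤ.+ + c ℤ.* tri z ℤ.+ + d ℤ.* tri w

tIs : ℕ → ℕ → ℕ → ℕ → ℕ → ℤ → Set
tIs a b c d n N = HasCount (TSol a b c d n) N

-- Kronecker symbol (a/m) for a : ℕ and m ≥ 1, defined as the
-- completely multiplicative function of m with
--   (a/p) = Legendre symbol (Euler's criterion) for odd primes p,
--   (a/2) = 0 if a even, 1 if a ≡ ±1 (mod 8), -1 if a ≡ ±3 (mod 8),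
--   (a/1) = 1.

-- Legendre symbol (a/p) for odd prime p = 2 + j, via Euler's criterion
legendre : ℕ → (j : ℕ) → ℤ
legendre a j =
  let p = suc (suc j)
      r = (a ^ ((p ∸ 1) ℕ./ 2)) % p
  in if r ≡ᵇ 0 then + 0 else (if r ≡ᵇ 1 then + 1 else - (+ 1))

kron2 : ℕ → ℤ
kron2 a =
  let r = a % 8
  in if (r ≡ᵇ 1) ∨ (r ≡ᵇ 7) then + 1
     else (if (r ≡ᵇ 3) ∨ (r ≡ᵇ 5) then - (+ 1) else + 0)

-- smallest divisor ≥ 2 of m, returned as j with divisor 2 + j
-- (search from 2 + j upwards with fuel)
minDivAux : ℕ → ℕ → ℕ → ℕ
minDivAux zero    j m = j
minDivAux (suc f) j m =
  if m % suc (suc j) ≡ᵇ 0 then j else minDivAux f (suc j) m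

-- for m ≥ 2, 2 + minDiv m is the least prime factor of m
minDiv : ℕ → ℕ
minDiv m = minDivAux m 0 m

kronAux : ℕ → ℕ → ℕ → ℤ
kronAux a zero    m = + 1
kronAux a (suc f) zero = + 1
kronAux a (suc f) (suc zero) = + 1
kronAux a (suc f) m@(suc (suc _)) =
  let j = minDiv m
      s = if j ≡ᵇ 0 then kron2 a else legendre a j
  in s ℤ.* kronAux a f (m ℕ./ suc (suc j))

-- Kronecker symbol (a/m), intended for m ≥ 1
kronecker : ℕ → ℕ → ℤ
kronecker a m = kronAux a m m

sumℤ : List ℤ → ℤ
sumℤ = foldr ℤ._+_ (+ 0)

range1 : ℕ → List ℕ
range1 m = applyUpTo suc m

sumDivisors : ℕ → (ℕ → ℤ) → ℤ
sumDivisors m f = sumℤ (map f (filter (λ d → d ∣? m) (range1 m)))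

sumPairs : ℕ → (ℕ → ℕ → Bool) → (ℕ → ℕ → ℤ) → ℤ
sumPairs M P f =
  sumℤ (concatMap (λ a → map (λ b → if P a b then f a b else + 0) (range1 M)) (range1 M))

sgnPow : ℕ → ℤ
sgnPow zero    = + 1
sgnPow (suc k) = - sgnPow k

-- Σ_{a,b ∈ ℕ, 2 ∤ a, K = a² + 3b²} (-1)^((a-1)/2) a.
-- Any such a, b satisfy a, b ≤ K, so summing over 1..K is exhaustive.
repSum : ℕ → ℤ
repSum K = sumPairs K
  (λ a b → (a % 2 ≡ᵇ 1) ∧ (K ≡ᵇ a ℕ.* a ℕ.+ 3 ℕ.* (b ℕ.* b)))
  (λ a b → sgnPow ((a ∸ 1) ℕ./ 2) ℤ.* + a)

{-# OPTIONS --safe #-}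
-- With N = 8n + 9, t counts the solutions of N = x² + y² + z² + 3w² with x, z, w odd (then y ≡ 2 mod 4). Let A count those
-- with y, z, w even. The solutions with z ≡ w (mod 2) number 2t + 2A, and t - A is a cusp form contribution.
-- * 2t + 2A = 6 E₂ - 2 E₁, where E₁ = Σ_{d | N} d χ₁₂(d) and E₂ = Σ_{d | N} (N/d) χ₁₂(d): the numbers of representations by
--   x² + y² and by u² + uv + v² are 4 Σ χ₄ and 6 Σ χ₃, so representations by their sums become sums of χ₄(a) χ₃(b) over
--   c a x + c′ b y = N. Liouville's identity with χ₁₂ evaluates enough of these, at N and at 3N, once the 3-neighbours of
--   the lattice of 2(u² + uv + v²) + s² + w² are related to x² + y² + z² + 3w².
-- * The count for x² + y² comes from Uspensky's identity on N = i² + dδ. The count for u² + uv + v² is obtained by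
--   comparing squares of power series: both squares are evaluated by Liouville's identity.
-- * t - A = -2 Σ (-1)^((a-1)/2) a over 4N = a² + 3b², by Uspensky's identity for χ₄ ⊗ χ₄.
-- * Gauss's lemma identifies (3/d) with χ₁₂(d) for d prime to 6, whence E₁ = Σ_{d | n₁} d (3/d) and E₂ = 3^β (3/n₁) E₁.
module Submission where

open import Defs
open import Data.Nat as ℕ using (ℕ; zero; suc; _^_)
open import Data.Nat.Divisibility using (_∣_)
import Data.Nat.Divisibility as ℕV
open import Data.Nat.Primality using (Prime; euclidsLemma; prime⇒nonTrivial; _Rough_; 2-rough; ∤⇒rough-suc; rough∧∣⇒prime)
import Data.Nat.Properties as ℕP
import Data.Nat.DivMod as ℕD
open import Data.Integer as ℤ using (ℤ; +_; -[1+_]; -_; _-_; 0ℤ; 1ℤ; _+_; _*_; _<_; _≤_; ∣_∣)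
import Data.Integer.Properties as ℤP
open import Data.Integer.DivMod using (_%ℕ_; _/ℕ_; a≡a%ℕn+[a/ℕn]*n; n%ℕd<d; div-pos-is-/ℕ)
open import Data.Integer.Tactic.RingSolver using (solve-∀)
open import Data.List as List using (List; []; _∷_; map; filter; upTo; _++_; cartesianProduct; length)
open import Data.List.Membership.Propositional using (_∈_)
open import Data.List.Membership.Propositional.Properties
  using (∈-map⁺; ∈-map⁻; ∈-filter⁺; ∈-filter⁻; ∈-++⁺ˡ; ∈-++⁺ʳ; ∈-++⁻; ∈-upTo⁺; ∈-applyUpTo⁺; ∈-applyUpTo⁻; ∈-cartesianProduct⁺)
open import Data.List.Membership.Propositional.Properties.WithK using (unique∧set⇒bag)
import Data.List.Properties as LP
open import Data.List.Relation.Binary.BagAndSetEquality using (∼bag⇒↭)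
open import Data.List.Relation.Binary.Permutation.Propositional as Perm using (_↭_)
open import Data.List.Relation.Unary.Any using (here; there)
import Data.List.Relation.Unary.All as All
import Data.List.Relation.Unary.All.Properties as AllP
open import Data.List.Relation.Unary.AllPairs using ([]; _∷_)
open import Data.List.Relation.Unary.Unique.Propositional using (Unique)
import Data.List.Relation.Unary.Unique.Propositional.Properties as UP
open import Data.Vec as Vec using (Vec; []; _∷_)
open import Data.Fin as Fin using (Fin; toℕ; fromℕ<)
import Data.Fin.Properties as FinP
open import Data.Product using (∃; _×_; _,_; proj₁; proj₂)
open import Data.Product.Properties using (,-injectiveʳ)
open import Data.Sum using (_⊎_; inj₁; inj₂)
open import Data.Empty using (⊥-elim)
open import Data.Bool using (Bool; if_then_else_; _∧_)
open import Function using (_∘_; id; case_of_)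
open import Function.Bundles using (mk⇔)
open import Relation.Binary using (tri<; tri≈; tri>)
open import Relation.Nullary using (¬_; Dec; yes; no; does)
open import Relation.Nullary.Decidable using (_×-dec_; _⊎-dec_; _→-dec_; ¬?; True; toWitness; map′)
open import Relation.Binary.PropositionalEquality
  using (_≡_; _≢_; refl; sym; cong; cong₂; subst)
  renaming (trans to infixr 20 _∙_)

-- Sums over finite sets

-- χ₁₂ is the right character because χ₁₂(2k - b) - χ₁₂(2k + b) factors into a function of k built
-- from χ₃ and a function of b built from χ₄: a Liouville sum of χ₁₂ is thereby a combination of
-- convolutions of the two representation numbers. The combinations available at N leave one degree
-- of freedom. Passing to 3N gives one more relation but also one more unknown; the neighbour
-- relation ties two of the unknowns to the total count of x² + y² + z² + 3w², and by symmetry that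
-- total is 3/2 of the count with z ≡ w that is sought. This closes the linear system.
--
-- t - A is accessible because both counts are controlled by the number α of solutions with x odd, y
-- ≡ 2 (mod 4) and z, w even. The substitution (z, w) = (V + 3W, V - W) gives t = 2α, and
-- congruences modulo 8 give A = B + 2α, where B counts the solutions of A with 4 | w, each with the
-- sign (-1)^(y/2). Only B remains, and its sign is what lets Uspensky's identity collapse a sum of
-- three squares to one square.

private variable
  A B : Set

+-congˡ : ∀ {a b c : ℤ} → b ≡ c → a + b ≡ a + c
+-congˡ refl = refl

-- Finiteness as data: a duplicate-free list of exactly the elements satisfying `P`. All sums below
-- run over such lists.
record Enum {A : Set} (P : A → Set) : Set where
  constructor enum
  field
    list     : List A
    unique   : Unique list
    sound    : ∀ {q} → q ∈ list → P q
    complete : ∀ {q} → P q → q ∈ list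
open Enum

private
  sum-cong : (L : List A) {f g : A → ℤ} → (∀ {x} → x ∈ L → f x ≡ g x) → sumℤ (map f L) ≡ sumℤ (map g L)
  sum-cong [] h = refl
  sum-cong (x ∷ L) h = cong₂ _+_ (h (here refl)) (sum-cong L (h ∘ there))

  sum-↭ : {L L′ : List A} (f : A → ℤ) → L ↭ L′ → sumℤ (map f L) ≡ sumℤ (map f L′)
  sum-↭ f Perm.refl = refl
  sum-↭ f (Perm.prep x p) = +-congˡ {f x} (sum-↭ f p)
  sum-↭ f (Perm.swap x y p) = cong (λ s → f x + (f y + s)) (sum-↭ f p) ∙ exch (f x) (f y) _
    where
    exch : ∀ a b c → a + (b + c) ≡ b + (a + c)
    exch = solve-∀
  sum-↭ f (Perm.trans p q) = sum-↭ f p ∙ sum-↭ f q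

  unique-map : {φ : A → B} {L : List A} → Unique L →
    (∀ {x y} → x ∈ L → y ∈ L → φ x ≡ φ y → x ≡ y) → Unique (map φ L)
  unique-map [] inj = []
  unique-map (x∉ ∷ u) inj =
    AllP.map⁺ (All.tabulate λ {y} y∈ φx≡φy → All.lookup x∉ y∈ (inj (here refl) (there y∈) φx≡φy))
    ∷ unique-map u λ a b → inj (there a) (there b)

opaque
  ∑ : {P : A → Set} → Enum P → (A → ℤ) → ℤ
  ∑ e f = sumℤ (map f (list e))

  ∑-list : {P : A → Set} (e : Enum P) (f : A → ℤ) → ∑ e f ≡ sumℤ (map f (list e))
  ∑-list e f = refl

  ∑-count : {P : A → Set} (e : Enum P) → ∑ e (λ _ → 1ℤ) ≡ + length (list e)
  ∑-count {A} e = go (list e)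
    where
    go : ∀ (L : List A) → sumℤ (map (λ _ → 1ℤ) L) ≡ + length L
    go [] = refl
    go (_ ∷ L) = +-congˡ {1ℤ} (go L)

  ∑-cong : {P : A → Set} (e : Enum P) {f g : A → ℤ} → (∀ x → P x → f x ≡ g x) → ∑ e f ≡ ∑ e g
  ∑-cong e h = sum-cong (list e) λ x∈ → h _ (sound e x∈)

  mapEnum : {P : A → Set} {Q : B → Set} (φ : A → B) (ψ : B → A) →
    (∀ x → P x → Q (φ x)) → (∀ y → Q y → P (ψ y)) →
    (∀ x → P x → ψ (φ x) ≡ x) → (∀ y → Q y → φ (ψ y) ≡ y) →
    Enum P → Enum Q
  mapEnum φ ψ PQ QP ψφ φψ e = record
    { list = map φ (list e)
    ; unique = unique-map (unique e) λ x∈ y∈ eq → sym (ψφ _ (sound e x∈)) ∙ (cong ψ eq ∙ ψφ _ (sound e y∈))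
    ; sound = λ q∈ → case ∈-map⁻ φ q∈ of λ { (x , x∈ , refl) → PQ x (sound e x∈) }
    ; complete = λ {q} Qq → subst (_∈ map φ (list e)) (φψ q Qq) (∈-map⁺ φ (complete e (QP q Qq)))
    }

  -- Duplicate-free lists with the same members are permutations of each other. A sum therefore
  -- depends on the predicate alone, and identities between sums can be proved by bijections between
  -- predicates.
  ∑-irr : {P : A → Set} (e e′ : Enum P) (f : A → ℤ) → ∑ e f ≡ ∑ e′ f
  ∑-irr e e′ f = sum-↭ f (∼bag⇒↭ (unique∧set⇒bag (unique e) (unique e′)
    (mk⇔ (complete e′ ∘ sound e) (complete e ∘ sound e′))))

  ∑-bij : {P : A → Set} {Q : B → Set} (e : Enum P) (e′ : Enum Q) (φ : A → B) (ψ : B → A) →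
    (∀ x → P x → Q (φ x)) → (∀ y → Q y → P (ψ y)) →
    (∀ x → P x → ψ (φ x) ≡ x) → (∀ y → Q y → φ (ψ y) ≡ y) →
    {f : A → ℤ} {g : B → ℤ} → (∀ x → P x → f x ≡ g (φ x)) →
    ∑ e f ≡ ∑ e′ g
  ∑-bij e e′ φ ψ PQ QP ψφ φψ {f} {g} fg =
    ∑-cong e fg ∙ (cong sumℤ (LP.map-∘ (list e)) ∙ ∑-irr (mapEnum φ ψ PQ QP ψφ φψ e) e′ g)

  ∑-id : {P Q : A → Set} (e : Enum P) (e′ : Enum Q) → (∀ x → P x → Q x) → (∀ x → Q x → P x) →
    {f g : A → ℤ} → (∀ x → P x → f x ≡ g x) → ∑ e f ≡ ∑ e′ g
  ∑-id e e′ PQ QP = ∑-bij e e′ id id PQ QP (λ _ _ → refl) (λ _ _ → refl)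

  ∑-inv : {P : A → Set} (e : Enum P) (φ : A → A) → (∀ x → P x → P (φ x)) → (∀ x → P x → φ (φ x) ≡ x) →
    {f g : A → ℤ} → (∀ x → P x → f x ≡ g (φ x)) → ∑ e f ≡ ∑ e g
  ∑-inv e φ pres inv = ∑-bij e e φ φ pres pres inv inv

  ∑-+ : {P : A → Set} (e : Enum P) (f g : A → ℤ) → ∑ e (λ x → f x + g x) ≡ ∑ e f + ∑ e g
  ∑-+ {A} e f g = go (list e)
    where
    exch : ∀ a b c d → (a + b) + (c + d) ≡ (a + c) + (b + d)
    exch = solve-∀
    go : ∀ (L : List A) → sumℤ (map (λ x → f x + g x) L) ≡ sumℤ (map f L) + sumℤ (map g L)
    go [] = refl
    go (x ∷ L) = +-congˡ {f x + g x} (go L) ∙ exch (f x) (g x) _ _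

  ∑-* : {P : A → Set} (e : Enum P) (c : ℤ) (f : A → ℤ) → ∑ e (λ x → c * f x) ≡ c * ∑ e f
  ∑-* {A} e c f = go (list e)
    where
    go : ∀ (L : List A) → sumℤ (map (λ x → c * f x) L) ≡ c * sumℤ (map f L)
    go [] = sym (ℤP.*-zeroʳ c)
    go (x ∷ L) = +-congˡ {c * f x} (go L) ∙ sym (ℤP.*-distribˡ-+ c (f x) _)

  ∑-0 : {P : A → Set} (e : Enum P) {f : A → ℤ} → (∀ x → P x → f x ≡ 0ℤ) → ∑ e f ≡ 0ℤ
  ∑-0 {A} e h = ∑-cong e h ∙ go (list e)
    where
    go : ∀ (L : List A) → sumℤ (map (λ _ → 0ℤ) L) ≡ 0ℤ
    go [] = refl
    go (_ ∷ L) = ℤP.+-identityˡ _ ∙ go L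

  ∑-neg : {P : A → Set} (e : Enum P) (f : A → ℤ) → ∑ e (λ x → - f x) ≡ - ∑ e f
  ∑-neg e f = ∑-cong e (λ x _ → sym (ℤP.-1*i≡-i (f x))) ∙ (∑-* e (- + 1) f ∙ ℤP.-1*i≡-i _)

  ∑-- : {P : A → Set} (e : Enum P) (f g : A → ℤ) → ∑ e (λ x → f x - g x) ≡ ∑ e f - ∑ e g
  ∑-- e f g = ∑-+ e f (λ x → - g x) ∙ +-congˡ {∑ e f} (∑-neg e g)

  self-neg⇒0 : ∀ a → a ≡ - a → a ≡ 0ℤ
  self-neg⇒0 (+ zero) _ = refl
  self-neg⇒0 (+ suc n) ()
  self-neg⇒0 -[1+ n ] ()

  -- A sign-reversing involution: reindexing shows that the sum is its own negative. At a fixed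
  -- point the hypothesis itself forces `f` to vanish.
  ∑-anti : {P : A → Set} (e : Enum P) (φ : A → A) → (∀ x → P x → P (φ x)) → (∀ x → P x → φ (φ x) ≡ x) →
    {f : A → ℤ} → (∀ x → P x → f x ≡ - f (φ x)) → ∑ e f ≡ 0ℤ
  ∑-anti e φ pres inv {f} h = self-neg⇒0 _ (∑-inv e φ pres inv {f} {λ x → - f x} h ∙ ∑-neg e f)

  restrict : {P : A → Set} {R : A → Set} → Enum P → (∀ x → Dec (R x)) → Enum (λ x → P x × R x)
  restrict e R? = record
    { list = filter R? (list e)
    ; unique = UP.filter⁺ R? (unique e)
    ; sound = λ q∈ → let (a , b) = ∈-filter⁻ R? q∈ in sound e a , b
    ; complete = λ (p , r) → ∈-filter⁺ R? (complete e p) r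
    }

  ∑-split : {P : A → Set} {R : A → Set} (e : Enum P) (R? : ∀ x → Dec (R x)) (f : A → ℤ) →
    ∑ e f ≡ ∑ (restrict e R?) f + ∑ (restrict e (¬? ∘ R?)) f
  ∑-split {A} e R? f = go (list e)
    where
    r1 : ∀ a b c → a + (b + c) ≡ (a + b) + c
    r1 = solve-∀
    r2 : ∀ a b c → a + (b + c) ≡ b + (a + c)
    r2 = solve-∀
    go : ∀ (L : List A) → sumℤ (map f L) ≡ sumℤ (map f (filter R? L)) + sumℤ (map f (filter (¬? ∘ R?) L))
    go [] = refl
    go (x ∷ L) with R? x
    ... | yes _ = +-congˡ {f x} (go L) ∙ r1 (f x) _ _
    ... | no _ = +-congˡ {f x} (go L) ∙ r2 (f x) (sumℤ (map f (filter R? L))) _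

  ∑-part : {P Q R : A → Set} (e : Enum P) (eQ : Enum Q) (eR : Enum R) →
    (∀ x → P x → Q x ⊎ R x) → (∀ x → Q x → P x) → (∀ x → R x → P x) → (∀ x → Q x → ¬ R x) →
    (f : A → ℤ) → ∑ e f ≡ ∑ eQ f + ∑ eR f
  ∑-part {A} {P} {Q} {R} e eQ eR split QP RP disj f =
    ∑-irr e (record
      { list = list eQ ++ list eR
      ; unique = UP.++⁺ (unique eQ) (unique eR) λ (a , b) → disj _ (sound eQ a) (sound eR b)
      ; sound = λ q∈ → case ∈-++⁻ (list eQ) q∈ of λ { (inj₁ a) → QP _ (sound eQ a) ; (inj₂ b) → RP _ (sound eR b) }
      ; complete = λ {q} p → case split q p of λ
          { (inj₁ a) → ∈-++⁺ˡ (complete eQ a) ; (inj₂ b) → ∈-++⁺ʳ (list eQ) (complete eR b) } }) f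
    ∙ go (list eQ)
    where
    go : ∀ (L : List A) → sumℤ (map f (L ++ list eR)) ≡ sumℤ (map f L) + ∑ eR f
    go [] = sym (ℤP.+-identityˡ _)
    go (x ∷ L) = +-congˡ {f x} (go L) ∙ sym (ℤP.+-assoc (f x) _ _)

private
  module Rows {I : A → Set} {F : A → B → Set} (eI : Enum I) (eF : ∀ a → Enum (F a)) where
    row : A → List (A × B)
    row a = map (a ,_) (list (eF a))
    cat : List A → List (A × B)
    cat [] = []
    cat (a ∷ L) = row a ++ cat L
    row⁻ : ∀ a {q} → q ∈ row a → proj₁ q ≡ a × F (proj₁ q) (proj₂ q)
    row⁻ a q∈ = case ∈-map⁻ (a ,_) q∈ of λ { (b , b∈ , refl) → refl , sound (eF a) b∈ }
    cat⁻ : ∀ L {q} → q ∈ cat L → proj₁ q ∈ L × F (proj₁ q) (proj₂ q)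
    cat⁻ (a ∷ L) q∈ with ∈-++⁻ (row a) q∈
    ... | inj₁ r = here (proj₁ (row⁻ a r)) , proj₂ (row⁻ a r)
    ... | inj₂ c = there (proj₁ (cat⁻ L c)) , proj₂ (cat⁻ L c)
    cat⁺ : ∀ L {a b} → a ∈ L → F a b → (a , b) ∈ cat L
    cat⁺ (a ∷ L) (here refl) p = ∈-++⁺ˡ (∈-map⁺ (a ,_) (complete (eF a) p))
    cat⁺ (a ∷ L) (there m) p = ∈-++⁺ʳ (row a) (cat⁺ L m p)
    catU : ∀ {L} → Unique L → Unique (cat L)
    catU [] = []
    catU {a ∷ L} (x∉ ∷ u) = UP.++⁺ (UP.map⁺ ,-injectiveʳ (unique (eF a))) (catU u)
      λ {q} (r , c) → All.lookup x∉ (proj₁ (cat⁻ L c)) (sym (proj₁ (row⁻ a r)))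
    opaque
      unfolding ∑
      catS : ∀ (f : A × B → ℤ) L → sumℤ (map f (cat L)) ≡ sumℤ (map (λ a → ∑ (eF a) (λ b → f (a , b))) L)
      catS f [] = refl
      catS f (a ∷ L) = app (row a) (cat L) ∙ cong₂ _+_ (cong sumℤ (sym (LP.map-∘ (list (eF a))))) (catS f L)
        where
        app : ∀ (L L′ : List (A × B)) → sumℤ (map f (L ++ L′)) ≡ sumℤ (map f L) + sumℤ (map f L′)
        app [] L′ = sym (ℤP.+-identityˡ _)
        app (x ∷ L) L′ = +-congˡ {f x} (app L L′) ∙ sym (ℤP.+-assoc (f x) _ _)

opaque
  unfolding ∑

  depEnum : {I : A → Set} {F : A → B → Set} → Enum I → (∀ a → Enum (F a)) → Enum {A × B} (λ (a , b) → I a × F a b)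
  depEnum eI eF = record
    { list = cat (list eI)
    ; unique = catU (unique eI)
    ; sound = λ q∈ → let (a∈ , b) = cat⁻ (list eI) q∈ in sound eI a∈ , b
    ; complete = λ (i , b) → cat⁺ (list eI) (complete eI i) b
    }
    where open Rows eI eF

  ∑-dep : {I : A → Set} {F : A → B → Set} (eI : Enum I) (eF : ∀ a → Enum (F a)) (f : A × B → ℤ) →
    ∑ (depEnum eI eF) f ≡ ∑ eI (λ a → ∑ (eF a) (λ b → f (a , b)))
  ∑-dep eI eF f = Rows.catS eI eF f (list eI)

  ∑-single : {P : A → Set} (e : Enum P) (a : A) → P a → (f : A → ℤ) →
    (∀ x → P x → x ≢ a → f x ≡ 0ℤ) → ∑ e f ≡ f a
  ∑-single {A} {P} e a Pa f h = go (list e) (unique e) (complete e Pa) (λ x∈ → sound e x∈)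
    where
    zeros : ∀ (L : List A) → (∀ {x} → x ∈ L → P x) → (∀ {x} → x ∈ L → x ≢ a) → sumℤ (map f L) ≡ 0ℤ
    zeros [] _ _ = refl
    zeros (x ∷ L) pr ne = cong₂ _+_ (h x (pr (here refl)) (ne (here refl))) (zeros L (pr ∘ there) (ne ∘ there))
    go : ∀ (L : List A) → Unique L → a ∈ L → (∀ {x} → x ∈ L → P x) → sumℤ (map f L) ≡ f a
    go (x ∷ L) (x∉ ∷ u) (here refl) pr = +-congˡ {f x} (zeros L (pr ∘ there) λ y∈ eq → All.lookup x∉ y∈ (sym eq)) ∙ ℤP.+-identityʳ _
    go (x ∷ L) (x∉ ∷ u) (there a∈) pr = cong₂ _+_ (h x (pr (here refl)) (All.lookup x∉ a∈)) (go L u a∈ (pr ∘ there)) ∙ ℤP.+-identityˡ _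

∑-fubini : {I : A → Set} {F : A → B → Set} {P : A × B → Set} (eI : Enum I) (eF : ∀ a → Enum (F a)) (eP : Enum P) →
  (∀ a b → P (a , b) → I a × F a b) → (∀ a b → I a → F a b → P (a , b)) → (f : A × B → ℤ) →
  ∑ eP f ≡ ∑ eI (λ a → ∑ (eF a) (λ b → f (a , b)))
∑-fubini eI eF eP to from f =
  ∑-id eP (depEnum eI eF) (λ (a , b) → to a b) (λ (a , b) (i , p) → from a b i p) (λ _ _ → refl) ∙ ∑-dep eI eF f

∑-product : {P : A → Set} {Q : B → Set} {R : A × B → Set} (e : Enum P) (e′ : Enum Q) (eR : Enum R) →
  (∀ a b → R (a , b) → P a × Q b) → (∀ a b → P a → Q b → R (a , b)) → (f : A → ℤ) (g : B → ℤ) →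
  ∑ eR (λ (a , b) → f a * g b) ≡ ∑ e f * ∑ e′ g
∑-product e e′ eR to from f g =
  ∑-fubini e (λ _ → e′) eR to from _
  ∙ (∑-cong e (λ a _ → ∑-* e′ (f a) g ∙ ℤP.*-comm (f a) _) ∙ (∑-* e (∑ e′ g) f ∙ ℤP.*-comm (∑ e′ g) _))

-- Finite sets cut out of boxes

record Boxed (A : Set) : Set where
  field
    size     : A → ℕ
    box      : ℕ → List A
    boxU     : ∀ n → Unique (box n)
    boxC     : ∀ {n} a → size a ℕ.≤ n → a ∈ box n
open Boxed {{...}}

instance
  ℤ-boxed : Boxed ℤ
  ℤ-boxed = record
    { size = ∣_∣
    ; box = λ n → map +_ (upTo (suc n)) ++ map -[1+_] (upTo n)
    ; boxU = λ n → UP.++⁺ (UP.map⁺ ℤP.+-injective (UP.upTo⁺ (suc n))) (UP.map⁺ ℤP.-[1+-injective (UP.upTo⁺ n))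
        λ (p , q) → case (∈-map⁻ +_ p , ∈-map⁻ -[1+_] q) of λ { ((_ , _ , refl) , (_ , _ , ())) }
    ; boxC = λ { (+ m) m≤ → ∈-++⁺ˡ (∈-map⁺ +_ (∈-upTo⁺ (ℕ.s≤s m≤)))
               ; {n} -[1+ m ] m< → ∈-++⁺ʳ (map +_ (upTo (suc n))) (∈-map⁺ -[1+_] (∈-upTo⁺ m<)) }
    }
  ×-boxed : {{Boxed A}} → {{Boxed B}} → Boxed (A × B)
  ×-boxed = record
    { size = λ (a , b) → size a ℕ.⊔ size b
    ; box = λ n → cartesianProduct (box n) (box n)
    ; boxU = λ n → UP.cartesianProduct⁺ (boxU n) (boxU n)
    ; boxC = λ (a , b) h → ∈-cartesianProduct⁺ (boxC a (ℕP.m⊔n≤o⇒m≤o (size a) (size b) h)) (boxC b (ℕP.m⊔n≤o⇒n≤o (size a) (size b) h))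
    }

opaque
  boxEnum : {{_ : Boxed A}} {P : A → Set} → (∀ a → Dec (P a)) → (n : ℕ) → (∀ a → P a → size a ℕ.≤ n) → Enum P
  boxEnum P? n bd = record
    { list = filter P? (box n)
    ; unique = UP.filter⁺ P? (boxU n)
    ; sound = λ q∈ → proj₂ (∈-filter⁻ P? {xs = box n} q∈)
    ; complete = λ {q} p → ∈-filter⁺ P? (boxC q (bd q p)) p
    }

-- Positivity, residues and characters

Pos : ℤ → Set
Pos x = 0ℤ < x

pos? : ∀ x → Dec (Pos x)
pos? x = 0ℤ ℤ.<? x

pos+ : ∀ {a b} → Pos a → Pos b → Pos (a + b)
pos+ = ℤP.+-mono-<

pos* : ∀ {a b} → Pos a → Pos b → Pos (a * b)
pos* {+ suc m} {+ suc n} _ _ = ℤ.+<+ (ℕ.s≤s ℕ.z≤n)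
pos* {+ zero} (ℤ.+<+ ())
pos* {+ suc m} {+ zero} _ (ℤ.+<+ ())

¬pos0 : ¬ Pos 0ℤ
¬pos0 (ℤ.+<+ ())

pos≡ : ∀ {a b} → a ≡ b → Pos a → Pos b
pos≡ = subst Pos

pos¬neg : ∀ {x} → Pos x → ¬ Pos (- x)
pos¬neg {x} p q = ¬pos0 (pos≡ (ℤP.+-inverseʳ x) (pos+ p q))

sgn : ∀ x → Pos x ⊎ (x ≡ 0ℤ ⊎ Pos (- x))
sgn x with ℤP.<-cmp 0ℤ x
... | tri< p _ _ = inj₁ p
... | tri≈ _ e _ = inj₂ (inj₁ (sym e))
... | tri> _ _ q = inj₂ (inj₂ (ℤP.neg-mono-< q))

cmp : ∀ a b → Pos (a - b) ⊎ (a ≡ b ⊎ Pos (b - a))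
cmp a b with sgn (a - b)
... | inj₁ p = inj₁ p
... | inj₂ (inj₁ e) = inj₂ (inj₁ (ℤP.i-j≡0⇒i≡j a b e))
... | inj₂ (inj₂ q) = inj₂ (inj₂ (pos≡ (eq a b) q))
  where
  eq : ∀ a b → - (a - b) ≡ b - a
  eq = solve-∀

pos*⁻ : ∀ {a b} → Pos a → Pos (a * b) → Pos b
pos*⁻ {a} {b} p q with sgn b
... | inj₁ r = r
... | inj₂ (inj₁ refl) = ⊥-elim (¬pos0 (pos≡ (ℤP.*-zeroʳ a) q))
... | inj₂ (inj₂ r) = ⊥-elim (pos¬neg q (pos≡ (sym (ℤP.neg-distribʳ-* a b)) (pos* p r)))

nn+ : ∀ {a b} → 0ℤ ≤ a → 0ℤ ≤ b → 0ℤ ≤ a + b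
nn+ = ℤP.+-mono-≤

nn* : ∀ {a b} → 0ℤ ≤ a → 0ℤ ≤ b → 0ℤ ≤ a * b
nn* {+ m} {+ n} _ _ = subst (0ℤ ≤_) (ℤP.pos-* m n) (ℤ.+≤+ ℕ.z≤n)

nn≡ : ∀ {a b} → a ≡ b → 0ℤ ≤ a → 0ℤ ≤ b
nn≡ = subst (0ℤ ≤_)

nn² : ∀ x → 0ℤ ≤ x * x
nn² (+ n) = nn* {+ n} {+ n} (ℤ.+≤+ ℕ.z≤n) (ℤ.+≤+ ℕ.z≤n)
nn² -[1+ n ] = ℤ.+≤+ ℕ.z≤n

pos⇒nn : ∀ {a} → Pos a → 0ℤ ≤ a
pos⇒nn = ℤP.<⇒≤

pos-pred : ∀ {a} → Pos a → 0ℤ ≤ a - 1ℤ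
pos-pred {+ suc n} p = ℤ.+≤+ ℕ.z≤n
pos-pred {+ zero} (ℤ.+<+ ())

nn⇒≡0⊎pos : ∀ {a} → 0ℤ ≤ a → a ≡ 0ℤ ⊎ Pos a
nn⇒≡0⊎pos {+ zero} _ = inj₁ refl
nn⇒≡0⊎pos {+ suc n} _ = inj₂ (ℤ.+<+ (ℕ.s≤s ℕ.z≤n))

nn-pos : ∀ {a b} → 0ℤ ≤ a → Pos b → Pos (a + b)
nn-pos = ℤP.+-mono-≤-<

abs-mono : ∀ {a N} → 0ℤ ≤ a → 0ℤ ≤ N - a → ∣ a ∣ ℕ.≤ ∣ N ∣
abs-mono {+ a} {N} p q with ℤP.0≤i-j⇒j≤i {N} {+ a} q
... | ℤ.+≤+ h = h

abs-sq : ∀ x {N} → 0ℤ ≤ N - x * x → ∣ x ∣ ℕ.≤ ∣ N ∣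
abs-sq x {N} h = ℕP.≤-trans (ℕP.≤-trans (le ∣ x ∣) (ℕP.≤-reflexive (sym (ℤP.abs-* x x)))) (abs-mono {x * x} {N} (nn² x) h)
  where
  le : ∀ n → n ℕ.≤ n ℕ.* n
  le zero = ℕ.z≤n
  le (suc n) = ℕP.m≤m*n (suc n) (suc n)

*-cancel : ∀ c {a b} → Pos c → c * a ≡ c * b → a ≡ b
*-cancel (+ suc n) {a} {b} _ = ℤP.*-cancelˡ-≡ (+ suc n) a b
*-cancel (+ zero) (ℤ.+<+ ())

pos-ℕ : ∀ n → Pos (+ suc n)
pos-ℕ n = ℤ.+<+ (ℕ.s≤s ℕ.z≤n)

-- Strong induction on positive integers; the recursion descends on a natural number `B` that bounds
-- `n` from above.
pos-rec : (P : ℤ → Set) → (∀ n → Pos n → (∀ i → Pos i → Pos (n - i) → P i) → P n) → ∀ n → Pos n → P n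
pos-rec P step n pn = go ∣ n ∣ n pn (nn≡ (sym (cong (_- n) (ℤP.0≤i⇒+∣i∣≡i (pos⇒nn pn)) ∙ ℤP.+-inverseʳ n)) (ℤ.+≤+ ℕ.z≤n))
  where
  i₀ : ∀ n → 0ℤ - n + n ≡ 0ℤ
  i₀ = solve-∀
  i₁ : ∀ B n i → (1ℤ + B) - n + (n - i - 1ℤ) ≡ B - i
  i₁ = solve-∀
  go : ∀ B n → Pos n → 0ℤ ≤ + B - n → P n
  go zero n pn b = ⊥-elim (¬pos0 (pos≡ (i₀ n) (nn-pos b pn)))
  go (suc B) n pn b = step n pn λ i pi lt → go B i pi (nn≡ (i₁ (+ B) n i) (nn+ b (pos-pred lt)))

-- Linear-combination certificates: once `l - r` is exhibited as a multiple of `p - q`, an equation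
-- p = q yields l = r. The multiplier `c` is the only creative input; the displayed identity goes to
-- the ring solver.
lc : ∀ {l r} c {p q} → p ≡ q → l - r ≡ c * (p - q) → l ≡ r
lc {l} {r} c {p} {q} refl h = ℤP.i-j≡0⇒i≡j l r (h ∙ (cong (c *_) (ℤP.+-inverseʳ p) ∙ ℤP.*-zeroʳ c))

lc2 : ∀ {l r} c {p q} → p ≡ q → ∀ c′ {p′ q′} → p′ ≡ q′ → l - r ≡ c * (p - q) + c′ * (p′ - q′) → l ≡ r
lc2 {l} {r} c {p} refl c′ {p′} refl h = ℤP.i-j≡0⇒i≡j l r (h ∙ cong₂ _+_
  (cong (c *_) (ℤP.+-inverseʳ p) ∙ ℤP.*-zeroʳ c) (cong (c′ *_) (ℤP.+-inverseʳ p′) ∙ ℤP.*-zeroʳ c′))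

-- Statements about residues of polynomial expressions are decided by running through all residue vectors.

data Ex (n : ℕ) : Set where
  var : Fin n → Ex n
  κ   : ℤ → Ex n
  _⊕_ _⊖_ _⊗_ : Ex n → Ex n → Ex n
infixl 7 _⊕_ _⊖_
infixl 8 _⊗_

ev : ∀ {n} → Vec ℤ n → Ex n → ℤ
ev ρ (var i) = Vec.lookup ρ i
ev ρ (κ z) = z
ev ρ (a ⊕ b) = ev ρ a + ev ρ b
ev ρ (a ⊖ b) = ev ρ a - ev ρ b
ev ρ (a ⊗ b) = ev ρ a * ev ρ b

pattern v0 = var Fin.zero
pattern v1 = var (Fin.suc Fin.zero)
pattern v2 = var (Fin.suc (Fin.suc Fin.zero))
pattern v3 = var (Fin.suc (Fin.suc (Fin.suc Fin.zero)))

-- The evidence that d divides m guarantees that the residue modulo d depends only on the residues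
-- of the variables modulo m.
data Entry (m n : ℕ) : Set where
  _mod_ : Ex n → (d : ℕ) → {{_ : ℕ.NonZero d}} → {_ : True (d ℕV.∣? m)} → Entry m n
infix 6 _mod_

private
  %-unique : ∀ d .{{_ : ℕ.NonZero d}} {x r q} → r ℕ.< d → x ≡ + r + q * + d → x %ℕ d ≡ r
  %-unique d {x} {r} {q} r<d eq = go (q - x /ℕ d) refl
    where
    r′ = x %ℕ d
    e1 : + r′ - + r ≡ (q - x /ℕ d) * + d
    e1 = lc2 (- 1ℤ) (a≡a%ℕn+[a/ℕn]*n x d) 1ℤ eq (id1 (+ r′) (+ r) q (x /ℕ d) (+ d) x)
      where
      id1 : ∀ a b q q′ d x → (a - b) - (q - q′) * d ≡ - 1ℤ * (x - (a + q′ * d)) + 1ℤ * (x - (b + q * d))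
      id1 = solve-∀
    big : ∀ {a b : ℕ} k → a ℕ.< d → + a - + b ≢ + suc k * + d
    big {a} {b} k a<d h = ℕP.<⇒≱ a<d (ℕP.≤-trans (ℕP.m≤n*m d (suc k)) (ℕP.m+n≤o⇒n≤o b
      (ℕP.≤-reflexive (ℤP.+-injective (ℤP.pos-+ b (suc k ℕ.* d) ∙ (+-congˡ {+ b} (ℤP.pos-* (suc k) d)
        ∙ lc (- 1ℤ) h (id2 (+ a) (+ b) (+ suc k * + d))))))))
      where
      id2 : ∀ a b c → b + c - a ≡ - 1ℤ * (a - b - c)
      id2 = solve-∀
    go : ∀ t → q - x /ℕ d ≡ t → r′ ≡ r
    go (+ zero) tq = ℤP.+-injective (ℤP.i-j≡0⇒i≡j (+ r′) (+ r) (e1 ∙ cong (_* + d) tq))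
    go (+ suc k) tq = ⊥-elim (big {r′} {r} k (n%ℕd<d x d) (e1 ∙ cong (_* + d) tq))
    go -[1+ k ] tq = ⊥-elim (big {r} {r′} k r<d (lc (- 1ℤ) (e1 ∙ cong (_* + d) tq) (id3 (+ r) (+ r′) (+ suc k) (+ d))))
      where
      id3 : ∀ a b c d → (a - b) - c * d ≡ - 1ℤ * (b - a - (- c) * d)
      id3 = solve-∀

%-shift : ∀ d .{{_ : ℕ.NonZero d}} x y k → x ≡ y + k * + d → x %ℕ d ≡ y %ℕ d
%-shift d x y k eq = %-unique d {x} {q = y /ℕ d + k} (n%ℕd<d y d)
  (lc2 1ℤ eq 1ℤ (a≡a%ℕn+[a/ℕn]*n y d) (id1 x y (+ (y %ℕ d)) (y /ℕ d) k (+ d)))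
  where
  id1 : ∀ x y r q k d → x - (r + (q + k) * d) ≡ 1ℤ * (x - (y + k * d)) + 1ℤ * (y - (r + q * d))
  id1 = solve-∀

private
  infix 4 _≈[_]_
  _≈[_]_ : ℤ → ℕ → ℤ → Set
  x ≈[ m ] y = ∃ λ k → x ≡ y + k * + m

  ev≈ : ∀ {n} m (ρ ρ′ : Vec ℤ n) → (∀ i → Vec.lookup ρ i ≈[ m ] Vec.lookup ρ′ i) → ∀ e → ev ρ e ≈[ m ] ev ρ′ e
  ev≈ m ρ ρ′ h (var i) = h i
  ev≈ m ρ ρ′ h (κ z) = 0ℤ , sym (ℤP.+-identityʳ z)
  ev≈ m ρ ρ′ h (a ⊕ b) with ev≈ m ρ ρ′ h a | ev≈ m ρ ρ′ h b
  ... | k , p | l , q = k + l , (cong₂ _+_ p q ∙ i (ev ρ′ a) (ev ρ′ b) k l (+ m))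
    where
    i : ∀ a b k l m → (a + k * m) + (b + l * m) ≡ a + b + (k + l) * m
    i = solve-∀
  ev≈ m ρ ρ′ h (a ⊖ b) with ev≈ m ρ ρ′ h a | ev≈ m ρ ρ′ h b
  ... | k , p | l , q = k - l , (cong₂ _-_ p q ∙ i (ev ρ′ a) (ev ρ′ b) k l (+ m))
    where
    i : ∀ a b k l m → (a + k * m) - (b + l * m) ≡ a - b + (k - l) * m
    i = solve-∀
  ev≈ m ρ ρ′ h (a ⊗ b) with ev≈ m ρ ρ′ h a | ev≈ m ρ ρ′ h b
  ... | k , p | l , q = k * ev ρ′ b + ev ρ′ a * l + k * l * + m , (cong₂ _*_ p q ∙ i (ev ρ′ a) (ev ρ′ b) k l (+ m))
    where
    i : ∀ a b k l m → (a + k * m) * (b + l * m) ≡ a * b + (k * b + a * l + k * l * m) * m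
    i = solve-∀

  rem : ∀ {m n} → Vec ℤ n → Entry m n → ℕ
  rem ρ (e mod d) = ev ρ e %ℕ d

  fins : ∀ {m n} → Vec (Fin m) n → Vec ℤ n
  fins = Vec.map (λ i → + toℕ i)

  rem≡ : ∀ {m n} (ρ ρ′ : Vec ℤ n) → (∀ i → Vec.lookup ρ i ≈[ m ] Vec.lookup ρ′ i) → (e : Entry m n) → rem ρ e ≡ rem ρ′ e
  rem≡ {m} ρ ρ′ h (_mod_ e d {w}) with ev≈ m ρ ρ′ h e | toWitness w
  ... | k , p | ℕV.divides q refl =
    %-shift d (ev ρ e) (ev ρ′ e) (k * + q) (p ∙ +-congˡ {ev ρ′ e} (cong (k *_) (ℤP.pos-* q d) ∙ sym (ℤP.*-assoc k (+ q) (+ d))))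

allVec? : ∀ {m} n {P : Vec (Fin m) n → Set} → (∀ v → Dec (P v)) → Dec (∀ v → P v)
allVec? zero P? = map′ (λ p → λ { [] → p }) (λ f → f []) (P? [])
allVec? (suc n) P? = map′ (λ f → λ { (i ∷ v) → f i v }) (λ f i v → f (i ∷ v)) (FinP.all? λ i → allVec? n λ v → P? (i ∷ v))

-- The decision procedure is evaluated on every vector of residues modulo `m`. Replacing each
-- variable by its residue changes no entry, so the verdict transfers to arbitrary integers.
by-residues : ∀ m .{{_ : ℕ.NonZero m}} {n k} (es : Vec (Entry m n) k) {P : Vec ℕ k → Set} (P? : ∀ v → Dec (P v)) →
  {_ : True (allVec? {m} n (λ r → P? (Vec.map (rem (fins r)) es)))} →
  ∀ ρ → P (Vec.map (rem ρ) es)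
by-residues m es {P} P? {w} ρ = subst P (maps es) (toWitness w (red ρ))
  where
  red : ∀ {n} → Vec ℤ n → Vec (Fin m) n
  red = Vec.map (λ x → fromℕ< (n%ℕd<d x m))
  close : ∀ {n} (ρ : Vec ℤ n) i → Vec.lookup (fins (red ρ)) i ≈[ m ] Vec.lookup ρ i
  close (x ∷ ρ) Fin.zero = - (x /ℕ m) , (cong +_ (FinP.toℕ-fromℕ< (n%ℕd<d x m))
    ∙ lc (- 1ℤ) (a≡a%ℕn+[a/ℕn]*n x m) (i (+ (x %ℕ m)) x (x /ℕ m) (+ m)))
    where
    i : ∀ r x q m → r - (x + - q * m) ≡ - 1ℤ * (x - (r + q * m))
    i = solve-∀
  close (x ∷ ρ) (Fin.suc i) = close ρ i
  maps : ∀ {k} (es : Vec (Entry m _) k) → Vec.map (rem (fins (red ρ))) es ≡ Vec.map (rem ρ) es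
  maps [] = refl
  maps (e ∷ es) = cong₂ _∷_ (rem≡ _ _ (close ρ) e) (maps es)

res≡ : ∀ m .{{_ : ℕ.NonZero m}} {n k} (es : Vec (Entry m n) k) (F G : Vec ℕ k → ℤ) →
  {_ : True (allVec? {m} n (λ r → F (Vec.map (rem (fins r)) es) ℤ.≟ G (Vec.map (rem (fins r)) es)))} →
  ∀ ρ → F (Vec.map (rem ρ) es) ≡ G (Vec.map (rem ρ) es)
res≡ m es F G {w} = by-residues m es (λ v → F v ℤ.≟ G v) {w}

res⇒ : ∀ m .{{_ : ℕ.NonZero m}} {n k} (es : Vec (Entry m n) k) (C D F G : Vec ℕ k → ℤ) →
  {_ : True (allVec? {m} n (λ r → (C (Vec.map (rem (fins r)) es) ℤ.≟ D (Vec.map (rem (fins r)) es))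
     →-dec (F (Vec.map (rem (fins r)) es) ℤ.≟ G (Vec.map (rem (fins r)) es))))} →
  ∀ ρ → C (Vec.map (rem ρ) es) ≡ D (Vec.map (rem ρ) es) → F (Vec.map (rem ρ) es) ≡ G (Vec.map (rem ρ) es)
res⇒ m es C D F G {w} = by-residues m es (λ v → (C v ℤ.≟ D v) →-dec (F v ℤ.≟ G v)) {w}

t4 t3 t12 t2 t4′ t3′ tz3 : ℕ → ℤ
t4 1 = 1ℤ
t4 3 = - 1ℤ
t4 _ = 0ℤ
t3 1 = 1ℤ
t3 2 = - 1ℤ
t3 _ = 0ℤ
t12 1 = 1ℤ
t12 11 = 1ℤ
t12 5 = - 1ℤ
t12 7 = - 1ℤ
t12 _ = 0ℤ
t2 1 = 1ℤ
t2 _ = 0ℤ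
t4′ 3 = 1ℤ
t4′ 9 = - 1ℤ
t4′ _ = 0ℤ
t3′ 2 = 1ℤ
t3′ 4 = - 1ℤ
t3′ _ = 0ℤ
tz3 0 = 1ℤ
tz3 _ = 0ℤ

χ4 χ3 χ12 odd χ4′ χ3′ z3 s₂ σ : ℤ → ℤ
χ4 x = t4 (x %ℕ 4)
χ3 x = t3 (x %ℕ 3)
χ12 x = t12 (x %ℕ 12)
odd x = t2 (x %ℕ 2)
z3 x = tz3 (x %ℕ 3)
-- χ4′ x = χ4 (x / 3) and χ3′ x = χ3 (x / 2), zero at non-multiples.
χ4′ x = t4′ (x %ℕ 12)
χ3′ x = t3′ (x %ℕ 6)
s₂ x = χ4 x + + 3 * χ4′ x
σ x = χ3 x + + 2 * χ3′ x

%0⇒mult : ∀ d .{{_ : ℕ.NonZero d}} x → x %ℕ d ≡ 0 → ∃ λ k → x ≡ + d * k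
%0⇒mult d x h = x /ℕ d , (a≡a%ℕn+[a/ℕn]*n x d ∙ (cong (λ r → + r + x /ℕ d * + d) h ∙ (ℤP.+-identityˡ _ ∙ ℤP.*-comm _ (+ d))))

mult⇒%0 : ∀ d .{{_ : ℕ.NonZero d}} x k → x ≡ + d * k → x %ℕ d ≡ 0
mult⇒%0 d x k h = %-shift d x 0ℤ k (h ∙ (ℤP.*-comm (+ d) k ∙ sym (ℤP.+-identityˡ _))) ∙ ℕD.m*n%n≡0 0 d

χ4-neg : ∀ x → χ4 (- x) ≡ - χ4 x
-- Expressions have no unary minus, so `- x` is treated as `0ℤ - x`.
χ4-neg x = subst (λ y → χ4 y ≡ - χ4 x) (ℤP.+-identityˡ (- x))
  (res≡ 4 (κ 0ℤ ⊖ v0 mod 4 ∷ v0 mod 4 ∷ []) (λ { (a ∷ _) → t4 a }) (λ { (_ ∷ b ∷ _) → - t4 b }) (x ∷ []))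

-- `σ` and `s₂` are defined so as to be the two factors here; the corrections 2 χ₃(k/2) and 3
-- χ₄(b/3) are what the imprimitive arguments require. The difference of χ₁₂ on the left is what
-- Liouville's identity produces.
χ12-key : ∀ k b → χ12 (+ 2 * k - b) - χ12 (+ 2 * k + b) ≡ σ k * s₂ b * odd b
χ12-key k b = res≡ 12 (κ (+ 2) ⊗ v0 ⊖ v1 mod 12 ∷ κ (+ 2) ⊗ v0 ⊕ v1 mod 12 ∷ v0 mod 3 ∷ v0 mod 6 ∷ v1 mod 4 ∷ v1 mod 12 ∷ v1 mod 2 ∷ [])
  (λ { (x ∷ y ∷ _) → t12 x - t12 y })
  (λ { (_ ∷ _ ∷ k3 ∷ k6 ∷ b4 ∷ b12 ∷ b2 ∷ []) → (t3 k3 + + 2 * t3′ k6) * (t4 b4 + + 3 * t4′ b12) * t2 b2 })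
  (k ∷ b ∷ [])

-- Liouville's identity

ℤ² ℤ³ ℤ⁴ : Set
ℤ² = ℤ × ℤ
ℤ³ = ℤ × ℤ × ℤ
ℤ⁴ = ℤ × ℤ × ℤ × ℤ

_>?_ : {A : Set} (u v : A → ℤ) → ∀ t → Dec (Pos (u t - v t))
(u >? v) t = pos? (u t - v t)

restrict-> : {P : A → Set} → Enum P → (u v : A → ℤ) → Enum (λ t → P t × Pos (u t - v t))
restrict-> e u v = restrict e (u >? v)

restrict-≡ : {P : A → Set} → Enum P → (u v : A → ℤ) → Enum (λ t → P t × u t ≡ v t)
restrict-≡ e u v = restrict e (λ t → u t ℤ.≟ v t)

∑-cmp : {P : A → Set} (e : Enum P) (u v : A → ℤ) (f : A → ℤ) →
  ∑ e f ≡ ∑ (restrict-> e u v) f + (∑ (restrict-≡ e u v) f + ∑ (restrict-> e v u) f)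
∑-cmp {P = P} e u v f = ∑-split e (u >? v) f ∙ +-congˡ {∑ (restrict-> e u v) f}
  (∑-part (restrict e (¬? ∘ (u >? v))) (restrict-≡ e u v) (restrict-> e v u)
    (λ t (p , ¬q) → case cmp (u t) (v t) of λ
      { (inj₁ q) → ⊥-elim (¬q q) ; (inj₂ (inj₁ q)) → inj₁ (p , q) ; (inj₂ (inj₂ q)) → inj₂ (p , q) })
    (λ t (p , q) → p , λ r → ¬pos0 (pos≡ (ℤP.i≡j⇒i-j≡0 q) r))
    (λ t (p , q) → p , λ r → pos¬neg q (pos≡ (neg (u t) (v t)) r))
    (λ t (_ , q) (_ , r) → ¬pos0 (pos≡ (ℤP.i≡j⇒i-j≡0 (sym q)) r)) f)
  where
  neg : ∀ a b → a - b ≡ - (b - a)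
  neg = solve-∀

-- The index set of a convolution of divisor sums: c i + c′ k = N together with factorizations i = a
-- x and k = b y.
Ω : ℤ → ℤ → ℤ → ℤ⁴ → Set
Ω c c′ N (a , b , x , y) = (Pos a × Pos b × Pos x × Pos y) × c * (a * x) + c′ * (b * y) ≡ N

private
  bound₁ : ∀ {c a x r N} → Pos c → Pos a → Pos x → 0ℤ ≤ r → c * (a * x) + r ≡ N → ∣ a ∣ ℕ.≤ ∣ N ∣
  bound₁ {c} {a} {x} {r} pc pa px pr refl = abs-mono {a} {c * (a * x) + r} (pos⇒nn pa)
    (nn≡ (i c a x r) (nn+ (nn* (pos-pred (pos* pc px)) (pos⇒nn pa)) pr))
    where
    i : ∀ c a x r → (c * x - 1ℤ) * a + r ≡ c * (a * x) + r - a
    i = solve-∀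

opaque
  Ω-enum : ∀ {c c′} → Pos c → Pos c′ → ∀ N → Enum (Ω c c′ N)
  Ω-enum {c} {c′} pc pc′ N = boxEnum
    (λ (a , b , x , y) → (pos? a ×-dec pos? b ×-dec pos? x ×-dec pos? y) ×-dec (_ ℤ.≟ N)) ∣ N ∣
    λ (a , b , x , y) ((pa , pb , px , py) , eq) →
      let ax = pos⇒nn (pos* pc (pos* pa px)) ; by = pos⇒nn (pos* pc′ (pos* pb py)) in
      ℕP.⊔-lub (bound₁ {c} {a} {x} pc pa px by eq)
      (ℕP.⊔-lub (bound₁ {c′} {b} {y} pc′ pb py ax (ℤP.+-comm (c′ * (b * y)) _ ∙ eq))
      (ℕP.⊔-lub (bound₁ {c} {x} {a} pc px pa by (cong (λ t → c * t + c′ * (b * y)) (ℤP.*-comm x a) ∙ eq))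
                (bound₁ {c′} {y} {b} pc′ py pb ax (ℤP.+-comm (c′ * (y * b)) _ ∙ (cong (λ t → c * (a * x) + c′ * t) (ℤP.*-comm y b) ∙ eq)))))

Dv : ℤ → ℤ → ℤ² → Set
Dv c N (e , d) = (Pos e × Pos d) × c * (e * d) ≡ N

opaque
  Dv-enum : ∀ {c} → Pos c → ∀ N → Enum (Dv c N)
  Dv-enum {c} pc N = boxEnum (λ (e , d) → (pos? e ×-dec pos? d) ×-dec (_ ℤ.≟ N)) ∣ N ∣
    λ (e , d) ((pe , pd) , eq) →
      ℕP.⊔-lub (bound₁ {c} {e} {d} pc pe pd (ℤ.+≤+ ℕ.z≤n) (ℤP.+-identityʳ _ ∙ eq))
               (bound₁ {c} {d} {e} pc pd pe (ℤ.+≤+ ℕ.z≤n) (ℤP.+-identityʳ _ ∙ (cong (c *_) (ℤP.*-comm d e) ∙ eq)))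

Below : ℤ → ℤ → Set
Below d k = Pos k × Pos (d - k)

opaque
  Below-enum : ∀ d → Enum (Below d)
  Below-enum d = boxEnum (λ k → pos? k ×-dec pos? (d - k)) ∣ d ∣
    λ k (p , q) → abs-mono {k} {d} (pos⇒nn p) (pos⇒nn q)

-- The boundary of Liouville's identity: a solution of a x + b y = N with a = b, or with x = y, is a
-- factorization of N in which one factor is cut into two positive parts.
Tri : ℤ → ℤ² × ℤ → Set
Tri N (ed , k) = Dv 1ℤ N ed × Below (proj₂ ed) k

opaque
  Tri-enum : ∀ N → Enum (Tri N)
  Tri-enum N = boxEnum
    (λ ((e , d) , k) → ((pos? e ×-dec pos? d) ×-dec (_ ℤ.≟ N)) ×-dec (pos? k ×-dec pos? (d - k))) ∣ N ∣
    λ ((e , d) , k) (((pe , pd) , eq) , (p , q)) →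
      let dN = bound₁ {1ℤ} {d} {e} (pos-ℕ 0) pd pe (ℤ.+≤+ ℕ.z≤n) (ℤP.+-identityʳ _ ∙ (cong (1ℤ *_) (ℤP.*-comm d e) ∙ eq)) in
      ℕP.⊔-lub (ℕP.⊔-lub (bound₁ {1ℤ} {e} {d} (pos-ℕ 0) pe pd (ℤ.+≤+ ℕ.z≤n) (ℤP.+-identityʳ _ ∙ eq)) dN)
               (ℕP.≤-trans (abs-mono {k} {d} (pos⇒nn p) (pos⇒nn q)) dN)

1+ : Pos 1ℤ
1+ = pos-ℕ 0

Ω₁ : ∀ N → Enum (Ω 1ℤ 1ℤ N)
Ω₁ = Ω-enum 1+ 1+

swapΩ : ℤ⁴ → ℤ⁴
swapΩ (a , b , x , y) = b , a , y , x

swapΩ-pres : ∀ {c c′} N t → Ω c c′ N t → Ω c′ c N (swapΩ t)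
swapΩ-pres {c} {c′} N (a , b , x , y) ((pa , pb , px , py) , eq) = (pb , pa , py , px) , (ℤP.+-comm (c′ * (b * y)) (c * (a * x)) ∙ eq)

pa pb px py : ℤ⁴ → ℤ
pa (a , b , x , y) = a
pb (a , b , x , y) = b
px (a , b , x , y) = x
py (a , b , x , y) = y

-- Unimodular substitutions that preserve a x + b y. Subtracting b from a and adding x to y carries
-- the region a > b onto y > x, with inverse `plus`. The substitution of `chain` carries b > a onto
-- x > y without touching a and y, hence preserves every `Ψ` that depends on these two only.
module Shear (Ψ : ℤ⁴ → ℤ) (Ψ-inv : ∀ A B X Y → Ψ (A , B + A , X - Y , Y) ≡ Ψ (A , B , X , Y)) (N : ℤ) where
  private
    e = Ω₁ N

    r1 : ∀ u v → u - v + v ≡ u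
    r1 = solve-∀
    r2 : ∀ u v → u + v - v ≡ u
    r2 = solve-∀
    r3 : ∀ u v → v + u - v ≡ u
    r3 = solve-∀
    r4 : ∀ u v → v + (u - v) ≡ u
    r4 = solve-∀
    q1 : ∀ a b x y → 1ℤ * ((a - b) * x) + 1ℤ * (b * (x + y)) ≡ 1ℤ * (a * x) + 1ℤ * (b * y)
    q1 = solve-∀
    q2 : ∀ a b x y → 1ℤ * ((a + b) * x) + 1ℤ * (b * (y - x)) ≡ 1ℤ * (a * x) + 1ℤ * (b * y)
    q2 = solve-∀
    q3 : ∀ a b x y → 1ℤ * (a * (x + y)) + 1ℤ * ((b - a) * y) ≡ 1ℤ * (a * x) + 1ℤ * (b * y)
    q3 = solve-∀
    q4 : ∀ a b x y → 1ℤ * (a * (x - y)) + 1ℤ * ((b + a) * y) ≡ 1ℤ * (a * x) + 1ℤ * (b * y)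
    q4 = solve-∀
    pr : ∀ {a a′ b b′ x x′ y y′ : ℤ} → a ≡ a′ → b ≡ b′ → x ≡ x′ → y ≡ y′ → (a , b , x , y) ≡ (a′ , b′ , x′ , y′)
    pr refl refl refl refl = refl

  minus : ∑ (restrict-> e pa pb) (λ (a , b , x , y) → Ψ (a - b , b , x , x + y)) ≡ ∑ (restrict-> e py px) Ψ
  minus = ∑-bij (restrict-> e pa pb) (restrict-> e py px) (λ (a , b , x , y) → a - b , b , x , x + y) (λ (a , b , x , y) → a + b , b , x , y - x)
    (λ (a , b , x , y) (((p , q , r , s) , eq) , g) → ((g , q , r , pos+ r s) , (q1 a b x y ∙ eq)) , pos≡ (sym (r3 y x)) s)
    (λ (a , b , x , y) (((p , q , r , s) , eq) , g) → ((pos+ p q , q , r , g) , (q2 a b x y ∙ eq)) , pos≡ (sym (r2 a b)) p)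
    (λ (a , b , x , y) _ → pr (r1 a b) refl refl (r3 y x))
    (λ (a , b , x , y) _ → pr (r2 a b) refl refl (r4 y x)) (λ _ _ → refl)

  plus : ∑ (restrict-> e py px) (λ (a , b , x , y) → Ψ (a + b , b , x , y - x)) ≡ ∑ (restrict-> e pa pb) Ψ
  plus = ∑-bij (restrict-> e py px) (restrict-> e pa pb) (λ (a , b , x , y) → a + b , b , x , y - x) (λ (a , b , x , y) → a - b , b , x , x + y)
    (λ (a , b , x , y) (((p , q , r , s) , eq) , g) → ((pos+ p q , q , r , g) , (q2 a b x y ∙ eq)) , pos≡ (sym (r2 a b)) p)
    (λ (a , b , x , y) (((p , q , r , s) , eq) , g) → ((g , q , r , pos+ r s) , (q1 a b x y ∙ eq)) , pos≡ (sym (r3 y x)) s)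
    (λ (a , b , x , y) _ → pr (r2 a b) refl refl (r4 y x))
    (λ (a , b , x , y) _ → pr (r1 a b) refl refl (r3 y x)) (λ _ _ → refl)

  chain : ∑ (restrict-> e pb pa) Ψ ≡ ∑ (restrict-> e px py) Ψ
  chain = ∑-bij (restrict-> e pb pa) (restrict-> e px py) (λ (a , b , x , y) → a , b - a , x + y , y) (λ (a , b , x , y) → a , b + a , x - y , y)
    (λ (a , b , x , y) (((p , q , r , s) , eq) , g) → ((p , g , pos+ r s , s) , (q3 a b x y ∙ eq)) , pos≡ (sym (r2 x y)) r)
    (λ (a , b , x , y) (((p , q , r , s) , eq) , g) → ((p , pos+ q p , g , s) , (q4 a b x y ∙ eq)) , pos≡ (sym (r2 b a)) q)
    (λ (a , b , x , y) _ → pr refl (r1 b a) (r2 x y) refl)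
    (λ (a , b , x , y) _ → pr refl (r2 b a) (r1 x y) refl)
    (λ (a , b , x , y) _ → cong Ψ (sym (pr refl (r1 b a) (r2 x y) refl)) ∙ Ψ-inv a (b - a) (x + y) y)

  -- The sums over y > x and over a > b are both completed to the sum over all solutions. The
  -- complements contain x > y and b > a, which agree by `chain`, so only the two diagonals are
  -- left.
  core : ∑ (restrict-> e pa pb) (λ (a , b , x , y) → Ψ (a - b , b , x , x + y))
       - ∑ (restrict-> e py px) (λ (a , b , x , y) → Ψ (a + b , b , x , y - x))
       ≡ ∑ (restrict-≡ e pa pb) Ψ - ∑ (restrict-≡ e py px) Ψ
  core = cong₂ _-_ minus plus ∙ comb (Σ′ (restrict-> e py px)) (Σ′ (restrict-≡ e py px)) (Σ′ (restrict-> e pa pb)) (Σ′ (restrict-≡ e pa pb)) (∑-cmp e py px Ψ) (∑-cmp e pa pb Ψ) chain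
    where
    Σ′ : {P : ℤ⁴ → Set} → Enum P → ℤ
    Σ′ e = ∑ e Ψ
    comb : ∀ Y>X Y=X A>B A=B {t X>Y B>A} → t ≡ Y>X + (Y=X + X>Y) → t ≡ A>B + (A=B + B>A) → B>A ≡ X>Y →
      Y>X - A>B ≡ A=B - Y=X
    comb Y>X Y=X A>B A=B {t} {X>Y} p q refl = lc2 (- 1ℤ) p 1ℤ q (alg t Y>X Y=X X>Y A>B A=B)
      where
      alg : ∀ t Y>X Y=X X>Y A>B A=B → (Y>X - A>B) - (A=B - Y=X)
        ≡ - 1ℤ * (t - (Y>X + (Y=X + X>Y))) + 1ℤ * (t - (A>B + (A=B + X>Y)))
      alg = solve-∀

-- Liouville's identity, with a weight c that is compatible with the shears through c₁.
module Liouville (f : ℤ → ℤ → ℤ) (f-even₁ : ∀ u v → f (- u) v ≡ f u v) (f-even₂ : ∀ u v → f u (- v) ≡ f u v)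
  (c c₁ : ℤ⁴ → ℤ)
  (c-swap : ∀ t → c (swapΩ t) ≡ c t)
  (c-minus : ∀ a b x y → c (a , b , x , y) ≡ c₁ (a - b , b , x , x + y))
  (c-plus : ∀ a b x y → c (a , b , x , y) ≡ c₁ (a + b , b , x , y - x))
  (c₁-inv : ∀ A B X Y → c₁ (A , B + A , X - Y , Y) ≡ c₁ (A , B , X , Y))
  (N : ℤ) where
  private
    e = Ω₁ N
    Ψ F G : ℤ⁴ → ℤ
    Ψ (a , b , x , y) = c₁ (a , b , x , y) * f a y
    F (a , b , x , y) = c (a , b , x , y) * f (a - b) (x + y)
    G (a , b , x , y) = c (a , b , x , y) * f (a + b) (x - y)
    module S = Shear Ψ (λ A B X Y → cong (_* f A Y) (c₁-inv A B X Y)) N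

    n1 : ∀ u v → - (u - v) ≡ v - u
    n1 = solve-∀

    F> : ∑ (restrict-> e pa pb) F ≡ ∑ (restrict-> e pa pb) (λ (a , b , x , y) → Ψ (a - b , b , x , x + y))
    F> = ∑-cong (restrict-> e pa pb) λ (a , b , x , y) _ → cong (_* f (a - b) (x + y)) (c-minus a b x y)
    F< : ∑ (restrict-> e pb pa) F ≡ ∑ (restrict-> e pa pb) F
    F< = ∑-bij (restrict-> e pb pa) (restrict-> e pa pb) swapΩ swapΩ
      (λ t (p , q) → swapΩ-pres {1ℤ} {1ℤ} N t p , q) (λ t (p , q) → swapΩ-pres {1ℤ} {1ℤ} N t p , q) (λ _ _ → refl) (λ _ _ → refl)
      λ (a , b , x , y) _ → cong₂ _*_ (sym (c-swap (a , b , x , y)))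
        (sym (f-even₁ (a - b) (x + y)) ∙ cong₂ f (n1 a b) (ℤP.+-comm x y))
    G> : ∑ (restrict-> e py px) G ≡ ∑ (restrict-> e py px) (λ (a , b , x , y) → Ψ (a + b , b , x , y - x))
    G> = ∑-cong (restrict-> e py px) λ (a , b , x , y) _ → cong₂ _*_ (c-plus a b x y)
      (sym (f-even₂ (a + b) (x - y)) ∙ cong (f (a + b)) (n1 x y))
    G< : ∑ (restrict-> e px py) G ≡ ∑ (restrict-> e py px) G
    G< = ∑-bij (restrict-> e px py) (restrict-> e py px) swapΩ swapΩ
      (λ t (p , q) → swapΩ-pres {1ℤ} {1ℤ} N t p , q) (λ t (p , q) → swapΩ-pres {1ℤ} {1ℤ} N t p , q) (λ _ _ → refl) (λ _ _ → refl)
      λ (a , b , x , y) _ → cong₂ _*_ (sym (c-swap (a , b , x , y)))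
        (sym (f-even₂ (a + b) (x - y)) ∙ cong₂ f (ℤP.+-comm a b) (n1 x y))

    F= G= : ℤ² × ℤ → ℤ
    F= ((d , D) , k) = c (d , d , D - k , k) * f 0ℤ D + + 2 * (c₁ (d , d , D - k , k) * f d k)
    G= ((d , D) , k) = c (k , D - k , d , d) * f D 0ℤ + + 2 * (c₁ (k , D - k , d , d) * f k d)

    s1 : ∀ u v → u + v - v ≡ u
    s1 = solve-∀
    s2 : ∀ d D k → 1ℤ * (d * (D - k)) + 1ℤ * (d * k) ≡ 1ℤ * (d * D)
    s2 = solve-∀
    s3 : ∀ b x y → 1ℤ * (b * (x + y)) ≡ 1ℤ * (b * x) + 1ℤ * (b * y)
    s3 = solve-∀
    s4 : ∀ u v → u - v + v ≡ u
    s4 = solve-∀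
    s5 : ∀ u v → v + u - v ≡ u
    s5 = solve-∀
    s6 : ∀ u v → v + (u - v) ≡ u
    s6 = solve-∀
    s7 : ∀ y a b → 1ℤ * (y * (a + b)) ≡ 1ℤ * (a * y) + 1ℤ * (b * y)
    s7 = solve-∀
    s8 : ∀ d D k → 1ℤ * (k * d) + 1ℤ * ((D - k) * d) ≡ 1ℤ * (d * D)
    s8 = solve-∀
    pr : ∀ {a a′ b b′ x x′ y y′ : ℤ} → a ≡ a′ → b ≡ b′ → x ≡ x′ → y ≡ y′ → (a , b , x , y) ≡ (a′ , b′ , x′ , y′)
    pr refl refl refl refl = refl
    pr3 : ∀ {a a′ b b′ x x′ : ℤ} → a ≡ a′ → b ≡ b′ → x ≡ x′ → ((a , b) , x) ≡ ((a′ , b′) , x′)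
    pr3 refl refl refl = refl

    -- On a = b the equation reads a (x + y) = N. The term 2 `Ψ` is the diagonal that the shears
    -- leave behind, counted once for each side of a = b.
    F≡ : ∑ (restrict-≡ e pa pb) (λ t → F t + + 2 * Ψ t) ≡ ∑ (Tri-enum N) F=
    F≡ = ∑-bij (restrict-≡ e pa pb) (Tri-enum N) (λ (a , b , x , y) → (b , x + y) , y) (λ ((d , D) , k) → d , d , D - k , k)
      (λ { (a , b , x , y) (((p , q , r , s) , eq) , refl) →
        ((p , pos+ r s) , (s3 a x y ∙ eq)) , (s , pos≡ (sym (s1 x y)) r) })
      (λ ((d , D) , k) (((p , q) , eq) , (r , s)) → ((p , p , s , r) , (s2 d D k ∙ eq)) , refl)
      (λ { (a , b , x , y) (_ , refl) → pr refl refl (s1 x y) refl })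
      (λ ((d , D) , k) _ → pr3 refl (s4 D k) refl)
      λ { (a , b , x , y) (_ , refl) → cong₂ _+_
        (cong₂ _*_ (cong c (pr refl refl (sym (s1 x y)) refl)) (cong (λ u → f u (x + y)) (ℤP.+-inverseʳ a)))
        (cong (λ u → + 2 * (u * f a y)) (cong c₁ (pr refl refl (sym (s1 x y)) refl))) }

    G≡ : ∑ (restrict-≡ e py px) (λ t → G t + + 2 * Ψ t) ≡ ∑ (Tri-enum N) G=
    G≡ = ∑-bij (restrict-≡ e py px) (Tri-enum N) (λ (a , b , x , y) → (y , a + b) , a) (λ ((d , D) , k) → k , D - k , d , d)
      (λ { (a , b , x , y) (((p , q , r , s) , eq) , refl) →
        ((s , pos+ p q) , (s7 y a b ∙ eq)) , (p , pos≡ (sym (s5 b a)) q) })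
      (λ ((d , D) , k) (((p , q) , eq) , (r , s)) → ((r , s , p , p) , (s8 d D k ∙ eq)) , refl)
      (λ { (a , b , x , y) (_ , refl) → pr refl (s5 b a) refl refl })
      (λ ((d , D) , k) _ → pr3 refl (s6 D k) refl)
      λ { (a , b , x , y) (_ , refl) → cong₂ _+_
        (cong₂ _*_ (cong c (pr refl (sym (s5 b a)) refl refl)) (cong (f (a + b)) (ℤP.+-inverseʳ y)))
        (cong (λ u → + 2 * (u * f a y)) (cong c₁ (pr refl (sym (s5 b a)) refl refl))) }

  -- Exchanging (a, x) with (b, y) identifies the regions a > b and b > a, and likewise y > x and x
  -- > y. Each off-diagonal region thus occurs twice, which is the origin of the factor 2 before the
  -- `c₁` terms.
  liouville : ∑ e (λ (a , b , x , y) → c (a , b , x , y) * (f (a - b) (x + y) - f (a + b) (x - y)))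
    ≡ ∑ (Tri-enum N) (λ ((d , D) , k) →
        (c (d , d , D - k , k) * f 0ℤ D + + 2 * (c₁ (d , d , D - k , k) * f d k))
        - (c (k , D - k , d , d) * f D 0ℤ + + 2 * (c₁ (k , D - k , d , d) * f k d)))
  liouville =
    ∑-cong e (λ (a , b , x , y) _ → dist (c (a , b , x , y)) _ _) ∙ (∑-- e F G
    ∙ (lc3 (Σ> F) (Σ= F) (Σ>′ G) (Σ=′ G) (Σ= Ψ) (Σ=′ Ψ) (∑-cmp e pa pb F) (∑-cmp e py px G) F< G< F> G> S.core
    ∙ (cong₂ _-_ (collect (restrict-≡ e pa pb) F ∙ F≡) (collect (restrict-≡ e py px) G ∙ G≡)
    ∙ sym (∑-- (Tri-enum N) F= G=))))
    where
    Σ> Σ= Σ>′ Σ=′ : (ℤ⁴ → ℤ) → ℤ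
    Σ> = ∑ (restrict-> e pa pb)
    Σ= = ∑ (restrict-≡ e pa pb)
    Σ>′ = ∑ (restrict-> e py px)
    Σ=′ = ∑ (restrict-≡ e py px)
    dist : ∀ c u v → c * (u - v) ≡ c * u - c * v
    dist = solve-∀
    collect : ∀ {P} (e : Enum P) F → ∑ e F + + 2 * ∑ e Ψ ≡ ∑ e (λ t → F t + + 2 * Ψ t)
    collect e F = +-congˡ {∑ e F} (sym (∑-* e (+ 2) Ψ)) ∙ sym (∑-+ e F _)
    lc3 : ∀ f> f= g> g= m= p= {ΣF ΣG f< g< m p} → ΣF ≡ f> + (f= + f<) → ΣG ≡ g> + (g= + g<) →
      f< ≡ f> → g< ≡ g> → f> ≡ m → g> ≡ p → m - p ≡ m= - p= → ΣF - ΣG ≡ (f= + + 2 * m=) - (g= + + 2 * p=)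
    lc3 f> f= g> g= m= p= refl refl refl refl refl refl h = lc (+ 2) h (i f> f= g> g= m= p=)
      where
      i : ∀ f> f= g> g= m= p= → ((f> + (f= + f>)) - (g> + (g= + g>))) - ((f= + + 2 * m=) - (g= + + 2 * p=))
        ≡ + 2 * ((f> - g>) - (m= - p=))
      i = solve-∀

-- Uspensky's identity

-- Telescoping, with `F` a discrete antiderivative of `w`; `F` vanishes at 1 because no k satisfies
-- 0 < k < 1.
below-closed : (w F : ℤ → ℤ) → F 1ℤ ≡ 0ℤ → (∀ x → F (x + 1ℤ) ≡ F x + w x) →
  ∀ D → Pos D → ∑ (Below-enum D) w ≡ F D
below-closed w F F1 step (+ zero) (ℤ.+<+ ())
below-closed w F F1 step (+ suc zero) _ = ∑-0 (Below-enum 1ℤ) (λ x (p , q) → ⊥-elim (none p q)) ∙ sym F1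
  where
  none : ∀ {x} → Pos x → ¬ Pos (1ℤ - x)
  none {+ suc zero} p (ℤ.+<+ ())
  none {+ zero} (ℤ.+<+ ())
below-closed w F F1 step (+ suc (suc n)) _ =
  ∑-part (Below-enum D′) (Below-enum D) at
    (λ x (p , q) → case nn⇒≡0⊎pos (pos-pred q) of λ
      { (inj₁ e) → inj₂ (lc (- 1ℤ) e (i1 (+ n) x))
      ; (inj₂ r) → inj₁ (p , pos≡ (i2 (+ n) x) r) })
    (λ x (p , q) → p , pos≡ (i3 (+ n) x) (pos+ q 1+))
    (λ { x refl → pos-ℕ n , pos≡ (i4 (+ n)) 1+ })
    (λ { x (p , q) refl → ¬pos0 (pos≡ (ℤP.+-inverseʳ D) q) }) w
  ∙ (cong₂ _+_ (below-closed w F F1 step (+ suc n) (pos-ℕ n)) (∑-single at D refl w (λ x e ne → ⊥-elim (ne e)))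
  ∙ (sym (step D) ∙ cong F (ℤP.+-comm D 1ℤ)))
  where
  D D′ : ℤ
  D = + suc n
  D′ = + suc (suc n)
  at : Enum (_≡ D)
  at = enum (D ∷ []) (All.[] ∷ []) (λ { (here e) → e }) here
  i1 : ∀ n x → x - (1ℤ + n) ≡ - 1ℤ * ((1ℤ + (1ℤ + n)) - x - 1ℤ - 0ℤ)
  i1 = solve-∀
  i2 : ∀ n x → (1ℤ + (1ℤ + n)) - x - 1ℤ ≡ (1ℤ + n) - x
  i2 = solve-∀
  i3 : ∀ n x → (1ℤ + n) - x + 1ℤ ≡ (1ℤ + (1ℤ + n)) - x
  i3 = solve-∀
  i4 : ∀ n → 1ℤ ≡ (1ℤ + (1ℤ + n)) - (1ℤ + n)
  i4 = solve-∀

t± tc te tε2 : ℕ → ℤ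
t± 0 = 1ℤ
t± _ = - 1ℤ
tc 0 = - 1ℤ
tc 1 = - 1ℤ
tc _ = 1ℤ
te 1 = 1ℤ
te 3 = - 1ℤ
te _ = 0ℤ
tε2 0 = 1ℤ
tε2 2 = - 1ℤ
tε2 _ = 0ℤ

-- alt x = (-1)^x and alt₂ x = (-1)^(x/2) for even x, 0 for odd x.
alt alt₂ : ℤ → ℤ
alt x = t± (x %ℕ 2)
alt₂ x = tε2 (x %ℕ 4)

odds-below : ∀ s → Pos s → ∑ (Below-enum (+ 2 * s)) odd ≡ s
odds-below s ps = *-cancel (+ 2) (pos-ℕ 1) (sym (∑-* (Below-enum (+ 2 * s)) (+ 2) odd)
  ∙ (below-closed (λ x → + 2 * odd x) (λ x → x - odd x) refl
      (λ x → lc 1ℤ (step x) (i x (odd x) (odd (x + 1ℤ)))) (+ 2 * s) (pos* (pos-ℕ 1) ps)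
  ∙ (cong (λ u → + 2 * s - u) (res≡ 2 (κ (+ 2) ⊗ v0 mod 2 ∷ []) (λ { (a ∷ []) → t2 a }) (λ _ → 0ℤ) (s ∷ []))
  ∙ ℤP.+-identityʳ _)))
  where
  step : ∀ x → - odd (x + 1ℤ) ≡ odd x - 1ℤ
  step x = res≡ 2 (v0 ⊕ κ 1ℤ mod 2 ∷ v0 mod 2 ∷ []) (λ { (a ∷ b ∷ []) → - t2 a }) (λ { (a ∷ b ∷ []) → t2 b - 1ℤ }) (x ∷ [])
  i : ∀ x o o′ → x + 1ℤ - o′ - (x - o + + 2 * o) ≡ 1ℤ * (- o′ - (o - 1ℤ))
  i = solve-∀

-- Twice x χ₄(x) has an antiderivative c(x) x + e(x) with coefficients of period 4, tabulated by
-- `tc` and `te`. At the even endpoint 2s the constant term is zero and c(2s) = -(-1)^s.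
χ4-moment : ∀ s → Pos s → ∑ (Below-enum (+ 2 * s)) (λ d → d * χ4 d) ≡ - (alt s * s)
χ4-moment s ps = *-cancel (+ 2) (pos-ℕ 1) (sym (∑-* (Below-enum (+ 2 * s)) (+ 2) _)
  ∙ (below-closed (λ x → + 2 * (x * χ4 x)) F refl
      (λ x → lc2 (x + 1ℤ) (step₁ x) 1ℤ (step₂ x) (i x (c (x + 1ℤ)) (e (x + 1ℤ)) (c x) (e x) (χ4 x)) ) (+ 2 * s) (pos* (pos-ℕ 1) ps)
  ∙ (cong₂ (λ u v → u * (+ 2 * s) + v)
       (res≡ 4 (κ (+ 2) ⊗ v0 mod 4 ∷ v0 mod 2 ∷ []) (λ { (a ∷ b ∷ []) → tc a }) (λ { (a ∷ b ∷ []) → - t± b }) (s ∷ []))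
       (res≡ 4 (κ (+ 2) ⊗ v0 mod 4 ∷ []) (λ { (a ∷ []) → te a }) (λ _ → 0ℤ) (s ∷ []))
  ∙ j (alt s) s)))
  where
  c e F : ℤ → ℤ
  c x = tc (x %ℕ 4)
  e x = te (x %ℕ 4)
  F x = c x * x + e x
  step₁ : ∀ x → c (x + 1ℤ) ≡ c x + + 2 * χ4 x
  step₁ x = res≡ 4 (v0 ⊕ κ 1ℤ mod 4 ∷ v0 mod 4 ∷ []) (λ { (a ∷ b ∷ []) → tc a }) (λ { (a ∷ b ∷ []) → tc b + + 2 * t4 b }) (x ∷ [])
  step₂ : ∀ x → e (x + 1ℤ) ≡ e x - c x - + 2 * χ4 x
  step₂ x = res≡ 4 (v0 ⊕ κ 1ℤ mod 4 ∷ v0 mod 4 ∷ []) (λ { (a ∷ b ∷ []) → te a }) (λ { (a ∷ b ∷ []) → te b - tc b - + 2 * t4 b }) (x ∷ [])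
  i : ∀ x c′ e′ c e χ → (c′ * (x + 1ℤ) + e′) - (c * x + e + + 2 * (x * χ)) ≡ (x + 1ℤ) * (c′ - (c + + 2 * χ)) + 1ℤ * (e′ - (e - c - + 2 * χ))
  i = solve-∀
  j : ∀ a s → - a * (+ 2 * s) + 0ℤ ≡ + 2 * - (a * s)
  j = solve-∀

U : ℤ → ℤ³ → Set
U n (i , d , δ) = (Pos d × Pos δ) × i * i + d * δ ≡ n

opaque
  U-enum : ∀ n → Enum (U n)
  U-enum n = boxEnum (λ (i , d , δ) → (pos? d ×-dec pos? δ) ×-dec (_ ℤ.≟ n)) ∣ n ∣
    λ (i , d , δ) ((pd , pδ) , eq) →
      ℕP.⊔-lub (abs-sq i {n} (nn≡ (lc 1ℤ eq (i1 i (d * δ) n)) (pos⇒nn (pos* pd pδ))))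
      (ℕP.⊔-lub (abs-mono {d} {n} (pos⇒nn pd) (nn≡ (lc 1ℤ eq (i2 i d δ n)) (nn+ (nn² i) (nn* (pos⇒nn pd) (pos-pred pδ)))))
                (abs-mono {δ} {n} (pos⇒nn pδ) (nn≡ (lc 1ℤ eq (i3 i d δ n)) (nn+ (nn² i) (nn* (pos⇒nn pδ) (pos-pred pd))))))
    where
    i1 : ∀ i m n → m - (n - i * i) ≡ 1ℤ * (i * i + m - n)
    i1 = solve-∀
    i2 : ∀ i d δ n → i * i + d * (δ - 1ℤ) - (n - d) ≡ 1ℤ * (i * i + d * δ - n)
    i2 = solve-∀
    i3 : ∀ i d δ n → i * i + δ * (d - 1ℤ) - (n - δ) ≡ 1ℤ * (i * i + d * δ - n)
    i3 = solve-∀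

neg-i : ℤ³ → ℤ³
neg-i (i , d , δ) = - i , d , δ

U-neg-i : ∀ n t → U n t → U n (neg-i t)
U-neg-i n (i , d , δ) (p , eq) = p , (cong (λ u → u + d * δ) (neg² i) ∙ eq)
  where
  neg² : ∀ i → - i * - i ≡ i * i
  neg² = solve-∀

neg-i² : ∀ t → neg-i (neg-i t) ≡ t
neg-i² (i , d , δ) = cong (_, d , δ) (ℤP.neg-involutive i)

Sq : ℤ → ℤ → Set
Sq n s = Pos s × s * s ≡ n

opaque
  Sq-enum : ∀ n → Enum (Sq n)
  Sq-enum n = boxEnum (λ s → pos? s ×-dec (_ ℤ.≟ n)) ∣ n ∣
    λ s (_ , eq) → abs-sq s {n} (nn≡ (sym (ℤP.i≡j⇒i-j≡0 (sym eq))) (ℤ.+≤+ ℕ.z≤n))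

-- Uspensky's identity: the reflections (i,d,δ) ↦ (δ-i, d+2i-δ, δ) and (i,d,δ) ↦ (-i,δ,d) of n = i² + dδ
-- cancel everything except the terms with δ = d + 2i, where n = (i+d)².
module Uspensky (G : ℤ → ℤ → ℤ) (G-odd₁ : ∀ x y → G (- x) y ≡ - G x y) (G-odd₂ : ∀ x y → G x (- y) ≡ - G x y) (n : ℤ) where
  private
    e = U-enum n
    f h : ℤ³ → ℤ
    f (i , d , δ) = G (δ - + 2 * i) (d + i) * χ4 (+ 2 * (d + i) - δ)
    h (i , d , δ) = G (d + δ) i * χ4 (d - δ)
    u v u′ v′ : ℤ³ → ℤ
    u (i , d , δ) = d + + 2 * i
    v (i , d , δ) = δ
    u′ (i , d , δ) = δ + + 2 * i
    v′ (i , d , δ) = d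

    pr : ∀ {a a′ b b′ x x′ : ℤ} → a ≡ a′ → b ≡ b′ → x ≡ x′ → (a , b , x) ≡ (a′ , b′ , x′)
    pr refl refl refl = refl

    k1 : ∀ i d δ → (δ - i) * (δ - i) + (d + + 2 * i - δ) * δ ≡ i * i + d * δ
    k1 = solve-∀
    k2 : ∀ i d δ → d ≡ d + + 2 * i - δ + + 2 * (δ - i) - δ
    k2 = solve-∀
    k3 : ∀ i d δ → δ - (δ - i) ≡ i
    k3 = solve-∀
    k4 : ∀ i d δ → d + + 2 * i - δ + + 2 * (δ - i) - δ ≡ d
    k4 = solve-∀
    k5 : ∀ i δ → δ - + 2 * (δ - i) ≡ - (δ - + 2 * i)
    k5 = solve-∀
    k6 : ∀ i d δ → d + + 2 * i - δ + (δ - i) ≡ d + i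
    k6 = solve-∀
    k7 : ∀ i d δ → (i + d) * (i + d) + d * (δ - (d + + 2 * i)) ≡ i * i + d * δ
    k7 = solve-∀
    k8 : ∀ i d δ → δ ≡ δ - (d + + 2 * i) + + 2 * (i + d) - d
    k8 = solve-∀
    k9 : ∀ i d δ → (i - d) * (i - d) + d * (δ + + 2 * i - d) ≡ i * i + d * δ
    k9 = solve-∀
    k10 : ∀ i d δ → δ ≡ δ + + 2 * i - d - (d + + 2 * (i - d))
    k10 = solve-∀
    k11 : ∀ i d → i + d - d ≡ i
    k11 = solve-∀
    k12 : ∀ i d → i - d + d ≡ i
    k12 = solve-∀
    k13 : ∀ i d δ → δ - + 2 * i ≡ d + (δ - (d + + 2 * i))
    k13 = solve-∀
    k14 : ∀ i d δ → + 2 * (d + i) - δ ≡ d - (δ - (d + + 2 * i))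
    k14 = solve-∀
    k15 : ∀ i d δ → - i * - i + δ * d ≡ i * i + d * δ
    k15 = solve-∀
    k16 : ∀ i d δ → d - (δ + + 2 * i) ≡ d + + 2 * - i - δ
    k16 = solve-∀

    upper : ∑ (restrict-> e u v) f ≡ 0ℤ
    upper = ∑-anti (restrict-> e u v) (λ (i , d , δ) → δ - i , d + + 2 * i - δ , δ)
      (λ (i , d , δ) (((p , q) , eq) , g) → ((g , q) , (k1 i d δ ∙ eq)) , pos≡ (k2 i d δ) p)
      (λ (i , d , δ) _ → pr (k3 i d δ) (k4 i d δ) refl)
      λ (i , d , δ) _ → neg-neg (G (δ - + 2 * i) (d + i)) (χ4 (+ 2 * (d + i) - δ)) (cong₂ _*_ (cong₂ G (k5 i δ) (k6 i d δ) ∙ G-odd₁ (δ - + 2 * i) (d + i)) (cong (λ t → χ4 (+ 2 * t - δ)) (k6 i d δ)))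
      where
      neg-neg : ∀ g x {g′} → g′ ≡ - g * x → g * x ≡ - g′
      neg-neg g x refl = i g x
        where
        i : ∀ g x → g * x ≡ - (- g * x)
        i = solve-∀

    h-sum : ∑ e h ≡ 0ℤ
    h-sum = ∑-anti e neg-i (U-neg-i n) (λ t _ → neg-i² t)
      λ (i , d , δ) _ → i2 (G (d + δ) i) (χ4 (d - δ)) (G-odd₂ (d + δ) i)
      where
      i2 : ∀ g x {g′} → g′ ≡ - g → g * x ≡ - (g′ * x)
      i2 g x refl = i3 g x
        where
        i3 : ∀ g x → g * x ≡ - (- g * x)
        i3 = solve-∀

    h-mid : ∑ (restrict-≡ e u′ v′) h ≡ 0ℤ
    h-mid = ∑-0 (restrict-≡ e u′ v′) λ { (i , d , δ) (_ , refl) →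
      cong (G (δ + + 2 * i + δ) i *_) (res≡ 4 (v1 ⊕ κ (+ 2) ⊗ v0 ⊖ v1 mod 4 ∷ []) (λ { (a ∷ []) → t4 a }) (λ _ → 0ℤ) (i ∷ δ ∷ []))
      ∙ ℤP.*-zeroʳ (G (δ + + 2 * i + δ) i) }

    h-flip : ∑ (restrict-> e v′ u′) h ≡ ∑ (restrict-> e u′ v′) h
    h-flip = ∑-bij (restrict-> e v′ u′) (restrict-> e u′ v′) φ φ
      (λ (i , d , δ) (((p , q) , eq) , g) → ((q , p) , (k15 i d δ ∙ eq)) , pos≡ (k16 i d δ) g)
      (λ (i , d , δ) (((p , q) , eq) , g) → ((q , p) , (k15 i d δ ∙ eq)) , pos≡ (k16′ i d δ) g)
      (λ (i , d , δ) _ → pr (ℤP.neg-involutive i) refl refl)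
      (λ (i , d , δ) _ → pr (ℤP.neg-involutive i) refl refl)
      λ (i , d , δ) _ → flip (G (d + δ) i) (χ4 (d - δ)) (cong₂ _*_ (cong (λ t → G t (- i)) (ℤP.+-comm δ d) ∙ G-odd₂ (d + δ) i) (cong χ4 (k18 d δ) ∙ χ4-neg (d - δ)))
      where
      φ : ℤ³ → ℤ³
      φ (i , d , δ) = - i , δ , d
      k16′ : ∀ i d δ → δ + + 2 * i - d ≡ δ - (d + + 2 * - i)
      k16′ = solve-∀
      k18 : ∀ d δ → δ - d ≡ - (d - δ)
      k18 = solve-∀
      flip : ∀ g x {r} → r ≡ - g * - x → g * x ≡ r
      flip g x refl = i g x
        where
        i : ∀ g x → g * x ≡ - g * - x
        i = solve-∀

    -- A shear carries this region to δ + 2i > d and turns the summand into `h`. The full sum of `h`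
    -- vanishes by i ↦ -i, its boundary d = δ + 2i vanishes because χ₄(2i) = 0, and (i, d, δ) ↦ (-i,
    -- δ, d) identifies the two sides; each side is therefore zero.
    lower : ∑ (restrict-> e v u) f ≡ 0ℤ
    lower = ∑-bij (restrict-> e v u) (restrict-> e u′ v′)
      (λ (i , d , δ) → i + d , d , δ - (d + + 2 * i)) (λ (i , d , δ) → i - d , d , δ + + 2 * i - d)
      (λ (i , d , δ) (((p , q) , eq) , g) → ((p , g) , (k7 i d δ ∙ eq)) , pos≡ (k8 i d δ) q)
      (λ (i , d , δ) (((p , q) , eq) , g) → ((p , g) , (k9 i d δ ∙ eq)) , pos≡ (k10 i d δ) q)
      (λ (i , d , δ) _ → pr (k11 i d) refl (sym (k8 i d δ)))
      (λ (i , d , δ) _ → pr (k12 i d) refl (sym (k10 i d δ)))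
      (λ (i , d , δ) _ → cong₂ _*_ (cong₂ G (k13 i d δ) (ℤP.+-comm d i)) (cong χ4 (k14 i d δ)))
      ∙ half (∑ (restrict-> e u′ v′) h) (sym (∑-cmp e u′ v′ h) ∙ h-sum) h-mid h-flip
      where
      half : ∀ x {y z} → x + (y + z) ≡ 0ℤ → y ≡ 0ℤ → z ≡ x → x ≡ 0ℤ
      half x p refl refl = *-cancel (+ 2) {x} {0ℤ} (pos-ℕ 1) (lc 1ℤ p (i x))
        where
        i : ∀ x → + 2 * x - + 2 * 0ℤ ≡ 1ℤ * (x + (0ℤ + x) - 0ℤ)
        i = solve-∀

    rim : ∑ (restrict-≡ e u v) f ≡ ∑ (depEnum (Sq-enum n) (λ s → Below-enum (+ 2 * s))) (λ (s , d) → G d s * χ4 d)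
    rim = ∑-bij (restrict-≡ e u v) (depEnum (Sq-enum n) (λ s → Below-enum (+ 2 * s)))
      (λ (i , d , δ) → d + i , d) (λ (s , d) → s - d , d , + 2 * s - d)
      (λ { (i , d , δ) (((p , q) , eq) , refl) → (pos*⁻ {+ 2} {d + i} (pos-ℕ 1) (pos≡ (m1 i d) (pos+ p q)) , (m2 i d ∙ eq)) , (p , pos≡ (m3 i d) q) })
      (λ { (s , d) ((ps , eq) , (p , q)) → ((p , q) , (m4 s d ∙ eq)) , m5 s d })
      (λ { (i , d , δ) (_ , refl) → pr (m6 i d) refl (m7 i d) })
      (λ (s , d) _ → cong (_, d) (m8 s d))
      (λ { (i , d , δ) (_ , refl) → cong₂ _*_ (cong (λ t → G t (d + i)) (m9 i d)) (cong χ4 (m10 i d)) })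
      where
      m1 : ∀ i d → d + (d + + 2 * i) ≡ + 2 * (d + i)
      m1 = solve-∀
      m2 : ∀ i d → (d + i) * (d + i) ≡ i * i + d * (d + + 2 * i)
      m2 = solve-∀
      m3 : ∀ i d → d + + 2 * i ≡ + 2 * (d + i) - d
      m3 = solve-∀
      m4 : ∀ s d → (s - d) * (s - d) + d * (+ 2 * s - d) ≡ s * s
      m4 = solve-∀
      m5 : ∀ s d → d + + 2 * (s - d) ≡ + 2 * s - d
      m5 = solve-∀
      m6 : ∀ i d → d + i - d ≡ i
      m6 = solve-∀
      m7 : ∀ i d → + 2 * (d + i) - d ≡ d + + 2 * i
      m7 = solve-∀
      m8 : ∀ s d → d + (s - d) ≡ s
      m8 = solve-∀
      m9 : ∀ i d → d + + 2 * i - + 2 * i ≡ d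
      m9 = solve-∀
      m10 : ∀ i d → + 2 * (d + i) - (d + + 2 * i) ≡ d
      m10 = solve-∀

  uspensky : ∑ e f ≡ ∑ (Sq-enum n) (λ s → ∑ (Below-enum (+ 2 * s)) (λ d → G d s * χ4 d))
  uspensky = ∑-cmp e u v f ∙ (cong₂ _+_ upper (cong₂ _+_ rim lower) ∙ (z _ ∙ ∑-dep (Sq-enum n) (λ s → Below-enum (+ 2 * s)) (λ (s , d) → G d s * χ4 d)))
    where
    z : ∀ x → 0ℤ + (x + 0ℤ) ≡ x
    z x = ℤP.+-identityˡ (x + 0ℤ) ∙ ℤP.+-identityʳ x

-- Uspensky's identity for the product of χ₄ in both variables. Averaging over i and -i reduces the
-- three characters to (-1)^(i/2) χ₄(δ) on even i and to 0 on odd i, thanks to n ≡ 1 (mod 4). On the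
-- other side χ₄(d)² counts the odd d below 2s, of which there are s.
signed-squares : ∀ n → n %ℕ 4 ≡ 1 → ∑ (U-enum n) (λ (i , d , δ) → alt₂ i * χ4 δ) ≡ ∑ (Sq-enum n) (λ s → s * χ4 s)
signed-squares n n≡1 = *-cancel (+ 2) (pos-ℕ 1) (
  sym (∑-* (U-enum n) (+ 2) (λ (i , d , δ) → alt₂ i * χ4 δ)) ∙ (sym sym-f ∙ (dbl ∙ cong (+ 2 *_) (Us.uspensky ∙ ∑-cong (Sq-enum n) rhs))))
  where
  module Us = Uspensky (λ x y → χ4 x * χ4 y) (λ x y → cong (_* χ4 y) (χ4-neg x) ∙ sym (ℤP.neg-distribˡ-* (χ4 x) (χ4 y)))
    (λ x y → cong (χ4 x *_) (χ4-neg y) ∙ sym (ℤP.neg-distribʳ-* (χ4 x) (χ4 y))) n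
  f : ℤ³ → ℤ
  f (i , d , δ) = χ4 (δ - + 2 * i) * χ4 (d + i) * χ4 (+ 2 * (d + i) - δ)
  dbl : ∑ (U-enum n) (λ t → f t + f (neg-i t)) ≡ + 2 * ∑ (U-enum n) f
  dbl = ∑-+ (U-enum n) f (f ∘ neg-i) ∙ (+-congˡ {∑ (U-enum n) f}
    (∑-inv (U-enum n) neg-i (U-neg-i n) (λ t _ → neg-i² t) {f ∘ neg-i} {f} (λ _ _ → refl)) ∙ i (∑ (U-enum n) f))
    where
    i : ∀ x → x + x ≡ + 2 * x
    i = solve-∀
  sym-f : ∑ (U-enum n) (λ t → f t + f (neg-i t)) ≡ ∑ (U-enum n) (λ (i , d , δ) → + 2 * (alt₂ i * χ4 δ))
  sym-f = ∑-cong (U-enum n) λ (i , d , δ) (_ , eq) → subst (λ j → f (i , d , δ) + f (j , d , δ) ≡ + 2 * (alt₂ i * χ4 δ)) (ℤP.+-identityˡ (- i))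
    (res⇒ 4 (v0 ⊗ v0 ⊕ v1 ⊗ v2 mod 4 ∷ v2 ⊖ κ (+ 2) ⊗ v0 mod 4 ∷ v1 ⊕ v0 mod 4 ∷ κ (+ 2) ⊗ (v1 ⊕ v0) ⊖ v2 mod 4
        ∷ v2 ⊖ κ (+ 2) ⊗ (κ 0ℤ ⊖ v0) mod 4 ∷ v1 ⊕ (κ 0ℤ ⊖ v0) mod 4 ∷ κ (+ 2) ⊗ (v1 ⊕ (κ 0ℤ ⊖ v0)) ⊖ v2 mod 4 ∷ v0 mod 4 ∷ v2 mod 4 ∷ [])
      (λ { (m ∷ _) → + m }) (λ _ → 1ℤ)
      (λ { (_ ∷ a ∷ b ∷ c ∷ a′ ∷ b′ ∷ c′ ∷ _) → t4 a * t4 b * t4 c + t4 a′ * t4 b′ * t4 c′ })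
      (λ { (_ ∷ _ ∷ _ ∷ _ ∷ _ ∷ _ ∷ _ ∷ p ∷ q ∷ []) → + 2 * (tε2 p * t4 q) })
      (i ∷ d ∷ δ ∷ []) (cong +_ (cong (_%ℕ 4) eq ∙ n≡1)))
  rhs : ∀ s → Sq n s → ∑ (Below-enum (+ 2 * s)) (λ d → χ4 d * χ4 s * χ4 d) ≡ s * χ4 s
  rhs s (ps , _) = ∑-cong (Below-enum (+ 2 * s)) (λ d _ → i (χ4 d) (χ4 s) ∙ cong (χ4 s *_)
      (res≡ 4 (v0 mod 4 ∷ v0 mod 2 ∷ []) (λ { (a ∷ b ∷ []) → t4 a * t4 a }) (λ { (a ∷ b ∷ []) → t2 b }) (d ∷ [])))
    ∙ (∑-* (Below-enum (+ 2 * s)) (χ4 s) odd ∙ (cong (χ4 s *_) (odds-below s ps) ∙ ℤP.*-comm (χ4 s) s))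
    where
    i : ∀ x y → x * y * x ≡ y * (x * x)
    i = solve-∀

-- Sums of two squares

R2 : ℤ → ℤ² → Set
R2 n (x , y) = x * x + y * y ≡ n

opaque
  R2-enum : ∀ n → Enum (R2 n)
  R2-enum n = boxEnum (λ (x , y) → _ ℤ.≟ n) ∣ n ∣ λ (x , y) eq →
    ℕP.⊔-lub (abs-sq x {n} (nn≡ (lc 1ℤ eq (i1 x y n)) (nn² y))) (abs-sq y {n} (nn≡ (lc 1ℤ eq (i2 x y n)) (nn² x)))
    where
    i1 : ∀ x y n → y * y - (n - x * x) ≡ 1ℤ * (x * x + y * y - n)
    i1 = solve-∀
    i2 : ∀ x y n → x * x - (n - y * y) ≡ 1ℤ * (x * x + y * y - n)
    i2 = solve-∀

count : {P : A → Set} → Enum P → ℤ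
count e = ∑ e (λ _ → 1ℤ)

r2 ρ : ℤ → ℤ
r2 n = count (R2-enum n)
ρ n = ∑ (Dv-enum 1+ n) (λ (e , _) → χ4 e)

private
  alt² : ∀ n → alt n * alt n ≡ 1ℤ
  alt² n = res≡ 2 (v0 mod 2 ∷ []) (λ { (a ∷ []) → t± a * t± a }) (λ _ → 1ℤ) (n ∷ [])

  -- Uspensky's identity for G(x, y) = x y. A common sign -(-1)^n appears on both sides and is
  -- cancelled; the part of the summand that is odd in i drops out.
  ρ-moment : ∀ n → ∑ (U-enum n) (λ (i , d , δ) → (d * δ - + 2 * (i * i)) * χ4 δ) ≡ n * count (Sq-enum n)
  ρ-moment n = cancel (alt n) (∑ (U-enum n) T₀) (n * count (Sq-enum n)) (alt² n) (sym lhs ∙ (Us.uspensky ∙ rhs))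
    where
    module Us = Uspensky _*_ (λ x y → sym (ℤP.neg-distribˡ-* x y)) (λ x y → sym (ℤP.neg-distribʳ-* x y)) n
    T₀ T₁ : ℤ³ → ℤ
    T₀ (i , d , δ) = (d * δ - + 2 * (i * i)) * χ4 δ
    T₁ (i , d , δ) = i * ((δ - + 2 * d) * χ4 δ)
    cancel : ∀ a x y → a * a ≡ 1ℤ → - a * x ≡ - a * y → x ≡ y
    cancel a x y h k = lc2 (- (x - y)) h (- a) k (i a x y)
      where
      i : ∀ a x y → x - y ≡ - (x - y) * (a * a - 1ℤ) + - a * (- a * x - - a * y)
      i = solve-∀
    χ-shift : ∀ i d δ → χ4 (+ 2 * (d + i) - δ) ≡ - alt (i * i + d * δ) * χ4 δ
    χ-shift i d δ = res≡ 4 (κ (+ 2) ⊗ (v1 ⊕ v0) ⊖ v2 mod 4 ∷ v0 ⊗ v0 ⊕ v1 ⊗ v2 mod 2 ∷ v2 mod 4 ∷ [])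
      (λ { (a ∷ _) → t4 a }) (λ { (_ ∷ b ∷ c ∷ []) → - t± b * t4 c }) (i ∷ d ∷ δ ∷ [])
    C0 : ∑ (U-enum n) T₁ ≡ 0ℤ
    C0 = ∑-anti (U-enum n) neg-i (U-neg-i n) (λ t _ → neg-i² t) λ (i , d , δ) _ → j i ((δ - + 2 * d) * χ4 δ)
      where
      j : ∀ i x → i * x ≡ - (- i * x)
      j = solve-∀
    lhs : ∑ (U-enum n) (λ (i , d , δ) → (δ - + 2 * i) * (d + i) * χ4 (+ 2 * (d + i) - δ)) ≡ - alt n * ∑ (U-enum n) T₀
    lhs = ∑-cong (U-enum n) (λ (i , d , δ) (_ , eq) →
        cong ((δ - + 2 * i) * (d + i) *_) (χ-shift i d δ ∙ cong (λ m → - alt m * χ4 δ) eq) ∙ j (alt n) i d δ (χ4 δ))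
      ∙ (∑-* (U-enum n) (- alt n) (λ t → T₀ t + T₁ t)
      ∙ cong (- alt n *_) (∑-+ (U-enum n) T₀ T₁ ∙ (+-congˡ {∑ (U-enum n) T₀} C0 ∙ ℤP.+-identityʳ _)))
      where
      j : ∀ a i d δ χ → (δ - + 2 * i) * (d + i) * (- a * χ) ≡ - a * ((d * δ - + 2 * (i * i)) * χ + i * ((δ - + 2 * d) * χ))
      j = solve-∀
    rhs : ∑ (Sq-enum n) (λ s → ∑ (Below-enum (+ 2 * s)) (λ d → d * s * χ4 d)) ≡ - alt n * (n * count (Sq-enum n))
    rhs = ∑-cong (Sq-enum n) (λ s (ps , eq) →
        ∑-cong (Below-enum (+ 2 * s)) (λ d _ → j d s (χ4 d)) ∙ (∑-* (Below-enum (+ 2 * s)) s (λ d → d * χ4 d)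
        ∙ (cong (s *_) (χ4-moment s ps) ∙ (k s (alt s) ∙ cong₂ (λ a m → - a * (m * 1ℤ)) (alt-sq s ∙ cong alt eq) eq))))
      ∙ (∑-* (Sq-enum n) (- alt n) (λ _ → n * 1ℤ) ∙ cong (- alt n *_) (∑-* (Sq-enum n) n (λ _ → 1ℤ)))
      where
      j : ∀ d s χ → d * s * χ ≡ s * (d * χ)
      j = solve-∀
      k : ∀ s a → s * - (a * s) ≡ - a * (s * s * 1ℤ)
      k = solve-∀
      alt-sq : ∀ s → alt s ≡ alt (s * s)
      alt-sq s = res≡ 2 (v0 mod 2 ∷ v0 ⊗ v0 mod 2 ∷ []) (λ { (a ∷ _) → t± a }) (λ { (_ ∷ b ∷ []) → t± b }) (s ∷ [])

  Z Z≤ Z= : ℤ → ℤ → Set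
  Z n i = Pos (n - i * i)
  Z≤ n i = 0ℤ ≤ n - i * i
  Z= n i = i * i ≡ n

  opaque
    Z-enum : ∀ n → Enum (Z n)
    Z-enum n = boxEnum (λ i → pos? _) ∣ n ∣ λ i p → abs-sq i {n} (pos⇒nn p)

  opaque
    Z≤-enum : ∀ n → Enum (Z≤ n)
    Z≤-enum n = boxEnum (λ i → _ ℤ.≤? _) ∣ n ∣ λ i p → abs-sq i {n} p

  opaque
    Z=-enum : ∀ n → Enum (Z= n)
    Z=-enum n = boxEnum (λ i → _ ℤ.≟ n) ∣ n ∣ λ i eq → abs-sq i {n} (nn≡ (sym (ℤP.i≡j⇒i-j≡0 (sym eq))) (ℤ.+≤+ ℕ.z≤n))

  r2-0 : r2 0ℤ ≡ 1ℤ
  r2-0 = ∑-single (R2-enum 0ℤ) (0ℤ , 0ℤ) refl (λ _ → 1ℤ) λ (x , y) eq ne → ⊥-elim (ne (cong₂ _,_ (z x y eq) (z y x (ℤP.+-comm (y * y) (x * x) ∙ eq))))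
    where
    z : ∀ x y → x * x + y * y ≡ 0ℤ → x ≡ 0ℤ
    z x y eq with nn⇒≡0⊎pos (nn² x)
    ... | inj₂ p = ⊥-elim (¬pos0 (pos≡ (ℤP.+-comm (y * y) (x * x) ∙ eq) (nn-pos (nn² y) p)))
    ... | inj₁ e with ℤP.i*j≡0⇒i≡0∨j≡0 x e
    ...   | inj₁ q = q
    ...   | inj₂ q = q

  Z=-count : ∀ n → Pos n → count (Z=-enum n) ≡ + 2 * count (Sq-enum n)
  Z=-count n pn = ∑-part (Z=-enum n) (Sq-enum n) negs
      (λ i eq → case sgn i of λ
        { (inj₁ p) → inj₁ (p , eq)
        ; (inj₂ (inj₁ refl)) → ⊥-elim (¬pos0 (pos≡ (sym eq) pn))
        ; (inj₂ (inj₂ p)) → inj₂ (p , (n² i ∙ eq)) })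
      (λ i (_ , eq) → eq) (λ i (_ , eq) → sym (n² i) ∙ eq) (λ i (p , _) (q , _) → pos¬neg p q) (λ _ → 1ℤ)
    ∙ (+-congˡ {count (Sq-enum n)} (∑-bij negs (Sq-enum n) -_ -_ (λ _ p → p)
        (λ i (p , eq) → pos≡ (sym (ℤP.neg-involutive i)) p , (n² (- i) ∙ (n² i ∙ eq)))
        (λ i _ → ℤP.neg-involutive i) (λ i _ → ℤP.neg-involutive i) (λ _ _ → refl)) ∙ d (count (Sq-enum n)))
    where
    n² : ∀ i → - i * - i ≡ i * i
    n² = solve-∀
    d : ∀ x → x + x ≡ + 2 * x
    d = solve-∀
    negs : Enum (λ i → Sq n (- i))
    negs = mapEnum -_ -_ (λ i (p , eq) → pos≡ (sym (ℤP.neg-involutive i)) p , (n² (- i) ∙ (n² i ∙ eq))) (λ _ p → p)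
      (λ i _ → ℤP.neg-involutive i) (λ i _ → ℤP.neg-involutive i) (Sq-enum n)

  Sph : ℤ → ℤ × ℤ² → Set
  Sph n (i , x , y) = i * i + (x * x + y * y) ≡ n

  opaque
    Sph-enum : ∀ n → Enum (Sph n)
    Sph-enum n = boxEnum (λ (i , x , y) → _ ℤ.≟ n) ∣ n ∣ λ (i , x , y) eq →
      ℕP.⊔-lub (abs-sq i {n} (nn≡ (lc 1ℤ eq (i1 i x y n)) (nn+ (nn² x) (nn² y))))
      (ℕP.⊔-lub (abs-sq x {n} (nn≡ (lc 1ℤ eq (i2 i x y n)) (nn+ (nn² i) (nn² y))))
                (abs-sq y {n} (nn≡ (lc 1ℤ eq (i3 i x y n)) (nn+ (nn² i) (nn² x)))))
      where
      i1 : ∀ i x y n → x * x + y * y - (n - i * i) ≡ 1ℤ * (i * i + (x * x + y * y) - n)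
      i1 = solve-∀
      i2 : ∀ i x y n → i * i + y * y - (n - x * x) ≡ 1ℤ * (i * i + (x * x + y * y) - n)
      i2 = solve-∀
      i3 : ∀ i x y n → i * i + x * x - (n - y * y) ≡ 1ℤ * (i * i + (x * x + y * y) - n)
      i3 = solve-∀

  -- On i² + x² + y² = n the weight n - 3i² is (x² - i²) + (y² - i²), which sums to zero by
  -- permuting the coordinates. The points with i² = n carry weight -2n each and are moved to the
  -- right-hand side.
  r2-moment : ∀ n → Pos n → ∑ (Z-enum n) (λ i → (n - + 3 * (i * i)) * r2 (n - i * i)) ≡ + 4 * (n * count (Sq-enum n))
  r2-moment n pn = lc2 1ℤ (sym split ∙ (sym fub ∙ zero′)) (- 1ℤ) rim (alg (∑ (Z-enum n) w) (∑ (Z=-enum n) w) (n * count (Sq-enum n)))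
    where
    w : ℤ → ℤ
    w i = (n - + 3 * (i * i)) * r2 (n - i * i)
    alg : ∀ z e s → z - + 4 * s ≡ 1ℤ * (z + e - 0ℤ) + - 1ℤ * (e - - (+ 4 * s))
    alg = solve-∀
    split : ∑ (Z≤-enum n) w ≡ ∑ (Z-enum n) w + ∑ (Z=-enum n) w
    split = ∑-part (Z≤-enum n) (Z-enum n) (Z=-enum n)
      (λ i p → case nn⇒≡0⊎pos p of λ { (inj₁ e) → inj₂ (sym (ℤP.i-j≡0⇒i≡j n (i * i) e)) ; (inj₂ q) → inj₁ q })
      (λ i → pos⇒nn) (λ i e → nn≡ (sym (ℤP.i≡j⇒i-j≡0 (sym e))) (ℤ.+≤+ ℕ.z≤n))
      (λ i p e → ¬pos0 (pos≡ (ℤP.i≡j⇒i-j≡0 (sym e)) p)) w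
    rim : ∑ (Z=-enum n) w ≡ - (+ 4 * (n * count (Sq-enum n)))
    rim = ∑-cong (Z=-enum n) (λ i e → cong₂ (λ u v → (n - + 3 * u) * v) e (cong r2 (ℤP.i≡j⇒i-j≡0 (sym e)) ∙ r2-0))
      ∙ (∑-* (Z=-enum n) (n - + 3 * n) (λ _ → 1ℤ) ∙ (cong ((n - + 3 * n) *_) (Z=-count n pn) ∙ i n (count (Sq-enum n))))
      where
      i : ∀ n c → (n - + 3 * n) * (+ 2 * c) ≡ - (+ 4 * (n * c))
      i = solve-∀
    W D₁ D₂ : ℤ × ℤ² → ℤ
    W (i , x , y) = n - + 3 * (i * i)
    D₁ (i , x , y) = x * x - i * i
    D₂ (i , x , y) = y * y - i * i
    fub : ∑ (Sph-enum n) W ≡ ∑ (Z≤-enum n) w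
    fub = ∑-fubini (Z≤-enum n) (λ i → R2-enum (n - i * i)) (Sph-enum n)
        (λ { i (x , y) refl → nn≡ (i1 i (x * x + y * y)) (nn+ (nn² x) (nn² y)) , i1 i (x * x + y * y) })
        (λ i (x , y) _ eq → lc 1ℤ eq (i2 i (x * x + y * y) n)) W
      ∙ ∑-cong (Z≤-enum n) λ i _ → ∑-cong (R2-enum (n - i * i)) (λ _ _ → sym (ℤP.*-identityʳ _)) ∙ ∑-* (R2-enum (n - i * i)) (n - + 3 * (i * i)) (λ _ → 1ℤ)
      where
      i1 : ∀ i m → m ≡ i * i + m - i * i
      i1 = solve-∀
      i2 : ∀ i m n → i * i + m - n ≡ 1ℤ * (m - (n - i * i))
      i2 = solve-∀
    zero′ : ∑ (Sph-enum n) W ≡ 0ℤ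
    zero′ = ∑-cong (Sph-enum n) (λ { (i , x , y) refl → i1 i x y }) ∙ (∑-+ (Sph-enum n) D₁ D₂ ∙ cong₂ _+_
      (∑-anti (Sph-enum n) (λ (i , x , y) → x , i , y) (λ (i , x , y) eq → s1 i x y ∙ eq) (λ _ _ → refl) (λ (i , x , y) _ → s3 (x * x) (i * i)))
      (∑-anti (Sph-enum n) (λ (i , x , y) → y , x , i) (λ (i , x , y) eq → s2 i x y ∙ eq) (λ _ _ → refl) (λ (i , x , y) _ → s3 (y * y) (i * i))))
      where
      i1 : ∀ i x y → i * i + (x * x + y * y) - + 3 * (i * i) ≡ (x * x - i * i) + (y * y - i * i)
      i1 = solve-∀
      s1 : ∀ i x y → x * x + (i * i + y * y) ≡ i * i + (x * x + y * y)
      s1 = solve-∀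
      s2 : ∀ i x y → y * y + (x * x + i * i) ≡ i * i + (x * x + y * y)
      s2 = solve-∀
      s3 : ∀ a b → a - b ≡ - (b - a)
      s3 = solve-∀

  ρ-moment′ : ∀ n → ∑ (Z-enum n) (λ i → (n - + 3 * (i * i)) * ρ (n - i * i)) ≡ n * count (Sq-enum n)
  ρ-moment′ n = sym (∑-fubini (Z-enum n) (λ i → Dv-enum 1+ (n - i * i)) flipU
        (λ i (δ , d) ((pd , pδ) , eq) → pos≡ (lc 1ℤ eq (i1 i d δ n)) (pos* pd pδ) , ((pδ , pd) , lc 1ℤ eq (i2 i d δ n)))
        (λ i (δ , d) _ ((pδ , pd) , eq) → (pd , pδ) , lc 1ℤ eq (i3 i d δ n)) (λ (i , δ , d) → (n - + 3 * (i * i)) * χ4 δ)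
      ∙ ∑-cong (Z-enum n) (λ i _ → ∑-* (Dv-enum 1+ (n - i * i)) (n - + 3 * (i * i)) (λ (δ , d) → χ4 δ)))
    ∙ (∑-bij flipU (U-enum n) sw sw (λ _ p → p) (λ _ p → p) (λ _ _ → refl) (λ _ _ → refl)
        (λ (i , δ , d) (_ , eq) → cong (_* χ4 δ) {n - + 3 * (i * i)} {d * δ - + 2 * (i * i)} (lc (- 1ℤ) eq (i4 i d δ n)))
    ∙ ρ-moment n)
    where
    sw : ℤ³ → ℤ³
    sw (i , d , δ) = i , δ , d
    flipU : Enum (U n ∘ sw)
    flipU = mapEnum sw sw (λ _ p → p) (λ _ p → p) (λ _ _ → refl) (λ _ _ → refl) (U-enum n)
    i1 : ∀ i d δ n → d * δ - (n - i * i) ≡ 1ℤ * (i * i + d * δ - n)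
    i1 = solve-∀
    i2 : ∀ i d δ n → 1ℤ * (δ * d) - (n - i * i) ≡ 1ℤ * (i * i + d * δ - n)
    i2 = solve-∀
    i3 : ∀ i d δ n → i * i + d * δ - n ≡ 1ℤ * (1ℤ * (δ * d) - (n - i * i))
    i3 = solve-∀
    i4 : ∀ i d δ n → n - + 3 * (i * i) - (d * δ - + 2 * (i * i)) ≡ - 1ℤ * (i * i + d * δ - n)
    i4 = solve-∀

-- Both sides satisfy Σ_{i² < n} (n - 3i²) F(n - i²) = 4 n [n is a square].
two-squares : ∀ n → Pos n → r2 n ≡ + 4 * ρ n
two-squares = pos-rec (λ n → r2 n ≡ + 4 * ρ n) λ n pn IH → step n pn IH
  where
  g : ℤ → ℤ
  g m = r2 m - + 4 * ρ m
  step : ∀ n → Pos n → (∀ i → Pos i → Pos (n - i) → r2 i ≡ + 4 * ρ i) → r2 n ≡ + 4 * ρ n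
  step n pn IH = ℤP.i-j≡0⇒i≡j (r2 n) (+ 4 * ρ n) (*-cancel n {g n} {0ℤ} pn (sym at0 ∙ (total ∙ sym (ℤP.*-zeroʳ n))))
    where
    w : ℤ → ℤ
    w i = (n - + 3 * (i * i)) * g (n - i * i)
    total : ∑ (Z-enum n) w ≡ 0ℤ
    total = ∑-cong (Z-enum n) (λ i _ → dist (n - + 3 * (i * i)) (r2 (n - i * i)) (ρ (n - i * i)))
      ∙ (∑-- (Z-enum n) (λ i → (n - + 3 * (i * i)) * r2 (n - i * i)) (λ i → + 4 * ((n - + 3 * (i * i)) * ρ (n - i * i)))
      ∙ (cong₂ _-_ (r2-moment n pn) (∑-* (Z-enum n) (+ 4) (λ i → (n - + 3 * (i * i)) * ρ (n - i * i)) ∙ cong (+ 4 *_) (ρ-moment′ n))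
      ∙ ℤP.+-inverseʳ (+ 4 * (n * count (Sq-enum n)))))
      where
      dist : ∀ a b c → a * (b - + 4 * c) ≡ a * b - + 4 * (a * c)
      dist = solve-∀
    -- For i ≠ 0 the argument n - i² is smaller than n and `g` vanishes there by induction, so the
    -- recursion determines `g n`.
    at0 : ∑ (Z-enum n) w ≡ n * g n
    at0 = ∑-single (Z-enum n) 0ℤ (pos≡ (sym (ℤP.+-identityʳ n)) pn) w (λ i p ne → vanish i p (nn⇒≡0⊎pos (nn² i)) ne)
      ∙ cong₂ _*_ (ℤP.+-identityʳ n) (cong g (ℤP.+-identityʳ n))
      where
      vanish : ∀ i → Z n i → i * i ≡ 0ℤ ⊎ Pos (i * i) → i ≢ 0ℤ → w i ≡ 0ℤ
      vanish i p (inj₁ e) ne with ℤP.i*j≡0⇒i≡0∨j≡0 i e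
      ... | inj₁ q = ⊥-elim (ne q)
      ... | inj₂ q = ⊥-elim (ne q)
      vanish i p (inj₂ q) ne = cong ((n - + 3 * (i * i)) *_) (ℤP.i≡j⇒i-j≡0 {r2 (n - i * i)} {+ 4 * ρ (n - i * i)} (IH (n - i * i) p (pos≡ (j n (i * i)) q)))
        ∙ ℤP.*-zeroʳ (n - + 3 * (i * i))
        where
        j : ∀ n m → m ≡ n - (n - m)
        j = solve-∀

-- Convolutions of characters

∑-supp : {P R : A → Set} (e : Enum P) (R? : ∀ x → Dec (R x)) (f : A → ℤ) →
  (∀ x → P x → ¬ R x → f x ≡ 0ℤ) → ∑ e f ≡ ∑ (restrict e R?) f
∑-supp e R? f h = ∑-split e R? f ∙ (+-congˡ {∑ (restrict e R?) f} (∑-0 (restrict e (¬? ∘ R?)) (λ x (p , r) → h x p r)) ∙ ℤP.+-identityʳ _)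

Div : ℕ → ℤ → Set
Div m x = x %ℕ suc m ≡ 0

div? : ∀ m x → Dec (Div m x)
div? m x = x %ℕ suc m ℕ.≟ 0

div-eq : ∀ m x → Div m x → + suc m * (x /ℕ suc m) ≡ x
div-eq m x h = sym (proj₂ (%0⇒mult (suc m) x h))

mul-div : ∀ m x → (+ suc m * x) /ℕ suc m ≡ x
mul-div m x = *-cancel (+ suc m) (pos-ℕ m) (div-eq m (+ suc m * x) (mult⇒%0 (suc m) (+ suc m * x) x refl))

mul-Div : ∀ m x → Div m (+ suc m * x)
mul-Div m x = mult⇒%0 (suc m) (+ suc m * x) x refl

-- Sums supported on multiples of m + 1 in one coordinate are reindexed by the quotient.
Dv-scale : ∀ m k (F : ℤ² → ℤ) → (∀ e d → Dv 1ℤ (+ suc m * k) (e , d) → ¬ Div m d → F (e , d) ≡ 0ℤ) →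
  ∑ (Dv-enum 1+ (+ suc m * k)) F ≡ ∑ (Dv-enum 1+ k) (λ (e , d) → F (e , + suc m * d))
Dv-scale m k F h = ∑-supp (Dv-enum 1+ _) (λ (_ , d) → div? m d) F (λ (e , d) → h e d)
  ∙ ∑-bij (restrict (Dv-enum 1+ _) (λ (_ , d) → div? m d)) (Dv-enum 1+ k) (λ (e , d) → e , d /ℕ suc m) (λ (e , d) → e , + suc m * d)
    (λ (e , d) (((pe , pd) , eq) , r) → (pe , pos*⁻ (pos-ℕ m) (pos≡ (sym (div-eq m d r)) pd)) ,
      *-cancel (+ suc m) (pos-ℕ m) (i (+ suc m) e (d /ℕ suc m) ∙ (cong (λ t → 1ℤ * (e * t)) (div-eq m d r) ∙ eq)))
    (λ (e , d) ((pe , pd) , eq) → ((pe , pos* (pos-ℕ m) pd) , (sym (i (+ suc m) e d) ∙ cong (+ suc m *_) eq)) , mul-Div m d)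
    (λ (e , d) (_ , r) → cong (e ,_) (div-eq m d r)) (λ (e , d) _ → cong (e ,_) (mul-div m d))
    (λ (e , d) (_ , r) → cong (λ t → F (e , t)) (sym (div-eq m d r)))
  where
  i : ∀ m e d → m * (1ℤ * (e * d)) ≡ 1ℤ * (e * (m * d))
  i = solve-∀

Dv-swap : ∀ k (F : ℤ² → ℤ) → ∑ (Dv-enum 1+ k) F ≡ ∑ (Dv-enum 1+ k) (λ (e , d) → F (d , e))
Dv-swap k F = ∑-inv (Dv-enum 1+ k) (λ (e , d) → d , e)
  (λ (e , d) ((pe , pd) , eq) → (pd , pe) , (cong (1ℤ *_) (ℤP.*-comm d e) ∙ eq)) (λ _ _ → refl) (λ _ _ → refl)

Dv-scale′ : ∀ m k (F : ℤ² → ℤ) → (∀ e d → Dv 1ℤ (+ suc m * k) (e , d) → ¬ Div m e → F (e , d) ≡ 0ℤ) →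
  ∑ (Dv-enum 1+ (+ suc m * k)) F ≡ ∑ (Dv-enum 1+ k) (λ (e , d) → F (+ suc m * e , d))
Dv-scale′ m k F h = Dv-swap (+ suc m * k) F ∙ (Dv-scale m k (λ (e , d) → F (d , e))
  (λ e d ((pe , pd) , eq) → h d e ((pd , pe) , (cong (1ℤ *_) (ℤP.*-comm d e) ∙ eq))) ∙ Dv-swap k (λ (e , d) → F (+ suc m * d , e)))

Ω-scale-a : ∀ m {c c′} (pc : Pos c) (pc′ : Pos c′) (pmc : Pos (+ suc m * c)) N (F : ℤ⁴ → ℤ) →
  (∀ a b x y → Ω c c′ N (a , b , x , y) → ¬ Div m a → F (a , b , x , y) ≡ 0ℤ) →
  ∑ (Ω-enum pc pc′ N) F ≡ ∑ (Ω-enum pmc pc′ N) (λ (a , b , x , y) → F (+ suc m * a , b , x , y))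
Ω-scale-a m {c} {c′} pc pc′ pmc N F h = ∑-supp (Ω-enum pc pc′ N) (λ (a , _) → div? m a) F (λ (a , b , x , y) → h a b x y)
  ∙ ∑-bij (restrict (Ω-enum pc pc′ N) (λ (a , _) → div? m a)) (Ω-enum pmc pc′ N)
    (λ (a , r) → a /ℕ suc m , r) (λ (a , r) → + suc m * a , r)
    (λ (a , b , x , y) (((p , q) , eq) , r) → (pos*⁻ (pos-ℕ m) (pos≡ (sym (div-eq m a r)) p) , q) ,
      (i (+ suc m) c (a /ℕ suc m) x (c′ * (b * y)) ∙ (cong (λ t → c * (t * x) + c′ * (b * y)) (div-eq m a r) ∙ eq)))
    (λ (a , b , x , y) ((p , q) , eq) → ((pos* (pos-ℕ m) p , q) , (sym (i (+ suc m) c a x (c′ * (b * y))) ∙ eq)) , mul-Div m a)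
    (λ (a , t) (_ , r) → cong (_, t) (div-eq m a r)) (λ (a , t) _ → cong (_, t) (mul-div m a))
    (λ (a , b , x , y) (_ , r) → cong (λ t → F (t , b , x , y)) (sym (div-eq m a r)))
  where
  i : ∀ m c a x r → m * c * (a * x) + r ≡ c * (m * a * x) + r
  i = solve-∀

transposeΩ : ∀ {c c′} (pc : Pos c) (pc′ : Pos c′) N (F : ℤ⁴ → ℤ) →
  ∑ (Ω-enum pc pc′ N) F ≡ ∑ (Ω-enum pc pc′ N) (λ (a , b , x , y) → F (x , b , a , y))
transposeΩ {c} {c′} pc pc′ N F = ∑-inv (Ω-enum pc pc′ N) (λ (a , b , x , y) → x , b , a , y)
  (λ (a , b , x , y) ((p , q , r , s) , eq) → (r , q , p , s) , (cong (λ t → c * t + c′ * (b * y)) (ℤP.*-comm x a) ∙ eq))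
  (λ _ _ → refl) (λ _ _ → refl)

∑-swapΩ : ∀ {c c′} (pc : Pos c) (pc′ : Pos c′) N (F : ℤ⁴ → ℤ) →
  ∑ (Ω-enum pc pc′ N) F ≡ ∑ (Ω-enum pc′ pc N) (F ∘ swapΩ)
∑-swapΩ {c} {c′} pc pc′ N F = ∑-bij (Ω-enum pc pc′ N) (Ω-enum pc′ pc N) swapΩ swapΩ
  (swapΩ-pres {c} {c′} N) (swapΩ-pres {c′} {c} N) (λ _ _ → refl) (λ _ _ → refl) (λ _ _ → refl)

Ω-scale-x : ∀ m {c c′} (pc : Pos c) (pc′ : Pos c′) (pmc : Pos (+ suc m * c)) N (F : ℤ⁴ → ℤ) →
  (∀ a b x y → Ω c c′ N (a , b , x , y) → ¬ Div m x → F (a , b , x , y) ≡ 0ℤ) →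
  ∑ (Ω-enum pc pc′ N) F ≡ ∑ (Ω-enum pmc pc′ N) (λ (a , b , x , y) → F (a , b , + suc m * x , y))
Ω-scale-x m {c} {c′} pc pc′ pmc N F h = transposeΩ pc pc′ N F
  ∙ (Ω-scale-a m pc pc′ pmc N (λ (a , b , x , y) → F (x , b , a , y))
      (λ a b x y ((p , q , r , s) , eq) → h x b a y ((r , q , p , s) , (cong (λ t → c * t + c′ * (b * y)) (ℤP.*-comm x a) ∙ eq)))
  ∙ transposeΩ pmc pc′ N (λ (a , b , x , y) → F (x , b , + suc m * a , y)))

Ad : ℤ → ℤ → ℤ → ℤ² → Set
Ad c c′ N (i , k) = (Pos i × Pos k) × c * i + c′ * k ≡ N

opaque
  Ad-enum : ∀ {c c′} → Pos c → Pos c′ → ∀ N → Enum (Ad c c′ N)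
  Ad-enum {c} {c′} pc pc′ N = boxEnum (λ (i , k) → (pos? i ×-dec pos? k) ×-dec (_ ℤ.≟ N)) ∣ N ∣
    λ { (i , k) ((p , q) , refl) → ℕP.⊔-lub
      (abs-mono {i} {c * i + c′ * k} (pos⇒nn p) (nn≡ (i1 c c′ i k) (nn+ (nn* (pos-pred pc) (pos⇒nn p)) (pos⇒nn (pos* pc′ q)))))
      (abs-mono {k} {c * i + c′ * k} (pos⇒nn q) (nn≡ (i2 c c′ i k) (nn+ (nn* (pos-pred pc′) (pos⇒nn q)) (pos⇒nn (pos* pc p))))) }
    where
    i1 : ∀ c c′ i k → (c - 1ℤ) * i + c′ * k ≡ c * i + c′ * k - i
    i1 = solve-∀
    i2 : ∀ c c′ i k → (c′ - 1ℤ) * k + c * i ≡ c * i + c′ * k - k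
    i2 = solve-∀

∑-dep-product : {I : A → Set} {F G : A → ℤ² → Set} (eI : Enum I) (eF : ∀ a → Enum (F a)) (eG : ∀ a → Enum (G a)) (f g : ℤ² → ℤ) →
  ∑ (depEnum eI (λ a → depEnum (eF a) (λ _ → eG a))) (λ (_ , p , q) → f p * g q) ≡ ∑ eI (λ a → ∑ (eF a) f * ∑ (eG a) g)
∑-dep-product eI eF eG f g = ∑-dep eI (λ a → depEnum (eF a) (λ _ → eG a)) _ ∙ ∑-cong eI λ a _ →
  ∑-product (eF a) (eG a) (depEnum (eF a) (λ _ → eG a)) (λ _ _ r → r) (λ _ _ p q → p , q) f g

-- Solutions are grouped by the products i = a x and k = b y.
conv : ∀ {c c′} (pc : Pos c) (pc′ : Pos c′) N (f g : ℤ² → ℤ) →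
  ∑ (Ω-enum pc pc′ N) (λ (a , b , x , y) → f (a , x) * g (b , y))
    ≡ ∑ (Ad-enum pc pc′ N) (λ (i , k) → ∑ (Dv-enum 1+ i) f * ∑ (Dv-enum 1+ k) g)
conv {c} {c′} pc pc′ N f g = ∑-bij (Ω-enum pc pc′ N)
    (depEnum (Ad-enum pc pc′ N) (λ (i , k) → depEnum (Dv-enum 1+ i) (λ _ → Dv-enum 1+ k)))
    (λ (a , b , x , y) → (a * x , b * y) , (a , x) , (b , y)) (λ (_ , (a , x) , (b , y)) → a , b , x , y)
    (λ (a , b , x , y) ((p , q , r , s) , eq) → ((pos* p r , pos* q s) , eq) , ((p , r) , ℤP.*-identityˡ (a * x)) , ((q , s) , ℤP.*-identityˡ (b * y)))
    (λ ((i , k) , (a , x) , (b , y)) ((_ , eq) , ((p , r) , e₁) , ((q , s) , e₂)) →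
      (p , q , r , s) , (cong₂ (λ u v → c * u + c′ * v) (sym (ℤP.*-identityˡ (a * x)) ∙ e₁) (sym (ℤP.*-identityˡ (b * y)) ∙ e₂) ∙ eq))
    (λ _ _ → refl)
    (λ ((i , k) , (a , x) , (b , y)) (_ , (_ , e₁) , (_ , e₂)) →
      cong₂ (λ u v → (u , v) , (a , x) , (b , y)) (sym (ℤP.*-identityˡ (a * x)) ∙ e₁) (sym (ℤP.*-identityˡ (b * y)) ∙ e₂))
    (λ _ _ → refl)
  ∙ ∑-dep-product (Ad-enum pc pc′ N) (λ (i , _) → Dv-enum 1+ i) (λ (_ , k) → Dv-enum 1+ k) f g

even : ℤ → ℤ
even x = 1ℤ - odd x

-- Liouville's identity on odd solutions

private
  -- `evens` is what the condition that all four coordinates are odd becomes after a shear: a ± b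
  -- and x ± y are even, while b and x remain odd.
  odds evens : ℤ⁴ → ℤ
  odds (a , b , x , y) = odd a * odd b * (odd x * odd y)
  evens (a , b , x , y) = even a * odd b * (odd x * even y)

  odds-minus : ∀ a b x y → odds (a , b , x , y) ≡ evens (a - b , b , x , x + y)
  odds-minus a b x y = res≡ 2 (v0 mod 2 ∷ v1 mod 2 ∷ v2 mod 2 ∷ v3 mod 2 ∷ v0 ⊖ v1 mod 2 ∷ v2 ⊕ v3 mod 2 ∷ [])
    (λ { (a ∷ b ∷ x ∷ y ∷ _) → t2 a * t2 b * (t2 x * t2 y) })
    (λ { (a ∷ b ∷ x ∷ y ∷ u ∷ v ∷ []) → (1ℤ - t2 u) * t2 b * (t2 x * (1ℤ - t2 v)) }) (a ∷ b ∷ x ∷ y ∷ [])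

  odds-plus : ∀ a b x y → odds (a , b , x , y) ≡ evens (a + b , b , x , y - x)
  odds-plus a b x y = res≡ 2 (v0 mod 2 ∷ v1 mod 2 ∷ v2 mod 2 ∷ v3 mod 2 ∷ v0 ⊕ v1 mod 2 ∷ v3 ⊖ v2 mod 2 ∷ [])
    (λ { (a ∷ b ∷ x ∷ y ∷ _) → t2 a * t2 b * (t2 x * t2 y) })
    (λ { (a ∷ b ∷ x ∷ y ∷ u ∷ v ∷ []) → (1ℤ - t2 u) * t2 b * (t2 x * (1ℤ - t2 v)) }) (a ∷ b ∷ x ∷ y ∷ [])

  evens-inv : ∀ a b x y → evens (a , b + a , x - y , y) ≡ evens (a , b , x , y)
  evens-inv a b x y = res≡ 2 (v0 mod 2 ∷ v1 mod 2 ∷ v2 mod 2 ∷ v3 mod 2 ∷ v1 ⊕ v0 mod 2 ∷ v2 ⊖ v3 mod 2 ∷ [])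
    (λ { (a ∷ b ∷ x ∷ y ∷ u ∷ v ∷ []) → (1ℤ - t2 a) * t2 u * (t2 v * (1ℤ - t2 y)) })
    (λ { (a ∷ b ∷ x ∷ y ∷ _) → (1ℤ - t2 a) * t2 b * (t2 x * (1ℤ - t2 y)) }) (a ∷ b ∷ x ∷ y ∷ [])

  odds-swap : ∀ t → odds (swapΩ t) ≡ odds t
  odds-swap (a , b , x , y) = i (odd a) (odd b) (odd x) (odd y)
    where
    i : ∀ a b x y → b * a * (y * x) ≡ a * b * (x * y)
    i = solve-∀

module OddLiouville (f : ℤ → ℤ → ℤ) (f-even₁ : ∀ u v → f (- u) v ≡ f u v) (f-even₂ : ∀ u v → f u (- v) ≡ f u v) (N : ℤ) where
  private
    open module L = Liouville f f-even₁ f-even₂ odds evens odds-swap odds-minus odds-plus evens-inv N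

  -- The `c₁` terms vanish, because `evens` contradicts both a = b and x = y. What remains counts
  -- the odd k below an even D, and there are D / 2 of them.
  odd-liouville : + 2 * ∑ (Ω₁ N) (λ (a , b , x , y) → odd a * odd b * (odd x * odd y) * (f (a - b) (x + y) - f (a + b) (x - y)))
    ≡ ∑ (Dv-enum 1+ N) (λ (d , D) → odd d * even D * D * (f 0ℤ D - f D 0ℤ))
  odd-liouville = cong (+ 2 *_) (liouville
      ∙ (∑-cong (Tri-enum N) (λ ((d , D) , k) _ → term d D k)
      ∙ ∑-fubini (Dv-enum 1+ N) (λ (d , D) → Below-enum D) (Tri-enum N) (λ _ _ p → p) (λ _ _ p q → p , q) _))
    ∙ (sym (∑-* (Dv-enum 1+ N) (+ 2) _) ∙ ∑-cong (Dv-enum 1+ N) λ (d , D) ((_ , pD) , _) →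
      cong (+ 2 *_) (∑-* (Below-enum D) (odd d * even D * (f 0ℤ D - f D 0ℤ)) odd)
      ∙ inner (odd d) (even D) (f 0ℤ D - f D 0ℤ) (∑ (Below-enum D) odd) D (odd D) (half D pD) (ev-od D))
    where
    ev-od : ∀ D → even D * odd D ≡ 0ℤ
    ev-od D = res≡ 2 (v0 mod 2 ∷ []) (λ { (a ∷ []) → (1ℤ - t2 a) * t2 a }) (λ _ → 0ℤ) (D ∷ [])
    half : ∀ D → Pos D → + 2 * ∑ (Below-enum D) odd ≡ D - odd D
    half D pD = sym (∑-* (Below-enum D) (+ 2) odd)
      ∙ below-closed (λ x → + 2 * odd x) (λ x → x - odd x) refl (λ x → lc 1ℤ (step x) (i x (odd x) (odd (x + 1ℤ)))) D pD
      where
      step : ∀ x → - odd (x + 1ℤ) ≡ odd x - 1ℤ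
      step x = res≡ 2 (v0 ⊕ κ 1ℤ mod 2 ∷ v0 mod 2 ∷ []) (λ { (a ∷ b ∷ []) → - t2 a }) (λ { (a ∷ b ∷ []) → t2 b - 1ℤ }) (x ∷ [])
      i : ∀ x o o′ → x + 1ℤ - o′ - (x - o + + 2 * o) ≡ 1ℤ * (- o′ - (o - 1ℤ))
      i = solve-∀
    inner : ∀ o e g s D q → + 2 * s ≡ D - q → e * q ≡ 0ℤ → + 2 * (o * e * g * s) ≡ o * e * D * g
    inner o e g s D q h h′ = lc2 (o * e * g) h (- (o * g)) h′ (i o e g s D q)
      where
      i : ∀ o e g s D q → + 2 * (o * e * g * s) - o * e * D * g ≡ o * e * g * (+ 2 * s - (D - q)) + - (o * g) * (e * q - 0ℤ)
      i = solve-∀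
    term : ∀ d D k → (odds (d , d , D - k , k) * f 0ℤ D + + 2 * (evens (d , d , D - k , k) * f d k))
        - (odds (k , D - k , d , d) * f D 0ℤ + + 2 * (evens (k , D - k , d , d) * f k d))
      ≡ odd d * even D * (f 0ℤ D - f D 0ℤ) * odd k
    term d D k = cong₂ _-_ (cong₂ (λ u v → u * f 0ℤ D + + 2 * (v * f d k)) e1 e2) (cong₂ (λ u v → u * f D 0ℤ + + 2 * (v * f k d)) e3 e4)
      ∙ i (odd d * even D) (odd k) (f 0ℤ D) (f D 0ℤ) (f d k) (f k d)
      where
      E6 : Vec (Entry 2 3) 4
      E6 = v0 mod 2 ∷ v1 mod 2 ∷ v2 mod 2 ∷ v1 ⊖ v2 mod 2 ∷ []
      e1 : odds (d , d , D - k , k) ≡ odd d * even D * odd k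
      e1 = res≡ 2 E6 (λ { (a ∷ b ∷ c ∷ e ∷ []) → t2 a * t2 a * (t2 e * t2 c) }) (λ { (a ∷ b ∷ c ∷ e ∷ []) → t2 a * (1ℤ - t2 b) * t2 c }) (d ∷ D ∷ k ∷ [])
      e2 : evens (d , d , D - k , k) ≡ 0ℤ
      e2 = res≡ 2 E6 (λ { (a ∷ b ∷ c ∷ e ∷ []) → (1ℤ - t2 a) * t2 a * (t2 e * (1ℤ - t2 c)) }) (λ _ → 0ℤ) (d ∷ D ∷ k ∷ [])
      e3 : odds (k , D - k , d , d) ≡ odd d * even D * odd k
      e3 = res≡ 2 E6 (λ { (a ∷ b ∷ c ∷ e ∷ []) → t2 c * t2 e * (t2 a * t2 a) }) (λ { (a ∷ b ∷ c ∷ e ∷ []) → t2 a * (1ℤ - t2 b) * t2 c }) (d ∷ D ∷ k ∷ [])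
      e4 : evens (k , D - k , d , d) ≡ 0ℤ
      e4 = res≡ 2 E6 (λ { (a ∷ b ∷ c ∷ e ∷ []) → (1ℤ - t2 c) * t2 e * (t2 a * (1ℤ - t2 a)) }) (λ _ → 0ℤ) (d ∷ D ∷ k ∷ [])
      i : ∀ oe k F G f g → (oe * k * F + + 2 * (0ℤ * f)) - (oe * k * G + + 2 * (0ℤ * g)) ≡ oe * (F - G) * k
      i = solve-∀

z3-neg : ∀ u → z3 (- u) ≡ z3 u
z3-neg u = subst (λ v → z3 v ≡ z3 u) (ℤP.+-identityˡ (- u))
  (res≡ 3 (κ 0ℤ ⊖ v0 mod 3 ∷ v0 mod 3 ∷ []) (λ { (a ∷ _) → tz3 a }) (λ { (_ ∷ b ∷ []) → tz3 b }) (u ∷ []))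

alt₂-neg : ∀ u → alt₂ (- u) ≡ alt₂ u
alt₂-neg u = subst (λ v → alt₂ v ≡ alt₂ u) (ℤP.+-identityˡ (- u))
  (res≡ 4 (κ 0ℤ ⊖ v0 mod 4 ∷ v0 mod 4 ∷ []) (λ { (a ∷ _) → tε2 a }) (λ { (_ ∷ b ∷ []) → tε2 b }) (u ∷ []))

Hd : ℤ → ℤ
Hd N = ∑ (Dv-enum 1+ N) (λ (d , D) → odd d * even D * D * (1ℤ - z3 D))

-- χ₃(a) χ₃(b) is the indicator of 3 | a - b minus that of 3 | a + b, which is Liouville's summand
-- for f(u, v) = [3 | u].
χ3-convolution : ∀ N → + 2 * ∑ (Ω₁ N) (λ (a , b , x , y) → odd a * odd x * χ3 a * (odd b * odd y * χ3 b)) ≡ Hd N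
χ3-convolution N = cong (+ 2 *_) (∑-cong (Ω₁ N) (λ (a , b , x , y) _ →
    i (odd a) (odd b) (odd x) (odd y) (χ3 a) (χ3 b) ∙ cong (odd a * odd b * (odd x * odd y) *_) (key a b)))
  ∙ O.odd-liouville
  where
  module O = OddLiouville (λ u _ → z3 u) (λ u _ → z3-neg u) (λ _ _ → refl) N
  i : ∀ a b x y f g → a * x * f * (b * y * g) ≡ a * b * (x * y) * (f * g)
  i = solve-∀
  key : ∀ a b → χ3 a * χ3 b ≡ z3 (a - b) - z3 (a + b)
  key a b = res≡ 3 (v0 mod 3 ∷ v1 mod 3 ∷ v0 ⊖ v1 mod 3 ∷ v0 ⊕ v1 mod 3 ∷ [])
    (λ { (a ∷ b ∷ _) → t3 a * t3 b }) (λ { (_ ∷ _ ∷ c ∷ d ∷ []) → tz3 c - tz3 d }) (a ∷ b ∷ [])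

3+ : Pos (+ 3)
3+ = pos-ℕ 2

Q : ∀ {c c′} → Pos c → Pos c′ → ℤ → ℤ
Q pc pc′ N = ∑ (Ω-enum pc pc′ N) (λ (a , b , x , y) → χ4 a * odd x * (χ4 b * odd y))

z3-non : ∀ a → ¬ Div 2 a → z3 a ≡ 0ℤ
z3-non a h with a %ℕ 3
... | zero = ⊥-elim (h refl)
... | suc _ = refl

private
  Q-swap : ∀ {c c′} (pc : Pos c) (pc′ : Pos c′) N → Q pc pc′ N ≡ Q pc′ pc N
  Q-swap pc pc′ N = ∑-swapΩ pc pc′ N _ ∙ ∑-cong (Ω-enum pc′ pc N) (λ (a , b , x , y) _ → ℤP.*-comm (χ4 b * odd y) (χ4 a * odd x))

  z3-mul : ∀ a → z3 (+ 3 * a) ≡ 1ℤ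
  z3-mul a = res≡ 3 (κ (+ 3) ⊗ v0 mod 3 ∷ []) (λ { (a ∷ []) → tz3 a }) (λ _ → 1ℤ) (a ∷ [])

  χ4-mul3 : ∀ a → χ4 (+ 3 * a) ≡ - χ4 a
  χ4-mul3 a = res≡ 4 (κ (+ 3) ⊗ v0 mod 4 ∷ v0 mod 4 ∷ []) (λ { (a ∷ _) → t4 a }) (λ { (_ ∷ b ∷ []) → - t4 b }) (a ∷ [])

  odd-mul3 : ∀ a → odd (+ 3 * a) ≡ odd a
  odd-mul3 a = res≡ 2 (κ (+ 3) ⊗ v0 mod 2 ∷ v0 mod 2 ∷ []) (λ { (a ∷ _) → t2 a }) (λ { (_ ∷ b ∷ []) → t2 b }) (a ∷ [])

  0*′ : ∀ {u} v → u ≡ 0ℤ → u * v ≡ 0ℤ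
  0*′ v refl = ℤP.*-zeroˡ v

  -- z3 a and z3 x restrict to multiples of 3; χ4 (3a) = -χ4 a but odd (3x) = odd x.
  Q-za : ∀ {c c′} (pc : Pos c) (pc′ : Pos c′) (p : Pos (+ 3 * c)) N (w : ℤ → ℤ) →
    ∑ (Ω-enum pc pc′ N) (λ (a , b , x , y) → z3 a * (χ4 a * odd x * (χ4 b * odd y * w b)))
    ≡ - ∑ (Ω-enum p pc′ N) (λ (a , b , x , y) → χ4 a * odd x * (χ4 b * odd y * w b))
  Q-za pc pc′ p N w = Ω-scale-a 2 pc pc′ p N _ (λ a b x y _ h → 0*′ (χ4 a * odd x * (χ4 b * odd y * w b)) (z3-non a h))
    ∙ (∑-cong (Ω-enum p pc′ N) (λ (a , b , x , y) _ → cong₂ (λ u v → u * (v * odd x * (χ4 b * odd y * w b))) (z3-mul a) (χ4-mul3 a) ∙ i (χ4 a) (odd x) (χ4 b * odd y * w b))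
    ∙ ∑-neg (Ω-enum p pc′ N) _)
    where
    i : ∀ a x r → 1ℤ * (- a * x * r) ≡ - (a * x * r)
    i = solve-∀

  Q-zx : ∀ {c c′} (pc : Pos c) (pc′ : Pos c′) (p : Pos (+ 3 * c)) N (w : ℤ → ℤ) →
    ∑ (Ω-enum pc pc′ N) (λ (a , b , x , y) → z3 x * (χ4 a * odd x * (χ4 b * odd y * w y)))
    ≡ ∑ (Ω-enum p pc′ N) (λ (a , b , x , y) → χ4 a * odd x * (χ4 b * odd y * w y))
  Q-zx pc pc′ p N w = Ω-scale-x 2 pc pc′ p N _ (λ a b x y _ h → 0*′ (χ4 a * odd x * (χ4 b * odd y * w y)) (z3-non x h))
    ∙ ∑-cong (Ω-enum p pc′ N) (λ (a , b , x , y) _ → cong₂ (λ u v → u * (χ4 a * v * (χ4 b * odd y * w y))) (z3-mul x) (odd-mul3 x) ∙ i (χ4 a * odd x * (χ4 b * odd y * w y)))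
    where
    i : ∀ r → 1ℤ * r ≡ r
    i = solve-∀

  q wa wb wab wx wy wxy : ℤ⁴ → ℤ
  q (a , b , x , y) = χ4 a * odd x * (χ4 b * odd y)
  wa (a , b , x , y) = z3 a * q (a , b , x , y)
  wb (a , b , x , y) = z3 b * q (a , b , x , y)
  wab (a , b , x , y) = z3 a * z3 b * q (a , b , x , y)
  wx (a , b , x , y) = z3 x * q (a , b , x , y)
  wy (a , b , x , y) = z3 y * q (a , b , x , y)
  wxy (a , b , x , y) = z3 x * z3 y * q (a , b , x , y)

  module _ (N : ℤ) where
    private
      e = Ω₁ N
      one : ∀ a x b y → a * x * (b * y) ≡ a * x * (b * y * 1ℤ)
      one = solve-∀
      sw : ∀ u a x b y → u * (a * x * (b * y)) ≡ u * (b * y * (a * x * 1ℤ))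
      sw = solve-∀

    Σa Σb Σab Σx Σy Σxy : ℤ
    Σa = ∑ e wa
    Σb = ∑ e wb
    Σab = ∑ e wab
    Σx = ∑ e wx
    Σy = ∑ e wy
    Σxy = ∑ e wxy

    Σa≡ : Σa ≡ - Q 3+ 1+ N
    Σa≡ = ∑-cong e (λ (a , b , x , y) _ → cong (z3 a *_) (one (χ4 a) (odd x) (χ4 b) (odd y)))
      ∙ (Q-za 1+ 1+ 3+ N (λ _ → 1ℤ) ∙ cong -_ (∑-cong (Ω-enum 3+ 1+ N) (λ (a , b , x , y) _ → sym (one (χ4 a) (odd x) (χ4 b) (odd y)))))

    Σx≡ : Σx ≡ Q 3+ 1+ N
    Σx≡ = ∑-cong e (λ (a , b , x , y) _ → cong (z3 x *_) (one (χ4 a) (odd x) (χ4 b) (odd y)))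
      ∙ (Q-zx 1+ 1+ 3+ N (λ _ → 1ℤ) ∙ ∑-cong (Ω-enum 3+ 1+ N) (λ (a , b , x , y) _ → sym (one (χ4 a) (odd x) (χ4 b) (odd y))))

    Σb≡ : Σb ≡ Σa
    Σb≡ = ∑-swapΩ 1+ 1+ N _ ∙ ∑-cong e (λ (a , b , x , y) _ → cong (z3 a *_) (ℤP.*-comm (χ4 b * odd y) (χ4 a * odd x)))

    Σy≡ : Σy ≡ Σx
    Σy≡ = ∑-swapΩ 1+ 1+ N _ ∙ ∑-cong e (λ (a , b , x , y) _ → cong (z3 x *_) (ℤP.*-comm (χ4 b * odd y) (χ4 a * odd x)))

    Σab≡ : Σab ≡ Q 3+ 3+ N
    Σab≡ = ∑-cong e (λ (a , b , x , y) _ → i1 (z3 a) (z3 b) (χ4 a) (odd x) (χ4 b) (odd y))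
      ∙ (Q-za 1+ 1+ 3+ N z3 ∙ (cong -_ (∑-swapΩ 3+ 1+ N _
      ∙ (∑-cong (Ω-enum 1+ 3+ N) (λ (a , b , x , y) _ → i2 (z3 a) (χ4 b) (odd y) (χ4 a) (odd x)) ∙ Q-za 1+ 3+ 3+ N (λ _ → 1ℤ)))
      ∙ (ℤP.neg-involutive _ ∙ ∑-cong (Ω-enum 3+ 3+ N) (λ (a , b , x , y) _ → sym (one (χ4 a) (odd x) (χ4 b) (odd y))))))
      where
      i1 : ∀ z w a x b y → z * w * (a * x * (b * y)) ≡ z * (a * x * (b * y * w))
      i1 = solve-∀
      i2 : ∀ z b y a x → b * y * (a * x * z) ≡ z * (a * x * (b * y * 1ℤ))
      i2 = solve-∀

    Σxy≡ : Σxy ≡ Q 3+ 3+ N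
    Σxy≡ = ∑-cong e (λ (a , b , x , y) _ → i1 (z3 x) (z3 y) (χ4 a) (odd x) (χ4 b) (odd y))
      ∙ (Q-zx 1+ 1+ 3+ N z3 ∙ (∑-swapΩ 3+ 1+ N _
      ∙ (∑-cong (Ω-enum 1+ 3+ N) (λ (a , b , x , y) _ → i2 (z3 x) (χ4 b) (odd y) (χ4 a) (odd x)) ∙ Q-zx 1+ 3+ 3+ N (λ _ → 1ℤ)))
      ∙ ∑-cong (Ω-enum 3+ 3+ N) (λ (a , b , x , y) _ → sym (one (χ4 a) (odd x) (χ4 b) (odd y))))
      where
      i1 : ∀ z w a x b y → z * w * (a * x * (b * y)) ≡ z * (a * x * (b * y * w))
      i1 = solve-∀
      i2 : ∀ z b y a x → b * y * (a * x * z) ≡ z * (a * x * (b * y * 1ℤ))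
      i2 = solve-∀

  -- For odd a and b the factor `alt₂ u` equals χ₄(a) χ₄(b) at u = a - b and the opposite at u = a +
  -- b. The difference of the indicators of 3 | u and 3 | v then cancels the constants, leaving only
  -- terms with a multiple of 3 among a, b or among x, y.
  f₀ : ℤ → ℤ → ℤ
  f₀ u v = alt₂ u * (z3 u - z3 v)

  f₀-term : ∀ a b x y → odd a * odd b * (odd x * odd y) * (f₀ (a - b) (x + y) - f₀ (a + b) (x - y))
    ≡ (+ 3 * (z3 a * z3 b * (χ4 a * odd x * (χ4 b * odd y))) - z3 a * (χ4 a * odd x * (χ4 b * odd y)) - z3 b * (χ4 a * odd x * (χ4 b * odd y)))
      - (+ 3 * (z3 x * z3 y * (χ4 a * odd x * (χ4 b * odd y))) - z3 x * (χ4 a * odd x * (χ4 b * odd y)) - z3 y * (χ4 a * odd x * (χ4 b * odd y)))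
  f₀-term a b x y = i1 (odd a) (odd b) (odd x) (odd y) (alt₂ (a - b)) (alt₂ (a + b)) (z3 (a - b)) (z3 (x + y)) (z3 (a + b)) (z3 (x - y))
    ∙ (cong₂ (λ u v → odd x * odd y * (u * (z3 (a - b) - z3 (x + y)) - v * (z3 (a + b) - z3 (x - y)))) k1 k2
    ∙ (i2 (odd x) (odd y) (χ4 a) (χ4 b) (z3 (a - b)) (z3 (a + b)) (z3 (x + y)) (z3 (x - y))
    ∙ (cong₂ (λ u v → odd x * odd y * (χ4 a * χ4 b * (u - v))) (k3 a b) (k3 x y)
    ∙ i3 (odd x) (odd y) (χ4 a) (χ4 b) (z3 a) (z3 b) (z3 x) (z3 y))))
    where
    i1 : ∀ a b x y p q s t u v → a * b * (x * y) * (p * (s - t) - q * (u - v)) ≡ x * y * (a * b * p * (s - t) - a * b * q * (u - v))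
    i1 = solve-∀
    i2 : ∀ x y a b s t u v → x * y * (a * b * (s - u) - - (a * b) * (t - v)) ≡ x * y * (a * b * ((s + t) - (v + u)))
    i2 = solve-∀
    i3 : ∀ ox oy a b za zb zx zy → ox * oy * (a * b * ((1ℤ - za - zb + + 3 * (za * zb)) - (1ℤ - zx - zy + + 3 * (zx * zy))))
      ≡ (+ 3 * (za * zb * (a * ox * (b * oy))) - za * (a * ox * (b * oy)) - zb * (a * ox * (b * oy)))
      - (+ 3 * (zx * zy * (a * ox * (b * oy))) - zx * (a * ox * (b * oy)) - zy * (a * ox * (b * oy)))
    i3 = solve-∀
    k1 : odd a * odd b * alt₂ (a - b) ≡ χ4 a * χ4 b
    k1 = res≡ 4 (v0 mod 2 ∷ v1 mod 2 ∷ v0 ⊖ v1 mod 4 ∷ v0 mod 4 ∷ v1 mod 4 ∷ [])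
      (λ { (a ∷ b ∷ c ∷ _) → t2 a * t2 b * tε2 c }) (λ { (_ ∷ _ ∷ _ ∷ d ∷ e ∷ []) → t4 d * t4 e }) (a ∷ b ∷ [])
    k2 : odd a * odd b * alt₂ (a + b) ≡ - (χ4 a * χ4 b)
    k2 = res≡ 4 (v0 mod 2 ∷ v1 mod 2 ∷ v0 ⊕ v1 mod 4 ∷ v0 mod 4 ∷ v1 mod 4 ∷ [])
      (λ { (a ∷ b ∷ c ∷ _) → t2 a * t2 b * tε2 c }) (λ { (_ ∷ _ ∷ _ ∷ d ∷ e ∷ []) → - (t4 d * t4 e) }) (a ∷ b ∷ [])
    k3 : ∀ a b → z3 (a - b) + z3 (a + b) ≡ 1ℤ - z3 a - z3 b + + 3 * (z3 a * z3 b)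
    k3 a b = res≡ 3 (v0 ⊖ v1 mod 3 ∷ v0 ⊕ v1 mod 3 ∷ v0 mod 3 ∷ v1 mod 3 ∷ [])
      (λ { (a ∷ b ∷ _) → tz3 a + tz3 b }) (λ { (_ ∷ _ ∷ a ∷ b ∷ []) → 1ℤ - tz3 a - tz3 b + + 3 * (tz3 a * tz3 b) }) (a ∷ b ∷ [])

-- For even m, both convolutions are multiples of Σ_{d D = m, d odd, 3 ∤ D} D.
χ4-convolution : ∀ m → Div 1 m → Q 1+ 3+ (+ 2 * m) ≡ ∑ (Ω₁ m) (λ (a , b , x , y) → odd a * odd x * χ3 a * (odd b * odd y * χ3 b))
χ4-convolution m m-even = *-cancel (+ 8) (pos-ℕ 7) (eight (Q 1+ 3+ N) (Q 3+ 1+ N) (Q 3+ 3+ N) (Q-swap 1+ 3+ N) split ∙ (O.odd-liouville ∙ (H≡ ∙ i (Hd m) ∙ fin)))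
  where
  N = + 2 * m
  module O = OddLiouville f₀ (λ u v → cong₂ (λ p q → p * (q - z3 v)) (alt₂-neg u) (z3-neg u)) (λ u v → cong (λ q → alt₂ u * (z3 u - q)) (z3-neg v)) N
  SS = ∑ (Ω₁ m) (λ (a , b , x , y) → odd a * odd x * χ3 a * (odd b * odd y * χ3 b))
  i : ∀ h → + 2 * (+ 2 * h) ≡ + 4 * h
  i = solve-∀
  fin : + 4 * Hd m ≡ + 8 * SS
  fin = cong (+ 4 *_) (sym (χ3-convolution m)) ∙ j SS
    where
    j : ∀ s → + 4 * (+ 2 * s) ≡ + 8 * s
    j = solve-∀
  LHS = ∑ (Ω₁ N) (λ (a , b , x , y) → odd a * odd b * (odd x * odd y) * (f₀ (a - b) (x + y) - f₀ (a + b) (x - y)))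
  -- A multiple of 3 in place of a changes the sign, since χ₄(3) = -1, and in place of x it does
  -- not. Hence the four terms with one multiple of 3 add up, while those with two cancel.
  split : LHS ≡ (+ 3 * Q 3+ 3+ N - - Q 3+ 1+ N - - Q 3+ 1+ N) - (+ 3 * Q 3+ 3+ N - Q 3+ 1+ N - Q 3+ 1+ N)
  split = ∑-cong (Ω₁ N) (λ (a , b , x , y) _ → f₀-term a b x y)
    ∙ ∑-- (Ω₁ N) (λ t → + 3 * wab t - wa t - wb t) (λ t → + 3 * wxy t - wx t - wy t)
    ∙ cong₂ _-_ (three wab wa wb (Σab≡ N) (Σa≡ N) (Σb≡ N ∙ Σa≡ N)) (three wxy wx wy (Σxy≡ N) (Σx≡ N) (Σy≡ N ∙ Σx≡ N))
    where
    three : ∀ f g h {F G H} → ∑ (Ω₁ N) f ≡ F → ∑ (Ω₁ N) g ≡ G → ∑ (Ω₁ N) h ≡ H → ∑ (Ω₁ N) (λ t → + 3 * f t - g t - h t) ≡ + 3 * F - G - H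
    three f g h refl refl refl = ∑-- (Ω₁ N) (λ t → + 3 * f t - g t) h
      ∙ cong (_- ∑ (Ω₁ N) h) (∑-- (Ω₁ N) (λ t → + 3 * f t) g ∙ cong (_- ∑ (Ω₁ N) g) (∑-* (Ω₁ N) (+ 3) f))
  eight : ∀ p q r {s} → p ≡ q → s ≡ (+ 3 * r - - q - - q) - (+ 3 * r - q - q) → + 8 * p ≡ + 2 * s
  eight p q r refl refl = j p r
    where
    j : ∀ q r → + 8 * q ≡ + 2 * ((+ 3 * r - - q - - q) - (+ 3 * r - q - q))
    j = solve-∀
  H≡ : ∑ (Dv-enum 1+ N) (λ (d , D) → odd d * even D * D * (f₀ 0ℤ D - f₀ D 0ℤ)) ≡ + 2 * (+ 2 * Hd m)
  H≡ = Dv-scale 1 m _ (λ d D (_ , eq) h → i0 (odd d) D (f₀ 0ℤ D - f₀ D 0ℤ) (od D h))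
    ∙ (∑-cong (Dv-enum 1+ m) (λ (d , D) (_ , eq) → term d D (cong (_%ℕ 2) eq ∙ m-even))
    ∙ ∑-* (Dv-enum 1+ m) (+ 2) (λ (d , D) → + 2 * (odd d * even D * D * (1ℤ - z3 D))) ∙ cong (+ 2 *_) (∑-* (Dv-enum 1+ m) (+ 2) (λ (d , D) → odd d * even D * D * (1ℤ - z3 D))))
    where
    i0 : ∀ o D g {e} → e ≡ 0ℤ → o * e * D * g ≡ 0ℤ
    i0 o D g refl = j o D g
      where
      j : ∀ o D g → o * 0ℤ * D * g ≡ 0ℤ
      j = solve-∀
    od : ∀ D → ¬ Div 1 D → even D ≡ 0ℤ
    od D h with D %ℕ 2 | n%ℕd<d D 2
    ... | 0 | _ = ⊥-elim (h refl)
    ... | 1 | _ = refl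
    ... | suc (suc _) | ℕ.s≤s (ℕ.s≤s ())
    term : ∀ d D → (1ℤ * (d * D)) %ℕ 2 ≡ 0 → odd d * even (+ 2 * D) * (+ 2 * D) * (f₀ 0ℤ (+ 2 * D) - f₀ (+ 2 * D) 0ℤ)
      ≡ + 2 * (+ 2 * (odd d * even D * D * (1ℤ - z3 D)))
    term d D h = cong (λ z → odd d * even (+ 2 * D) * (+ 2 * D) * (1ℤ * (1ℤ - z) - alt₂ (+ 2 * D) * (z - 1ℤ))) z2
      ∙ (j1 (odd d) (even (+ 2 * D)) D (alt₂ (+ 2 * D)) (1ℤ - z3 D) (z3 D)
      ∙ cong (λ u → u * (+ 2 * D * (1ℤ - z3 D))) k
      ∙ j2 (odd d * even D) D (z3 D))
      where
      z2 : z3 (+ 2 * D) ≡ z3 D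
      z2 = res≡ 3 (κ (+ 2) ⊗ v0 mod 3 ∷ v0 mod 3 ∷ []) (λ { (a ∷ _) → tz3 a }) (λ { (_ ∷ b ∷ []) → tz3 b }) (D ∷ [])
      j1 : ∀ o e D a u z → o * e * (+ 2 * D) * (1ℤ * (1ℤ - z) - a * (z - 1ℤ)) ≡ o * e * (1ℤ + a) * (+ 2 * D * (1ℤ - z))
      j1 = solve-∀
      j2 : ∀ oe D z → + 2 * oe * (+ 2 * D * (1ℤ - z)) ≡ + 2 * (+ 2 * (oe * D * (1ℤ - z)))
      j2 = solve-∀
      k : odd d * even (+ 2 * D) * (1ℤ + alt₂ (+ 2 * D)) ≡ + 2 * (odd d * even D)
      k = res⇒ 4 (κ 1ℤ ⊗ (v0 ⊗ v1) mod 2 ∷ v0 mod 2 ∷ κ (+ 2) ⊗ v1 mod 2 ∷ κ (+ 2) ⊗ v1 mod 4 ∷ v1 mod 2 ∷ [])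
        (λ { (a ∷ _) → + a }) (λ _ → 0ℤ)
        (λ { (_ ∷ o ∷ e ∷ a ∷ _) → t2 o * (1ℤ - t2 e) * (1ℤ + tε2 a) }) (λ { (_ ∷ o ∷ _ ∷ _ ∷ e ∷ []) → + 2 * (t2 o * (1ℤ - t2 e)) })
        (d ∷ D ∷ []) (cong +_ h)

-- The form u² + uv + v²

Odd : ℤ → Set
Odd x = x %ℕ 2 ≡ 1

odd? : ∀ x → Dec (Odd x)
odd? x = x %ℕ 2 ℕ.≟ 1

odd-1 : ∀ x → Odd x → odd x ≡ 1ℤ
odd-1 x h = cong t2 h

¬Odd⇒Div : ∀ x → ¬ Odd x → Div 1 x
¬Odd⇒Div x h with x %ℕ 2 | n%ℕd<d x 2
... | 0 | _ = refl
... | 1 | _ = ⊥-elim (h refl)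
... | suc (suc _) | ℕ.s≤s (ℕ.s≤s ())

odd-0 : ∀ x → ¬ Odd x → odd x ≡ 0ℤ
odd-0 x h = cong t2 (¬Odd⇒Div x h)

Odd¬Div : ∀ x → Odd x → ¬ Div 1 x
Odd¬Div x h h′ = case sym h ∙ h′ of λ ()

¬Div⇒Odd : ∀ x → ¬ Div 1 x → Odd x
¬Div⇒Odd x h with odd? x
... | yes o = o
... | no ¬o = ⊥-elim (h (¬Odd⇒Div x ¬o))

private
  1≢0 : 1 ≢ 0
  1≢0 ()

-- Through y = 2u + v and z = v these are the solutions of u² + uv + v² = m with v odd.
K : ℤ → ℤ² → Set
K m (y , z) = (Odd y × Odd z) × y * y + + 3 * (z * z) ≡ + 4 * m

opaque
  K-enum : ∀ m → Enum (K m)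
  K-enum m = boxEnum (λ (y , z) → (odd? y ×-dec odd? z) ×-dec (_ ℤ.≟ _)) ∣ + 4 * m ∣
    λ (y , z) (_ , eq) → ℕP.⊔-lub
      (abs-sq y {+ 4 * m} (nn≡ (lc 1ℤ eq (i1 y z (+ 4 * m))) (nn* {+ 3} (ℤ.+≤+ ℕ.z≤n) (nn² z))))
      (abs-sq z {+ 4 * m} (nn≡ (lc 1ℤ eq (i2 y z (+ 4 * m))) (nn+ (nn² y) (nn* {+ 2} (ℤ.+≤+ ℕ.z≤n) (nn² z)))))
    where
    i1 : ∀ y z n → + 3 * (z * z) - (n - y * y) ≡ 1ℤ * (y * y + + 3 * (z * z) - n)
    i1 = solve-∀
    i2 : ∀ y z n → y * y + + 2 * (z * z) - (n - z * z) ≡ 1ℤ * (y * y + + 3 * (z * z) - n)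
    i2 = solve-∀

S′ : ℤ → ℤ
S′ m = ∑ (Dv-enum 1+ m) (λ (a , x) → odd a * odd x * χ3 a)

private
  R2o : ℤ → ℤ² → Set
  R2o n (p , q) = R2 n (p , q) × Odd (p + q)

  opaque
    R2o-enum : ∀ n → Enum (R2o n)
    R2o-enum n = restrict (R2-enum n) (λ (p , q) → odd? (p + q))

  sq-parity : ∀ p q → (p * p + q * q) %ℕ 2 ≡ (p + q) %ℕ 2
  sq-parity p q = ℤP.+-injective (res≡ 2 (v0 ⊗ v0 ⊕ v1 ⊗ v1 mod 2 ∷ v0 ⊕ v1 mod 2 ∷ []) (λ { (a ∷ _) → + a }) (λ { (_ ∷ b ∷ []) → + b }) (p ∷ q ∷ []))

  -- p + q has the parity of p² + q² = i, so the set is everything for odd i and empty for even i.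
  R2o-count : ∀ i → Pos i → count (R2o-enum i) ≡ + 4 * ∑ (Dv-enum 1+ i) (λ (a , x) → χ4 a * odd x)
  R2o-count i pi = parity (odd? i)
    ∙ cong (+ 4 *_) (sym (∑-* (Dv-enum 1+ i) (odd i) (λ (a , _) → χ4 a)) ∙ ∑-cong (Dv-enum 1+ i) λ (a , x) (_ , eq) →
        cong (λ j → odd j * χ4 a) (sym eq) ∙ k a x)
    where
    k : ∀ a x → odd (1ℤ * (a * x)) * χ4 a ≡ χ4 a * odd x
    k a x = res≡ 4 (κ 1ℤ ⊗ (v0 ⊗ v1) mod 2 ∷ v0 mod 4 ∷ v1 mod 2 ∷ []) (λ { (c ∷ a ∷ _) → t2 c * t4 a }) (λ { (_ ∷ a ∷ x ∷ []) → t4 a * t2 x }) (a ∷ x ∷ [])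
    parity : Dec (Odd i) → count (R2o-enum i) ≡ + 4 * (odd i * ρ i)
    parity (yes o) = ∑-id (R2o-enum i) (R2-enum i) (λ _ → proj₁) (λ (p , q) eq → eq , (sym (sq-parity p q) ∙ cong (_%ℕ 2) eq ∙ o)) (λ _ _ → refl)
      ∙ two-squares i pi ∙ cong (+ 4 *_) (sym (cong (_* ρ i) (odd-1 i o) ∙ ℤP.*-identityˡ (ρ i)))
    parity (no ¬o) = ∑-0 (R2o-enum i) (λ (p , q) (eq , o) → ⊥-elim (¬o (sym (cong (_%ℕ 2) eq) ∙ sq-parity p q ∙ o)))
      ∙ sym (cong (λ t → + 4 * (t * ρ i)) (odd-0 i ¬o) ∙ cong (+ 4 *_) (ℤP.*-zeroˡ (ρ i)))

  odd-form-Div4 : ∀ y z → Odd y → Odd z → Div 3 (y * y + + 3 * (z * z))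
  odd-form-Div4 y z oy oz = ℤP.+-injective (res⇒ 4 (v0 ⊗ v0 ⊕ κ (+ 3) ⊗ (v1 ⊗ v1) mod 4 ∷ v0 mod 2 ∷ v1 mod 2 ∷ [])
    (λ { (_ ∷ a ∷ b ∷ []) → + a + + b }) (λ _ → + 2) (λ { (c ∷ _) → + c }) (λ _ → 0ℤ) (y ∷ z ∷ []) (cong₂ (λ u v → + u + + v) oy oz))

  odd-sq-pos : ∀ y → Odd y → Pos (y * y)
  odd-sq-pos y o with nn⇒≡0⊎pos (nn² y)
  ... | inj₂ p = p
  ... | inj₁ e with ℤP.i*j≡0⇒i≡0∨j≡0 y e
  ...   | inj₁ refl = case o of λ ()
  ...   | inj₂ refl = case o of λ ()

  sum-odd-pos : ∀ p q → Odd (p + q) → Pos (p * p + q * q)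
  sum-odd-pos p q o with nn⇒≡0⊎pos (nn+ (nn² p) (nn² q))
  ... | inj₂ r = r
  ... | inj₁ e = ⊥-elim (1≢0 (sym o ∙ sym (sq-parity p q) ∙ cong (_%ℕ 2) e))

  parity-sum : ∀ y z → Odd y → Odd z → Div 1 (y + z) × Div 1 (y - z)
  parity-sum y z oy oz =
    ℤP.+-injective (res⇒ 2 (v0 mod 2 ∷ v1 mod 2 ∷ v0 ⊕ v1 mod 2 ∷ []) (λ { (a ∷ b ∷ _) → + a + + b }) (λ _ → + 2) (λ { (_ ∷ _ ∷ c ∷ []) → + c }) (λ _ → 0ℤ) (y ∷ z ∷ []) h) ,
    ℤP.+-injective (res⇒ 2 (v0 mod 2 ∷ v1 mod 2 ∷ v0 ⊖ v1 mod 2 ∷ []) (λ { (a ∷ b ∷ _) → + a + + b }) (λ _ → + 2) (λ { (_ ∷ _ ∷ c ∷ []) → + c }) (λ _ → 0ℤ) (y ∷ z ∷ []) h)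
    where
    h : + (y %ℕ 2) + + (z %ℕ 2) ≡ + 2
    h = cong₂ (λ u v → + u + + v) oy oz

  -- With p = (y + y′)/2 and q = (y - y′)/2 one has y² + y′² = 2 (p² + q²), and likewise for z, z′.
  -- Two copies of y² + 3z² thus become a sum of two squares plus three times another.
  KK : ∀ M → ∑ (Ad-enum 1+ 1+ M) (λ (i , k) → count (K-enum i) * count (K-enum k))
    ≡ ∑ (Ad-enum 1+ 3+ (+ 2 * M)) (λ (i , k) → count (R2o-enum i) * count (R2o-enum k))
  KK M = sym (∑-dep-product (Ad-enum 1+ 1+ M) (λ (i , _) → K-enum i) (λ (_ , k) → K-enum k) (λ _ → 1ℤ) (λ _ → 1ℤ))
    ∙ ∑-bij (depEnum (Ad-enum 1+ 1+ M) (λ (i , k) → depEnum (K-enum i) (λ _ → K-enum k)))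
            (depEnum (Ad-enum 1+ 3+ (+ 2 * M)) (λ (i , k) → depEnum (R2o-enum i) (λ _ → R2o-enum k)))
        φ ψ φ-ok ψ-ok ψφ φψ (λ _ _ → refl)
    ∙ ∑-dep-product (Ad-enum 1+ 3+ (+ 2 * M)) (λ (i , _) → R2o-enum i) (λ (_ , k) → R2o-enum k) (λ _ → 1ℤ) (λ _ → 1ℤ)
    where
    T : Set
    T = ℤ² × ℤ² × ℤ²
    nrm form : ℤ → ℤ → ℤ
    nrm p q = p * p + q * q
    form y z = y * y + + 3 * (z * z)
    φ′ ψ′ : ℤ → ℤ → ℤ → ℤ → T
    φ′ p q r s = (nrm p q , nrm r s) , (p , q) , (r , s)
    ψ′ y z y′ z′ = (form y z /ℕ 4 , form y′ z′ /ℕ 4) , (y , z) , (y′ , z′)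
    φ ψ : T → T
    φ (_ , (y , z) , (y′ , z′)) = φ′ ((y + y′) /ℕ 2) ((y - y′) /ℕ 2) ((z + z′) /ℕ 2) ((z - z′) /ℕ 2)
    ψ (_ , (p , q) , (r , s)) = ψ′ (p + q) (r + s) (p - q) (r - s)
    P₁ P₂ : T → Set
    P₁ ((i , k) , yz , yz′) = Ad 1ℤ 1ℤ M (i , k) × (K i yz × K k yz′)
    P₂ ((i , k) , pq , rs) = Ad 1ℤ (+ 3) (+ 2 * M) (i , k) × (R2o i pq × R2o k rs)
    dbl : ∀ u v → + 2 * u ≡ + 2 * v → u ≡ v
    dbl u v = *-cancel (+ 2) {u} {v} (pos-ℕ 1)
    quad : ∀ u v → + 4 * u ≡ + 4 * v → u ≡ v
    quad u v = *-cancel (+ 4) {u} {v} (pos-ℕ 3)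
    back : ∀ y y′ → Div 1 (y + y′) → Div 1 (y - y′) → (y + y′) /ℕ 2 + (y - y′) /ℕ 2 ≡ y × (y + y′) /ℕ 2 - (y - y′) /ℕ 2 ≡ y′
    back y y′ h h′ = dbl _ y (lc2 1ℤ (div-eq 1 (y + y′) h) 1ℤ (div-eq 1 (y - y′) h′) (i1 ((y + y′) /ℕ 2) ((y - y′) /ℕ 2) y y′)) ,
                     dbl _ y′ (lc2 1ℤ (div-eq 1 (y + y′) h) (- 1ℤ) (div-eq 1 (y - y′) h′) (i2 ((y + y′) /ℕ 2) ((y - y′) /ℕ 2) y y′))
      where
      i1 : ∀ p q y y′ → + 2 * (p + q) - + 2 * y ≡ 1ℤ * (+ 2 * p - (y + y′)) + 1ℤ * (+ 2 * q - (y - y′))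
      i1 = solve-∀
      i2 : ∀ p q y y′ → + 2 * (p - q) - + 2 * y′ ≡ 1ℤ * (+ 2 * p - (y + y′)) + - 1ℤ * (+ 2 * q - (y - y′))
      i2 = solve-∀
    φ-ok : ∀ t → P₁ t → P₂ (φ t)
    φ-ok ((i , k) , (y , z) , (y′ , z′)) (((_ , _) , eq) , ((oy , oz) , e) , ((oy′ , oz′) , e′)) =
      go ((y + y′) /ℕ 2) ((y - y′) /ℕ 2) ((z + z′) /ℕ 2) ((z - z′) /ℕ 2) (back y y′ (proj₁ yy) (proj₂ yy)) (back z z′ (proj₁ zz) (proj₂ zz))
      where
      yy = parity-sum y y′ oy oy′
      zz = parity-sum z z′ oz oz′
      go : ∀ p q r s → p + q ≡ y × p - q ≡ y′ → r + s ≡ z × r - s ≡ z′ → P₂ (φ′ p q r s)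
      go p q r s (refl , refl) (refl , refl) =
        ((sum-odd-pos p q oy , sum-odd-pos r s oz) ,
          dbl _ _ (lc2 1ℤ (cong₂ _+_ e e′) (+ 4) eq (j p q r s i k M))) ,
        (refl , oy) , (refl , oz)
        where
        j : ∀ p q r s i k M → + 2 * (1ℤ * (p * p + q * q) + + 3 * (r * r + s * s)) - + 2 * (+ 2 * M)
          ≡ 1ℤ * (((p + q) * (p + q) + + 3 * ((r + s) * (r + s))) + ((p - q) * (p - q) + + 3 * ((r - s) * (r - s))) - (+ 4 * i + + 4 * k))
            + + 4 * (1ℤ * i + 1ℤ * k - M)
        j = solve-∀
    diff-odd : ∀ p q → Odd (p + q) → Odd (p - q)
    diff-odd p q o = ℤP.+-injective (res≡ 2 (v0 ⊖ v1 mod 2 ∷ v0 ⊕ v1 mod 2 ∷ []) (λ { (a ∷ _) → + a }) (λ { (_ ∷ b ∷ []) → + b }) (p ∷ q ∷ [])) ∙ o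
    form-pos : ∀ y z → Odd y → Odd z → Pos (form y z /ℕ 4)
    form-pos y z oy oz = pos*⁻ {+ 4} {form y z /ℕ 4} (pos-ℕ 3) (pos≡ (sym (div-eq 3 (form y z) (odd-form-Div4 y z oy oz)))
      (pos+ (odd-sq-pos y oy) (pos* (pos-ℕ 2) (odd-sq-pos z oz))))
    ψ-ok : ∀ t → P₂ t → P₁ (ψ t)
    ψ-ok ((i , k) , (p , q) , (r , s)) ((_ , eq) , (e , o) , (e′ , o′)) =
      ((form-pos (p + q) (r + s) o o′ , form-pos (p - q) (r - s) o₂ o₂′) ,
        quad _ _ (comb (div-eq 3 (form (p + q) (r + s)) d) (div-eq 3 (form (p - q) (r - s)) d′) e e′ eq)) ,
      ((o , o′) , sym (div-eq 3 (form (p + q) (r + s)) d)) , ((o₂ , o₂′) , sym (div-eq 3 (form (p - q) (r - s)) d′))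
      where
      o₂ = diff-odd p q o
      o₂′ = diff-odd r s o′
      d = odd-form-Div4 (p + q) (r + s) o o′
      d′ = odd-form-Div4 (p - q) (r - s) o₂ o₂′
      comb : ∀ {u v} → + 4 * u ≡ form (p + q) (r + s) → + 4 * v ≡ form (p - q) (r - s) → p * p + q * q ≡ i → r * r + s * s ≡ k →
        1ℤ * i + + 3 * k ≡ + 2 * M → + 4 * (1ℤ * u + 1ℤ * v) ≡ + 4 * M
      comb {u} {v} h h′ refl refl h″ = lc2 1ℤ (cong₂ _+_ h h′) (+ 2) h″ (j p q r s u v M)
        where
        j : ∀ p q r s u v M → + 4 * (1ℤ * u + 1ℤ * v) - + 4 * M
          ≡ 1ℤ * (+ 4 * u + + 4 * v - (((p + q) * (p + q) + + 3 * ((r + s) * (r + s))) + ((p - q) * (p - q) + + 3 * ((r - s) * (r - s)))))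
            + + 2 * (1ℤ * (p * p + q * q) + + 3 * (r * r + s * s) - + 2 * M)
        j = solve-∀
    ψφ : ∀ t → P₁ t → ψ (φ t) ≡ t
    ψφ ((i , k) , (y , z) , (y′ , z′)) (_ , ((oy , oz) , e) , ((oy′ , oz′) , e′)) =
      go ((y + y′) /ℕ 2) ((y - y′) /ℕ 2) ((z + z′) /ℕ 2) ((z - z′) /ℕ 2) (back y y′ (proj₁ yy) (proj₂ yy)) (back z z′ (proj₁ zz) (proj₂ zz))
      where
      yy = parity-sum y y′ oy oy′
      zz = parity-sum z z′ oz oz′
      m4 : ∀ {f} j → f ≡ + 4 * j → f /ℕ 4 ≡ j
      m4 j refl = mul-div 3 j
      go : ∀ p q r s → p + q ≡ y × p - q ≡ y′ → r + s ≡ z × r - s ≡ z′ → ψ′ (p + q) (r + s) (p - q) (r - s) ≡ ((i , k) , (y , z) , (y′ , z′))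
      go p q r s (refl , refl) (refl , refl) = cong₂ (λ u v → (u , v) , (y , z) , (y′ , z′)) (m4 i e) (m4 k e′)
    φψ : ∀ t → P₂ t → φ (ψ t) ≡ t
    φψ ((i , k) , (p , q) , (r , s)) (_ , (refl , _) , (refl , _)) = four (h₁ p q) (h₂ p q) (h₁ r s) (h₂ r s)
      where
      h₁ : ∀ p q → (p + q + (p - q)) /ℕ 2 ≡ p
      h₁ p q = cong (_/ℕ 2) (j p q) ∙ mul-div 1 p
        where
        j : ∀ p q → p + q + (p - q) ≡ + 2 * p
        j = solve-∀
      h₂ : ∀ p q → (p + q - (p - q)) /ℕ 2 ≡ q
      h₂ p q = cong (_/ℕ 2) (j p q) ∙ mul-div 1 q
        where
        j : ∀ p q → p + q - (p - q) ≡ + 2 * q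
        j = solve-∀
      four : ∀ {p p′ q q′ r r′ s s′} → p ≡ p′ → q ≡ q′ → r ≡ r′ → s ≡ s′ → φ′ p q r s ≡ φ′ p′ q′ r′ s′
      four refl refl refl refl = refl

KK-S : ∀ M → Div 1 M → ∑ (Ad-enum 1+ 1+ M) (λ (i , k) → count (K-enum i) * count (K-enum k))
  ≡ + 16 * ∑ (Ad-enum 1+ 1+ M) (λ (i , k) → S′ i * S′ k)
KK-S M ev = KK M
  ∙ ∑-cong (Ad-enum 1+ 3+ (+ 2 * M)) (λ (i , k) ((pi , pk) , _) → cong₂ _*_ (R2o-count i pi) (R2o-count k pk) ∙ j (X i) (X k))
  ∙ ∑-* (Ad-enum 1+ 3+ (+ 2 * M)) (+ 16) (λ (i , k) → X i * X k)
  ∙ cong (+ 16 *_) (sym (conv 1+ 3+ (+ 2 * M) (λ (a , x) → χ4 a * odd x) (λ (a , x) → χ4 a * odd x))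
    ∙ χ4-convolution M ev ∙ conv 1+ 1+ M (λ (a , x) → odd a * odd x * χ3 a) (λ (a , x) → odd a * odd x * χ3 a))
  where
  X : ℤ → ℤ
  X i = ∑ (Dv-enum 1+ i) (λ (a , x) → χ4 a * odd x)
  j : ∀ x y → + 4 * x * (+ 4 * y) ≡ + 16 * (x * y)
  j = solve-∀

private
  count-nn : {P : A → Set} (e : Enum P) → 0ℤ ≤ count e
  count-nn e = nn≡ (sym (∑-count e)) (ℤ.+≤+ ℕ.z≤n)

  odd-mul : ∀ a x → odd a * odd x ≡ odd (1ℤ * (a * x))
  odd-mul a x = res≡ 2 (v0 mod 2 ∷ v1 mod 2 ∷ κ 1ℤ ⊗ (v0 ⊗ v1) mod 2 ∷ []) (λ { (a ∷ b ∷ _) → t2 a * t2 b }) (λ { (_ ∷ _ ∷ c ∷ []) → t2 c }) (a ∷ x ∷ [])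

  -- y² + 3z² is 4 modulo 8 when y and z are odd.
  K-even : ∀ m → ¬ Odd m → count (K-enum m) ≡ 0ℤ
  K-even m ¬o = ∑-0 (K-enum m) λ (y , z) ((oy , oz) , eq) → ⊥-elim (¬o (ℤP.+-injective
    (res⇒ 8 (κ (+ 4) ⊗ v0 mod 8 ∷ v0 mod 2 ∷ []) (λ { (a ∷ _) → + a }) (λ _ → + 4) (λ { (_ ∷ b ∷ []) → + b }) (λ _ → 1ℤ) (m ∷ [])
      (cong (λ t → + (t %ℕ 8)) (sym eq)
       ∙ res⇒ 8 (v0 ⊗ v0 ⊕ κ (+ 3) ⊗ (v1 ⊗ v1) mod 8 ∷ v0 mod 2 ∷ v1 mod 2 ∷ []) (λ { (_ ∷ a ∷ b ∷ []) → + a + + b }) (λ _ → + 2)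
           (λ { (c ∷ _) → + c }) (λ _ → + 4) (y ∷ z ∷ []) (cong₂ (λ u v → + u + + v) oy oz)))))

  S′-even : ∀ m → ¬ Odd m → S′ m ≡ 0ℤ
  S′-even m ¬o = ∑-0 (Dv-enum 1+ m) λ (a , x) (_ , eq) → cong (_* χ3 a) (odd-mul a x ∙ cong odd eq ∙ odd-0 m ¬o) ∙ ℤP.*-zeroˡ (χ3 a)

  pos-≤1 : ∀ {a} → Pos a → 0ℤ ≤ 1ℤ - a → a ≡ 1ℤ
  pos-≤1 {+ suc zero} _ _ = refl
  pos-≤1 {+ zero} (ℤ.+<+ ())
  pos-≤1 {+ suc (suc n)} _ ()

  S′-1 : S′ 1ℤ ≡ 1ℤ
  S′-1 = ∑-single (Dv-enum 1+ 1ℤ) (1ℤ , 1ℤ) ((pos-ℕ 0 , pos-ℕ 0) , refl) (λ (a , x) → odd a * odd x * χ3 a)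
    λ (a , x) ((pa , px) , eq) ne → ⊥-elim (ne (cong₂ _,_
      (pos-≤1 pa (nn≡ (lc 1ℤ eq (i1 a x)) (nn* (pos⇒nn pa) (pos-pred px))))
      (pos-≤1 px (nn≡ (lc 1ℤ eq (i2 a x)) (nn* (pos⇒nn px) (pos-pred pa))))))
    where
    i1 : ∀ a x → a * (x - 1ℤ) - (1ℤ - a) ≡ 1ℤ * (1ℤ * (a * x) - 1ℤ)
    i1 = solve-∀
    i2 : ∀ a x → x * (a - 1ℤ) - (1ℤ - x) ≡ 1ℤ * (1ℤ * (a * x) - 1ℤ)
    i2 = solve-∀

  defect : ℤ² → ℤ
  defect (i , k) = count (K-enum i) * count (K-enum k) - + 16 * (S′ i * S′ k)

  defect-sum : ∀ M → Div 1 M → ∑ (Ad-enum 1+ 1+ M) defect ≡ 0ℤ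
  defect-sum M ev = ∑-- (Ad-enum 1+ 1+ M) (λ (i , k) → count (K-enum i) * count (K-enum k)) (λ (i , k) → + 16 * (S′ i * S′ k))
    ∙ cong₂ _-_ (KK-S M ev) (∑-* (Ad-enum 1+ 1+ M) (+ 16) (λ (i , k) → S′ i * S′ k)) ∙ ℤP.+-inverseʳ (+ 16 * ∑ (Ad-enum 1+ 1+ M) (λ (i , k) → S′ i * S′ k))

  defect-zero : ∀ i k → count (K-enum i) ≡ + 4 * S′ i → count (K-enum k) ≡ + 4 * S′ k → defect (i , k) ≡ 0ℤ
  defect-zero i k p q = cong₂ (λ u v → u * v - + 16 * (S′ i * S′ k)) p q ∙ j (S′ i) (S′ k)
    where
    j : ∀ s t → + 4 * s * (+ 4 * t) - + 16 * (s * t) ≡ 0ℤ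
    j = solve-∀

  -- The coefficient at 2 of the two squares gives K(1)² = 16, and a count is nonnegative. This
  -- fixes the sign of the square root of the series.
  K-1 : count (K-enum 1ℤ) ≡ + 4
  K-1 = root (count (K-enum 1ℤ)) (count-nn (K-enum 1ℤ)) (sym at ∙ defect-sum (+ 2) refl)
    where
    at : ∑ (Ad-enum 1+ 1+ (+ 2)) defect ≡ count (K-enum 1ℤ) * count (K-enum 1ℤ) - + 16
    at = ∑-single (Ad-enum 1+ 1+ (+ 2)) (1ℤ , 1ℤ) ((pos-ℕ 0 , pos-ℕ 0) , refl) defect
      (λ (i , k) ((pi , pk) , eq) ne → ⊥-elim (ne (cong₂ _,_
        (pos-≤1 pi (nn≡ (lc 1ℤ eq (i1 i k)) (pos-pred pk))) (pos-≤1 pk (nn≡ (lc 1ℤ eq (i2 i k)) (pos-pred pi))))))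
      ∙ cong (λ s → count (K-enum 1ℤ) * count (K-enum 1ℤ) - + 16 * (s * s)) S′-1
      where
      i1 : ∀ i k → k - 1ℤ - (1ℤ - i) ≡ 1ℤ * (1ℤ * i + 1ℤ * k - + 2)
      i1 = solve-∀
      i2 : ∀ i k → i - 1ℤ - (1ℤ - k) ≡ 1ℤ * (1ℤ * i + 1ℤ * k - + 2)
      i2 = solve-∀
    root : ∀ g → 0ℤ ≤ g → g * g - + 16 ≡ 0ℤ → g ≡ + 4
    root g nn h with ℤP.i*j≡0⇒i≡0∨j≡0 (g - + 4) {g + + 4} (lc 1ℤ h (i1 g))
      where
      i1 : ∀ g → (g - + 4) * (g + + 4) - 0ℤ ≡ 1ℤ * (g * g - + 16 - 0ℤ)
      i1 = solve-∀
    ... | inj₁ e = ℤP.i-j≡0⇒i≡j g (+ 4) e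
    ... | inj₂ e = ⊥-elim (¬pos0 (pos≡ e (nn-pos nn (pos-ℕ 3))))

private
  Claim : ℤ → Set
  Claim m = count (K-enum m) ≡ + 4 * S′ m

  -- In the coefficient at m + 1 of the difference of the squares, the induction hypothesis removes
  -- every pair except (m, 1) and (1, m). With K(1) = 4 what is left is 8 (K(m) - 4 S′(m)) = 0.
  K-step : ∀ m → Pos m → Odd m → m ≢ 1ℤ → (∀ i → Pos i → Pos (m - i) → Claim i) → Claim m
  K-step m pm o m≢1 IH = fin (count (K-enum m)) (S′ m) (sym two ∙ defect-sum (m + 1ℤ) m+1-even)
    where
    m+1-even : Div 1 (m + 1ℤ)
    m+1-even = ℤP.+-injective (res⇒ 2 (v0 mod 2 ∷ v0 ⊕ κ 1ℤ mod 2 ∷ []) (λ { (a ∷ _) → + a }) (λ _ → 1ℤ) (λ { (_ ∷ b ∷ []) → + b }) (λ _ → 0ℤ) (m ∷ []) (cong +_ o))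
    E = Ad-enum 1+ 1+ (m + 1ℤ)
    fin : ∀ g s → g * + 4 - + 16 * (s * 1ℤ) + (+ 4 * g - + 16 * (1ℤ * s)) ≡ 0ℤ → g ≡ + 4 * s
    fin g s h = *-cancel (+ 8) {g} {+ 4 * s} (pos-ℕ 7) (lc 1ℤ h (i g s))
      where
      i : ∀ g s → + 8 * g - + 8 * (+ 4 * s) ≡ 1ℤ * (g * + 4 - + 16 * (s * 1ℤ) + (+ 4 * g - + 16 * (1ℤ * s)) - 0ℤ)
      i = solve-∀
    snd-of : ∀ {i k} → 1ℤ * i + 1ℤ * k ≡ m + 1ℤ → i ≡ m → k ≡ 1ℤ
    snd-of {i} {k} eq refl = lc 1ℤ eq (j i k)
      where
      j : ∀ i k → k - 1ℤ ≡ 1ℤ * (1ℤ * i + 1ℤ * k - (i + 1ℤ))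
      j = solve-∀
    small : ∀ {i k} → 1ℤ * i + 1ℤ * k ≡ m + 1ℤ → Pos k → k ≢ 1ℤ → Pos (m - i)
    small {i} {k} eq pk k≢1 = case nn⇒≡0⊎pos (pos-pred pk) of λ
      { (inj₁ e) → ⊥-elim (k≢1 (ℤP.i-j≡0⇒i≡j k 1ℤ e))
      ; (inj₂ p) → pos≡ (lc 1ℤ eq (j m i k)) p }
      where
      j : ∀ m i k → k - 1ℤ - (m - i) ≡ 1ℤ * (1ℤ * i + 1ℤ * k - (m + 1ℤ))
      j = solve-∀
    two : ∑ E defect ≡ count (K-enum m) * + 4 - + 16 * (S′ m * 1ℤ) + (+ 4 * count (K-enum m) - + 16 * (1ℤ * S′ m))
    two = ∑-split E (λ (i , _) → i ℤ.≟ m) defect ∙ cong₂ _+_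
      (∑-single (restrict E (λ (i , _) → i ℤ.≟ m)) (m , 1ℤ) (((pm , pos-ℕ 0) , j m) , refl) defect
        (λ (i , k) ((_ , eq) , e) ne → ⊥-elim (ne (cong₂ _,_ e (snd-of eq e))))
       ∙ cong₂ (λ g s → count (K-enum m) * g - + 16 * (S′ m * s)) K-1 S′-1)
      (∑-single (restrict E (¬? ∘ λ (i , _) → i ℤ.≟ m)) (1ℤ , m) (((pos-ℕ 0 , pm) , j′ m) , (λ e → m≢1 (sym e))) defect
        (λ (i , k) (((pi , pk) , eq) , i≢m) ne → defect-zero i k
          (IH i pi (small eq pk (λ k≡1 → i≢m (other i k eq k≡1))))
          (IH k pk (small (ℤP.+-comm (1ℤ * k) (1ℤ * i) ∙ eq) pi (λ i≡1 → ne (cong₂ _,_ i≡1 (other k i (ℤP.+-comm (1ℤ * k) (1ℤ * i) ∙ eq) i≡1))))))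
       ∙ cong₂ (λ g s → g * count (K-enum m) - + 16 * (s * S′ m)) K-1 S′-1)
      where
      j : ∀ m → 1ℤ * m + 1ℤ * 1ℤ ≡ m + 1ℤ
      j = solve-∀
      j′ : ∀ m → 1ℤ * 1ℤ + 1ℤ * m ≡ m + 1ℤ
      j′ = solve-∀
      other : ∀ i k → 1ℤ * i + 1ℤ * k ≡ m + 1ℤ → k ≡ 1ℤ → i ≡ m
      other i k eq refl = lc 1ℤ eq (l i m)
        where
        l : ∀ i m → i - m ≡ 1ℤ * (1ℤ * i + 1ℤ * 1ℤ - (m + 1ℤ))
        l = solve-∀

-- The series Σ K(m) q^m and 4 Σ S′(m) q^m have equal squares and leading coefficients.
K-count : ∀ m → Pos m → count (K-enum m) ≡ + 4 * S′ m
K-count = pos-rec Claim λ m pm IH → cases m pm IH (odd? m) (m ℤ.≟ 1ℤ)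
  where
  one : ∀ m → m ≡ 1ℤ → Claim m
  one m refl = K-1 ∙ sym (cong (+ 4 *_) S′-1)
  cases : ∀ m → Pos m → (∀ i → Pos i → Pos (m - i) → Claim i) → Dec (Odd m) → Dec (m ≡ 1ℤ) → Claim m
  cases m pm IH (no ¬o) _ = K-even m ¬o ∙ sym (cong (+ 4 *_) (S′-even m ¬o))
  cases m pm IH (yes _) (yes e) = one m e
  cases m pm IH (yes o) (no m≢1) = K-step m pm o m≢1 IH

-- Representations by u² + uv + v² and the divisor sum of χ₃

S : ℤ → ℤ
S m = ∑ (Dv-enum 1+ m) (λ (e , _) → χ3 e)

private
  -- A divisor of 2k with odd codivisor has the form 2e, and χ₃(2e) = -χ₃(e); it cancels the divisor
  -- e of k with the same odd codivisor.
  S-double : ∀ k → S (+ 2 * k) ≡ ∑ (Dv-enum 1+ k) (λ (e , d) → even d * χ3 e)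
  S-double k = ∑-cong (Dv-enum 1+ (+ 2 * k)) (λ (e , d) _ → i0 (odd d) (χ3 e))
    ∙ ∑-+ (Dv-enum 1+ (+ 2 * k)) (λ (e , d) → even d * χ3 e) (λ (e , d) → odd d * χ3 e)
    ∙ cong₂ _+_
      (Dv-scale 1 k (λ (e , d) → even d * χ3 e) (λ e d _ h → cong (λ o → (1ℤ - o) * χ3 e) (odd-1 d (¬Div⇒Odd d h)) ∙ ℤP.*-zeroˡ (χ3 e)))
      (Dv-scale′ 1 k (λ (e , d) → odd d * χ3 e) (λ e d (_ , eq) h → cong (_* χ3 e) (d-even e d (¬Div⇒Odd e h) eq) ∙ ℤP.*-zeroˡ (χ3 e)))
    ∙ sym (∑-+ (Dv-enum 1+ k) (λ (e , d) → even (+ 2 * d) * χ3 e) (λ (e , d) → odd d * χ3 (+ 2 * e)))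
    ∙ ∑-cong (Dv-enum 1+ k) (λ (e , d) _ → cong₂ (λ u v → (1ℤ - u) * χ3 e + odd d * v) (odd-0 (+ 2 * d) (λ o → Odd¬Div (+ 2 * d) o (mul-Div 1 d))) (χ3-double e) ∙ i1 (odd d) (χ3 e))
    where
    i0 : ∀ o x → x ≡ (1ℤ - o) * x + o * x
    i0 = solve-∀
    i1 : ∀ o x → (1ℤ - 0ℤ) * x + o * - x ≡ (1ℤ - o) * x
    i1 = solve-∀
    χ3-double : ∀ e → χ3 (+ 2 * e) ≡ - χ3 e
    χ3-double e = res≡ 3 (κ (+ 2) ⊗ v0 mod 3 ∷ v0 mod 3 ∷ []) (λ { (a ∷ _) → t3 a }) (λ { (_ ∷ b ∷ []) → - t3 b }) (e ∷ [])
    d-even : ∀ e d → Odd e → 1ℤ * (e * d) ≡ + 2 * k → odd d ≡ 0ℤ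
    d-even e d o eq = sym (ℤP.*-identityˡ (odd d)) ∙ cong (_* odd d) (sym (odd-1 e o)) ∙ odd-mul e d ∙ cong odd eq
      ∙ odd-0 (+ 2 * k) (λ o′ → Odd¬Div (+ 2 * k) o′ (mul-Div 1 k))

S-2·odd : ∀ k → Odd k → S (+ 2 * k) ≡ 0ℤ
S-2·odd k o = S-double k ∙ ∑-0 (Dv-enum 1+ k) λ (e , d) (_ , eq) → cong (λ t → (1ℤ - t) * χ3 e) (d-odd e d eq) ∙ ℤP.*-zeroˡ (χ3 e)
  where
  d-odd : ∀ e d → 1ℤ * (e * d) ≡ k → odd d ≡ 1ℤ
  d-odd e d eq = res⇒ 2 (κ 1ℤ ⊗ (v0 ⊗ v1) mod 2 ∷ v1 mod 2 ∷ []) (λ { (a ∷ _) → + a }) (λ _ → 1ℤ) (λ { (_ ∷ b ∷ []) → t2 b }) (λ _ → 1ℤ)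
    (e ∷ d ∷ []) (cong +_ (cong (_%ℕ 2) eq ∙ o))

S-4· : ∀ j → S (+ 2 * (+ 2 * j)) ≡ S j
S-4· j = S-double (+ 2 * j)
  ∙ Dv-scale 1 j (λ (e , d) → even d * χ3 e) (λ e d _ h → cong (λ o → (1ℤ - o) * χ3 e) (odd-1 d (¬Div⇒Odd d h)) ∙ ℤP.*-zeroˡ (χ3 e))
  ∙ ∑-cong (Dv-enum 1+ j) (λ (e , d) _ → cong (λ u → (1ℤ - u) * χ3 e) (odd-0 (+ 2 * d) (λ o → Odd¬Div (+ 2 * d) o (mul-Div 1 d))) ∙ ℤP.*-identityˡ (χ3 e))

S-3· : ∀ k → S (+ 3 * k) ≡ S k
S-3· k = Dv-scale 2 k (λ (e , _) → χ3 e) (λ e d (_ , eq) h → by-residues 3 (κ 1ℤ ⊗ (v0 ⊗ v1) mod 3 ∷ v0 mod 3 ∷ v1 mod 3 ∷ [])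
    {λ { (a ∷ b ∷ c ∷ []) → a ≡ 0 → c ≢ 0 → t3 b ≡ 0ℤ }}
    (λ { (a ∷ b ∷ c ∷ []) → (a ℕ.≟ 0) →-dec (¬? (c ℕ.≟ 0) →-dec (t3 b ℤ.≟ 0ℤ)) }) (e ∷ d ∷ []) (cong (_%ℕ 3) eq ∙ mul-Div 2 k) h)

Hx : ℤ → ℤ² → Set
Hx n (u , v) = u * u + u * v + v * v ≡ n

opaque
  Hx-enum : ∀ n → Enum (Hx n)
  Hx-enum n = boxEnum (λ (u , v) → _ ℤ.≟ n) ∣ + 4 * n ∣ λ (u , v) eq → ℕP.⊔-lub
    (abs-sq u {+ 4 * n} (nn≡ (lc (+ 4) eq (i1 u v n)) (nn+ (nn² (+ 2 * v + u)) (nn* {+ 2} (ℤ.+≤+ ℕ.z≤n) (nn² u)))))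
    (abs-sq v {+ 4 * n} (nn≡ (lc (+ 4) eq (i2 u v n)) (nn+ (nn² (+ 2 * u + v)) (nn* {+ 2} (ℤ.+≤+ ℕ.z≤n) (nn² v)))))
    where
    i1 : ∀ u v n → (+ 2 * v + u) * (+ 2 * v + u) + + 2 * (u * u) - (+ 4 * n - u * u) ≡ + 4 * (u * u + u * v + v * v - n)
    i1 = solve-∀
    i2 : ∀ u v n → (+ 2 * u + v) * (+ 2 * u + v) + + 2 * (v * v) - (+ 4 * n - v * v) ≡ + 4 * (u * u + u * v + v * v - n)
    i2 = solve-∀

private
  K-Hx : ∀ n → ∑ (Hx-enum n) (λ (u , v) → odd v) ≡ count (K-enum n)
  K-Hx n = ∑-supp (Hx-enum n) (λ (_ , v) → odd? v) (λ (_ , v) → odd v) (λ (_ , v) _ → odd-0 v)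
    ∙ ∑-bij (restrict (Hx-enum n) (λ (_ , v) → odd? v)) (K-enum n)
      (λ (u , v) → + 2 * u + v , v) (λ (y , z) → (y - z) /ℕ 2 , z)
      (λ (u , v) (eq , o) → (odd-shift u v o , o) , lc (+ 4) eq (i1 u v n))
      (λ (y , z) ((oy , oz) , eq) → *-cancel (+ 4) (pos-ℕ 3) (fromHalf y z ((y - z) /ℕ 2) (half y z oy oz) eq) , oz)
      (λ (u , v) _ → cong (_, v) (cong (_/ℕ 2) (i2 u v) ∙ mul-div 1 u))
      (λ (y , z) ((oy , oz) , _) → cong (_, z) (lc 1ℤ (half y z oy oz) (i3 y z ((y - z) /ℕ 2))))
      (λ (u , v) (_ , o) → odd-1 v o)
    where
    i1 : ∀ u v n → (+ 2 * u + v) * (+ 2 * u + v) + + 3 * (v * v) - + 4 * n ≡ + 4 * (u * u + u * v + v * v - n)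
    i1 = solve-∀
    i2 : ∀ u v → + 2 * u + v - v ≡ + 2 * u
    i2 = solve-∀
    i3 : ∀ y z h → + 2 * h + z - y ≡ 1ℤ * (+ 2 * h - (y - z))
    i3 = solve-∀
    odd-shift : ∀ u v → Odd v → Odd (+ 2 * u + v)
    odd-shift u v o = ℤP.+-injective (res≡ 2 (κ (+ 2) ⊗ v0 ⊕ v1 mod 2 ∷ v1 mod 2 ∷ []) (λ { (a ∷ _) → + a }) (λ { (_ ∷ b ∷ []) → + b }) (u ∷ v ∷ [])) ∙ o
    half : ∀ y z → Odd y → Odd z → + 2 * ((y - z) /ℕ 2) ≡ y - z
    half y z oy oz = div-eq 1 (y - z) (ℤP.+-injective (res⇒ 2 (v0 mod 2 ∷ v1 mod 2 ∷ v0 ⊖ v1 mod 2 ∷ []) (λ { (a ∷ b ∷ _) → + a + + b }) (λ _ → + 2)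
      (λ { (_ ∷ _ ∷ c ∷ []) → + c }) (λ _ → 0ℤ) (y ∷ z ∷ []) (cong₂ (λ u v → + u + + v) oy oz)))
    fromHalf : ∀ y z h → + 2 * h ≡ y - z → y * y + + 3 * (z * z) ≡ + 4 * n → + 4 * (h * h + h * z + z * z) ≡ + 4 * n
    fromHalf y z h e eq = lc2 (+ 2 * h + y + z) e 1ℤ eq (j y z h n)
      where
      j : ∀ y z h n → + 4 * (h * h + h * z + z * z) - + 4 * n ≡ (+ 2 * h + y + z) * (+ 2 * h - (y - z)) + 1ℤ * (y * y + + 3 * (z * z) - + 4 * n)
      j = solve-∀

  -- For odd n exactly two of u, v, u + v are odd, and automorphisms of the form permute the three
  -- up to sign.
  hex-odd : ∀ n → Odd n → + 2 * count (Hx-enum n) ≡ + 3 * count (K-enum n)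
  hex-odd n o = sym (∑-* (Hx-enum n) (+ 2) (λ _ → 1ℤ))
    ∙ ∑-cong (Hx-enum n) (λ (u , v) eq → two u v (cong (_%ℕ 2) eq ∙ o))
    ∙ ∑-+ (Hx-enum n) (λ (u , v) → odd u + odd v) (λ (u , v) → odd (u + v))
    ∙ cong₂ _+_ (∑-+ (Hx-enum n) (λ (u , v) → odd u) (λ (u , v) → odd v) ∙ cong₂ _+_
        (∑-inv (Hx-enum n) (λ (u , v) → v , u) (λ (u , v) eq → i1 u v ∙ eq) (λ _ _ → refl) {g = λ (u , v) → odd v} (λ _ _ → refl)) refl)
        (∑-bij (Hx-enum n) (Hx-enum n) (λ (u , v) → - v , u + v) (λ (u , v) → u + v , - u)
          (λ (u , v) eq → i2 u v ∙ eq) (λ (u , v) eq → i3 u v ∙ eq)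
          (λ (u , v) _ → cong₂ _,_ (i4 u v) (ℤP.neg-involutive v)) (λ (u , v) _ → cong₂ _,_ (ℤP.neg-involutive u) (i5 u v)) {g = λ (u , v) → odd v} (λ _ _ → refl))
    ∙ i6 (∑ (Hx-enum n) (λ (u , v) → odd v)) ∙ cong (+ 3 *_) (K-Hx n)
    where
    two : ∀ u v → (u * u + u * v + v * v) %ℕ 2 ≡ 1 → + 2 * 1ℤ ≡ odd u + odd v + odd (u + v)
    two u v h = res⇒ 2 (v0 ⊗ v0 ⊕ v0 ⊗ v1 ⊕ v1 ⊗ v1 mod 2 ∷ v0 mod 2 ∷ v1 mod 2 ∷ v0 ⊕ v1 mod 2 ∷ []) (λ { (a ∷ _) → + a }) (λ _ → 1ℤ)
      (λ _ → + 2) (λ { (_ ∷ a ∷ b ∷ c ∷ []) → t2 a + t2 b + t2 c }) (u ∷ v ∷ []) (cong +_ h)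
    i1 : ∀ u v → v * v + v * u + u * u ≡ u * u + u * v + v * v
    i1 = solve-∀
    i2 : ∀ u v → - v * - v + - v * (u + v) + (u + v) * (u + v) ≡ u * u + u * v + v * v
    i2 = solve-∀
    i3 : ∀ u v → (u + v) * (u + v) + (u + v) * - u + - u * - u ≡ u * u + u * v + v * v
    i3 = solve-∀
    i4 : ∀ u v → - v + (u + v) ≡ u
    i4 = solve-∀
    i5 : ∀ u v → u + v + - u ≡ v
    i5 = solve-∀
    i6 : ∀ x → x + x + x ≡ + 3 * x
    i6 = solve-∀

  hex-parity : ∀ u v → Div 1 (u * u + u * v + v * v) → Div 1 u × Div 1 v
  hex-parity u v = by-residues 2 (v0 ⊗ v0 ⊕ v0 ⊗ v1 ⊕ v1 ⊗ v1 mod 2 ∷ v0 mod 2 ∷ v1 mod 2 ∷ [])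
    {λ { (a ∷ b ∷ c ∷ []) → a ≡ 0 → b ≡ 0 × c ≡ 0 }} (λ { (a ∷ b ∷ c ∷ []) → (a ℕ.≟ 0) →-dec ((b ℕ.≟ 0) ×-dec (c ℕ.≟ 0)) }) (u ∷ v ∷ [])

  hex-4 : ∀ j → count (Hx-enum (+ 2 * (+ 2 * j))) ≡ count (Hx-enum j)
  hex-4 j = ∑-bij (Hx-enum (+ 2 * (+ 2 * j))) (Hx-enum j) (λ (u , v) → u /ℕ 2 , v /ℕ 2) (λ (u , v) → + 2 * u , + 2 * v)
    (λ (u , v) eq → let (du , dv) = hp u v eq in *-cancel (+ 4) (pos-ℕ 3)
      (i1 (u /ℕ 2) (v /ℕ 2) ∙ cong₂ (λ u v → u * u + u * v + v * v) (div-eq 1 u du) (div-eq 1 v dv) ∙ eq ∙ i3 j))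
    (λ (u , v) eq → sym (i1 u v) ∙ cong (+ 4 *_) eq ∙ sym (i3 j))
    (λ (u , v) eq → let (du , dv) = hp u v eq in cong₂ _,_ (div-eq 1 u du) (div-eq 1 v dv))
    (λ (u , v) _ → cong₂ _,_ (mul-div 1 u) (mul-div 1 v)) (λ _ _ → refl)
    where
    hp : ∀ u v → Hx (+ 2 * (+ 2 * j)) (u , v) → Div 1 u × Div 1 v
    hp u v eq = hex-parity u v (cong (_%ℕ 2) eq ∙ mul-Div 1 (+ 2 * j))
    i1 : ∀ u v → + 4 * (u * u + u * v + v * v) ≡ + 2 * u * (+ 2 * u) + + 2 * u * (+ 2 * v) + + 2 * v * (+ 2 * v)
    i1 = solve-∀
    i3 : ∀ j → + 2 * (+ 2 * j) ≡ + 4 * j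
    i3 = solve-∀

  hex-2·odd : ∀ k → Odd k → count (Hx-enum (+ 2 * k)) ≡ 0ℤ
  hex-2·odd k o = ∑-0 (Hx-enum (+ 2 * k)) λ (u , v) eq → ⊥-elim (no4 u v (cong (_%ℕ 4) eq ∙
    ℤP.+-injective (res⇒ 4 (κ (+ 2) ⊗ v0 mod 4 ∷ v0 mod 2 ∷ []) (λ { (_ ∷ b ∷ []) → + b }) (λ _ → 1ℤ) (λ { (a ∷ _) → + a }) (λ _ → + 2) (k ∷ []) (cong +_ o))))
    where
    no4 : ∀ u v → (u * u + u * v + v * v) %ℕ 4 ≢ 2
    no4 u v = by-residues 4 (v0 ⊗ v0 ⊕ v0 ⊗ v1 ⊕ v1 ⊗ v1 mod 4 ∷ []) {λ { (a ∷ []) → a ≢ 2 }} (λ { (a ∷ []) → ¬? (a ℕ.≟ 2) }) (u ∷ v ∷ [])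

-- An even value forces u and v to be even, so twice an odd number is not represented and 4j has as
-- many representations as j. `S` obeys the same two rules.
hex-count : ∀ n → Pos n → count (Hx-enum n) ≡ + 6 * S n
hex-count = pos-rec Goal λ n pn IH → cases n pn IH (odd? n)
  where
  S′≡S : ∀ n → Odd n → S′ n ≡ S n
  S′≡S n o = ∑-cong (Dv-enum 1+ n) λ (a , x) (_ , eq) → cong (_* χ3 a) (odd-mul a x ∙ cong odd eq ∙ odd-1 n o) ∙ ℤP.*-identityˡ (χ3 a)
  Goal : ℤ → Set
  Goal n = count (Hx-enum n) ≡ + 6 * S n
  at-odd : ∀ n → Pos n → Odd n → Goal n
  at-odd n pn o = *-cancel (+ 2) (pos-ℕ 1) (hex-odd n o ∙ cong (+ 3 *_) (K-count n pn ∙ cong (+ 4 *_) (S′≡S n o)) ∙ i (S n))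
    where
    i : ∀ s → + 3 * (+ 4 * s) ≡ + 2 * (+ 6 * s)
    i = solve-∀
  at-even : ∀ n k → n ≡ + 2 * k → Pos n → (∀ i → Pos i → Pos (n - i) → Goal i) → Dec (Odd k) → Goal n
  at-even n k refl pn IH (yes o) = hex-2·odd k o ∙ sym (cong (+ 6 *_) (S-2·odd k o))
  at-even n k refl pn IH (no ¬o) = at-4 (k /ℕ 2) (div-eq 1 k (¬Odd⇒Div k ¬o))
    where
    at-4 : ∀ j → + 2 * j ≡ k → Goal (+ 2 * k)
    at-4 j refl = hex-4 j ∙ IH j pj (pos≡ (i2 j) (pos+ (pos* {+ 2} (pos-ℕ 1) pj) pj)) ∙ cong (+ 6 *_) (sym (S-4· j))
      where
      pj : Pos j
      pj = pos*⁻ {+ 2} (pos-ℕ 1) (pos*⁻ {+ 2} (pos-ℕ 1) pn)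
      i2 : ∀ j → + 2 * j + j ≡ + 2 * (+ 2 * j) - j
      i2 = solve-∀
  cases : ∀ n → Pos n → (∀ i → Pos i → Pos (n - i) → Goal i) → Dec (Odd n) → Goal n
  cases n pn IH (yes o) = at-odd n pn o
  cases n pn IH (no ¬o) = at-even n (n /ℕ 2) (sym (div-eq 1 n (¬Odd⇒Div n ¬o))) pn IH (odd? (n /ℕ 2))

-- Liouville's identity with χ₁₂

E₁ E₂ : ℤ → ℤ
E₁ N = ∑ (Dv-enum 1+ N) (λ (d , D) → D * χ12 D)
E₂ N = ∑ (Dv-enum 1+ N) (λ (d , D) → D * χ12 d)

2+ : Pos (+ 2)
2+ = pos-ℕ 1
4+ : Pos (+ 4)
4+ = pos-ℕ 3
8+ : Pos (+ 8)
8+ = pos-ℕ 7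

-- The table of χ₁₂(1) + ... + χ₁₂(r - 1); it is periodic because a full period sums to zero.
tJ : ℕ → ℤ
tJ 2 = 1ℤ
tJ 3 = 1ℤ
tJ 4 = 1ℤ
tJ 5 = 1ℤ
tJ 8 = - 1ℤ
tJ 9 = - 1ℤ
tJ 10 = - 1ℤ
tJ 11 = - 1ℤ
tJ _ = 0ℤ

J : ℤ → ℤ
J x = tJ (x %ℕ 12)

-- For odd D the partial sum of χ₁₂ counted twice, with the endpoint added once, is again the
-- function `s₂` of `χ12-key`.
χ12-below : ∀ D → Pos D → Odd D → + 2 * ∑ (Below-enum D) χ12 ≡ s₂ D - χ12 D
χ12-below D pD oD = cong (+ 2 *_) (below-closed χ12 J refl
    (λ x → res≡ 12 (v0 ⊕ κ 1ℤ mod 12 ∷ v0 mod 12 ∷ []) (λ { (a ∷ _) → tJ a }) (λ { (_ ∷ b ∷ []) → tJ b + t12 b }) (x ∷ [])) D pD)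
  ∙ res⇒ 12 (v0 mod 2 ∷ v0 mod 12 ∷ v0 mod 4 ∷ []) (λ { (a ∷ _) → + a }) (λ _ → 1ℤ) (λ { (_ ∷ b ∷ _) → + 2 * tJ b })
      (λ { (_ ∷ b ∷ c ∷ []) → t4 c + + 3 * t4′ b - t12 b }) (D ∷ []) (cong +_ oD)

odd-below : ∀ D → Pos D → Odd D → + 2 * ∑ (Below-enum D) odd ≡ D - 1ℤ
odd-below D pD oD = sym (∑-* (Below-enum D) (+ 2) odd)
  ∙ below-closed (λ x → + 2 * odd x) (λ x → x - odd x) refl (λ x → lc 1ℤ (step x) (i x (odd x) (odd (x + 1ℤ)))) D pD ∙ cong (λ o → D - o) (odd-1 D oD)
  where
  step : ∀ x → - odd (x + 1ℤ) ≡ odd x - 1ℤ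
  step x = res≡ 2 (v0 ⊕ κ 1ℤ mod 2 ∷ v0 mod 2 ∷ []) (λ { (a ∷ b ∷ []) → - t2 a }) (λ { (a ∷ b ∷ []) → t2 b - 1ℤ }) (x ∷ [])
  i : ∀ x o o′ → x + 1ℤ - o′ - (x - o + + 2 * o) ≡ 1ℤ * (- o′ - (o - 1ℤ))
  i = solve-∀

one-below : ∀ D → Pos D → count (Below-enum D) ≡ D - 1ℤ
one-below D pD = below-closed (λ _ → 1ℤ) (λ x → x - 1ℤ) refl i D pD
  where
  i : ∀ x → x + 1ℤ - 1ℤ ≡ x - 1ℤ + 1ℤ
  i = solve-∀

χ12-neg : ∀ u → χ12 (- u) ≡ χ12 u
χ12-neg u = subst (λ v → χ12 v ≡ χ12 u) (ℤP.+-identityˡ (- u))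
  (res≡ 12 (κ 0ℤ ⊖ v0 mod 12 ∷ v0 mod 12 ∷ []) (λ { (a ∷ _) → t12 a }) (λ { (_ ∷ b ∷ []) → t12 b }) (u ∷ []))

odd-neg : ∀ u → odd (- u) ≡ odd u
odd-neg u = subst (λ v → odd v ≡ odd u) (ℤP.+-identityˡ (- u))
  (res≡ 2 (κ 0ℤ ⊖ v0 mod 2 ∷ v0 mod 2 ∷ []) (λ { (a ∷ _) → t2 a }) (λ { (_ ∷ b ∷ []) → t2 b }) (u ∷ []))

X : ∀ {c} → Pos c → ℤ → ℤ
X pc N = ∑ (Ω-enum pc 1+ N) (λ (a , b , x , y) → σ a * s₂ b)

Δ : ℤ → ℤ → ℤ
Δ a b = χ12 (a - b) - χ12 (a + b)

-- χ₁₂ vanishes on even numbers, so a nonzero difference has exactly one of a and b even.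
Δ-parity : ∀ a b → Δ a b ≡ even a * Δ a b + even b * Δ a b
Δ-parity a b = res≡ 12 (v0 ⊖ v1 mod 12 ∷ v0 ⊕ v1 mod 12 ∷ v0 mod 2 ∷ v1 mod 2 ∷ []) (λ { (p ∷ q ∷ _) → t12 p - t12 q })
  (λ { (p ∷ q ∷ a ∷ b ∷ []) → (1ℤ - t2 a) * (t12 p - t12 q) + (1ℤ - t2 b) * (t12 p - t12 q) }) (a ∷ b ∷ [])

Δ-swap : ∀ a b → Δ b a ≡ Δ a b
Δ-swap a b = cong₂ _-_ (sym (χ12-neg (b - a)) ∙ cong χ12 (i a b)) (cong χ12 (ℤP.+-comm b a))
  where
  i : ∀ a b → - (b - a) ≡ a - b
  i = solve-∀

even-mul2 : ∀ a → even (+ 2 * a) ≡ 1ℤ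
even-mul2 a = cong (λ o → 1ℤ - o) (odd-0 (+ 2 * a) (λ o → Odd¬Div (+ 2 * a) o (mul-Div 1 a)))

even-non : ∀ a → ¬ Div 1 a → even a ≡ 0ℤ
even-non a h = cong (λ o → 1ℤ - o) (odd-1 a (¬Div⇒Odd a h))

-- By symmetry one may assume a even; then a = 2a′ and χ12-key applies.
Δ-sum : ∀ N (g : ℤ → ℤ) → ∑ (Ω₁ N) (λ (a , b , x , y) → Δ a b * g (x + y))
  ≡ + 2 * ∑ (Ω-enum 2+ 1+ N) (λ (a , b , x , y) → σ a * s₂ b * g (x + y))
Δ-sum N g = ∑-cong (Ω₁ N) (λ (a , b , x , y) _ → cong (_* g (x + y)) (Δ-parity a b) ∙ i1 (even a * Δ a b) (even b * Δ a b) (g (x + y)))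
  ∙ ∑-+ (Ω₁ N) F G
  ∙ +-congˡ {∑ (Ω₁ N) F} (∑-swapΩ 1+ 1+ N G ∙ ∑-cong (Ω₁ N) (λ (a , b , x , y) _ → cong₂ (λ u v → even a * u * g v) (Δ-swap a b) (ℤP.+-comm y x)))
  ∙ i2 (∑ (Ω₁ N) F)
  ∙ cong (+ 2 *_) (Ω-scale-a 1 1+ 1+ 2+ N F (λ a b x y _ h → vanish* (Δ a b) (g (x + y)) (even-non a h))
    ∙ ∑-cong (Ω-enum 2+ 1+ N) (λ (a , b , x , y) _ → cong₂ (λ u v → u * v * g (x + y)) (even-mul2 a) (χ12-key a b)
      ∙ cong (λ t → t * g (x + y)) (ℤP.*-identityˡ (σ a * s₂ b * odd b) ∙ ℤP.*-assoc (σ a) (s₂ b) (odd b) ∙ cong (σ a *_) (s₂-odd b))))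
  where
  F G : ℤ⁴ → ℤ
  F (a , b , x , y) = even a * Δ a b * g (x + y)
  G (a , b , x , y) = even b * Δ a b * g (x + y)
  vanish* : ∀ {e} u v → e ≡ 0ℤ → e * u * v ≡ 0ℤ
  vanish* u v refl = ℤP.*-zeroˡ v
  i1 : ∀ a b c → (a + b) * c ≡ a * c + b * c
  i1 = solve-∀
  i2 : ∀ x → x + x ≡ + 2 * x
  i2 = solve-∀
  s₂-odd : ∀ b → s₂ b * odd b ≡ s₂ b
  s₂-odd b = res≡ 12 (v0 mod 4 ∷ v0 mod 12 ∷ v0 mod 2 ∷ []) (λ { (a ∷ b ∷ c ∷ []) → (t4 a + + 3 * t4′ b) * t2 c }) (λ { (a ∷ b ∷ _) → t4 a + + 3 * t4′ b }) (b ∷ [])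

Dv-odd : ∀ N → Odd N → ∀ d D → 1ℤ * (d * D) ≡ N → Odd d × Odd D
Dv-odd N oN d D eq = by-residues 2 (κ 1ℤ ⊗ (v0 ⊗ v1) mod 2 ∷ v0 mod 2 ∷ v1 mod 2 ∷ [])
  {λ { (a ∷ b ∷ c ∷ []) → a ≡ 1 → b ≡ 1 × c ≡ 1 }} (λ { (a ∷ b ∷ c ∷ []) → (a ℕ.≟ 1) →-dec ((b ℕ.≟ 1) ×-dec (c ℕ.≟ 1)) }) (d ∷ D ∷ [])
  (cong (_%ℕ 2) eq ∙ oN)

module Trivial (f : ℤ → ℤ → ℤ) (f-even₁ : ∀ u v → f (- u) v ≡ f u v) (f-even₂ : ∀ u v → f u (- v) ≡ f u v) (N : ℤ) where
  open module L′ = Liouville f f-even₁ f-even₂ (λ _ → 1ℤ) (λ _ → 1ℤ) (λ _ → refl) (λ _ _ _ _ → refl) (λ _ _ _ _ → refl) (λ _ _ _ _ → refl) N public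

  nested : ∑ (Ω₁ N) (λ (a , b , x , y) → f (a - b) (x + y) - f (a + b) (x - y))
    ≡ ∑ (Dv-enum 1+ N) (λ (d , D) → ∑ (Below-enum D) (λ k → (f 0ℤ D + + 2 * f d k) - (f D 0ℤ + + 2 * f k d)))
  nested = ∑-cong (Ω₁ N) (λ (a , b , x , y) _ → sym (ℤP.*-identityˡ (f (a - b) (x + y) - f (a + b) (x - y)))) ∙ liouville
    ∙ ∑-cong (Tri-enum N) (λ ((d , D) , k) _ → i (f 0ℤ D) (f d k) (f D 0ℤ) (f k d))
    ∙ ∑-fubini (Dv-enum 1+ N) (λ (d , D) → Below-enum D) (Tri-enum N) (λ _ _ p → p) (λ _ _ p q → p , q) _
    where
    i : ∀ a b c d → (1ℤ * a + + 2 * (1ℤ * b)) - (1ℤ * c + + 2 * (1ℤ * d)) ≡ (a + + 2 * b) - (c + + 2 * d)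
    i = solve-∀

χ-sums : ∀ N → ∑ (Dv-enum 1+ N) (λ (d , D) → χ12 D) ≡ ∑ (Dv-enum 1+ N) (λ (d , D) → χ12 d)
χ-sums N = Dv-swap N (λ (d , D) → χ12 D)

Σs₂ : ℤ → ℤ
Σs₂ N = ∑ (Dv-enum 1+ N) (λ (d , D) → s₂ D)

-- Liouville's identity for f(u, v) = χ₁₂(u). The sums of χ₁₂(d) and of χ₁₂(D) that come from the
-- endpoints cancel by exchanging complementary divisors.
full : ∀ N → Odd N → + 2 * X 2+ N ≡ + 2 * E₂ N - E₁ N - Σs₂ N
full N oN = sym (∑-cong (Ω₁ N) (λ (a , b , x , y) _ → sym (ℤP.*-identityʳ (Δ a b))) ∙ Δ-sum N (λ _ → 1ℤ)
    ∙ cong (+ 2 *_) (∑-cong (Ω-enum 2+ 1+ N) (λ (a , b , x , y) _ → ℤP.*-identityʳ (σ a * s₂ b))))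
  ∙ T.nested
  ∙ ∑-cong (Dv-enum 1+ N) (λ (d , D) ((pd , pD) , eq) → row d D pD (proj₂ (Dv-odd N oN d D eq)))
  ∙ sums
  where
  module T = Trivial (λ u _ → χ12 u) (λ u _ → χ12-neg u) (λ _ _ → refl) N
  row : ∀ d D → Pos D → Odd D → ∑ (Below-enum D) (λ k → (χ12 0ℤ + + 2 * χ12 d) - (χ12 D + + 2 * χ12 k))
    ≡ (+ 2 * (D * χ12 d) - D * χ12 D - s₂ D) + + 2 * (χ12 D - χ12 d)
  row d D pD oD = ∑-- (Below-enum D) (λ _ → 0ℤ + + 2 * χ12 d) (λ k → χ12 D + + 2 * χ12 k)
    ∙ cong₂ _-_ (const (0ℤ + + 2 * χ12 d)) (∑-+ (Below-enum D) (λ _ → χ12 D) (λ k → + 2 * χ12 k) ∙ cong₂ _+_ (const (χ12 D)) (∑-* (Below-enum D) (+ 2) χ12 ∙ χ12-below D pD oD))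
    ∙ j D (χ12 d) (χ12 D) (s₂ D)
    where
    const : ∀ c → ∑ (Below-enum D) (λ _ → c) ≡ c * (D - 1ℤ)
    const c = ∑-cong (Below-enum D) (λ _ _ → sym (ℤP.*-identityʳ c)) ∙ ∑-* (Below-enum D) c (λ _ → 1ℤ) ∙ cong (c *_) (one-below D pD)
    j : ∀ D x X s → (0ℤ + + 2 * x) * (D - 1ℤ) - (X * (D - 1ℤ) + (s - X)) ≡ (+ 2 * (D * x) - D * X - s) + + 2 * (X - x)
    j = solve-∀
  e = Dv-enum 1+ N
  sums : ∑ e (λ (d , D) → (+ 2 * (D * χ12 d) - D * χ12 D - s₂ D) + + 2 * (χ12 D - χ12 d)) ≡ + 2 * E₂ N - E₁ N - Σs₂ N
  sums = ∑-+ e (λ (d , D) → + 2 * (D * χ12 d) - D * χ12 D - s₂ D) (λ (d , D) → + 2 * (χ12 D - χ12 d))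
    ∙ cong₂ _+_ (∑-- e (λ (d , D) → + 2 * (D * χ12 d) - D * χ12 D) (λ (d , D) → s₂ D)
        ∙ cong (_- Σs₂ N) (∑-- e (λ (d , D) → + 2 * (D * χ12 d)) (λ (d , D) → D * χ12 D) ∙ cong (_- E₁ N) (∑-* e (+ 2) (λ (d , D) → D * χ12 d))))
      (∑-* e (+ 2) (λ (d , D) → χ12 D - χ12 d) ∙ cong (+ 2 *_) (∑-- e (λ (d , D) → χ12 D) (λ (d , D) → χ12 d) ∙ ℤP.i≡j⇒i-j≡0 (χ-sums N)))
    ∙ ℤP.+-identityʳ (+ 2 * E₂ N - E₁ N - Σs₂ N)

-- Liouville's identity for f(u, v) = χ₁₂(u) [v odd]. In 2 a x + b y = N with N odd, y is odd, so x
-- + y is odd exactly when x is even; halving x turns the coefficient 2 into 4.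
half : ∀ N → Odd N → + 2 * X 4+ N ≡ E₂ N - Σs₂ N
half N oN = sym (Δ-sum N odd ∙ cong (+ 2 *_) halve)
  ∙ ∑-cong (Ω₁ N) (λ (a , b , x , y) _ → dist (χ12 (a - b)) (χ12 (a + b)) (odd (x + y)) ∙ cong (λ o → χ12 (a - b) * odd (x + y) - χ12 (a + b) * o) (odd-± x y))
  ∙ T.nested
  ∙ ∑-cong (Dv-enum 1+ N) (λ (d , D) ((pd , pD) , eq) → row d D pD (proj₁ (Dv-odd N oN d D eq)) (proj₂ (Dv-odd N oN d D eq)))
  ∙ sums
  where
  module T = Trivial (λ u v → χ12 u * odd v) (λ u v → cong (_* odd v) (χ12-neg u)) (λ u v → cong (χ12 u *_) (odd-neg v)) N
  e = Dv-enum 1+ N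
  dist : ∀ a b c → (a - b) * c ≡ a * c - b * c
  dist = solve-∀
  odd-± : ∀ x y → odd (x + y) ≡ odd (x - y)
  odd-± x y = res≡ 2 (v0 ⊕ v1 mod 2 ∷ v0 ⊖ v1 mod 2 ∷ []) (λ { (a ∷ _) → t2 a }) (λ { (_ ∷ b ∷ []) → t2 b }) (x ∷ y ∷ [])
  halve : ∑ (Ω-enum 2+ 1+ N) (λ (a , b , x , y) → σ a * s₂ b * odd (x + y)) ≡ X 4+ N
  halve = ∑-cong (Ω-enum 2+ 1+ N) (λ (a , b , x , y) (_ , eq) → ℤP.*-assoc (σ a) (s₂ b) (odd (x + y)) ∙ cong (σ a *_) (key a b x y (cong (_%ℕ 2) eq ∙ oN)))
    ∙ Ω-scale-x 1 2+ 1+ 4+ N (λ (a , b , x , y) → σ a * (s₂ b * even x)) (λ a b x y _ h → zero′ (σ a) (s₂ b) (even-non x h))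
    ∙ ∑-cong (Ω-enum 4+ 1+ N) (λ (a , b , x , y) _ → cong (λ u → σ a * (s₂ b * u)) (even-mul2 x) ∙ cong (σ a *_) (ℤP.*-identityʳ (s₂ b)))
    where
    zero′ : ∀ a b {u} → u ≡ 0ℤ → a * (b * u) ≡ 0ℤ
    zero′ a b refl = cong (a *_) (ℤP.*-zeroʳ b) ∙ ℤP.*-zeroʳ a
    key : ∀ a b x y → (+ 2 * (a * x) + 1ℤ * (b * y)) %ℕ 2 ≡ 1 → s₂ b * odd (x + y) ≡ s₂ b * even x
    key a b x y h = cong (_* odd (x + y)) (s₂-odd b) ∙ ℤP.*-assoc (s₂ b) (odd b) (odd (x + y)) ∙ cong (s₂ b *_)
        (res⇒ 2 (κ (+ 2) ⊗ (v0 ⊗ v2) ⊕ κ 1ℤ ⊗ (v1 ⊗ v3) mod 2 ∷ v1 mod 2 ∷ v2 ⊕ v3 mod 2 ∷ v2 mod 2 ∷ []) (λ { (c ∷ _) → + c }) (λ _ → 1ℤ)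
          (λ { (_ ∷ b ∷ s ∷ _) → t2 b * t2 s }) (λ { (_ ∷ b ∷ _ ∷ x ∷ []) → t2 b * (1ℤ - t2 x) }) (a ∷ b ∷ x ∷ y ∷ []) (cong +_ h))
      ∙ sym (ℤP.*-assoc (s₂ b) (odd b) (even x)) ∙ cong (_* even x) (sym (s₂-odd b))
      where
      s₂-odd : ∀ b → s₂ b ≡ s₂ b * odd b
      s₂-odd b = res≡ 12 (v0 mod 4 ∷ v0 mod 12 ∷ v0 mod 2 ∷ []) (λ { (a ∷ b ∷ _) → t4 a + + 3 * t4′ b }) (λ { (a ∷ b ∷ c ∷ []) → (t4 a + + 3 * t4′ b) * t2 c }) (b ∷ [])
  row : ∀ d D → Pos D → Odd d → Odd D → ∑ (Below-enum D) (λ k → (χ12 0ℤ * odd D + + 2 * (χ12 d * odd k)) - (χ12 D * odd 0ℤ + + 2 * (χ12 k * odd d)))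
    ≡ (D * χ12 d - s₂ D) + (χ12 D - χ12 d)
  row d D pD od oD = ∑-cong (Below-enum D) (λ k _ → cong (λ o → (0ℤ * odd D + + 2 * (χ12 d * odd k)) - (χ12 D * 0ℤ + + 2 * (χ12 k * o))) (odd-1 d od) ∙ i (odd D) (χ12 d) (odd k) (χ12 D) (χ12 k))
    ∙ ∑-- (Below-enum D) (λ k → χ12 d * (+ 2 * odd k)) (λ k → + 2 * χ12 k)
    ∙ cong₂ _-_ (∑-* (Below-enum D) (χ12 d) (λ k → + 2 * odd k) ∙ cong (χ12 d *_) (∑-* (Below-enum D) (+ 2) odd ∙ odd-below D pD oD))
                (∑-* (Below-enum D) (+ 2) χ12 ∙ χ12-below D pD oD)
    ∙ j D (χ12 d) (χ12 D) (s₂ D)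
    where
    i : ∀ p x q X y → (0ℤ * p + + 2 * (x * q)) - (X * 0ℤ + + 2 * (y * 1ℤ)) ≡ x * (+ 2 * q) - + 2 * y
    i = solve-∀
    j : ∀ D x X s → x * (D - 1ℤ) - (s - X) ≡ (D * x - s) + (X - x)
    j = solve-∀
  sums : ∑ e (λ (d , D) → (D * χ12 d - s₂ D) + (χ12 D - χ12 d)) ≡ E₂ N - Σs₂ N
  sums = ∑-+ e (λ (d , D) → D * χ12 d - s₂ D) (λ (d , D) → χ12 D - χ12 d)
    ∙ cong₂ _+_ (∑-- e (λ (d , D) → D * χ12 d) (λ (d , D) → s₂ D)) (∑-- e (λ (d , D) → χ12 D) (λ (d , D) → χ12 d) ∙ ℤP.i≡j⇒i-j≡0 (χ-sums N))
    ∙ ℤP.+-identityʳ (E₂ N - Σs₂ N)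

-- Convolutions of the divisor sums of χ₃ and χ₄

L : ∀ {c c′} → Pos c → Pos c′ → ℤ → ℤ
L pc pc′ N = ∑ (Ω-enum pc pc′ N) (λ (a , b , x , y) → χ3 a * χ4 b)

L-conv : ∀ {c c′} (pc : Pos c) (pc′ : Pos c′) N → L pc pc′ N ≡ ∑ (Ad-enum pc pc′ N) (λ (i , k) → S i * ρ k)
L-conv pc pc′ N = conv pc pc′ N (λ (a , _) → χ3 a) (λ (b , _) → χ4 b)

private
  χ3′-scale : ∀ {c c′} (pc : Pos c) (pc′ : Pos c′) (p : Pos (+ 2 * c)) N (g : ℤ → ℤ) →
    ∑ (Ω-enum pc pc′ N) (λ (a , b , x , y) → χ3′ a * g b) ≡ ∑ (Ω-enum p pc′ N) (λ (a , b , x , y) → χ3 a * g b)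
  χ3′-scale pc pc′ p N g = Ω-scale-a 1 pc pc′ p N (λ (a , b , x , y) → χ3′ a * g b) (λ a b x y _ h → cong (_* g b) (non a h) ∙ ℤP.*-zeroˡ (g b))
    ∙ ∑-cong (Ω-enum p pc′ N) (λ (a , b , x , y) _ → cong (_* g b)
        (res≡ 6 (κ (+ 2) ⊗ v0 mod 6 ∷ v0 mod 3 ∷ []) (λ { (a ∷ _) → t3′ a }) (λ { (_ ∷ b ∷ []) → t3 b }) (a ∷ [])))
    where
    non : ∀ a → ¬ Div 1 a → χ3′ a ≡ 0ℤ
    non a h = res⇒ 6 (v0 mod 2 ∷ v0 mod 6 ∷ []) (λ { (a ∷ _) → + a }) (λ _ → 1ℤ) (λ { (_ ∷ b ∷ []) → t3′ b }) (λ _ → 0ℤ) (a ∷ []) (cong +_ (¬Div⇒Odd a h))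

  χ4′-mul3 : ∀ a → χ4′ (+ 3 * a) ≡ χ4 a
  χ4′-mul3 a = res≡ 12 (κ (+ 3) ⊗ v0 mod 12 ∷ v0 mod 4 ∷ []) (λ { (a ∷ _) → t4′ a }) (λ { (_ ∷ b ∷ []) → t4 b }) (a ∷ [])

  χ4′-non : ∀ a → ¬ Div 2 a → χ4′ a ≡ 0ℤ
  χ4′-non a = by-residues 12 (v0 mod 3 ∷ v0 mod 12 ∷ []) {λ { (a ∷ b ∷ []) → a ≢ 0 → t4′ b ≡ 0ℤ }} (λ { (a ∷ b ∷ []) → ¬? (a ℕ.≟ 0) →-dec (t4′ b ℤ.≟ 0ℤ) }) (a ∷ [])

  χ4′-scale : ∀ {c c′} (pc : Pos c) (pc′ : Pos c′) (p : Pos (+ 3 * c′)) N (h : ℤ → ℤ) →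
    ∑ (Ω-enum pc pc′ N) (λ (a , b , x , y) → h a * χ4′ b) ≡ ∑ (Ω-enum pc p N) (λ (a , b , x , y) → h a * χ4 b)
  χ4′-scale pc pc′ p N h = ∑-swapΩ pc pc′ N (λ (a , b , x , y) → h a * χ4′ b)
    ∙ Ω-scale-a 2 pc′ pc p N (λ (a , b , x , y) → h b * χ4′ a) (λ a b x y _ d → cong (h b *_) (χ4′-non a d) ∙ ℤP.*-zeroʳ (h b))
    ∙ ∑-cong (Ω-enum p pc N) (λ (a , b , x , y) _ → cong (h b *_) (χ4′-mul3 a))
    ∙ ∑-swapΩ p pc N (λ (a , b , x , y) → h b * χ4 a)

  decompose : ∀ {c} (pc : Pos c) (p : Pos (+ 2 * c)) N →
    X pc N ≡ (L pc 1+ N + + 2 * L p 1+ N) + (+ 3 * L pc 3+ N + + 6 * L p 3+ N)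
  decompose pc p N = ∑-cong (Ω-enum pc 1+ N) (λ (a , b , x , y) _ → i (χ3 a) (χ3′ a) (χ4 b) (χ4′ b))
    ∙ ∑-+ (Ω-enum pc 1+ N) (λ (a , b , x , y) → χ3 a * χ4 b + + 2 * (χ3′ a * χ4 b)) (λ (a , b , x , y) → + 3 * (χ3 a * χ4′ b) + + 6 * (χ3′ a * χ4′ b))
    ∙ cong₂ _+_
      (∑-+ (Ω-enum pc 1+ N) (λ (a , b , x , y) → χ3 a * χ4 b) (λ (a , b , x , y) → + 2 * (χ3′ a * χ4 b))
        ∙ +-congˡ {L pc 1+ N} (∑-* (Ω-enum pc 1+ N) (+ 2) (λ (a , b , x , y) → χ3′ a * χ4 b) ∙ cong (+ 2 *_) (χ3′-scale pc 1+ p N χ4)))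
      (∑-+ (Ω-enum pc 1+ N) (λ (a , b , x , y) → + 3 * (χ3 a * χ4′ b)) (λ (a , b , x , y) → + 6 * (χ3′ a * χ4′ b))
        ∙ cong₂ _+_ (∑-* (Ω-enum pc 1+ N) (+ 3) (λ (a , b , x , y) → χ3 a * χ4′ b) ∙ cong (+ 3 *_) (χ4′-scale pc 1+ 3+ N χ3))
                    (∑-* (Ω-enum pc 1+ N) (+ 6) (λ (a , b , x , y) → χ3′ a * χ4′ b) ∙ cong (+ 6 *_) (χ3′-scale pc 1+ p N χ4′ ∙ χ4′-scale p 1+ 3+ N χ3)))
    where
    i : ∀ a a′ b b′ → (a + + 2 * a′) * (b + + 3 * b′) ≡ (a * b + + 2 * (a′ * b)) + (+ 3 * (a * b′) + + 6 * (a′ * b′))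
    i = solve-∀

-- Complementary divisors of a number that is 3 modulo 4 have opposite values of χ₄.
ρ-3mod4 : ∀ k → k %ℕ 4 ≡ 3 → ρ k ≡ 0ℤ
ρ-3mod4 k h = ∑-anti (Dv-enum 1+ k) (λ (e , d) → d , e) (λ (e , d) ((pe , pd) , eq) → (pd , pe) , (cong (1ℤ *_) (ℤP.*-comm d e) ∙ eq)) (λ _ _ → refl)
  λ (e , d) (_ , eq) → res⇒ 4 (κ 1ℤ ⊗ (v0 ⊗ v1) mod 4 ∷ v0 mod 4 ∷ v1 mod 4 ∷ []) (λ { (a ∷ _) → + a }) (λ _ → + 3)
    (λ { (_ ∷ b ∷ _) → t4 b }) (λ { (_ ∷ _ ∷ c ∷ []) → - t4 c }) (e ∷ d ∷ []) (cong +_ (cong (_%ℕ 4) eq ∙ h))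

L-zero : ∀ {c c′} (pc : Pos c) (pc′ : Pos c′) N → (∀ i k → c * i + c′ * k ≡ N → k %ℕ 4 ≡ 3) → L pc pc′ N ≡ 0ℤ
L-zero pc pc′ N h = L-conv pc pc′ N ∙ ∑-0 (Ad-enum pc pc′ N) λ (i , k) (_ , eq) → cong (S i *_) (ρ-3mod4 k (h i k eq)) ∙ ℤP.*-zeroʳ (S i)

Ad-scale : ∀ m {c c′} (pc : Pos c) (pc′ : Pos c′) (pmc : Pos (+ suc m * c)) N (F : ℤ² → ℤ) →
  (∀ i k → Ad c c′ N (i , k) → ¬ Div m i → F (i , k) ≡ 0ℤ) →
  ∑ (Ad-enum pc pc′ N) F ≡ ∑ (Ad-enum pmc pc′ N) (λ (i , k) → F (+ suc m * i , k))
Ad-scale m {c} {c′} pc pc′ pmc N F h = ∑-supp (Ad-enum pc pc′ N) (λ (i , _) → div? m i) F (λ (i , k) → h i k)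
  ∙ ∑-bij (restrict (Ad-enum pc pc′ N) (λ (i , _) → div? m i)) (Ad-enum pmc pc′ N)
    (λ (i , r) → i /ℕ suc m , r) (λ (i , r) → + suc m * i , r)
    (λ (i , k) (((p , q) , eq) , r) → (pos*⁻ (pos-ℕ m) (pos≡ (sym (div-eq m i r)) p) , q) ,
      (assoc (+ suc m) c (i /ℕ suc m) (c′ * k) ∙ cong (λ t → c * t + c′ * k) (div-eq m i r) ∙ eq))
    (λ (i , k) ((p , q) , eq) → ((pos* (pos-ℕ m) p , q) , (sym (assoc (+ suc m) c i (c′ * k)) ∙ eq)) , mul-Div m i)
    (λ (i , t) (_ , r) → cong (_, t) (div-eq m i r)) (λ (i , t) _ → cong (_, t) (mul-div m i))
    (λ (i , k) (_ , r) → cong (λ t → F (t , k)) (sym (div-eq m i r)))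
  where
  assoc : ∀ m c i r → m * c * i + r ≡ c * (m * i) + r
  assoc = solve-∀

-- Since 3 does not divide c, the equation forces 3 | i, and S(3i) = S(i).
L-3· : ∀ {c} (pc : Pos c) (p : Pos (+ 3 * c)) → c %ℕ 3 ≢ 0 → ∀ M → L pc 3+ (+ 3 * M) ≡ L pc 1+ M
L-3· {c} pc p c≢0 M = L-conv pc 3+ (+ 3 * M)
  ∙ Ad-scale 2 pc 3+ p (+ 3 * M) (λ (i , k) → S i * ρ k) (λ i k (_ , eq) h → ⊥-elim (by-residues 3 (v0 ⊗ v1 ⊕ κ (+ 3) ⊗ v2 mod 3 ∷ v0 mod 3 ∷ v1 mod 3 ∷ [])
      {λ { (a ∷ b ∷ c ∷ []) → a ≡ 0 → b ≢ 0 → ¬ (c ≢ 0) }} (λ { (a ∷ b ∷ c ∷ []) → (a ℕ.≟ 0) →-dec (¬? (b ℕ.≟ 0) →-dec ¬? (¬? (c ℕ.≟ 0))) })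
      (c ∷ i ∷ k ∷ []) (cong (_%ℕ 3) eq ∙ mul-Div 2 M) c≢0 h))
  ∙ ∑-id (Ad-enum p 3+ (+ 3 * M)) (Ad-enum pc 1+ M)
      (λ (i , k) (q , eq) → q , *-cancel (+ 3) 3+ (i₁ c i k ∙ eq)) (λ (i , k) (q , eq) → q , (sym (i₁ c i k) ∙ cong (+ 3 *_) eq))
      (λ (i , k) _ → cong (_* ρ k) (S-3· i))
  ∙ sym (L-conv pc 1+ M)
  where
  i₁ : ∀ c i k → + 3 * (c * i + 1ℤ * k) ≡ + 3 * c * i + + 3 * k
  i₁ = solve-∀

E₂-3· : ∀ M → E₂ (+ 3 * M) ≡ + 3 * E₂ M
E₂-3· M = Dv-scale 2 M (λ (d , D) → D * χ12 d) (λ d D (_ , eq) h → cong (D *_) (by-residues 12 (κ 1ℤ ⊗ (v0 ⊗ v1) mod 3 ∷ v1 mod 3 ∷ v0 mod 12 ∷ [])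
      {λ { (a ∷ b ∷ c ∷ []) → a ≡ 0 → b ≢ 0 → t12 c ≡ 0ℤ }} (λ { (a ∷ b ∷ c ∷ []) → (a ℕ.≟ 0) →-dec (¬? (b ℕ.≟ 0) →-dec (t12 c ℤ.≟ 0ℤ)) })
      (d ∷ D ∷ []) (cong (_%ℕ 3) eq ∙ mul-Div 2 M) h) ∙ ℤP.*-zeroʳ D)
  ∙ ∑-cong (Dv-enum 1+ M) (λ (d , D) _ → ℤP.*-assoc (+ 3) D (χ12 d)) ∙ ∑-* (Dv-enum 1+ M) (+ 3) (λ (d , D) → D * χ12 d)

E₁-3· : ∀ M → E₁ (+ 3 * M) ≡ E₁ M
E₁-3· M = Dv-scale′ 2 M (λ (d , D) → D * χ12 D) (λ d D (_ , eq) h → cong (D *_) (by-residues 12 (κ 1ℤ ⊗ (v0 ⊗ v1) mod 3 ∷ v0 mod 3 ∷ v1 mod 12 ∷ [])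
      {λ { (a ∷ b ∷ c ∷ []) → a ≡ 0 → b ≢ 0 → t12 c ≡ 0ℤ }} (λ { (a ∷ b ∷ c ∷ []) → (a ℕ.≟ 0) →-dec (¬? (b ℕ.≟ 0) →-dec (t12 c ℤ.≟ 0ℤ)) })
      (d ∷ D ∷ []) (cong (_%ℕ 3) eq ∙ mul-Div 2 M) h) ∙ ℤP.*-zeroʳ D)

-- At M ≡ 1 and at 3M ≡ 3 (mod 4) many of the convolutions in `decompose` vanish, because the
-- argument of `ρ` is forced to be 3 modulo 4. Four unknowns survive, bound by three relations.
module AtOneModFour (M : ℤ) (M≡1 : M %ℕ 4 ≡ 1) where
  private
    6+ : Pos (+ 6)
    6+ = pos-ℕ 5
    12+ : Pos (+ 12)
    12+ = pos-ℕ 11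
    24+ : Pos (+ 24)
    24+ = pos-ℕ 23

    oM : Odd M
    oM = ℤP.+-injective (res⇒ 4 (v0 mod 4 ∷ v0 mod 2 ∷ []) (λ { (a ∷ _) → + a }) (λ _ → 1ℤ) (λ { (_ ∷ b ∷ []) → + b }) (λ _ → 1ℤ) (M ∷ []) (cong +_ M≡1))
    3M≡3 : (+ 3 * M) %ℕ 4 ≡ 3
    3M≡3 = ℤP.+-injective (res⇒ 4 (v0 mod 4 ∷ κ (+ 3) ⊗ v0 mod 4 ∷ []) (λ { (a ∷ _) → + a }) (λ _ → 1ℤ) (λ { (_ ∷ b ∷ []) → + b }) (λ _ → + 3) (M ∷ []) (cong +_ M≡1))
    o3M : Odd (+ 3 * M)
    o3M = ℤP.+-injective (res⇒ 4 (v0 mod 4 ∷ κ (+ 3) ⊗ v0 mod 2 ∷ []) (λ { (a ∷ _) → + a }) (λ _ → 1ℤ) (λ { (_ ∷ b ∷ []) → + b }) (λ _ → 1ℤ) (M ∷ []) (cong +_ M≡1))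

    third : ∀ c → c %ℕ 4 ≡ 0 → ∀ i k → c * i + + 3 * k ≡ M → k %ℕ 4 ≡ 3
    third c c0 i k eq = by-residues 4 (v0 ⊗ v1 ⊕ κ (+ 3) ⊗ v2 mod 4 ∷ v0 mod 4 ∷ v2 mod 4 ∷ []) {λ { (a ∷ b ∷ c ∷ []) → a ≡ 1 → b ≡ 0 → c ≡ 3 }}
      (λ { (a ∷ b ∷ c ∷ []) → (a ℕ.≟ 1) →-dec ((b ℕ.≟ 0) →-dec (c ℕ.≟ 3)) }) (c ∷ i ∷ k ∷ []) (cong (_%ℕ 4) eq ∙ M≡1) c0
    first : ∀ c → c %ℕ 4 ≡ 0 → ∀ i k → c * i + 1ℤ * k ≡ + 3 * M → k %ℕ 4 ≡ 3
    first c c0 i k eq = by-residues 4 (v0 ⊗ v1 ⊕ κ 1ℤ ⊗ v2 mod 4 ∷ v0 mod 4 ∷ v2 mod 4 ∷ []) {λ { (a ∷ b ∷ c ∷ []) → a ≡ 3 → b ≡ 0 → c ≡ 3 }}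
      (λ { (a ∷ b ∷ c ∷ []) → (a ℕ.≟ 3) →-dec ((b ℕ.≟ 0) →-dec (c ℕ.≟ 3)) }) (c ∷ i ∷ k ∷ []) (cong (_%ℕ 4) eq ∙ 3M≡3) c0

    -- An odd i makes k ≡ 3 (mod 4), where `ρ` vanishes; twice an odd number is a zero of `S`; and
    -- S(4j) = S(j) on the remaining i.
    L21≡L81 : L 2+ 1+ M ≡ L 8+ 1+ M
    L21≡L81 = L-conv 2+ 1+ M ∙ Ad-scale 3 2+ 1+ 8+ M (λ (i , k) → S i * ρ k) (λ i k (_ , eq) h → off i k eq h (odd? i))
      ∙ ∑-cong (Ad-enum 8+ 1+ M) (λ (i , k) _ → cong (_* ρ k) (cong S (i₁ i) ∙ S-4· i)) ∙ sym (L-conv 8+ 1+ M)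
      where
      i₁ : ∀ i → + 4 * i ≡ + 2 * (+ 2 * i)
      i₁ = solve-∀
      off : ∀ i k → + 2 * i + 1ℤ * k ≡ M → ¬ Div 3 i → Dec (Odd i) → S i * ρ k ≡ 0ℤ
      off i k eq h (yes o) = cong (S i *_) (ρ-3mod4 k (by-residues 4 (κ (+ 2) ⊗ v0 ⊕ κ 1ℤ ⊗ v1 mod 4 ∷ v0 mod 2 ∷ v1 mod 4 ∷ []) {λ { (a ∷ b ∷ c ∷ []) → a ≡ 1 → b ≡ 1 → c ≡ 3 }}
        (λ { (a ∷ b ∷ c ∷ []) → (a ℕ.≟ 1) →-dec ((b ℕ.≟ 1) →-dec (c ℕ.≟ 3)) }) (i ∷ k ∷ []) (cong (_%ℕ 4) eq ∙ M≡1) o)) ∙ ℤP.*-zeroʳ (S i)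
      off i k eq h (no ¬o) = cong (_* ρ k) (cong S (sym i≡) ∙ S-2·odd (i /ℕ 2) (by-residues 4 (κ (+ 2) ⊗ v0 mod 4 ∷ v0 mod 2 ∷ []) {λ { (a ∷ b ∷ []) → a ≢ 0 → b ≡ 1 }}
        (λ { (a ∷ b ∷ []) → ¬? (a ℕ.≟ 0) →-dec (b ℕ.≟ 1) }) (i /ℕ 2 ∷ []) (λ e → h (cong (_%ℕ 4) (sym i≡) ∙ e)))) ∙ ℤP.*-zeroˡ (ρ k)
        where
        i≡ : + 2 * (i /ℕ 2) ≡ i
        i≡ = div-eq 1 i (¬Odd⇒Div i ¬o)

    -- The χ₄(D/3) part lives on 3 | M, and then M / 3 ≡ 3 (mod 4) makes it vanish.
    Σs₂-M : Σs₂ M ≡ ρ M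
    Σs₂-M = ∑-+ (Dv-enum 1+ M) (λ (d , D) → χ4 D) (λ (d , D) → + 3 * χ4′ D)
      ∙ cong₂ _+_ (Dv-swap M (λ (d , D) → χ4 D)) (∑-* (Dv-enum 1+ M) (+ 3) (λ (d , D) → χ4′ D) ∙ cong (+ 3 *_) (vanish (div? 2 M))) ∙ ℤP.+-identityʳ (ρ M)
      where
      scaled : ∀ M′ → + 3 * M′ ≡ M → ∑ (Dv-enum 1+ M) (λ (d , D) → χ4′ D) ≡ 0ℤ
      scaled M′ refl = Dv-scale 2 M′ (λ (d , D) → χ4′ D) (λ d D _ h → χ4′-non D h)
        ∙ ∑-cong (Dv-enum 1+ M′) (λ (d , D) _ → χ4′-mul3 D) ∙ Dv-swap M′ (λ (d , D) → χ4 D)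
        ∙ ρ-3mod4 M′ (by-residues 4 (κ (+ 3) ⊗ v0 mod 4 ∷ v0 mod 4 ∷ []) {λ { (a ∷ b ∷ []) → a ≡ 1 → b ≡ 3 }} (λ { (a ∷ b ∷ []) → (a ℕ.≟ 1) →-dec (b ℕ.≟ 3) }) (M′ ∷ []) M≡1)
      vanish : Dec (Div 2 M) → ∑ (Dv-enum 1+ M) (λ (d , D) → χ4′ D) ≡ 0ℤ
      vanish (yes d) = scaled (M /ℕ 3) (div-eq 2 M d)
      vanish (no ¬d) = ∑-0 (Dv-enum 1+ M) λ (d , D) (_ , eq) → by-residues 12 (κ 1ℤ ⊗ (v0 ⊗ v1) mod 3 ∷ v1 mod 12 ∷ [])
        {λ { (a ∷ b ∷ []) → a ≢ 0 → t4′ b ≡ 0ℤ }} (λ { (a ∷ b ∷ []) → ¬? (a ℕ.≟ 0) →-dec (t4′ b ℤ.≟ 0ℤ) }) (d ∷ D ∷ []) (λ e → ¬d (cong (_%ℕ 3) (sym eq) ∙ e))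

  L4 L8 L23 L3M : ℤ
  L4 = L 4+ 1+ M
  L8 = L 8+ 1+ M
  L23 = L 2+ 3+ M
  L3M = L 2+ 1+ (+ 3 * M)

  -- This is `half` at M. The term `ρ M` will cancel against the degenerate representations in
  -- `Qf-count`.
  eq₁ : + 2 * (L4 + + 2 * L8) ≡ E₂ M - ρ M
  eq₁ = fin (X 4+ M) L4 L8 (decompose 4+ 8+ M) (L-zero 4+ 3+ M (third (+ 4) refl)) (L-zero 8+ 3+ M (third (+ 8) refl)) ∙ half M oM ∙ cong (λ t → E₂ M - t) Σs₂-M
    where
    fin : ∀ x p q {r s} → x ≡ (p + + 2 * q) + (+ 3 * r + + 6 * s) → r ≡ 0ℤ → s ≡ 0ℤ → + 2 * (p + + 2 * q) ≡ + 2 * x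
    fin x p q refl refl refl = i p q
      where
      i : ∀ p q → + 2 * (p + + 2 * q) ≡ + 2 * ((p + + 2 * q) + (+ 3 * 0ℤ + + 6 * 0ℤ))
      i = solve-∀

  -- The difference of `full` and `half` at M, in which `Σs₂` cancels.
  eq₂ : + 2 * (L4 - L8 + + 3 * L23) ≡ E₂ M - E₁ M
  eq₂ = fin (X 2+ M) (X 4+ M) L4 L8 L23 (E₂ M) (E₁ M) (Σs₂ M) (decompose 2+ 4+ M) (decompose 4+ 8+ M) L21≡L81 (L-zero 4+ 3+ M (third (+ 4) refl)) (L-zero 8+ 3+ M (third (+ 8) refl))
      (full M oM) (half M oM)
    where
    fin : ∀ x y p q r E e σ {z a b} → x ≡ (z + + 2 * p) + (+ 3 * r + + 6 * a) → y ≡ (p + + 2 * q) + (+ 3 * a + + 6 * b) → z ≡ q → a ≡ 0ℤ → b ≡ 0ℤ →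
      + 2 * x ≡ + 2 * E - e - σ → + 2 * y ≡ E - σ → + 2 * (p - q + + 3 * r) ≡ E - e
    fin x y p q r E e σ refl refl refl refl refl h h′ = lc2 1ℤ h (- 1ℤ) h′ (i p q r E e σ)
      where
      i : ∀ p q r E e σ → + 2 * (p - q + + 3 * r) - (E - e)
        ≡ 1ℤ * (+ 2 * ((q + + 2 * p) + (+ 3 * r + + 6 * 0ℤ)) - (+ 2 * E - e - σ)) + - 1ℤ * (+ 2 * ((p + + 2 * q) + (+ 3 * 0ℤ + + 6 * 0ℤ)) - (E - σ))
      i = solve-∀

  -- The same difference at 3M. The convolutions with second coefficient 3 return to M by `L-3·`, so
  -- the only new unknown is `L3M`.
  eq₃ : + 2 * (L3M + + 3 * L4 - + 3 * L8) ≡ + 3 * E₂ M - E₁ M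
  eq₃ = fin (X 2+ (+ 3 * M)) (X 4+ (+ 3 * M)) L3M L4 L8 (Σs₂ (+ 3 * M)) (E₂ (+ 3 * M)) (E₁ (+ 3 * M)) (decompose 2+ 4+ (+ 3 * M)) (decompose 4+ 8+ (+ 3 * M))
      (L-zero 4+ 1+ (+ 3 * M) (first (+ 4) refl)) (L-zero 8+ 1+ (+ 3 * M) (first (+ 8) refl))
      (L-3· 2+ 6+ (λ ()) M ∙ L21≡L81) (L-3· 4+ 12+ (λ ()) M) (L-3· 8+ 24+ (λ ()) M) (full (+ 3 * M) o3M) (half (+ 3 * M) o3M)
    ∙ cong₂ _-_ (E₂-3· M) (E₁-3· M)
    where
    fin : ∀ x y l p q σ E e {z w a b c} → x ≡ (l + + 2 * z) + (+ 3 * a + + 6 * b) → y ≡ (z + + 2 * w) + (+ 3 * b + + 6 * c) → z ≡ 0ℤ → w ≡ 0ℤ → a ≡ q → b ≡ p → c ≡ q →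
      + 2 * x ≡ + 2 * E - e - σ → + 2 * y ≡ E - σ → + 2 * (l + + 3 * p - + 3 * q) ≡ E - e
    fin x y l p q σ E e refl refl refl refl refl refl refl h h′ = lc2 1ℤ h (- 1ℤ) h′ (i l p q E e σ)
      where
      i : ∀ l p q E e σ → + 2 * (l + + 3 * p - + 3 * q) - (E - e)
        ≡ 1ℤ * (+ 2 * ((l + + 2 * 0ℤ) + (+ 3 * q + + 6 * p)) - (+ 2 * E - e - σ)) + - 1ℤ * (+ 2 * ((0ℤ + + 2 * 0ℤ) + (+ 3 * p + + 6 * q)) - (E - σ))
      i = solve-∀

-- The Eisenstein part

private
  hex : ℤ² → ℤ
  hex (u , v) = u * u + u * v + v * v

  hex-nn : ∀ u v → 0ℤ ≤ hex (u , v)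
  hex-nn u v = ℤP.*-cancelˡ-≤-pos 0ℤ (hex (u , v)) (+ 4) (nn≡ (i u v) (nn+ (nn² (+ 2 * u + v)) (nn* {+ 3} (ℤ.+≤+ ℕ.z≤n) (nn² v))))
    where
    i : ∀ u v → (+ 2 * u + v) * (+ 2 * u + v) + + 3 * (v * v) ≡ + 4 * (u * u + u * v + v * v)
    i = solve-∀

  In : ℤ → ℤ → ℤ → ℤ² → Set
  In c c′ N (i , k) = (0ℤ ≤ i × 0ℤ ≤ k) × c * i + c′ * k ≡ N

  opaque
    In-enum : ∀ {c c′} → Pos c → Pos c′ → ∀ N → Enum (In c c′ N)
    In-enum {c} {c′} pc pc′ N = boxEnum (λ (i , k) → (_ ℤ.≤? _ ×-dec _ ℤ.≤? _) ×-dec (_ ℤ.≟ N)) ∣ N ∣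
      λ { (i , k) ((p , q) , refl) → ℕP.⊔-lub
        (abs-mono {i} {c * i + c′ * k} p (nn≡ (i1 c c′ i k) (nn+ (nn* (pos-pred pc) p) (nn* (pos⇒nn pc′) q))))
        (abs-mono {k} {c * i + c′ * k} q (nn≡ (i2 c c′ i k) (nn+ (nn* (pos-pred pc′) q) (nn* (pos⇒nn pc) p)))) }
      where
      i1 : ∀ c c′ i k → (c - 1ℤ) * i + c′ * k ≡ c * i + c′ * k - i
      i1 = solve-∀
      i2 : ∀ c c′ i k → (c′ - 1ℤ) * k + c * i ≡ c * i + c′ * k - k
      i2 = solve-∀

  Qf : ℤ → ℤ → ℤ → ℤ² × ℤ² → Set
  Qf c c′ N (uv , (x , y)) = c * hex uv + c′ * (x * x + y * y) ≡ N

  Qf-dep : ∀ {c c′} → Pos c → Pos c′ → ∀ N → Enum (λ ((i , k) , uv , xy) → In c c′ N (i , k) × (Hx i uv × R2 k xy))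
  Qf-dep pc pc′ N = depEnum (In-enum pc pc′ N) (λ (i , k) → depEnum (Hx-enum i) (λ _ → R2-enum k))

  module QfBij {c c′} (pc : Pos c) (pc′ : Pos c′) (N : ℤ) where
    f : ℤ² × ℤ² × ℤ² → ℤ² × ℤ²
    f = proj₂
    g : ℤ² × ℤ² → ℤ² × ℤ² × ℤ²
    g (uv , (x , y)) = (hex uv , x * x + y * y) , uv , (x , y)
    f-ok : ∀ t → In c c′ N (proj₁ t) × (Hx (proj₁ (proj₁ t)) (proj₁ (proj₂ t)) × R2 (proj₂ (proj₁ t)) (proj₂ (proj₂ t))) → Qf c c′ N (f t)
    f-ok ((i , k) , uv , xy) ((_ , eq) , e₁ , e₂) = cong₂ (λ i k → c * i + c′ * k) e₁ e₂ ∙ eq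
    g-ok : ∀ t → Qf c c′ N t → In c c′ N (proj₁ (g t)) × (Hx (hex (proj₁ t)) (proj₁ t) × R2 (proj₂ (proj₁ (g t))) (proj₂ t))
    g-ok ((u , v) , (x , y)) eq = ((hex-nn u v , nn+ (nn² x) (nn² y)) , eq) , refl , refl
    gf : ∀ t → In c c′ N (proj₁ t) × (Hx (proj₁ (proj₁ t)) (proj₁ (proj₂ t)) × R2 (proj₂ (proj₁ t)) (proj₂ (proj₂ t))) → g (f t) ≡ t
    gf ((i , k) , uv , xy) (_ , e₁ , e₂) = cong₂ (λ i k → (i , k) , uv , xy) e₁ e₂

  opaque
    Qf-enum : ∀ {c c′} → Pos c → Pos c′ → ∀ N → Enum (Qf c c′ N)
    Qf-enum {c} {c′} pc pc′ N = mapEnum f g f-ok g-ok gf (λ _ _ → refl) (Qf-dep pc pc′ N)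
      where open QfBij {c} {c′} pc pc′ N

  hex-0 : count (Hx-enum 0ℤ) ≡ 1ℤ
  hex-0 = ∑-single (Hx-enum 0ℤ) (0ℤ , 0ℤ) refl (λ _ → 1ℤ) λ (u , v) eq ne → ⊥-elim (ne (cong₂ _,_ (zero-of v u (cong (+ 4 *_) (sw u v) ∙ cong (+ 4 *_) eq)) (zero-of u v (cong (+ 4 *_) eq))))
    where
    sw : ∀ u v → v * v + v * u + u * u ≡ u * u + u * v + v * v
    sw = solve-∀
    i : ∀ u v → + 4 * (u * u + u * v + v * v) ≡ (+ 2 * u + v) * (+ 2 * u + v) + + 2 * (v * v) + v * v
    i = solve-∀
    zero-of : ∀ u v → + 4 * (u * u + u * v + v * v) ≡ + 4 * 0ℤ → v ≡ 0ℤ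
    zero-of u v h = case nn⇒≡0⊎pos (nn² v) of λ
      { (inj₂ p) → ⊥-elim (¬pos0 (pos≡ (sym (i u v) ∙ h) (nn-pos (nn+ (nn² (+ 2 * u + v)) (nn* {+ 2} (ℤ.+≤+ ℕ.z≤n) (nn² v))) p)))
      ; (inj₁ e) → case ℤP.i*j≡0⇒i≡0∨j≡0 v e of λ { (inj₁ q) → q ; (inj₂ q) → q } }

  At0 : ℤ → ℤ → ℤ² → Set
  At0 c′ N (i , k) = i ≡ 0ℤ × (Pos k × c′ * k ≡ N)

  opaque
    At0-enum : ∀ {c′} → Pos c′ → ∀ N → Enum (At0 c′ N)
    At0-enum {c′} pc′ N = boxEnum (λ (i , k) → (i ℤ.≟ 0ℤ) ×-dec (pos? k ×-dec (_ ℤ.≟ N))) ∣ N ∣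
      λ { (_ , k) (refl , p , refl) → abs-mono {k} {c′ * k} (pos⇒nn p) (nn≡ (i1 c′ k) (nn* (pos-pred pc′) (pos⇒nn p))) }
      where
      i1 : ∀ c′ k → (c′ - 1ℤ) * k ≡ c′ * k - k
      i1 = solve-∀

  -- 24 is the product of the factors 6 and 4 in the two representation numbers. The second summand
  -- collects the solutions with zero hexagonal part; the hypothesis excludes a zero sum of two
  -- squares.
  Qf-count : ∀ {c c′} (pc : Pos c) (pc′ : Pos c′) N → (∀ i → c * i ≢ N) →
    count (Qf-enum pc pc′ N) ≡ + 24 * L pc pc′ N + + 4 * ∑ (At0-enum pc′ N) (λ (_ , k) → ρ k)
  Qf-count {c} {c′} pc pc′ N ne = ∑-bij (Qf-enum pc pc′ N) (Qf-dep pc pc′ N) g f g-ok f-ok (λ _ _ → refl) gf (λ _ _ → refl)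
    ∙ ∑-dep-product (In-enum pc pc′ N) (λ (i , _) → Hx-enum i) (λ (_ , k) → R2-enum k) (λ _ → 1ℤ) (λ _ → 1ℤ)
    ∙ ∑-part (In-enum pc pc′ N) (Ad-enum pc pc′ N) (At0-enum pc′ N) split
        (λ (i , k) ((p , q) , eq) → (pos⇒nn p , pos⇒nn q) , eq)
        (λ { (_ , k) (refl , p , eq) → (ℤ.+≤+ ℕ.z≤n , pos⇒nn p) , (cong (λ t → t + c′ * k) (ℤP.*-zeroʳ c) ∙ ℤP.+-identityˡ (c′ * k) ∙ eq) })
        (λ { (i , k) ((p , _) , _) (refl , _) → ¬pos0 p }) w
    ∙ cong₂ _+_ (∑-cong (Ad-enum pc pc′ N) (λ (i , k) ((p , q) , _) → cong₂ _*_ (hex-count i p) (two-squares k q) ∙ i₁ (S i) (ρ k))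
          ∙ ∑-* (Ad-enum pc pc′ N) (+ 24) (λ (i , k) → S i * ρ k) ∙ cong (+ 24 *_) (sym (L-conv pc pc′ N)))
        (∑-cong (At0-enum pc′ N) (λ { (_ , k) (refl , p , _) → cong₂ _*_ hex-0 (two-squares k p) ∙ ℤP.*-identityˡ (+ 4 * ρ k) })
          ∙ ∑-* (At0-enum pc′ N) (+ 4) (λ (_ , k) → ρ k))
    where
    open QfBij {c} {c′} pc pc′ N
    w : ℤ² → ℤ
    w (i , k) = count (Hx-enum i) * count (R2-enum k)
    i₁ : ∀ s r → + 6 * s * (+ 4 * r) ≡ + 24 * (s * r)
    i₁ = solve-∀
    split : ∀ t → In c c′ N t → Ad c c′ N t ⊎ At0 c′ N t
    split (i , k) ((p , q) , eq) = case (nn⇒≡0⊎pos p , nn⇒≡0⊎pos q) of λ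
      { (_ , inj₁ k0) → ⊥-elim (ne i (sym (cong (λ k → c * i + c′ * k) k0 ∙ cong (λ t → c * i + t) (ℤP.*-zeroʳ c′) ∙ ℤP.+-identityʳ (c * i)) ∙ eq))
      ; (inj₁ i0 , inj₂ k+) → inj₂ (i0 , k+ , (sym (cong (λ i → c * i + c′ * k) i0 ∙ cong (λ t → t + c′ * k) (ℤP.*-zeroʳ c) ∙ ℤP.+-identityˡ (c′ * k)) ∙ eq))
      ; (inj₂ i+ , inj₂ k+) → inj₁ ((i+ , k+) , eq) }

R1 : ℤ → ℤ⁴ → Set
R1 M (x , y , z , w) = x * x + y * y + z * z + + 3 * (w * w) ≡ M

opaque
  R1-enum : ∀ M → Enum (R1 M)
  R1-enum M = boxEnum (λ (x , y , z , w) → _ ℤ.≟ M) ∣ M ∣ λ { (x , y , z , w) refl →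
    ℕP.⊔-lub (abs-sq x {x * x + y * y + z * z + + 3 * (w * w)} (nn≡ (i1 x y z w) (nn+ (nn+ (nn² y) (nn² z)) (w3 w))))
    (ℕP.⊔-lub (abs-sq y {x * x + y * y + z * z + + 3 * (w * w)} (nn≡ (i2 x y z w) (nn+ (nn+ (nn² x) (nn² z)) (w3 w))))
    (ℕP.⊔-lub (abs-sq z {x * x + y * y + z * z + + 3 * (w * w)} (nn≡ (i3 x y z w) (nn+ (nn+ (nn² x) (nn² y)) (w3 w))))
              (abs-sq w {x * x + y * y + z * z + + 3 * (w * w)} (nn≡ (i4 x y z w) (nn+ (nn+ (nn+ (nn² x) (nn² y)) (nn² z)) (nn* {+ 2} (ℤ.+≤+ ℕ.z≤n) (nn² w))))))) }
    where
    w3 : ∀ w → 0ℤ ≤ + 3 * (w * w)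
    w3 w = nn* {+ 3} (ℤ.+≤+ ℕ.z≤n) (nn² w)
    i1 : ∀ x y z w → y * y + z * z + + 3 * (w * w) ≡ x * x + y * y + z * z + + 3 * (w * w) - x * x
    i1 = solve-∀
    i2 : ∀ x y z w → x * x + z * z + + 3 * (w * w) ≡ x * x + y * y + z * z + + 3 * (w * w) - y * y
    i2 = solve-∀
    i3 : ∀ x y z w → x * x + y * y + + 3 * (w * w) ≡ x * x + y * y + z * z + + 3 * (w * w) - z * z
    i3 = solve-∀
    i4 : ∀ x y z w → x * x + y * y + z * z + + 2 * (w * w) ≡ x * x + y * y + z * z + + 3 * (w * w) - w * w
    i4 = solve-∀

same : ℤ → ℤ → ℤ
same z w = even (z - w)

private
  same-two : ∀ x y z w → (x * x + y * y + z * z + + 3 * (w * w)) %ℕ 4 ≡ 1 → same x w + same y w + same z w ≡ + 2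
  same-two x y z w h = res⇒ 4 (v0 ⊗ v0 ⊕ v1 ⊗ v1 ⊕ v2 ⊗ v2 ⊕ κ (+ 3) ⊗ (v3 ⊗ v3) mod 4 ∷ v0 ⊖ v3 mod 2 ∷ v1 ⊖ v3 mod 2 ∷ v2 ⊖ v3 mod 2 ∷ [])
    (λ { (a ∷ _) → + a }) (λ _ → 1ℤ) (λ { (_ ∷ a ∷ b ∷ c ∷ []) → (1ℤ - t2 a) + (1ℤ - t2 b) + (1ℤ - t2 c) }) (λ _ → + 2) (x ∷ y ∷ z ∷ w ∷ []) (cong +_ h)

  -- M ≡ 1 (mod 4) makes exactly two of x, y, z agree with w in parity, and the three coordinates
  -- are interchangeable.
  R1-same : ∀ M → M %ℕ 4 ≡ 1 → + 3 * ∑ (R1-enum M) (λ (x , y , z , w) → same z w) ≡ + 2 * count (R1-enum M)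
  R1-same M h = sym (∑-cong e (λ (x , y , z , w) eq → sym (same-two x y z w (cong (_%ℕ 4) eq ∙ h)))
      ∙ ∑-+ e (λ (x , y , z , w) → same x w + same y w) (λ (x , y , z , w) → same z w)
      ∙ cong (λ t → t + Σzw) (∑-+ e (λ (x , y , z , w) → same x w) (λ (x , y , z , w) → same y w)
          ∙ cong₂ _+_ (∑-inv e (λ (x , y , z , w) → z , y , x , w) (λ (x , y , z , w) eq → s1 x y z w ∙ eq) (λ _ _ → refl) {g = λ (x , y , z , w) → same z w} (λ _ _ → refl))
                      (∑-inv e (λ (x , y , z , w) → x , z , y , w) (λ (x , y , z , w) eq → s2 x y z w ∙ eq) (λ _ _ → refl) {g = λ (x , y , z , w) → same z w} (λ _ _ → refl)))
      ∙ i Σzw)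
    ∙ ∑-* e (+ 2) (λ _ → 1ℤ)
    where
    e = R1-enum M
    Σzw = ∑ e (λ (x , y , z , w) → same z w)
    i : ∀ z → z + z + z ≡ + 3 * z
    i = solve-∀
    s1 : ∀ x y z w → z * z + y * y + x * x + + 3 * (w * w) ≡ x * x + y * y + z * z + + 3 * (w * w)
    s1 = solve-∀
    s2 : ∀ x y z w → x * x + z * z + y * y + + 3 * (w * w) ≡ x * x + y * y + z * z + + 3 * (w * w)
    s2 = solve-∀

  -- z = 2u + w turns z² + 3w² into 4 (u² + uw + w²).
  R1-Qf : ∀ M → ∑ (R1-enum M) (λ (x , y , z , w) → same z w) ≡ count (Qf-enum 4+ 1+ M)
  R1-Qf M = ∑-supp (R1-enum M) (λ (x , y , z , w) → div? 1 (z - w)) (λ (x , y , z , w) → same z w) (λ (x , y , z , w) _ h → even-non (z - w) h)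
    ∙ ∑-bij (restrict (R1-enum M) (λ (x , y , z , w) → div? 1 (z - w))) (Qf-enum 4+ 1+ M)
      (λ (x , y , z , w) → ((z - w) /ℕ 2 , w) , (x , y)) (λ ((u , v) , (x , y)) → x , y , + 2 * u + v , v)
      (λ (x , y , z , w) (eq , d) → go x y z w ((z - w) /ℕ 2) (div-eq 1 (z - w) d) eq)
      (λ ((u , v) , (x , y)) eq → (i2 u v x y ∙ eq) , (cong (_%ℕ 2) (i3 u v) ∙ mul-Div 1 u))
      (λ (x , y , z , w) (_ , d) → cong (λ t → x , y , t , w) (lc 1ℤ (div-eq 1 (z - w) d) (i4 z w ((z - w) /ℕ 2))))
      (λ ((u , v) , xy) _ → cong (λ t → (t , v) , xy) (cong (_/ℕ 2) (i3 u v) ∙ mul-div 1 u))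
      (λ (x , y , z , w) (_ , d) → cong (λ r → 1ℤ - t2 r) d)
    where
    go : ∀ x y z w h → + 2 * h ≡ z - w → R1 M (x , y , z , w) → + 4 * (h * h + h * w + w * w) + 1ℤ * (x * x + y * y) ≡ M
    go x y z w h e eq = lc2 (+ 2 * h + w + z) e 1ℤ eq (j x y z w h M)
      where
      j : ∀ x y z w h M → + 4 * (h * h + h * w + w * w) + 1ℤ * (x * x + y * y) - M
        ≡ (+ 2 * h + w + z) * (+ 2 * h - (z - w)) + 1ℤ * (x * x + y * y + z * z + + 3 * (w * w) - M)
      j = solve-∀
    i2 : ∀ u v x y → x * x + y * y + (+ 2 * u + v) * (+ 2 * u + v) + + 3 * (v * v) ≡ + 4 * (u * u + u * v + v * v) + 1ℤ * (x * x + y * y)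
    i2 = solve-∀
    i3 : ∀ u v → + 2 * u + v - v ≡ + 2 * u
    i3 = solve-∀
    i4 : ∀ z w h → + 2 * h + w - z ≡ 1ℤ * (+ 2 * h - (z - w))
    i4 = solve-∀

  -- The 3-neighbours of the lattice of 2(u² + uv + v²) + s² + w².
  module Neighbours (M : ℤ) where
    e = Qf-enum 2+ 1+ (+ 3 * M)
    a₀ a₁ a₂ a₃ a₄ : ℤ² × ℤ² → ℤ
    a₀ ((u , v) , (s , w)) = z3 s * z3 w
    a₁ ((u , v) , (s , w)) = z3 s * z3 (w - (u - v))
    a₂ ((u , v) , (s , w)) = z3 s * z3 (w + (u - v))
    a₃ ((u , v) , (s , w)) = z3 w * z3 (s - (u - v))
    a₄ ((u , v) , (s , w)) = z3 w * z3 (s + (u - v))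

    -- Modulo 3 the equation says s² + w² ≡ (u - v)². If 3 does not divide u - v, exactly one of s
    -- and w is divisible by 3 and the other is ±(u - v), so one of the four sublattices contains
    -- the vector; otherwise s and w are both divisible by 3 and all four contain it.
    classes : ∀ t → Qf (+ 2) 1ℤ (+ 3 * M) t → a₁ t + a₂ t + (a₃ t + a₄ t) ≡ 1ℤ + + 3 * a₀ t
    classes ((u , v) , (s , w)) eq = res⇒ 3
      (κ (+ 2) ⊗ (v0 ⊗ v0 ⊕ v0 ⊗ v1 ⊕ v1 ⊗ v1) ⊕ κ 1ℤ ⊗ (v2 ⊗ v2 ⊕ v3 ⊗ v3) mod 3 ∷ v2 mod 3 ∷ v3 mod 3
        ∷ v3 ⊖ (v0 ⊖ v1) mod 3 ∷ v3 ⊕ (v0 ⊖ v1) mod 3 ∷ v2 ⊖ (v0 ⊖ v1) mod 3 ∷ v2 ⊕ (v0 ⊖ v1) mod 3 ∷ [])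
      (λ { (c ∷ _) → + c }) (λ _ → 0ℤ)
      (λ { (_ ∷ s ∷ w ∷ a ∷ b ∷ c ∷ d ∷ []) → tz3 s * tz3 a + tz3 s * tz3 b + (tz3 w * tz3 c + tz3 w * tz3 d) })
      (λ { (_ ∷ s ∷ w ∷ _) → 1ℤ + + 3 * (tz3 s * tz3 w) }) (u ∷ v ∷ s ∷ w ∷ []) (cong +_ (cong (_%ℕ 3) eq ∙ mul-Div 2 M))

    neg-w : ∀ t → Qf (+ 2) 1ℤ (+ 3 * M) t → Qf (+ 2) 1ℤ (+ 3 * M) (proj₁ t , proj₁ (proj₂ t) , - proj₂ (proj₂ t))
    neg-w ((u , v) , (s , w)) eq = i u v s w ∙ eq
      where
      i : ∀ u v s w → + 2 * (u * u + u * v + v * v) + 1ℤ * (s * s + - w * - w) ≡ + 2 * (u * u + u * v + v * v) + 1ℤ * (s * s + w * w)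
      i = solve-∀

    swap-sw : ∀ t → Qf (+ 2) 1ℤ (+ 3 * M) t → Qf (+ 2) 1ℤ (+ 3 * M) (proj₁ t , proj₂ (proj₂ t) , proj₁ (proj₂ t))
    swap-sw ((u , v) , (s , w)) eq = cong (λ t → + 2 * hex (u , v) + 1ℤ * t) (ℤP.+-comm (w * w) (s * s)) ∙ eq

    a₂≡a₁ : ∑ e a₂ ≡ ∑ e a₁
    a₂≡a₁ = ∑-inv e (λ (uv , (s , w)) → uv , (s , - w)) neg-w (λ (uv , (s , w)) _ → cong (λ t → uv , (s , t)) (ℤP.neg-involutive w))
      λ ((u , v) , (s , w)) _ → cong (z3 s *_) (sym (z3-neg (w + (u - v))) ∙ cong z3 (i w (u - v)))
      where
      i : ∀ w d → - (w + d) ≡ - w - d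
      i = solve-∀

    a₃≡a₁ : ∑ e a₃ ≡ ∑ e a₁
    a₃≡a₁ = ∑-inv e (λ (uv , (s , w)) → uv , (w , s)) swap-sw (λ _ _ → refl) (λ _ _ → refl)

    a₄≡a₂ : ∑ e a₄ ≡ ∑ e a₂
    a₄≡a₂ = ∑-inv e (λ (uv , (s , w)) → uv , (w , s)) swap-sw (λ _ _ → refl) (λ _ _ → refl)

    z3-Div : ∀ s → Div 2 s → z3 s ≡ 1ℤ
    z3-Div s d = cong tz3 d

    -- The isometry comes from the orthogonal splitting 3 (x² + y² + z²) = (x + y + z)² + 2 (u² + uv
    -- + v²) with u = x - y and v = y - z. The condition w ≡ u - v (mod 3) is what makes y = (w - u
    -- + v)/3 integral.
    a₁≡R1 : ∑ e a₁ ≡ count (R1-enum M)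
    a₁≡R1 = ∑-supp e D? a₁ (λ ((u , v) , (s , w)) _ h → off s (w - (u - v)) h)
      ∙ ∑-bij (restrict e D?) (R1-enum M)
        (λ ((u , v) , (s , w)) → φ u v (s /ℕ 3) ((w - (u - v)) /ℕ 3)) (λ (x , y , z , s) → ψ x y z s)
        (λ ((u , v) , (s , w)) (eq , (ds , dw)) → φ-ok u v s w (s /ℕ 3) ((w - (u - v)) /ℕ 3) (div-eq 2 s ds) (div-eq 2 (w - (u - v)) dw) eq)
        (λ (x , y , z , s) eq → ψ-ok x y z s eq , (mul-Div 2 s , (cong (_%ℕ 3) (y₃ x y z) ∙ mul-Div 2 y)))
        (λ ((u , v) , (s , w)) (_ , (ds , dw)) → ψφ u v s w (s /ℕ 3) ((w - (u - v)) /ℕ 3) (div-eq 2 s ds) (div-eq 2 (w - (u - v)) dw))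
        (λ (x , y , z , s) _ → φψ x y z (mul-div 2 s) (cong (_/ℕ 3) (y₃ x y z) ∙ mul-div 2 y))
        (λ ((u , v) , (s , w)) (_ , (ds , dw)) → cong₂ _*_ (z3-Div s ds) (z3-Div (w - (u - v)) dw))
      where
      D? : ∀ (t : ℤ² × ℤ²) → Dec (Div 2 (proj₁ (proj₂ t)) × Div 2 (proj₂ (proj₂ t) - (proj₁ (proj₁ t) - proj₂ (proj₁ t))))
      D? ((u , v) , (s , w)) = div? 2 s ×-dec div? 2 (w - (u - v))
      off : ∀ s d → ¬ (Div 2 s × Div 2 d) → z3 s * z3 d ≡ 0ℤ
      off s d h = case div? 2 s of λ
        { (no ¬ds) → cong (_* z3 d) (z3-non s ¬ds) ∙ ℤP.*-zeroˡ (z3 d)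
        ; (yes ds) → cong (z3 s *_) (z3-non d (λ dd → h (ds , dd))) ∙ ℤP.*-zeroʳ (z3 s) }
      φ : ℤ → ℤ → ℤ → ℤ → ℤ⁴
      φ u v s y = y + u , y , y - v , s
      ψ : ℤ → ℤ → ℤ → ℤ → ℤ² × ℤ²
      ψ x y z s = (x - y , y - z) , (+ 3 * s , x + y + z)
      y₃ : ∀ x y z → x + y + z - (x - y - (y - z)) ≡ + 3 * y
      y₃ = solve-∀
      φ-ok : ∀ u v s w s′ y → + 3 * s′ ≡ s → + 3 * y ≡ w - (u - v) → Qf (+ 2) 1ℤ (+ 3 * M) ((u , v) , (s , w)) → R1 M (φ u v s′ y)
      φ-ok u v _ w s′ y refl h eq = *-cancel (+ 3) 3+ (lc2 1ℤ eq (+ 3 * y + w + u - v) h (i u v w s′ y M))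
        where
        i : ∀ u v w s y M → + 3 * ((y + u) * (y + u) + y * y + (y - v) * (y - v) + + 3 * (s * s)) - + 3 * M
          ≡ 1ℤ * (+ 2 * (u * u + u * v + v * v) + 1ℤ * (+ 3 * s * (+ 3 * s) + w * w) - + 3 * M) + (+ 3 * y + w + u - v) * (+ 3 * y - (w - (u - v)))
        i = solve-∀
      ψ-ok : ∀ x y z s → R1 M (x , y , z , s) → Qf (+ 2) 1ℤ (+ 3 * M) (ψ x y z s)
      ψ-ok x y z s eq = i x y z s ∙ cong (+ 3 *_) eq
        where
        i : ∀ x y z s → + 2 * ((x - y) * (x - y) + (x - y) * (y - z) + (y - z) * (y - z)) + 1ℤ * (+ 3 * s * (+ 3 * s) + (x + y + z) * (x + y + z))
          ≡ + 3 * (x * x + y * y + z * z + + 3 * (s * s))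
        i = solve-∀
      ψφ : ∀ u v s w s′ y → + 3 * s′ ≡ s → + 3 * y ≡ w - (u - v) → ψ (y + u) y (y - v) s′ ≡ ((u , v) , (s , w))
      ψφ u v s w s′ y refl h = eq4 (i1 y u) (i2 y v) refl (lc 1ℤ h (i3 u v w y))
        where
        eq4 : ∀ {a a′ b b′ c c′ d d′ : ℤ} → a ≡ a′ → b ≡ b′ → c ≡ c′ → d ≡ d′ → ((a , b) , (c , d)) ≡ ((a′ , b′) , (c′ , d′))
        eq4 refl refl refl refl = refl
        i1 : ∀ y u → y + u - y ≡ u
        i1 = solve-∀
        i2 : ∀ y v → y - (y - v) ≡ v
        i2 = solve-∀
        i3 : ∀ u v w y → y + u + y + (y - v) - w ≡ 1ℤ * (+ 3 * y - (w - (u - v)))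
        i3 = solve-∀
      φψ : ∀ x y z {s s′ y′} → s′ ≡ s → y′ ≡ y → φ (x - y) (y - z) s′ y′ ≡ (x , y , z , s)
      φψ x y z {s} refl refl = cong₂ (λ a b → a , y , b , s) (i1 x y) (i2 y z)
        where
        i1 : ∀ x y → y + (x - y) ≡ x
        i1 = solve-∀
        i2 : ∀ y z → y - (y - z) ≡ z
        i2 = solve-∀

    -- Here also 3 | u - v. The map (u, v) ↦ (2u + v, v - u) multiplies the hexagonal form by 3,
    -- being multiplication by an element of norm 3, and its image is the set of pairs congruent
    -- modulo 3.
    a₀≡Qf : ∑ e a₀ ≡ count (Qf-enum 2+ 3+ M)
    a₀≡Qf = ∑-supp e D? a₀ (λ ((u , v) , (s , w)) _ h → off s w h)
      ∙ ∑-bij (restrict e D?) (Qf-enum 2+ 3+ M)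
        (λ ((u , v) , (s , w)) → φ ((u - v) /ℕ 3) v (s /ℕ 3) (w /ℕ 3)) (λ ((u , v) , (s , w)) → (+ 2 * u + v , v - u) , (+ 3 * s , + 3 * w))
        (λ ((u , v) , (s , w)) (eq , (ds , dw)) → φ-ok u v s w ((u - v) /ℕ 3) (s /ℕ 3) (w /ℕ 3)
          (div-eq 2 (u - v) (duv u v s w eq ds dw)) (div-eq 2 s ds) (div-eq 2 w dw) eq)
        (λ ((u , v) , (s , w)) eq → (i₁ u v s w ∙ cong (+ 3 *_) eq) , (mul-Div 2 s , mul-Div 2 w))
        (λ ((u , v) , (s , w)) (eq , (ds , dw)) → back u v s w ((u - v) /ℕ 3) (s /ℕ 3) (w /ℕ 3)
          (div-eq 2 (u - v) (duv u v s w eq ds dw)) (div-eq 2 s ds) (div-eq 2 w dw))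
        (λ ((u , v) , (s , w)) _ → forth u v (cong (_/ℕ 3) (i₂ u v) ∙ mul-div 2 u) (mul-div 2 s) (mul-div 2 w))
        (λ ((u , v) , (s , w)) (_ , (ds , dw)) → cong₂ _*_ (z3-Div s ds) (z3-Div w dw))
      where
      D? : ∀ (t : ℤ² × ℤ²) → Dec (Div 2 (proj₁ (proj₂ t)) × Div 2 (proj₂ (proj₂ t)))
      D? ((u , v) , (s , w)) = div? 2 s ×-dec div? 2 w
      off : ∀ s d → ¬ (Div 2 s × Div 2 d) → z3 s * z3 d ≡ 0ℤ
      off s d h = case div? 2 s of λ
        { (no ¬ds) → cong (_* z3 d) (z3-non s ¬ds) ∙ ℤP.*-zeroˡ (z3 d)
        ; (yes ds) → cong (z3 s *_) (z3-non d (λ dd → h (ds , dd))) ∙ ℤP.*-zeroʳ (z3 s) }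
      duv : ∀ u v s w → Qf (+ 2) 1ℤ (+ 3 * M) ((u , v) , (s , w)) → Div 2 s → Div 2 w → Div 2 (u - v)
      duv u v s w eq = by-residues 3 (κ (+ 2) ⊗ (v0 ⊗ v0 ⊕ v0 ⊗ v1 ⊕ v1 ⊗ v1) ⊕ κ 1ℤ ⊗ (v2 ⊗ v2 ⊕ v3 ⊗ v3) mod 3 ∷ v2 mod 3 ∷ v3 mod 3 ∷ v0 ⊖ v1 mod 3 ∷ [])
        {λ { (c ∷ s ∷ w ∷ d ∷ []) → c ≡ 0 → s ≡ 0 → w ≡ 0 → d ≡ 0 }}
        (λ { (c ∷ s ∷ w ∷ d ∷ []) → (c ℕ.≟ 0) →-dec ((s ℕ.≟ 0) →-dec ((w ℕ.≟ 0) →-dec (d ℕ.≟ 0))) }) (u ∷ v ∷ s ∷ w ∷ []) (cong (_%ℕ 3) eq ∙ mul-Div 2 M)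
      φ : ℤ → ℤ → ℤ → ℤ → ℤ² × ℤ²
      φ d v s w = (d , d + v) , (s , w)
      φ-ok : ∀ u v s w d s′ w′ → + 3 * d ≡ u - v → + 3 * s′ ≡ s → + 3 * w′ ≡ w → Qf (+ 2) 1ℤ (+ 3 * M) ((u , v) , (s , w)) → Qf (+ 2) (+ 3) M (φ d v s′ w′)
      φ-ok u v _ _ d s w h refl refl eq = *-cancel (+ 3) 3+ (lc2 1ℤ eq (+ 2 * (+ 3 * d + u + + 2 * v)) h (i u v d s w M))
        where
        i : ∀ u v d s w M → + 3 * (+ 2 * (d * d + d * (d + v) + (d + v) * (d + v)) + + 3 * (s * s + w * w)) - + 3 * M
          ≡ 1ℤ * (+ 2 * (u * u + u * v + v * v) + 1ℤ * (+ 3 * s * (+ 3 * s) + + 3 * w * (+ 3 * w)) - + 3 * M) + + 2 * (+ 3 * d + u + + 2 * v) * (+ 3 * d - (u - v))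
        i = solve-∀
      i₁ : ∀ u v s w → + 2 * ((+ 2 * u + v) * (+ 2 * u + v) + (+ 2 * u + v) * (v - u) + (v - u) * (v - u)) + 1ℤ * (+ 3 * s * (+ 3 * s) + + 3 * w * (+ 3 * w))
        ≡ + 3 * (+ 2 * (u * u + u * v + v * v) + + 3 * (s * s + w * w))
      i₁ = solve-∀
      i₂ : ∀ u v → + 2 * u + v - (v - u) ≡ + 3 * u
      i₂ = solve-∀
      eq4 : ∀ {a a′ b b′ c c′ d d′ : ℤ} → a ≡ a′ → b ≡ b′ → c ≡ c′ → d ≡ d′ → ((a , b) , (c , d)) ≡ ((a′ , b′) , (c′ , d′))
      eq4 refl refl refl refl = refl
      back : ∀ u v s w d s′ w′ → + 3 * d ≡ u - v → + 3 * s′ ≡ s → + 3 * w′ ≡ w → ((+ 2 * d + (d + v) , d + v - d) , (+ 3 * s′ , + 3 * w′)) ≡ ((u , v) , (s , w))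
      back u v s w d s′ w′ h hs hw = eq4 (lc 1ℤ h (i u v d)) (j d v) hs hw
        where
        i : ∀ u v d → + 2 * d + (d + v) - u ≡ 1ℤ * (+ 3 * d - (u - v))
        i = solve-∀
        j : ∀ d v → d + v - d ≡ v
        j = solve-∀
      forth : ∀ u v {d s s′ w w′} → d ≡ u → s′ ≡ s → w′ ≡ w → φ d (v - u) s′ w′ ≡ ((u , v) , (s , w))
      forth u v refl refl refl = eq4 refl (i u v) refl refl
        where
        i : ∀ u v → u + (v - u) ≡ v
        i = solve-∀

    neighbours : count e + + 3 * count (Qf-enum 2+ 3+ M) ≡ + 4 * count (R1-enum M)
    neighbours = sym (∑-cong e classes ∙ ∑-+ e (λ _ → 1ℤ) (λ t → + 3 * a₀ t) ∙ +-congˡ {count e} (∑-* e (+ 3) a₀ ∙ cong (+ 3 *_) a₀≡Qf))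
      ∙ ∑-+ e (λ t → a₁ t + a₂ t) (λ t → a₃ t + a₄ t) ∙ cong₂ _+_ (∑-+ e a₁ a₂) (∑-+ e a₃ a₄)
      ∙ four (count (R1-enum M)) a₁≡R1 (a₂≡a₁ ∙ a₁≡R1) (a₃≡a₁ ∙ a₁≡R1) (a₄≡a₂ ∙ a₂≡a₁ ∙ a₁≡R1)
      where
      four : ∀ r {a b c d} → a ≡ r → b ≡ r → c ≡ r → d ≡ r → a + b + (c + d) ≡ + 4 * r
      four r refl refl refl refl = i r
        where
        i : ∀ r → r + r + (r + r) ≡ + 4 * r
        i = solve-∀

-- This count is an Eisenstein series: it supplies the divisor sums of the theorem.
R1-eisenstein : ∀ M → Pos M → M %ℕ 4 ≡ 1 → ∑ (R1-enum M) (λ (x , y , z , w) → same z w) ≡ + 6 * E₂ M - + 2 * E₁ M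
R1-eisenstein M pM h = solve′ Ξ R (count (Qf-enum 2+ 1+ (+ 3 * M))) (count (Qf-enum 2+ 3+ M)) L4 L8 L23 L3M (ρ M) (E₂ M) (E₁ M)
    (R1-same M h) (Neighbours.neighbours M)
    (R1-Qf M ∙ Qf-count 4+ 1+ M (no-even 4 refl) ∙ +-congˡ {+ 24 * L4} (cong (+ 4 *_) at-M))
    (Qf-count 2+ 1+ (+ 3 * M) (no-even3 2 refl) ∙ +-congˡ {+ 24 * L3M} (cong (+ 4 *_) at-3M))
    (Qf-count 2+ 3+ M (no-even 2 refl) ∙ +-congˡ {+ 24 * L23} (cong (+ 4 *_) at-third))
    eq₁ eq₂ eq₃
  where
  open AtOneModFour M h
  Ξ = ∑ (R1-enum M) (λ (x , y , z , w) → same z w)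
  R = count (R1-enum M)
  no-even : ∀ c → c ℕ.% 2 ≡ 0 → ∀ i → + c * i ≢ M
  no-even c c0 i eq = by-residues 4 (v0 ⊗ v1 mod 4 ∷ v0 mod 2 ∷ []) {λ { (a ∷ b ∷ []) → a ≡ 1 → b ≢ 0 }} (λ { (a ∷ b ∷ []) → (a ℕ.≟ 1) →-dec ¬? (b ℕ.≟ 0) })
    (+ c ∷ i ∷ []) (cong (_%ℕ 4) eq ∙ h) c0
  no-even3 : ∀ c → c ℕ.% 2 ≡ 0 → ∀ i → + c * i ≢ + 3 * M
  no-even3 c c0 i eq = by-residues 4 (v0 ⊗ v1 mod 4 ∷ v0 mod 2 ∷ []) {λ { (a ∷ b ∷ []) → a ≡ 3 → b ≢ 0 }} (λ { (a ∷ b ∷ []) → (a ℕ.≟ 3) →-dec ¬? (b ℕ.≟ 0) })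
    (+ c ∷ i ∷ []) (cong (_%ℕ 4) eq ∙ 3M≡3) c0
    where
    3M≡3 : (+ 3 * M) %ℕ 4 ≡ 3
    3M≡3 = by-residues 4 (v0 mod 4 ∷ κ (+ 3) ⊗ v0 mod 4 ∷ []) {λ { (a ∷ b ∷ []) → a ≡ 1 → b ≡ 3 }} (λ { (a ∷ b ∷ []) → (a ℕ.≟ 1) →-dec (b ℕ.≟ 3) }) (M ∷ []) h
  at-M : ∑ (At0-enum 1+ M) (λ (_ , k) → ρ k) ≡ ρ M
  at-M = ∑-single (At0-enum 1+ M) (0ℤ , M) (refl , pM , ℤP.*-identityˡ M) (λ (_ , k) → ρ k)
    λ (i , k) (i0 , _ , e) ne → ⊥-elim (ne (cong₂ _,_ i0 (sym (ℤP.*-identityˡ k) ∙ e)))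
  at-3M : ∑ (At0-enum 1+ (+ 3 * M)) (λ (_ , k) → ρ k) ≡ 0ℤ
  at-3M = ∑-0 (At0-enum 1+ (+ 3 * M)) λ (i , k) (_ , _ , e) → ρ-3mod4 k (cong (_%ℕ 4) (sym (ℤP.*-identityˡ k) ∙ e)
    ∙ by-residues 4 (v0 mod 4 ∷ κ (+ 3) ⊗ v0 mod 4 ∷ []) {λ { (a ∷ b ∷ []) → a ≡ 1 → b ≡ 3 }} (λ { (a ∷ b ∷ []) → (a ℕ.≟ 1) →-dec (b ℕ.≟ 3) }) (M ∷ []) h)
  at-third : ∑ (At0-enum 3+ M) (λ (_ , k) → ρ k) ≡ 0ℤ
  at-third = ∑-0 (At0-enum 3+ M) λ (i , k) (_ , _ , e) → ρ-3mod4 k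
    (by-residues 4 (κ (+ 3) ⊗ v0 mod 4 ∷ v0 mod 4 ∷ []) {λ { (a ∷ b ∷ []) → a ≡ 1 → b ≡ 3 }} (λ { (a ∷ b ∷ []) → (a ℕ.≟ 1) →-dec (b ℕ.≟ 3) }) (k ∷ []) (cong (_%ℕ 4) e ∙ h))
  solve′ : ∀ ξ r h₃ H l4 l8 l23 l3 p E e → + 3 * ξ ≡ + 2 * r → h₃ + + 3 * H ≡ + 4 * r → ξ ≡ + 24 * l4 + + 4 * p → h₃ ≡ + 24 * l3 + + 4 * 0ℤ → H ≡ + 24 * l23 + + 4 * 0ℤ →
    + 2 * (l4 + + 2 * l8) ≡ E - p → + 2 * (l4 - l8 + + 3 * l23) ≡ E - e → + 2 * (l3 + + 3 * l4 - + 3 * l8) ≡ + 3 * E - e → ξ ≡ + 6 * E - + 2 * e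
  solve′ ξ r h₃ H l4 l8 l23 l3 p E e q₁ q₂ refl refl refl q₃ q₄ q₅ = *-cancel (+ 12) (pos-ℕ 11)
    -- Weights 2, 1, 1 on the three Liouville relations eliminate `l8` and give 12 l4 + 2p + 2 (l3 +
    -- 3 l23) = 6E - 2e. The first two terms are ξ/2, and the bracket contributes (h₃ + 3H)/12 = r/3
    -- = ξ/2 as well.
    (lc2 (+ 12) (cong₂ _+_ (cong₂ _+_ (cong (+ 2 *_) q₃) q₄) q₅) 1ℤ (cong₂ _+_ (cong (+ 2 *_) q₁) (sym q₂)) (i r l4 l8 l23 l3 p E e))
    where
    i : ∀ r l4 l8 l23 l3 p E e → + 12 * (+ 24 * l4 + + 4 * p) - + 12 * (+ 6 * E - + 2 * e)
      ≡ + 12 * (+ 2 * (+ 2 * (l4 + + 2 * l8)) + + 2 * (l4 - l8 + + 3 * l23) + + 2 * (l3 + + 3 * l4 - + 3 * l8) - (+ 2 * (E - p) + (E - e) + (+ 3 * E - e)))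
        + 1ℤ * (+ 2 * (+ 3 * (+ 24 * l4 + + 4 * p)) + + 4 * r - (+ 2 * (+ 2 * r) + ((+ 24 * l3 + + 4 * 0ℤ) + + 3 * (+ 24 * l23 + + 4 * 0ℤ))))
    i = solve-∀

-- The cuspidal part

private
  tm2 td4 : ℕ → ℤ
  tm2 2 = 1ℤ
  tm2 6 = 1ℤ
  tm2 _ = 0ℤ
  td4 0 = 1ℤ
  td4 4 = 1ℤ
  td4 _ = 0ℤ

2mod4 0mod4 : ℤ → ℤ
2mod4 x = tm2 (x %ℕ 8)
0mod4 x = td4 (x %ℕ 8)

private
  Sum8 : Ex 4
  Sum8 = v0 ⊗ v0 ⊕ v1 ⊗ v1 ⊕ v2 ⊗ v2 ⊕ κ (+ 3) ⊗ (v3 ⊗ v3)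

  swap-yz swap-xz swap-xy neg-w : ℤ⁴ → ℤ⁴
  swap-yz (x , y , z , w) = x , z , y , w
  swap-xz (x , y , z , w) = z , y , x , w
  swap-xy (x , y , z , w) = y , x , z , w
  neg-w (x , y , z , w) = x , y , z , - w

  module _ (N : ℤ) where
    R1-yz : ∀ t → R1 N t → R1 N (swap-yz t)
    R1-yz (x , y , z , w) eq = i x y z w ∙ eq
      where
      i : ∀ x y z w → x * x + z * z + y * y + + 3 * (w * w) ≡ x * x + y * y + z * z + + 3 * (w * w)
      i = solve-∀
    R1-xz : ∀ t → R1 N t → R1 N (swap-xz t)
    R1-xz (x , y , z , w) eq = i x y z w ∙ eq
      where
      i : ∀ x y z w → z * z + y * y + x * x + + 3 * (w * w) ≡ x * x + y * y + z * z + + 3 * (w * w)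
      i = solve-∀
    R1-xy : ∀ t → R1 N t → R1 N (swap-xy t)
    R1-xy (x , y , z , w) eq = i x y z w ∙ eq
      where
      i : ∀ x y z w → y * y + x * x + z * z + + 3 * (w * w) ≡ x * x + y * y + z * z + + 3 * (w * w)
      i = solve-∀
    R1-neg : ∀ t → R1 N t → R1 N (neg-w t)
    R1-neg (x , y , z , w) eq = i x y z w ∙ eq
      where
      i : ∀ x y z w → x * x + y * y + z * z + + 3 * (- w * - w) ≡ x * x + y * y + z * z + + 3 * (w * w)
      i = solve-∀

pos-half : {P : A → Set} (e : Enum P) (u : A → ℤ) (φ : A → A) → (∀ x → P x → P (φ x)) → (∀ x → P x → φ (φ x) ≡ x) →
  (∀ x → u (φ x) ≡ - u x) → (∀ x → P x → u x ≢ 0ℤ) → (f : A → ℤ) → (∀ x → P x → f (φ x) ≡ f x) →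
  ∑ e f ≡ + 2 * ∑ (restrict e (λ x → pos? (u x))) f
pos-half {P = P} e u φ pres inv uφ u≢0 f fφ =
  ∑-part e e⁺ e⁻
    (λ x p → case sgn (u x) of λ { (inj₁ q) → inj₁ (p , q) ; (inj₂ (inj₁ q)) → ⊥-elim (u≢0 x p q) ; (inj₂ (inj₂ q)) → inj₂ (p , q) })
    (λ _ → proj₁) (λ _ → proj₁) (λ x (_ , q) (_ , r) → pos¬neg q r) f
  ∙ +-congˡ {∑ e⁺ f} (∑-bij e⁻ e⁺ φ φ (λ x (p , q) → pres x p , pos≡ (sym (uφ x)) q)
      (λ x (p , q) → pres x p , pos≡ (sym (ℤP.neg-involutive (u x)) ∙ cong -_ (sym (uφ x))) q)
      (λ x (p , _) → inv x p) (λ x (p , _) → inv x p) (λ x (p , _) → sym (fφ x p)))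
  ∙ i (∑ e⁺ f)
  where
  e⁺ : Enum (λ x → P x × Pos (u x))
  e⁺ = restrict e (λ x → pos? (u x))
  e⁻ : Enum (λ x → P x × Pos (- u x))
  e⁻ = restrict e (λ x → pos? (- u x))
  i : ∀ x → x + x ≡ + 2 * x
  i = solve-∀

T : ℤ → ℤ⁴ → Set
T N t = R1 N t × (Odd (pa t) × Odd (px t) × Odd (py t))

odds? : ∀ (t : ℤ⁴) → Dec (Odd (pa t) × Odd (px t) × Odd (py t))
odds? (x , y , z , w) = odd? x ×-dec odd? z ×-dec odd? w

T-enum : ∀ N → Enum (T N)
T-enum N = restrict (R1-enum N) odds?

Cs : ℤ → ℤ² → Set
Cs N (s , w) = s * s + + 3 * (w * w) ≡ N × Pos s

private
  VW : ℤ → ℤ² → Set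
  VW N (V , W) = V * V + + 3 * (W * W) ≡ N

  opaque
    VW-enum : ∀ N → Enum (VW N)
    VW-enum N = boxEnum (λ (V , W) → _ ℤ.≟ N) ∣ N ∣ λ { (V , W) refl → ℕP.⊔-lub
      (abs-sq V {V * V + + 3 * (W * W)} (nn≡ (i1 V W) (nn* {+ 3} (ℤ.+≤+ ℕ.z≤n) (nn² W))))
      (abs-sq W {V * V + + 3 * (W * W)} (nn≡ (i2 V W) (nn+ (nn² V) (nn* {+ 2} (ℤ.+≤+ ℕ.z≤n) (nn² W))))) }
      where
      i1 : ∀ V W → + 3 * (W * W) ≡ V * V + + 3 * (W * W) - V * V
      i1 = solve-∀
      i2 : ∀ V W → V * V + + 2 * (W * W) ≡ V * V + + 3 * (W * W) - W * W
      i2 = solve-∀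

Cs-enum : ∀ N → Enum (Cs N)
Cs-enum N = restrict (VW-enum N) (λ (V , _) → pos? V)

-- The coefficient of q^N in the product of Σ s χ₄(s) q^(s²) over s > 0, which is η(8τ)³ by Jacobi,
-- and the theta series of 3w².
C : ℤ → ℤ
C N = ∑ (Cs-enum N) (λ (s , _) → s * χ4 s)

K⁺ : ℤ → ℤ² → Set
K⁺ N (y , z) = (K N (y , z) × Pos y) × Pos z

K⁺-enum : ∀ N → Enum (K⁺ N)
K⁺-enum N = restrict (restrict (K-enum N) (λ (y , _) → pos? y)) (λ (_ , z) → pos? z)

private
  Odd-neg : ∀ u → Odd u → Odd (- u)
  Odd-neg u o = cong (_%ℕ 2) (sym (ℤP.+-identityˡ (- u))) ∙ by-residues 2 (v0 mod 2 ∷ κ 0ℤ ⊖ v0 mod 2 ∷ []) {λ { (a ∷ b ∷ []) → a ≡ 1 → b ≡ 1 }} (λ { (a ∷ b ∷ []) → (a ℕ.≟ 1) →-dec (b ℕ.≟ 1) }) (u ∷ []) o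

  Odd≢0 : ∀ u → Odd u → u ≢ 0ℤ
  Odd≢0 u o refl = case o of λ ()

  neg² : ∀ i → - i * - i ≡ i * i
  neg² = solve-∀

  0mod4-Div : ∀ d → ¬ Div 3 d → 0mod4 d ≡ 0ℤ
  0mod4-Div d = by-residues 8 (v0 mod 4 ∷ v0 mod 8 ∷ []) {λ { (a ∷ b ∷ []) → a ≢ 0 → td4 b ≡ 0ℤ }} (λ { (a ∷ b ∷ []) → ¬? (a ℕ.≟ 0) →-dec (td4 b ℤ.≟ 0ℤ) }) (d ∷ [])

  0mod4-1 : ∀ d → Div 3 d → 0mod4 d ≡ 1ℤ
  0mod4-1 d = by-residues 8 (v0 mod 4 ∷ v0 mod 8 ∷ []) {λ { (a ∷ b ∷ []) → a ≡ 0 → td4 b ≡ 1ℤ }} (λ { (a ∷ b ∷ []) → (a ℕ.≟ 0) →-dec (td4 b ℤ.≟ 1ℤ) }) (d ∷ [])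

  -- For odd z and w exactly one of z - w and z + w is divisible by 4.
  one-sign : ∀ z w → odd z * odd w ≡ odd z * odd w * 0mod4 (z - w) + odd z * odd w * 0mod4 (z + w)
  one-sign z w = res≡ 8 (v0 mod 2 ∷ v1 mod 2 ∷ v0 ⊖ v1 mod 8 ∷ v0 ⊕ v1 mod 8 ∷ []) (λ { (a ∷ b ∷ _) → t2 a * t2 b })
    (λ { (a ∷ b ∷ c ∷ d ∷ []) → t2 a * t2 b * td4 c + t2 a * t2 b * td4 d }) (z ∷ w ∷ [])

  two-copies : ∀ {x y z} → x ≡ y + z → z ≡ y → x ≡ + 2 * y
  two-copies {y = y} refl refl = i y
    where
    i : ∀ x → x + x ≡ + 2 * x
    i = solve-∀

module AtOneModEight (N : ℤ) (N≡1 : N %ℕ 8 ≡ 1) where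
  private
    e = R1-enum N
    N≡1₄ : N %ℕ 4 ≡ 1
    N≡1₄ = by-residues 8 (v0 mod 8 ∷ v0 mod 4 ∷ []) {λ { (a ∷ b ∷ []) → a ≡ 1 → b ≡ 1 }} (λ { (a ∷ b ∷ []) → (a ℕ.≟ 1) →-dec (b ℕ.≟ 1) }) (N ∷ []) N≡1

    wT wA wB wα wβ wγ : ℤ⁴ → ℤ
    wT (x , y , z , w) = odd x * odd z * odd w
    wA (x , y , z , w) = odd x * even z * even w
    wB (x , y , z , w) = odd x * even z * 0mod4 w * alt₂ y
    wα (x , y , z , w) = odd x * 2mod4 y * (even z * even w)
    wβ (x , y , z , w) = odd x * 2mod4 y * (even z * 0mod4 w)
    wγ (x , y , z , w) = odd x * 2mod4 y * (even z * 2mod4 w)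

    -- When z and w have equal parity, z² + 3w² is divisible by 4, so exactly one of x and y is odd.
    -- The solutions with z, w odd give t and those with z, w even give A, each in two orders of x
    -- and y.
    same-split : ∀ x y z w → (x * x + y * y + z * z + + 3 * (w * w)) %ℕ 4 ≡ 1 →
      same z w ≡ (wT (x , y , z , w) + wT (y , x , z , w)) + (wA (x , y , z , w) + wA (y , x , z , w))
    same-split x y z w h = res⇒ 4 (Sum8 mod 4 ∷ v2 ⊖ v3 mod 2 ∷ v0 mod 2 ∷ v1 mod 2 ∷ v2 mod 2 ∷ v3 mod 2 ∷ []) (λ { (a ∷ _) → + a }) (λ _ → 1ℤ)
      (λ { (_ ∷ d ∷ _) → 1ℤ - t2 d })
      (λ { (_ ∷ _ ∷ x ∷ y ∷ z ∷ w ∷ []) → (t2 x * t2 z * t2 w + t2 y * t2 z * t2 w) + (t2 x * (1ℤ - t2 z) * (1ℤ - t2 w) + t2 y * (1ℤ - t2 z) * (1ℤ - t2 w)) })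
      (x ∷ y ∷ z ∷ w ∷ []) (cong +_ h)

    Ξ≡ : ∑ e (λ (x , y , z , w) → same z w) ≡ + 2 * ∑ e wT + + 2 * ∑ e wA
    Ξ≡ = ∑-cong e (λ (x , y , z , w) eq → same-split x y z w (cong (_%ℕ 4) eq ∙ N≡1₄))
      ∙ ∑-+ e (λ t → wT t + wT (swap-xy t)) (λ t → wA t + wA (swap-xy t))
      ∙ cong₂ _+_ (dbl wT) (dbl wA)
      where
      dbl : ∀ f → ∑ e (λ t → f t + f (swap-xy t)) ≡ + 2 * ∑ e f
      dbl f = ∑-+ e f (f ∘ swap-xy) ∙ +-congˡ {∑ e f} (∑-inv e swap-xy (R1-xy N) (λ _ _ → refl) {f ∘ swap-xy} {f} (λ _ _ → refl)) ∙ i (∑ e f)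
        where
        i : ∀ x → x + x ≡ + 2 * x
        i = solve-∀

    -- For x odd and z, w even, N ≡ 1 (mod 8) makes y even and an even number of y, z, w equal to 2
    -- modulo 4. If 4 | w, then y and z agree modulo 4 and 1 = (-1)^(y/2) + 2 [y ≡ 2]. If w ≡ 2,
    -- exactly one of y and z is 2 modulo 4, which gives `wγ` or its mirror image.
    A-B : ∑ e wA ≡ ∑ e wB + + 2 * ∑ e wα
    A-B = ∑-cong e (λ (x , y , z , w) eq → pw x y z w (cong (_%ℕ 8) eq ∙ N≡1))
      ∙ ∑-+ e wB (λ t → + 2 * wβ t + (wγ t + wγ (swap-yz t)))
      ∙ +-congˡ {∑ e wB} (∑-+ e (λ t → + 2 * wβ t) (λ t → wγ t + wγ (swap-yz t))
        ∙ cong₂ _+_ (∑-* e (+ 2) wβ) (∑-+ e wγ (wγ ∘ swap-yz) ∙ +-congˡ {∑ e wγ} (∑-inv e swap-yz (R1-yz N) (λ _ _ → refl) {wγ ∘ swap-yz} {wγ} (λ _ _ → refl)))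
        ∙ i (∑ e wβ) (∑ e wγ) ∙ cong (+ 2 *_) (sym (∑-+ e wβ wγ) ∙ ∑-cong e (λ (x , y , z , w) _ → sym (αβγ x y z w))))
      where
      i : ∀ b c → + 2 * b + (c + c) ≡ + 2 * (b + c)
      i = solve-∀
      αβγ : ∀ x y z w → wα (x , y , z , w) ≡ wβ (x , y , z , w) + wγ (x , y , z , w)
      αβγ x y z w = cong (λ t → odd x * 2mod4 y * (even z * t)) (res≡ 8 (v0 mod 2 ∷ v0 mod 8 ∷ []) (λ { (a ∷ _) → 1ℤ - t2 a }) (λ { (_ ∷ b ∷ []) → td4 b + tm2 b }) (w ∷ []))
        ∙ j (odd x * 2mod4 y) (even z) (0mod4 w) (2mod4 w)
        where
        j : ∀ a b c d → a * (b * (c + d)) ≡ a * (b * c) + a * (b * d)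
        j = solve-∀
      pw : ∀ x y z w → (x * x + y * y + z * z + + 3 * (w * w)) %ℕ 8 ≡ 1 →
        wA (x , y , z , w) ≡ wB (x , y , z , w) + (+ 2 * wβ (x , y , z , w) + (wγ (x , y , z , w) + wγ (x , z , y , w)))
      pw x y z w h = res⇒ 8 (Sum8 mod 8 ∷ v0 mod 2 ∷ v2 mod 2 ∷ v3 mod 2 ∷ v1 mod 2 ∷ v1 mod 4 ∷ v1 mod 8 ∷ v2 mod 8 ∷ v3 mod 8 ∷ []) (λ { (a ∷ _) → + a }) (λ _ → 1ℤ)
        (λ { (_ ∷ x ∷ z ∷ w ∷ _) → t2 x * (1ℤ - t2 z) * (1ℤ - t2 w) })
        (λ { (_ ∷ x ∷ z ∷ _ ∷ y ∷ y4 ∷ y8 ∷ z8 ∷ w8 ∷ []) → t2 x * (1ℤ - t2 z) * td4 w8 * tε2 y4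
          + (+ 2 * (t2 x * tm2 y8 * ((1ℤ - t2 z) * td4 w8)) + (t2 x * tm2 y8 * ((1ℤ - t2 z) * tm2 w8) + t2 x * tm2 z8 * ((1ℤ - t2 y) * tm2 w8))) })
        (x ∷ y ∷ z ∷ w ∷ []) (cong +_ h)

    -- (z, w) = (V + 3W, V - W) turns z² + 3w² into (2V)² + 3(2W)².
    T≡α : count (T-enum N) ≡ + 2 * ∑ e wα
    T≡α = sym (∑-supp e odds? wT (λ (x , y , z , w) _ h → off x z w h)
        ∙ ∑-cong (T-enum N) (λ (x , y , z , w) (_ , ox , oz , ow) → cong₂ _*_ (cong₂ _*_ (odd-1 x ox) (odd-1 z oz)) (odd-1 w ow)))
      -- V and W are integral exactly when z ≡ w (mod 4). By `one-sign` and the symmetry w ↦ -w this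
      -- is half of the solutions.
      ∙ two-copies (∑-cong e (λ (x , y , z , w) _ → i₁ (odd x) (odd z) (odd w) (0mod4 (z - w)) (0mod4 (z + w)) (one-sign z w)) ∙ ∑-+ e w₋ w₊)
          (∑-inv e neg-w (R1-neg N) (λ (x , y , z , w) _ → cong (λ t → x , y , z , t) (ℤP.neg-involutive w))
            (λ (x , y , z , w) _ → cong₂ (λ o d → odd x * (odd z * o * 0mod4 d)) (sym (odd-neg w)) (cong (λ t → z + t) (sym (ℤP.neg-involutive w)))))
      ∙ cong (+ 2 *_) (∑-supp e D₁ w₋ (λ (x , y , z , w) _ h → off₁ x z w h)
        ∙ ∑-bij (restrict e D₁) (restrict e D₂)
          (λ (x , y , z , w) → φ x y w ((z - w) /ℕ 4)) (λ (x , y , z , w) → ψ x y ((z - w) /ℕ 2) w)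
          (λ (x , y , z , w) (eq , ox , oz , ow , d) → φ-ok x y z w ((z - w) /ℕ 4) (div-eq 3 (z - w) d) ox oz ow eq)
          (λ (x , y , z , w) (eq , ox , y2 , dz , dw) → ψ-ok x y (z /ℕ 2) (w /ℕ 2) z w (div-eq 1 z dz) (div-eq 1 w dw) ox y2 eq)
          (λ (x , y , z , w) (_ , _ , _ , _ , d) → cong₂ (λ u v → x , y , u , v)
            (cong (λ k → k + + 2 * (+ 2 * ((z - w) /ℕ 4))) (half′ w ((z - w) /ℕ 4)) ∙ lc 1ℤ (div-eq 3 (z - w) d) (j₁ z w ((z - w) /ℕ 4)))
            (half′ w ((z - w) /ℕ 4)))
          (λ (x , y , z , w) (_ , _ , _ , dz , dw) → back x y z w (z /ℕ 2) (w /ℕ 2) (div-eq 1 z dz) (div-eq 1 w dw))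
          (λ (x , y , z , w) (_ , ox , oz , ow , d) → cong₂ _*_ (odd-1 x ox) (cong₂ _*_ (cong₂ _*_ (odd-1 z oz) (odd-1 w ow)) (0mod4-1 (z - w) d)))
        ∙ sym (∑-supp e D₂ wα (λ (x , y , z , w) _ h → off₂ x y z w h)
          ∙ ∑-cong (restrict e D₂) (λ (x , y , z , w) (_ , ox , y2 , dz , dw) → cong₂ _*_ (cong₂ _*_ (odd-1 x ox) (2mod4-1 y y2)) (cong₂ _*_ (cong (λ r → 1ℤ - t2 r) dz) (cong (λ r → 1ℤ - t2 r) dw)))))
      where
      w₋ w₊ : ℤ⁴ → ℤ
      w₋ (x , y , z , w) = odd x * (odd z * odd w * 0mod4 (z - w))
      w₊ (x , y , z , w) = odd x * (odd z * odd w * 0mod4 (z + w))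
      i₁ : ∀ x z w p q → z * w ≡ z * w * p + z * w * q → x * z * w ≡ x * (z * w * p) + x * (z * w * q)
      i₁ x z w p q h = lc x h (i x z w p q)
        where
        i : ∀ x z w p q → x * z * w - (x * (z * w * p) + x * (z * w * q)) ≡ x * (z * w - (z * w * p + z * w * q))
        i = solve-∀
      D₁ : ∀ (t : ℤ⁴) → Dec (Odd (pa t) × Odd (px t) × Odd (py t) × Div 3 (px t - py t))
      D₁ (x , y , z , w) = odd? x ×-dec odd? z ×-dec odd? w ×-dec div? 3 (z - w)
      D₂ : ∀ (t : ℤ⁴) → Dec (Odd (pa t) × (pb t %ℕ 4 ≡ 2) × Div 1 (px t) × Div 1 (py t))
      D₂ (x , y , z , w) = odd? x ×-dec (y %ℕ 4 ℕ.≟ 2) ×-dec div? 1 z ×-dec div? 1 w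
      2mod4-1 : ∀ y → y %ℕ 4 ≡ 2 → 2mod4 y ≡ 1ℤ
      2mod4-1 y = by-residues 8 (v0 mod 4 ∷ v0 mod 8 ∷ []) {λ { (a ∷ b ∷ []) → a ≡ 2 → tm2 b ≡ 1ℤ }} (λ { (a ∷ b ∷ []) → (a ℕ.≟ 2) →-dec (tm2 b ℤ.≟ 1ℤ) }) (y ∷ [])
      off : ∀ x z w → ¬ (Odd x × Odd z × Odd w) → odd x * odd z * odd w ≡ 0ℤ
      off x z w = by-residues 2 (v0 mod 2 ∷ v1 mod 2 ∷ v2 mod 2 ∷ []) {λ { (a ∷ b ∷ c ∷ []) → ¬ (a ≡ 1 × b ≡ 1 × c ≡ 1) → t2 a * t2 b * t2 c ≡ 0ℤ }}
        (λ { (a ∷ b ∷ c ∷ []) → ¬? ((a ℕ.≟ 1) ×-dec (b ℕ.≟ 1) ×-dec (c ℕ.≟ 1)) →-dec (t2 a * t2 b * t2 c ℤ.≟ 0ℤ) }) (x ∷ z ∷ w ∷ [])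
      off₁ : ∀ x z w → ¬ (Odd x × Odd z × Odd w × Div 3 (z - w)) → odd x * (odd z * odd w * 0mod4 (z - w)) ≡ 0ℤ
      off₁ x z w = by-residues 8 (v0 mod 2 ∷ v1 mod 2 ∷ v2 mod 2 ∷ v1 ⊖ v2 mod 4 ∷ v1 ⊖ v2 mod 8 ∷ []) {λ { (a ∷ b ∷ c ∷ d ∷ e ∷ []) → ¬ (a ≡ 1 × b ≡ 1 × c ≡ 1 × d ≡ 0) → t2 a * (t2 b * t2 c * td4 e) ≡ 0ℤ }}
        (λ { (a ∷ b ∷ c ∷ d ∷ e ∷ []) → ¬? ((a ℕ.≟ 1) ×-dec (b ℕ.≟ 1) ×-dec (c ℕ.≟ 1) ×-dec (d ℕ.≟ 0)) →-dec (t2 a * (t2 b * t2 c * td4 e) ℤ.≟ 0ℤ) }) (x ∷ z ∷ w ∷ [])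
      off₂ : ∀ x y z w → ¬ (Odd x × (y %ℕ 4 ≡ 2) × Div 1 z × Div 1 w) → odd x * 2mod4 y * (even z * even w) ≡ 0ℤ
      off₂ x y z w = by-residues 8 (v0 mod 2 ∷ v1 mod 4 ∷ v1 mod 8 ∷ v2 mod 2 ∷ v3 mod 2 ∷ []) {λ { (a ∷ b ∷ b′ ∷ c ∷ d ∷ []) → ¬ (a ≡ 1 × b ≡ 2 × c ≡ 0 × d ≡ 0) → t2 a * tm2 b′ * ((1ℤ - t2 c) * (1ℤ - t2 d)) ≡ 0ℤ }}
        (λ { (a ∷ b ∷ b′ ∷ c ∷ d ∷ []) → ¬? ((a ℕ.≟ 1) ×-dec (b ℕ.≟ 2) ×-dec (c ℕ.≟ 0) ×-dec (d ℕ.≟ 0)) →-dec (t2 a * tm2 b′ * ((1ℤ - t2 c) * (1ℤ - t2 d)) ℤ.≟ 0ℤ) }) (x ∷ y ∷ z ∷ w ∷ [])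
      φ ψ : ℤ → ℤ → ℤ → ℤ → ℤ⁴
      φ x y w h = x , y , + 2 * h + + 2 * w , + 2 * h
      ψ x y k w = x , y , k + + 2 * w , k
      φ-ok : ∀ x y z w h → + 4 * h ≡ z - w → Odd x → Odd z → Odd w → R1 N (x , y , z , w) →
        R1 N (φ x y w h) × Odd x × (y %ℕ 4 ≡ 2) × Div 1 (+ 2 * h + + 2 * w) × Div 1 (+ 2 * h)
      φ-ok x y z w h e ox oz ow eq = lc2 (+ 4 * h + w + z) e 1ℤ eq (i x y z w h N) , ox ,
        by-residues 8 (Sum8 mod 8 ∷ v0 mod 2 ∷ v2 mod 2 ∷ v3 mod 2 ∷ v1 mod 4 ∷ []) {λ { (a ∷ x ∷ z ∷ w ∷ y ∷ []) → a ≡ 1 → x ≡ 1 → z ≡ 1 → w ≡ 1 → y ≡ 2 }}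
          (λ { (a ∷ x ∷ z ∷ w ∷ y ∷ []) → (a ℕ.≟ 1) →-dec ((x ℕ.≟ 1) →-dec ((z ℕ.≟ 1) →-dec ((w ℕ.≟ 1) →-dec (y ℕ.≟ 2)))) }) (x ∷ y ∷ z ∷ w ∷ []) (cong (_%ℕ 8) eq ∙ N≡1) ox oz ow ,
        (cong (_%ℕ 2) (i′ h w) ∙ mul-Div 1 (h + w)) , mul-Div 1 h
        where
        i : ∀ x y z w h N → x * x + y * y + (+ 2 * h + + 2 * w) * (+ 2 * h + + 2 * w) + + 3 * (+ 2 * h * (+ 2 * h)) - N
          ≡ (+ 4 * h + w + z) * (+ 4 * h - (z - w)) + 1ℤ * (x * x + y * y + z * z + + 3 * (w * w) - N)
        i = solve-∀
        i′ : ∀ h w → + 2 * h + + 2 * w ≡ + 2 * (h + w)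
        i′ = solve-∀
      half′ : ∀ w h → (+ 2 * h + + 2 * w - + 2 * h) /ℕ 2 ≡ w
      half′ w h = cong (_/ℕ 2) (i w h) ∙ mul-div 1 w
        where
        i : ∀ w h → + 2 * h + + 2 * w - + 2 * h ≡ + 2 * w
        i = solve-∀
      j₁ : ∀ z w h → w + + 2 * (+ 2 * h) - z ≡ 1ℤ * (+ 4 * h - (z - w))
      j₁ = solve-∀
      k-eq : ∀ a b → (+ 2 * a - + 2 * b) /ℕ 2 ≡ a - b
      k-eq a b = cong (_/ℕ 2) (i a b) ∙ mul-div 1 (a - b)
        where
        i : ∀ a b → + 2 * a - + 2 * b ≡ + 2 * (a - b)
        i = solve-∀
      ψ-ok : ∀ x y a b z w → + 2 * a ≡ z → + 2 * b ≡ w → Odd x → y %ℕ 4 ≡ 2 → R1 N (x , y , z , w) →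
        R1 N (ψ x y ((z - w) /ℕ 2) w) × Odd x × Odd ((z - w) /ℕ 2 + + 2 * w) × Odd ((z - w) /ℕ 2) × Div 3 ((z - w) /ℕ 2 + + 2 * w - (z - w) /ℕ 2)
      ψ-ok x y a b _ _ refl refl ox y2 eq = go ((+ 2 * a - + 2 * b) /ℕ 2) (k-eq a b)
        where
        i : ∀ x y a b → x * x + y * y + (a - b + + 2 * (+ 2 * b)) * (a - b + + 2 * (+ 2 * b)) + + 3 * ((a - b) * (a - b)) ≡ x * x + y * y + + 2 * a * (+ 2 * a) + + 3 * (+ 2 * b * (+ 2 * b))
        i = solve-∀
        i′ : ∀ a b → a - b + + 2 * (+ 2 * b) - (a - b) ≡ + 4 * b
        i′ = solve-∀
        oab : Odd (a - b) × Odd (a - b + + 2 * (+ 2 * b))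
        oab = by-residues 8 (v0 ⊗ v0 ⊕ v1 ⊗ v1 ⊕ κ (+ 2) ⊗ v2 ⊗ (κ (+ 2) ⊗ v2) ⊕ κ (+ 3) ⊗ (κ (+ 2) ⊗ v3 ⊗ (κ (+ 2) ⊗ v3)) mod 8 ∷ v0 mod 2 ∷ v1 mod 4 ∷ v2 ⊖ v3 mod 2 ∷ v2 ⊖ v3 ⊕ κ (+ 2) ⊗ (κ (+ 2) ⊗ v3) mod 2 ∷ [])
          {λ { (a ∷ x ∷ y ∷ c ∷ d ∷ []) → a ≡ 1 → x ≡ 1 → y ≡ 2 → c ≡ 1 × d ≡ 1 }}
          (λ { (a ∷ x ∷ y ∷ c ∷ d ∷ []) → (a ℕ.≟ 1) →-dec ((x ℕ.≟ 1) →-dec ((y ℕ.≟ 2) →-dec ((c ℕ.≟ 1) ×-dec (d ℕ.≟ 1)))) }) (x ∷ y ∷ a ∷ b ∷ []) (cong (_%ℕ 8) eq ∙ N≡1) ox y2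
        go : ∀ k → k ≡ a - b → R1 N (ψ x y k (+ 2 * b)) × Odd x × Odd (k + + 2 * (+ 2 * b)) × Odd k × Div 3 (k + + 2 * (+ 2 * b) - k)
        go _ refl = (i x y a b ∙ eq) , ox , proj₂ oab , proj₁ oab , (cong (_%ℕ 4) (i′ a b) ∙ mul-Div 3 b)
      back : ∀ x y z w a b → + 2 * a ≡ z → + 2 * b ≡ w → φ x y ((z - w) /ℕ 2) (((z - w) /ℕ 2 + + 2 * w - (z - w) /ℕ 2) /ℕ 4) ≡ (x , y , z , w)
      back x y _ _ a b refl refl = go ((+ 2 * a - + 2 * b) /ℕ 2) (k-eq a b)
        where
        i : ∀ a b → a - b + + 2 * (+ 2 * b) - (a - b) ≡ + 4 * b
        i = solve-∀
        i′ : ∀ a b → + 2 * b + + 2 * (a - b) ≡ + 2 * a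
        i′ = solve-∀
        go : ∀ k → k ≡ a - b → φ x y k ((k + + 2 * (+ 2 * b) - k) /ℕ 4) ≡ (x , y , + 2 * a , + 2 * b)
        go _ refl = cong (φ x y (a - b)) (cong (_/ℕ 4) (i a b) ∙ mul-div 3 b) ∙ cong (λ t → x , y , t , + 2 * b) (i′ a b)

    WY : ℤ² → Set
    WY (w , y) = 0ℤ ≤ N - + 3 * (w * w) - y * y
    WY⁺ WY⁰ : ℤ² → Set
    WY⁺ (w , y) = Pos (N - + 3 * (w * w) - y * y)
    WY⁰ (w , y) = N - + 3 * (w * w) - y * y ≡ 0ℤ
    Wn : ℤ → Set
    Wn w = 0ℤ ≤ N - + 3 * (w * w)

    wy-bound : ∀ w y → WY (w , y) → ∣ w ∣ ℕ.⊔ ∣ y ∣ ℕ.≤ ∣ N ∣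
    wy-bound w y h = ℕP.⊔-lub
      (abs-sq w {N} (nn≡ (i1 w y N) (nn+ (nn+ h (nn² y)) (nn* {+ 2} (ℤ.+≤+ ℕ.z≤n) (nn² w)))))
      (abs-sq y {N} (nn≡ (i2 w y N) (nn+ h (nn* {+ 3} (ℤ.+≤+ ℕ.z≤n) (nn² w)))))
      where
      i1 : ∀ w y N → N - + 3 * (w * w) - y * y + y * y + + 2 * (w * w) ≡ N - w * w
      i1 = solve-∀
      i2 : ∀ w y N → N - + 3 * (w * w) - y * y + + 3 * (w * w) ≡ N - y * y
      i2 = solve-∀

    opaque
      WY-enum : Enum WY
      WY-enum = boxEnum (λ (w , y) → _ ℤ.≤? _) ∣ N ∣ λ (w , y) h → wy-bound w y h
      WY⁺-enum : Enum WY⁺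
      WY⁺-enum = boxEnum (λ (w , y) → pos? _) ∣ N ∣ λ (w , y) h → wy-bound w y (pos⇒nn h)
      WY⁰-enum : Enum WY⁰
      WY⁰-enum = boxEnum (λ (w , y) → _ ℤ.≟ _) ∣ N ∣ λ (w , y) h → wy-bound w y (nn≡ (sym h) (ℤ.+≤+ ℕ.z≤n))
      Wn-enum : Enum Wn
      Wn-enum = boxEnum (λ w → _ ℤ.≤? _) ∣ N ∣ λ w h → abs-sq w {N} (nn≡ (i w N) (nn+ h (nn* {+ 2} (ℤ.+≤+ ℕ.z≤n) (nn² w))))
        where
        i : ∀ w N → N - + 3 * (w * w) + + 2 * (w * w) ≡ N - w * w
        i = solve-∀

    g : ℤ² → ℤ
    g (w , y) = 0mod4 w * alt₂ y

    rest : ℤ → ℤ → ℤ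
    rest w y = N - + 3 * (w * w) - y * y

    -- With y even and 4 | w exactly one of x and z is odd, so at the cost of a factor 2 the parity
    -- conditions disappear and (x, z) runs over all representations by two squares.
    B₁ : + 2 * ∑ e wB ≡ ∑ WY-enum (λ (w , y) → g (w , y) * r2 (rest w y))
    B₁ = sym (∑-cong e (λ (x , y , z , w) eq → pw x y z w (cong (_%ℕ 8) eq ∙ N≡1)) ∙ ∑-+ e wB (wB ∘ swap-xz)
        ∙ two-copies refl (∑-inv e swap-xz (R1-xz N) (λ _ _ → refl) {wB ∘ swap-xz} {wB} (λ _ _ → refl)))
      ∙ ∑-bij e (depEnum WY-enum (λ (w , y) → R2-enum (rest w y)))
          (λ (x , y , z , w) → (w , y) , (x , z)) (λ ((w , y) , (x , z)) → x , y , z , w)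
          (λ (x , y , z , w) eq → nn≡ (lc 1ℤ eq (i1 x y z w N)) (nn+ (nn² x) (nn² z)) , lc 1ℤ eq (i1 x y z w N))
          (λ ((w , y) , (x , z)) (_ , eq) → lc 1ℤ eq (i2 x y z w N)) (λ _ _ → refl) (λ _ _ → refl) (λ _ _ → refl)
      ∙ ∑-dep WY-enum (λ (w , y) → R2-enum (rest w y)) (λ (wy , _) → g wy)
      ∙ ∑-cong WY-enum (λ (w , y) _ → ∑-cong (R2-enum (rest w y)) (λ _ _ → sym (ℤP.*-identityʳ (g (w , y)))) ∙ ∑-* (R2-enum (rest w y)) (g (w , y)) (λ _ → 1ℤ))
      where
      i1 : ∀ x y z w N → x * x + z * z - (N - + 3 * (w * w) - y * y) ≡ 1ℤ * (x * x + y * y + z * z + + 3 * (w * w) - N)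
      i1 = solve-∀
      i2 : ∀ x y z w N → x * x + y * y + z * z + + 3 * (w * w) - N ≡ 1ℤ * (x * x + z * z - (N - + 3 * (w * w) - y * y))
      i2 = solve-∀
      pw : ∀ x y z w → (x * x + y * y + z * z + + 3 * (w * w)) %ℕ 8 ≡ 1 → 0mod4 w * alt₂ y ≡ wB (x , y , z , w) + wB (z , y , x , w)
      pw x y z w h = res⇒ 8 (Sum8 mod 8 ∷ v0 mod 2 ∷ v1 mod 4 ∷ v2 mod 2 ∷ v3 mod 8 ∷ []) (λ { (a ∷ _) → + a }) (λ _ → 1ℤ)
        (λ { (_ ∷ _ ∷ y ∷ _ ∷ w ∷ []) → td4 w * tε2 y })
        (λ { (_ ∷ x ∷ y ∷ z ∷ w ∷ []) → t2 x * (1ℤ - t2 z) * td4 w * tε2 y + t2 z * (1ℤ - t2 x) * td4 w * tε2 y }) (x ∷ y ∷ z ∷ w ∷ []) (cong +_ h)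

    -- Where the weight is nonzero, y and w are even and N is odd, so the argument of `r2` is never
    -- zero and the two-squares formula applies.
    B₂ : ∑ WY-enum (λ (w , y) → g (w , y) * r2 (rest w y)) ≡ + 4 * ∑ WY⁺-enum (λ (w , y) → g (w , y) * ρ (rest w y))
    B₂ = ∑-part WY-enum WY⁺-enum WY⁰-enum
        (λ (w , y) h → case nn⇒≡0⊎pos h of λ { (inj₁ z) → inj₂ z ; (inj₂ p) → inj₁ p })
        (λ (w , y) → pos⇒nn) (λ (w , y) z → nn≡ (sym z) (ℤ.+≤+ ℕ.z≤n)) (λ (w , y) p z → ¬pos0 (pos≡ z p)) _
      ∙ cong₂ _+_ (∑-cong WY⁺-enum (λ (w , y) p → cong (g (w , y) *_) (two-squares (rest w y) p) ∙ i (g (w , y)) (ρ (rest w y))) ∙ ∑-* WY⁺-enum (+ 4) (λ (w , y) → g (w , y) * ρ (rest w y)))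
          (∑-0 WY⁰-enum (λ (w , y) z → cong (_* r2 (rest w y)) (odd-rest w y z) ∙ ℤP.*-zeroˡ (r2 (rest w y)))) ∙ ℤP.+-identityʳ _
      where
      i : ∀ g r → g * (+ 4 * r) ≡ + 4 * (g * r)
      i = solve-∀
      odd-rest : ∀ w y → WY⁰ (w , y) → g (w , y) ≡ 0ℤ
      odd-rest w y z = by-residues 8 (v0 ⊖ κ (+ 3) ⊗ (v1 ⊗ v1) ⊖ v2 ⊗ v2 mod 8 ∷ v0 mod 8 ∷ v1 mod 8 ∷ v2 mod 4 ∷ [])
        {λ { (a ∷ n ∷ w ∷ y ∷ []) → a ≡ 0 → n ≡ 1 → td4 w * tε2 y ≡ 0ℤ }} (λ { (a ∷ n ∷ w ∷ y ∷ []) → (a ℕ.≟ 0) →-dec ((n ℕ.≟ 1) →-dec (td4 w * tε2 y ℤ.≟ 0ℤ)) })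
        (N ∷ w ∷ y ∷ []) (cong (_%ℕ 8) z) N≡1

    B₃ : ∑ WY⁺-enum (λ (w , y) → g (w , y) * ρ (rest w y)) ≡ ∑ Wn-enum (λ w → 0mod4 w * ∑ (U-enum (N - + 3 * (w * w))) (λ (i , d , δ) → alt₂ i * χ4 δ))
    B₃ = ∑-cong WY⁺-enum (λ (w , y) _ → sym (∑-* (Dv-enum 1+ (rest w y)) (g (w , y)) (λ (δ , _) → χ4 δ)))
      ∙ sym (∑-dep WY⁺-enum (λ (w , y) → Dv-enum 1+ (rest w y)) (λ (wy , δ , _) → g wy * χ4 δ))
      ∙ ∑-bij (depEnum WY⁺-enum (λ (w , y) → Dv-enum 1+ (rest w y))) (depEnum Wn-enum (λ w → U-enum (N - + 3 * (w * w))))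
          (λ ((w , y) , (δ , d)) → w , (y , d , δ)) (λ (w , (y , d , δ)) → (w , y) , (δ , d))
          (λ ((w , y) , (δ , d)) (p , ((pδ , pd) , eq)) → nn≡ (i3 (N - + 3 * (w * w)) y) (nn+ (pos⇒nn p) (nn² y)) , ((pd , pδ) , lc 1ℤ eq (i1 (N - + 3 * (w * w)) y d δ)))
          (λ (w , (y , d , δ)) (_ , ((pd , pδ) , eq)) → pos≡ (lc 1ℤ eq (i2 (N - + 3 * (w * w)) y d δ)) (pos* pd pδ) , ((pδ , pd) , lc 1ℤ eq (i4 (N - + 3 * (w * w)) y d δ)))
          (λ _ _ → refl) (λ _ _ → refl) (λ ((w , y) , (δ , d)) _ → ℤP.*-assoc (0mod4 w) (alt₂ y) (χ4 δ))
      ∙ ∑-dep Wn-enum (λ w → U-enum (N - + 3 * (w * w))) (λ (w , (i , d , δ)) → 0mod4 w * (alt₂ i * χ4 δ))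
      ∙ ∑-cong Wn-enum (λ w _ → ∑-* (U-enum (N - + 3 * (w * w))) (0mod4 w) (λ (i , d , δ) → alt₂ i * χ4 δ))
      where
      i1 : ∀ m y d δ → y * y + d * δ - m ≡ 1ℤ * (1ℤ * (δ * d) - (m - y * y))
      i1 = solve-∀
      i2 : ∀ m y d δ → d * δ - (m - y * y) ≡ 1ℤ * (y * y + d * δ - m)
      i2 = solve-∀
      i3 : ∀ m y → m - y * y + y * y ≡ m
      i3 = solve-∀
      i4 : ∀ m y d δ → 1ℤ * (δ * d) - (m - y * y) ≡ 1ℤ * (y * y + d * δ - m)
      i4 = solve-∀

    B₄ : ∑ Wn-enum (λ w → 0mod4 w * ∑ (U-enum (N - + 3 * (w * w))) (λ (i , d , δ) → alt₂ i * χ4 δ)) ≡ C N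
    B₄ = ∑-cong Wn-enum (λ w _ → row w (div? 3 w) ∙ sym (∑-* (Sq-enum (N - + 3 * (w * w))) (0mod4 w) (λ s → s * χ4 s)))
      ∙ sym (∑-dep Wn-enum (λ w → Sq-enum (N - + 3 * (w * w))) (λ (w , s) → 0mod4 w * (s * χ4 s)))
      ∙ ∑-bij (depEnum Wn-enum (λ w → Sq-enum (N - + 3 * (w * w)))) (Cs-enum N) (λ (w , s) → s , w) (λ (s , w) → w , s)
          (λ (w , s) (_ , (p , eq)) → lc 1ℤ eq (i1 s w N) , p)
          (λ (s , w) (eq , p) → nn≡ (lc 1ℤ eq (i2 s w N)) (nn² s) , (p , lc 1ℤ eq (i2 s w N)))
          (λ _ _ → refl) (λ _ _ → refl) (λ (w , s) (_ , (_ , eq)) → drop s w (cong (_%ℕ 8) {s * s + + 3 * (w * w)} {N} (lc 1ℤ eq (i1 s w N)) ∙ N≡1))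
      where
      i1 : ∀ s w N → s * s + + 3 * (w * w) - N ≡ 1ℤ * (s * s - (N - + 3 * (w * w)))
      i1 = solve-∀
      i2 : ∀ s w N → s * s - (N - + 3 * (w * w)) ≡ 1ℤ * (s * s + + 3 * (w * w) - N)
      i2 = solve-∀
      drop : ∀ s w → (s * s + + 3 * (w * w)) %ℕ 8 ≡ 1 → 0mod4 w * (s * χ4 s) ≡ s * χ4 s
      drop s w h = i s (0mod4 w) (χ4 s) (res⇒ 8 (v0 ⊗ v0 ⊕ κ (+ 3) ⊗ (v1 ⊗ v1) mod 8 ∷ v1 mod 8 ∷ v0 mod 4 ∷ []) (λ { (a ∷ _) → + a }) (λ _ → 1ℤ)
          (λ { (_ ∷ w ∷ s ∷ []) → td4 w * t4 s }) (λ { (_ ∷ _ ∷ s ∷ []) → t4 s }) (s ∷ w ∷ []) (cong +_ h))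
        where
        i : ∀ s d x → d * x ≡ x → d * (s * x) ≡ s * x
        i s d x h = lc s h (j s d x)
          where
          j : ∀ s d x → d * (s * x) - s * x ≡ s * (d * x - x)
          j = solve-∀
      row : ∀ w → Dec (Div 3 w) → 0mod4 w * ∑ (U-enum (N - + 3 * (w * w))) (λ (i , d , δ) → alt₂ i * χ4 δ) ≡ 0mod4 w * ∑ (Sq-enum (N - + 3 * (w * w))) (λ s → s * χ4 s)
      row w (yes d) = cong (0mod4 w *_) (signed-squares (N - + 3 * (w * w)) (by-residues 4 (v0 ⊖ κ (+ 3) ⊗ (v1 ⊗ v1) mod 4 ∷ v0 mod 4 ∷ v1 mod 4 ∷ [])
        {λ { (a ∷ n ∷ w ∷ []) → n ≡ 1 → w ≡ 0 → a ≡ 1 }} (λ { (a ∷ n ∷ w ∷ []) → (n ℕ.≟ 1) →-dec ((w ℕ.≟ 0) →-dec (a ℕ.≟ 1)) }) (N ∷ w ∷ []) N≡1₄ d))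
      row w (no ¬d) = zl (0mod4-Div w ¬d) ∙ sym (zl (0mod4-Div w ¬d))
        where
        zl : ∀ {a b} → a ≡ 0ℤ → a * b ≡ 0ℤ
        zl {b = b} refl = ℤP.*-zeroˡ b

    B≡ : ∑ e wB ≡ + 2 * C N
    B≡ = *-cancel (+ 2) 2+ (B₁ ∙ B₂ ∙ cong (+ 4 *_) (B₃ ∙ B₄) ∙ i (C N))
      where
      i : ∀ c → + 4 * c ≡ + 2 * (+ 2 * c)
      i = solve-∀

    oN : Odd N
    oN = by-residues 8 (v0 mod 8 ∷ v0 mod 2 ∷ []) {λ { (a ∷ b ∷ []) → a ≡ 1 → b ≡ 1 }} (λ { (a ∷ b ∷ []) → (a ℕ.≟ 1) →-dec (b ℕ.≟ 1) }) (N ∷ []) N≡1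

    f : ℤ² → ℤ
    f (y , z) = y * χ4 y

    f-neg : ∀ y → - y * χ4 (- y) ≡ y * χ4 y
    f-neg y = cong (- y *_) (χ4-neg y) ∙ i y (χ4 y)
      where
      i : ∀ a b → - a * - b ≡ a * b
      i = solve-∀

    K-signs : ∑ (K-enum N) f ≡ + 4 * ∑ (K⁺-enum N) f
    K-signs = pos-half (K-enum N) proj₁ (λ (y , z) → - y , z)
        (λ (y , z) ((oy , oz) , eq) → (Odd-neg y oy , oz) , (cong (λ t → t + + 3 * (z * z)) (neg² y) ∙ eq))
        (λ (y , z) _ → cong (_, z) (ℤP.neg-involutive y)) (λ _ → refl) (λ (y , z) ((oy , _) , _) → Odd≢0 y oy) f (λ (y , z) _ → f-neg y)
      ∙ cong (+ 2 *_) (pos-half (restrict (K-enum N) (λ (y , _) → pos? y)) proj₂ (λ (y , z) → y , - z)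
        (λ (y , z) (((oy , oz) , eq) , p) → ((oy , Odd-neg z oz) , (cong (λ t → y * y + + 3 * t) (neg² z) ∙ eq)) , p)
        (λ (y , z) _ → cong (y ,_) (ℤP.neg-involutive z)) (λ _ → refl) (λ (y , z) (((_ , oz) , _) , _) → Odd≢0 z oz) f (λ _ _ → refl))
      ∙ i (∑ (K⁺-enum N) f)
      where
      i : ∀ x → + 2 * (+ 2 * x) ≡ + 4 * x
      i = solve-∀

    -- On the half y ≡ z (mod 4) put y = V + 3W and z = V - W. N ≡ 1 (mod 8) forces V odd and 4 | W,
    -- so χ₄(y) = χ₄(V); the part 3W of y then cancels under W ↦ -W.
    K-VW : ∑ (K-enum N) f ≡ + 4 * C N
    K-VW = two-copies (∑-cong (K-enum N) (λ (y , z) ((oy , oz) , _) → split y z oy oz) ∙ ∑-+ (K-enum N) f₋ f₊)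
        (∑-inv (K-enum N) (λ (y , z) → y , - z) (λ (y , z) ((oy , oz) , eq) → (oy , Odd-neg z oz) , (cong (λ t → y * y + + 3 * t) (neg² z) ∙ eq))
          (λ (y , z) _ → cong (y ,_) (ℤP.neg-involutive z)) (λ (y , z) _ → cong (λ t → y * χ4 y * 0mod4 (y + t)) (sym (ℤP.neg-involutive z))))
      ∙ cong (+ 2 *_) (∑-supp (K-enum N) D? f₋ (λ (y , z) _ h → cong (y * χ4 y *_) (0mod4-Div (y - z) h) ∙ ℤP.*-zeroʳ (y * χ4 y))
        ∙ ∑-bij (restrict (K-enum N) D?) (VW-enum N) (λ (y , z) → φ z ((y - z) /ℕ 4)) (λ (V , W) → V + + 3 * W , V - W)
            (λ (y , z) ((_ , eq) , d) → φ-ok y z ((y - z) /ℕ 4) (div-eq 3 (y - z) d) eq)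
            (λ (V , W) eq → (ψ-odd V W eq , (i1 V W ∙ cong (+ 4 *_) eq)) , (cong (_%ℕ 4) (i2 V W) ∙ mul-Div 3 W))
            (λ (y , z) (_ , d) → ψφ y z ((y - z) /ℕ 4) (div-eq 3 (y - z) d))
            (λ (V , W) _ → φψ V W (cong (_/ℕ 4) (i2 V W) ∙ mul-div 3 W))
            {g = λ (V , W) → (V + + 3 * W) * χ4 (V + + 3 * W)}
            (λ (y , z) (_ , d) → val y z ((y - z) /ℕ 4) (div-eq 3 (y - z) d))
        ∙ ∑-cong (VW-enum N) (λ (V , W) eq → drop V W (cong (_%ℕ 8) eq ∙ N≡1))
        ∙ ∑-+ (VW-enum N) f (λ (V , W) → + 3 * W * χ4 V)
        ∙ cong₂ _+_ (pos-half (VW-enum N) proj₁ (λ (V , W) → - V , W) (λ (V , W) eq → cong (λ t → t + + 3 * (W * W)) (neg² V) ∙ eq)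
              (λ (V , W) _ → cong (_, W) (ℤP.neg-involutive V)) (λ _ → refl) nz f (λ (V , W) _ → f-neg V))
            (∑-anti (VW-enum N) (λ (V , W) → V , - W) (λ (V , W) eq → cong (λ t → V * V + + 3 * t) (neg² W) ∙ eq)
              (λ (V , W) _ → cong (V ,_) (ℤP.neg-involutive W)) (λ (V , W) _ → i3 W (χ4 V)))
        ∙ ℤP.+-identityʳ (+ 2 * C N))
      ∙ i4 (C N)
      where
      f₋ f₊ : ℤ² → ℤ
      f₋ (y , z) = y * χ4 y * 0mod4 (y - z)
      f₊ (y , z) = y * χ4 y * 0mod4 (y + z)
      D? : ∀ (t : ℤ²) → Dec (Div 3 (proj₁ t - proj₂ t))
      D? (y , z) = div? 3 (y - z)
      split : ∀ y z → Odd y → Odd z → y * χ4 y ≡ f₋ (y , z) + f₊ (y , z)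
      split y z oy oz = lc (y * χ4 y) (sym (cong₂ _*_ (odd-1 y oy) (odd-1 z oz)) ∙ one-sign y z ∙ cong₂ (λ o o′ → o * o′ * 0mod4 (y - z) + o * o′ * 0mod4 (y + z)) (odd-1 y oy) (odd-1 z oz))
          (i (y * χ4 y) (0mod4 (y - z)) (0mod4 (y + z)))
        where
        i : ∀ u p q → u - (u * p + u * q) ≡ u * (1ℤ - (1ℤ * p + 1ℤ * q))
        i = solve-∀
      φ : ℤ → ℤ → ℤ²
      φ z h = z + h , h
      φ-ok : ∀ y z h → + 4 * h ≡ y - z → y * y + + 3 * (z * z) ≡ + 4 * N → VW N (φ z h)
      φ-ok y z h e eq = *-cancel (+ 4) 4+ (lc2 (+ 4 * h + z + y) e 1ℤ eq (i y z h N))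
        where
        i : ∀ y z h N → + 4 * ((z + h) * (z + h) + + 3 * (h * h)) - + 4 * N ≡ (+ 4 * h + z + y) * (+ 4 * h - (y - z)) + 1ℤ * (y * y + + 3 * (z * z) - + 4 * N)
        i = solve-∀
      i1 : ∀ V W → (V + + 3 * W) * (V + + 3 * W) + + 3 * ((V - W) * (V - W)) ≡ + 4 * (V * V + + 3 * (W * W))
      i1 = solve-∀
      i2 : ∀ V W → V + + 3 * W - (V - W) ≡ + 4 * W
      i2 = solve-∀
      i3 : ∀ W x → + 3 * W * x ≡ - (+ 3 * - W * x)
      i3 = solve-∀
      i4 : ∀ c → + 2 * (+ 2 * c) ≡ + 4 * c
      i4 = solve-∀
      ψ-odd : ∀ V W → VW N (V , W) → Odd (V + + 3 * W) × Odd (V - W)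
      ψ-odd V W eq = by-residues 2 (v0 ⊗ v0 ⊕ κ (+ 3) ⊗ (v1 ⊗ v1) mod 2 ∷ v0 ⊕ κ (+ 3) ⊗ v1 mod 2 ∷ v0 ⊖ v1 mod 2 ∷ [])
        {λ { (a ∷ b ∷ c ∷ []) → a ≡ 1 → b ≡ 1 × c ≡ 1 }} (λ { (a ∷ b ∷ c ∷ []) → (a ℕ.≟ 1) →-dec ((b ℕ.≟ 1) ×-dec (c ℕ.≟ 1)) }) (V ∷ W ∷ []) (cong (_%ℕ 2) eq ∙ oN)
      ψφ : ∀ y z h → + 4 * h ≡ y - z → (z + h + + 3 * h , z + h - h) ≡ (y , z)
      ψφ y z h e = cong₂ _,_ (lc 1ℤ e (i y z h)) (j z h)
        where
        i : ∀ y z h → z + h + + 3 * h - y ≡ 1ℤ * (+ 4 * h - (y - z))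
        i = solve-∀
        j : ∀ z h → z + h - h ≡ z
        j = solve-∀
      φψ : ∀ V W {h} → h ≡ W → φ (V - W) h ≡ (V , W)
      φψ V W refl = cong (_, W) (i V W)
        where
        i : ∀ V W → V - W + W ≡ V
        i = solve-∀
      val : ∀ y z h → + 4 * h ≡ y - z → f₋ (y , z) ≡ (z + h + + 3 * h) * χ4 (z + h + + 3 * h)
      val y z h e = cong (y * χ4 y *_) (0mod4-1 (y - z) (cong (_%ℕ 4) (sym e) ∙ mul-Div 3 h)) ∙ ℤP.*-identityʳ (y * χ4 y) ∙ cong (λ t → t * χ4 t) (sym (cong proj₁ (ψφ y z h e)))
      drop : ∀ V W → (V * V + + 3 * (W * W)) %ℕ 8 ≡ 1 → (V + + 3 * W) * χ4 (V + + 3 * W) ≡ V * χ4 V + + 3 * W * χ4 V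
      drop V W h = cong ((V + + 3 * W) *_) (res⇒ 8 (v0 ⊗ v0 ⊕ κ (+ 3) ⊗ (v1 ⊗ v1) mod 8 ∷ v0 ⊕ κ (+ 3) ⊗ v1 mod 4 ∷ v0 mod 4 ∷ []) (λ { (a ∷ _) → + a }) (λ _ → 1ℤ)
          (λ { (_ ∷ b ∷ _) → t4 b }) (λ { (_ ∷ _ ∷ c ∷ []) → t4 c }) (V ∷ W ∷ []) (cong +_ h)) ∙ ℤP.*-distribʳ-+ (χ4 V) V (+ 3 * W)
      nz : ∀ t → VW N t → proj₁ t ≢ 0ℤ
      nz (V , W) eq refl = by-residues 8 (κ (+ 3) ⊗ (v0 ⊗ v0) mod 8 ∷ []) {λ { (a ∷ []) → a ≢ 1 }} (λ { (a ∷ []) → ¬? (a ℕ.≟ 1) }) (W ∷ [])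
        (cong (_%ℕ 8) (sym (ℤP.+-identityˡ (+ 3 * (W * W))) ∙ eq) ∙ N≡1)

  T-count : Pos N → + 2 * count (T-enum N) ≡ + 3 * E₂ N - E₁ N - + 2 * ∑ (K⁺-enum N) (λ (y , _) → y * χ4 y)
  T-count pN = fin (∑ e wT) (∑ e wA) (∑ e wα) (C N) (∑ (K⁺-enum N) f) (E₂ N) (E₁ N) (count (T-enum N))
      (sym Ξ≡ ∙ R1-eisenstein N pN N≡1₄) A-B B≡ T≡α (sym K-signs ∙ K-VW) T≡wT
    where
    T≡wT : ∑ e wT ≡ count (T-enum N)
    T≡wT = ∑-supp e odds? wT (λ (x , y , z , w) _ h → off x z w h)
        ∙ ∑-cong (T-enum N) (λ (x , y , z , w) (_ , ox , oz , ow) → cong₂ _*_ (cong₂ _*_ (odd-1 x ox) (odd-1 z oz)) (odd-1 w ow))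
      where
      off : ∀ x z w → ¬ (Odd x × Odd z × Odd w) → odd x * odd z * odd w ≡ 0ℤ
      off x z w = by-residues 2 (v0 mod 2 ∷ v1 mod 2 ∷ v2 mod 2 ∷ []) {λ { (a ∷ b ∷ c ∷ []) → ¬ (a ≡ 1 × b ≡ 1 × c ≡ 1) → t2 a * t2 b * t2 c ≡ 0ℤ }}
        (λ { (a ∷ b ∷ c ∷ []) → ¬? ((a ℕ.≟ 1) ×-dec (b ℕ.≟ 1) ×-dec (c ℕ.≟ 1)) →-dec (t2 a * t2 b * t2 c ℤ.≟ 0ℤ) }) (x ∷ z ∷ w ∷ [])
    fin : ∀ wt wa α c k E e t {wb} → + 2 * wt + + 2 * wa ≡ + 6 * E - + 2 * e → wa ≡ wb + + 2 * α → wb ≡ + 2 * c → t ≡ + 2 * α → + 4 * k ≡ + 4 * c → wt ≡ t →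
      + 2 * t ≡ + 3 * E - e - + 2 * k
    fin wt wa α c k E e t h refl refl refl h′ refl = *-cancel (+ 2) 2+ (lc2 1ℤ h 1ℤ h′ (i α c k E e))
      where
      i : ∀ α c k E e → + 2 * (+ 2 * (+ 2 * α)) - + 2 * (+ 3 * E - e - + 2 * k)
        ≡ 1ℤ * (+ 2 * (+ 2 * α) + + 2 * (+ 2 * c + + 2 * α) - (+ 6 * E - + 2 * e)) + 1ℤ * (+ 4 * k - + 4 * c)
      i = solve-∀

-- The character (3/·)

alt-suc : ∀ x → alt (1ℤ + x) ≡ - alt x
alt-suc x = res≡ 2 (κ 1ℤ ⊕ v0 mod 2 ∷ v0 mod 2 ∷ []) (λ { (a ∷ _) → t± a }) (λ { (_ ∷ b ∷ []) → - t± b }) (x ∷ [])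

∏ : ℕ → (ℤ → ℤ) → ℤ
∏ zero F = 1ℤ
∏ (suc n) F = ∏ n F * F (+ suc n)

∏-cong : ∀ n {F G : ℤ → ℤ} → (∀ i → F i ≡ G i) → ∏ n F ≡ ∏ n G
∏-cong zero h = refl
∏-cong (suc n) h = cong₂ _*_ (∏-cong n h) (h (+ suc n))

∏-* : ∀ n (F G : ℤ → ℤ) → ∏ n (λ i → F i * G i) ≡ ∏ n F * ∏ n G
∏-* zero F G = refl
∏-* (suc n) F G = cong (_* (F (+ suc n) * G (+ suc n))) (∏-* n F G) ∙ i (∏ n F) (∏ n G) (F (+ suc n)) (G (+ suc n))
  where
  i : ∀ a b c d → a * b * (c * d) ≡ a * c * (b * d)
  i = solve-∀

∏-+ : ∀ m n (F : ℤ → ℤ) → ∏ (n ℕ.+ m) F ≡ ∏ m F * ∏ n (λ i → F (+ m + i))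
∏-+ m zero F = sym (ℤP.*-identityʳ (∏ m F))
∏-+ m (suc n) F = cong₂ _*_ (∏-+ m n F) (cong F (cong +_ (ℕP.+-comm (suc n) m))) ∙ ℤP.*-assoc (∏ m F) _ _

∏-front : ∀ n (F : ℤ → ℤ) → ∏ n (λ i → F (i - 1ℤ)) * F (+ n) ≡ F 0ℤ * ∏ n F
∏-front zero F = ℤP.*-comm 1ℤ (F 0ℤ)
∏-front (suc n) F = cong (λ t → ∏ n (λ i → F (i - 1ℤ)) * F t * F (+ suc n)) (k (+ n)) ∙ cong (_* F (+ suc n)) (∏-front n F) ∙ ℤP.*-assoc (F 0ℤ) (∏ n F) (F (+ suc n))
  where
  k : ∀ n → 1ℤ + n - 1ℤ ≡ n
  k = solve-∀

∏-reverse : ∀ n (F : ℤ → ℤ) c → ∏ n (λ i → F (c - i)) ≡ ∏ n (λ i → F (c - + n - 1ℤ + i))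
∏-reverse zero F c = refl
∏-reverse (suc n) F c = cong (_* F (c - + suc n)) (∏-reverse n F c) ∙ ℤP.*-comm (∏ n (λ i → F (c - + n - 1ℤ + i))) (F (c - + suc n))
  ∙ cong₂ _*_ (cong F (k₁ c (+ n))) (∏-cong n (λ i → cong F (k₂ c (+ n) i))) ∙ sym (front n (λ i → F (c - + suc n - 1ℤ + i)))
  where
  k₁ : ∀ c n → c - (1ℤ + n) ≡ c - (1ℤ + n) - 1ℤ + 1ℤ
  k₁ = solve-∀
  k₂ : ∀ c n i → c - n - 1ℤ + i ≡ c - (1ℤ + n) - 1ℤ + (1ℤ + i)
  k₂ = solve-∀
  front : ∀ n (F : ℤ → ℤ) → ∏ (suc n) F ≡ F 1ℤ * ∏ n (λ i → F (1ℤ + i))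
  front zero F = ℤP.*-comm 1ℤ (F 1ℤ)
  front (suc n) F = cong (_* F (+ suc (suc n))) (front n F) ∙ ℤP.*-assoc (F 1ℤ) _ _

∏-triple : ∀ n (F : ℤ → ℤ) → ∏ (n ℕ.* 3) F ≡ ∏ n (λ i → F (+ 3 * i - + 2) * F (+ 3 * i - 1ℤ) * F (+ 3 * i))
∏-triple zero F = refl
∏-triple (suc n) F = cong (λ t → t * F (+ suc (n ℕ.* 3)) * F (+ suc (suc (n ℕ.* 3))) * F (+ suc (suc (suc (n ℕ.* 3))))) (∏-triple n F)
  ∙ j (∏ n F₃) (F (+ suc (n ℕ.* 3))) (F (+ suc (suc (n ℕ.* 3)))) (F (+ suc (suc (suc (n ℕ.* 3)))))
  ∙ cong₂ (λ t u → ∏ n F₃ * (t * u)) (cong₂ (λ t u → F t * F u) (e₁ (+ n)) (e₂ (+ n))) (cong F (e₃ (+ n)))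
  where
  F₃ : ℤ → ℤ
  F₃ i = F (+ 3 * i - + 2) * F (+ 3 * i - 1ℤ) * F (+ 3 * i)
  j : ∀ p a b c → p * a * b * c ≡ p * (a * b * c)
  j = solve-∀
  n3 : + (n ℕ.* 3) ≡ + n * + 3
  n3 = ℤP.pos-* n 3
  i₁ : ∀ n → 1ℤ + n * + 3 ≡ + 3 * (1ℤ + n) - + 2
  i₁ = solve-∀
  i₂ : ∀ n → + 2 + n * + 3 ≡ + 3 * (1ℤ + n) - 1ℤ
  i₂ = solve-∀
  i₃ : ∀ n → + 3 + n * + 3 ≡ + 3 * (1ℤ + n)
  i₃ = solve-∀
  e₁ : ∀ m → + suc (n ℕ.* 3) ≡ + 3 * (+ suc n) - + 2
  e₁ _ = cong (λ t → 1ℤ + t) n3 ∙ i₁ (+ n)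
  e₂ : ∀ m → + suc (suc (n ℕ.* 3)) ≡ + 3 * (+ suc n) - 1ℤ
  e₂ _ = cong (λ t → + 2 + t) n3 ∙ i₂ (+ n)
  e₃ : ∀ m → + suc (suc (suc (n ℕ.* 3))) ≡ + 3 * (+ suc n)
  e₃ _ = cong (λ t → + 3 + t) n3 ∙ i₃ (+ n)

∏-mod : ∀ P n (F G : ℤ → ℤ) → (∀ i → ∃ λ q → F i ≡ G i + q * P) → ∃ λ q → ∏ n F ≡ ∏ n G + q * P
∏-mod P zero F G h = 0ℤ , refl
∏-mod P (suc n) F G h with ∏-mod P n F G h | h (+ suc n)
... | q , e | r , e′ = q * G (+ suc n) + ∏ n G * r + q * r * P , (cong₂ _*_ e e′ ∙ i (∏ n G) (G (+ suc n)) q r P)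
  where
  i : ∀ a b q r P → (a + q * P) * (b + r * P) ≡ a * b + (q * b + a * r + q * r * P) * P
  i = solve-∀

fact : ℕ → ℤ
fact n = ∏ n (λ i → i)

∏-27 : ∀ n → ∏ n (λ _ → - + 27) ≡ alt (+ n) * + (3 ^ (n ℕ.* 3))
∏-27 zero = refl
∏-27 (suc n) = cong (_* - + 27) (∏-27 n) ∙ i (alt (+ n)) (+ (3 ^ (n ℕ.* 3)))
  ∙ cong₂ _*_ (sym (alt-suc (+ n))) (cong (λ t → + 3 * t) (cong (+ 3 *_) (sym (ℤP.pos-* 3 (3 ^ (n ℕ.* 3)))) ∙ sym (ℤP.pos-* 3 (3 ℕ.* 3 ^ (n ℕ.* 3)))) ∙ sym (ℤP.pos-* 3 (3 ℕ.* (3 ℕ.* 3 ^ (n ℕ.* 3)))))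
  where
  i : ∀ a x → a * x * - + 27 ≡ - a * (+ 3 * (+ 3 * (+ 3 * x)))
  i = solve-∀

-- Gauss's lemma for 3: modulo P = 6n ± 1 the factors 3i, 3i - 1, 3i - 2 of (3n)! are ±3 times a rearrangement of 1, …, 3n.
gauss₊ : ∀ n P → P ≡ + 6 * + n + 1ℤ → ∃ λ q → fact (n ℕ.* 3) ≡ alt (+ n) * + (3 ^ (n ℕ.* 3)) * fact (n ℕ.* 3) + q * P
gauss₊ n P refl = let (q , e) = ∏-mod P n _ _ factor in q , (∏-triple n (λ i → i) ∙ e ∙ cong (λ t → t + q * P) collect)
  where
  G : ℤ → ℤ
  -- Modulo 6n + 1 one has 3 (2n + i) ≡ 3i - 1 and 3 (2n + 1 - i) ≡ -(3i - 2); the three factors of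
  -- `G` run over 1..n, 2n+1..3n and n+1..2n.
  G i = - + 27 * (i * (+ n + + n + i) * (+ n + + n + 1ℤ - i))
  factor : ∀ i → ∃ λ q → (+ 3 * i - + 2) * (+ 3 * i - 1ℤ) * (+ 3 * i) ≡ G i + q * (+ 6 * + n + 1ℤ)
  factor i = + 3 * i * (+ 3 * (+ n + + n + i) + + 3 * (+ n + + n + 1ℤ - i) - (+ 6 * + n + 1ℤ)) , j i (+ n)
    where
    j : ∀ i n → (+ 3 * i - + 2) * (+ 3 * i - 1ℤ) * (+ 3 * i)
      ≡ - + 27 * (i * (n + n + i) * (n + n + 1ℤ - i)) + + 3 * i * (+ 3 * (n + n + i) + + 3 * (n + n + 1ℤ - i) - (+ 6 * n + 1ℤ)) * (+ 6 * n + 1ℤ)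
    j = solve-∀
  collect : ∏ n G ≡ alt (+ n) * + (3 ^ (n ℕ.* 3)) * fact (n ℕ.* 3)
  collect = ∏-* n (λ _ → - + 27) _ ∙ cong₂ _*_ (∏-27 n) (∏-* n (λ i → i * (+ n + + n + i)) (λ i → + n + + n + 1ℤ - i)
    ∙ cong₂ _*_ (∏-* n (λ i → i) (λ i → + n + + n + i)) (∏-reverse n (λ i → i) (+ n + + n + 1ℤ) ∙ ∏-cong n (j (+ n)))
    ∙ k (fact n) (∏ n (λ i → + n + + n + i)) (∏ n (λ i → + n + i))
    ∙ sym (cong fact (n3 n) ∙ ∏-+ (n ℕ.+ n) n (λ i → i) ∙ cong (_* ∏ n (λ i → + n + + n + i)) (∏-+ n n (λ i → i))))
    where
    j : ∀ n i → n + n + 1ℤ - n - 1ℤ + i ≡ n + i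
    j = solve-∀
    k : ∀ f x y → f * x * y ≡ f * y * x
    k = solve-∀
    n3 : ∀ n → n ℕ.* 3 ≡ n ℕ.+ (n ℕ.+ n)
    n3 n = ℕP.*-comm n 3 ∙ cong (λ t → n ℕ.+ (n ℕ.+ t)) (ℕP.+-identityʳ n)

-- Here the rearranged factors run over 1..n, n..2n-1 and 2n..3n-1, whose product is (3n)!/3. This
-- accounts for the factor 3, which lowers the exponent from 3n to (P - 1)/2 = 3n - 1.
gauss₋ : ∀ n P → P ≡ + 6 * + suc n - 1ℤ → ∃ λ q → + 3 * fact (suc n ℕ.* 3) ≡ alt (+ suc n) * + (3 ^ (suc n ℕ.* 3)) * fact (suc n ℕ.* 3) + q * P
gauss₋ n₀ P refl = let (q , e) = ∏-mod P n _ _ factor in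
  + 3 * q , (cong (+ 3 *_) (∏-triple n (λ i → i) ∙ e) ∙ ℤP.*-distribˡ-+ (+ 3) (∏ n G) (q * P) ∙ cong₂ _+_ collect (sym (ℤP.*-assoc (+ 3) q P)))
  where
  n = suc n₀
  N = + n
  G : ℤ → ℤ
  -- Modulo 6n - 1 one has 3 (2n - i) ≡ -(3i - 1) and 3 (2n - 1 + i) ≡ 3i - 2.
  G i = - + 27 * (i * (N + N - i) * (N + N - 1ℤ + i))
  factor : ∀ i → ∃ λ q → (+ 3 * i - + 2) * (+ 3 * i - 1ℤ) * (+ 3 * i) ≡ G i + q * (+ 6 * N - 1ℤ)
  factor i = + 3 * i * (+ 3 * (N + N - 1ℤ + i) + + 3 * (N + N - i) - (+ 6 * N - 1ℤ)) , j i N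
    where
    j : ∀ i n → (+ 3 * i - + 2) * (+ 3 * i - 1ℤ) * (+ 3 * i)
      ≡ - + 27 * (i * (n + n - i) * (n + n - 1ℤ + i)) + + 3 * i * (+ 3 * (n + n - 1ℤ + i) + + 3 * (n + n - i) - (+ 6 * n - 1ℤ)) * (+ 6 * n - 1ℤ)
    j = solve-∀
  p₁ p₂ : ℤ
  p₁ = ∏ n (λ i → N + N - 1ℤ - N + i)
  p₂ = ∏ n (λ i → N + N - 1ℤ + i)
  fact3 : fact (n ℕ.* 3) ≡ fact n * ∏ n (λ i → N + i) * ∏ n (λ i → N + N + i)
  fact3 = cong fact (ℕP.*-comm n 3 ∙ cong (λ t → n ℕ.+ (n ℕ.+ t)) (ℕP.+-identityʳ n)) ∙ ∏-+ (n ℕ.+ n) n (λ i → i) ∙ cong (_* ∏ n (λ i → N + N + i)) (∏-+ n n (λ i → i))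
  shift₁ : p₁ * (N + N) ≡ N * ∏ n (λ i → N + i)
  shift₁ = cong (_* (N + N)) (∏-cong n (k N)) ∙ ∏-front n (λ i → N + i) ∙ cong (_* ∏ n (λ i → N + i)) (ℤP.+-identityʳ N)
    where
    k : ∀ N i → N + N - 1ℤ - N + i ≡ N + (i - 1ℤ)
    k = solve-∀
  shift₂ : p₂ * (N + N + N) ≡ (N + N) * ∏ n (λ i → N + N + i)
  shift₂ = cong (_* (N + N + N)) (∏-cong n (k N)) ∙ ∏-front n (λ i → N + N + i) ∙ cong (_* ∏ n (λ i → N + N + i)) (ℤP.+-identityʳ (N + N))
    where
    k : ∀ N i → N + N - 1ℤ + i ≡ N + N + (i - 1ℤ)
    k = solve-∀
  three : + 3 * (fact n * p₁ * p₂) ≡ fact (n ℕ.* 3)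
  three = *-cancel (+ 2 * (N * N)) (pos* {+ 2} (pos-ℕ 1) (pos* (pos-ℕ n₀) (pos-ℕ n₀)))
    (k₁ N (fact n) p₁ p₂ ∙ cong₂ (λ u v → fact n * u * v) shift₁ shift₂ ∙ k₂ N (fact n) (∏ n (λ i → N + i)) (∏ n (λ i → N + N + i)) ∙ cong (+ 2 * (N * N) *_) (sym fact3))
    where
    k₁ : ∀ N f a b → + 2 * (N * N) * (+ 3 * (f * a * b)) ≡ f * (a * (N + N)) * (b * (N + N + N))
    k₁ = solve-∀
    k₂ : ∀ N f a b → f * (N * a) * ((N + N) * b) ≡ + 2 * (N * N) * (f * a * b)
    k₂ = solve-∀
  collect : + 3 * ∏ n G ≡ alt N * + (3 ^ (n ℕ.* 3)) * fact (n ℕ.* 3)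
  collect = cong (+ 3 *_) (∏-* n (λ _ → - + 27) _ ∙ cong₂ _*_ (∏-27 n) (∏-* n (λ i → i * (N + N - i)) (λ i → N + N - 1ℤ + i)
      ∙ cong (_* p₂) (∏-* n (λ i → i) (λ i → N + N - i) ∙ cong (fact n *_) (∏-reverse n (λ i → i) (N + N) ∙ ∏-cong n (k₁ N)))))
    ∙ k₂ (alt N * + (3 ^ (n ℕ.* 3))) (fact n * p₁ * p₂) ∙ cong (alt N * + (3 ^ (n ℕ.* 3)) *_) three
    where
    k₁ : ∀ N i → N + N - N - 1ℤ + i ≡ N + N - 1ℤ - N + i
    k₁ = solve-∀
    k₂ : ∀ a x → + 3 * (a * x) ≡ a * (+ 3 * x)
    k₂ = solve-∀

private
  divides-of : ∀ {p a b} (q : ℤ) → a ≡ b + q * + p → p ∣ ∣ a - b ∣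
  divides-of {p} {a} {b} q e = ℕV.divides ∣ q ∣ (cong ∣_∣ {a - b} {q * + p} (lc 1ℤ e (i a b (q * + p))) ∙ ℤP.abs-* q (+ p))
    where
    i : ∀ a b x → a - b - x ≡ 1ℤ * (a - (b + x))
    i = solve-∀

  euclid : ∀ {p} → Prime p → ∀ a b → p ∣ ∣ a * b ∣ → ¬ (p ∣ ∣ b ∣) → p ∣ ∣ a ∣
  euclid {p} pp a b h nb = case euclidsLemma ∣ a ∣ ∣ b ∣ pp (subst (p ∣_) (ℤP.abs-* a b) h) of λ { (inj₁ x) → x ; (inj₂ y) → ⊥-elim (nb y) }

  fact-coprime : ∀ {p} → Prime p → ∀ n → n ℕ.< p → ¬ (p ∣ ∣ fact n ∣)
  fact-coprime {p} pp zero lt h = ℕP.<⇒≱ (ℕ.nonTrivial⇒n>1 p {{prime⇒nonTrivial pp}}) (ℕV.∣⇒≤ h)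
  fact-coprime {p} pp (suc n) lt h = case euclidsLemma ∣ fact n ∣ (suc n) pp (subst (p ∣_) (ℤP.abs-* (fact n) (+ suc n)) h) of λ
    { (inj₁ x) → fact-coprime pp n (ℕP.<-trans (ℕP.n<1+n n) lt) x ; (inj₂ y) → ℕP.<⇒≱ lt (ℕV.∣⇒≤ y) }

  -- `legendre` answers -1 for every remainder other than 0 and 1. For ε = -1 it is thus enough to
  -- exclude these two, and p > 2 separates 1 from -1.
  legendre-of : ∀ j h ε → ε ≡ 1ℤ ⊎ ε ≡ - 1ℤ → suc j ≡ h ℕ.* 2 → 2 ℕ.< suc (suc j) → suc (suc j) ∣ ∣ ε * + (3 ^ h) - 1ℤ ∣ → legendre 3 j ≡ ε
  legendre-of j h ε sign e lt d = cong (λ k → val (3 ^ k)) (cong (ℕ._/ 2) e ∙ ℕD.m*n/n≡m h 2) ∙ go sign d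
    where
    p = suc (suc j)
    pick : ℕ → ℤ
    pick r = if r ℕ.≡ᵇ 0 then + 0 else (if r ℕ.≡ᵇ 1 then + 1 else - (+ 1))
    val : ℕ → ℤ
    val x = pick (x ℕ.% p)
    mod1 : ∀ {x} → p ∣ ∣ + x - 1ℤ ∣ → x ℕ.% p ≡ 1
    mod1 {zero} (ℕV.divides (suc (suc q)) ())
    mod1 {zero} (ℕV.divides (suc zero) ())
    mod1 {zero} (ℕV.divides zero ())
    mod1 {suc x} (ℕV.divides q eq) = cong (ℕ._% p) (cong suc (cong ∣_∣ (sym (i (+ x))) ∙ eq)) ∙ ℕD.[m+kn]%n≡m%n 1 q p ∙ ℕD.m<n⇒m%n≡m {p} {1} (ℕ.s≤s (ℕ.s≤s ℕ.z≤n))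
      where
      i : ∀ x → 1ℤ + x - 1ℤ ≡ x
      i = solve-∀
    modneg : ∀ {x} → p ∣ suc x → x ℕ.% p ≢ 0 × x ℕ.% p ≢ 1
    modneg {x} d = (λ z → bad 1 (ℕ.s≤s (ℕ.s≤s ℕ.z≤n)) (ℕV.∣m+n∣m⇒∣n (subst (p ∣_) (ℕP.+-comm 1 x) d) (ℕV.m%n≡0⇒n∣m x p z)))
                 , (λ z → bad 2 lt (two z))
      where
      bad : ∀ k → suc k ℕ.≤ p → .{{_ : ℕ.NonZero k}} → ¬ (p ∣ k)
      bad k lt d = ℕP.<⇒≱ lt (ℕV.∣⇒≤ d)
      two : x ℕ.% p ≡ 1 → p ∣ 2
      two z = ℕV.∣m+n∣m⇒∣n (subst (p ∣_) (cong suc (ℕD.m≡m%n+[m/n]*n x p ∙ cong (ℕ._+ x ℕ./ p ℕ.* p) z) ∙ ℕP.+-comm 2 (x ℕ./ p ℕ.* p)) d) (ℕV.n∣m*n (x ℕ./ p))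
    go : ε ≡ 1ℤ ⊎ ε ≡ - 1ℤ → p ∣ ∣ ε * + (3 ^ h) - 1ℤ ∣ → val (3 ^ h) ≡ ε
    go (inj₁ refl) d = cong pick (mod1 {3 ^ h} (subst (λ t → p ∣ ∣ t - 1ℤ ∣) (ℤP.*-identityˡ (+ (3 ^ h))) d))
    go (inj₂ refl) d = neg (3 ^ h ℕ.% p) (modneg {3 ^ h} (subst (p ∣_) (cong ∣_∣ (i (+ (3 ^ h))) ∙ ℤP.∣-i∣≡∣i∣ (1ℤ + + (3 ^ h))) d))
      where
      i : ∀ x → - 1ℤ * x - 1ℤ ≡ - (1ℤ + x)
      i = solve-∀
      neg : ∀ r → r ≢ 0 × r ≢ 1 → pick r ≡ - 1ℤ
      neg zero (a , _) = ⊥-elim (a refl)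
      neg (suc zero) (_ , b) = ⊥-elim (b refl)
      neg (suc (suc r)) _ = refl

  alt-sign : ∀ x → alt x ≡ 1ℤ ⊎ alt x ≡ - 1ℤ
  alt-sign x = by-residues 2 (v0 mod 2 ∷ []) {λ { (a ∷ []) → t± a ≡ 1ℤ ⊎ t± a ≡ - 1ℤ }} (λ { (a ∷ []) → (t± a ℤ.≟ 1ℤ) ⊎-dec (t± a ℤ.≟ - 1ℤ) }) (x ∷ [])

  χ12-6₊ : ∀ x → χ12 (+ 6 * x + 1ℤ) ≡ alt x
  χ12-6₊ x = res≡ 12 (κ (+ 6) ⊗ v0 ⊕ κ 1ℤ mod 12 ∷ v0 mod 2 ∷ []) (λ { (a ∷ _) → t12 a }) (λ { (_ ∷ b ∷ []) → t± b }) (x ∷ [])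

  χ12-6₋ : ∀ x → χ12 (+ 6 * x - 1ℤ) ≡ alt x
  χ12-6₋ x = res≡ 12 (κ (+ 6) ⊗ v0 ⊖ κ 1ℤ mod 12 ∷ v0 mod 2 ∷ []) (λ { (a ∷ _) → t12 a }) (λ { (_ ∷ b ∷ []) → t± b }) (x ∷ [])

-- Write p = 6k ± 1. Cancelling the factorial, which is prime to p, from Gauss's congruence leaves
-- (-1)^k 3^((p-1)/2) ≡ 1, and χ₁₂(6k ± 1) = (-1)^k.
legendre-3 : ∀ j → Prime (suc (suc j)) → Odd (+ suc (suc j)) → ¬ Div 2 (+ suc (suc j)) → legendre 3 j ≡ χ12 (+ suc (suc j))
legendre-3 j pp o ¬3 = split (by-residues 6 (v0 mod 6 ∷ v0 mod 2 ∷ v0 mod 3 ∷ []) {λ { (a ∷ b ∷ c ∷ []) → b ≡ 1 → c ≢ 0 → a ≡ 1 ⊎ a ≡ 5 }}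
    (λ { (a ∷ b ∷ c ∷ []) → (b ℕ.≟ 1) →-dec (¬? (c ℕ.≟ 0) →-dec ((a ℕ.≟ 1) ⊎-dec (a ℕ.≟ 5))) }) (+ p ∷ []) o ¬3)
  where
  p k : ℕ
  p = suc (suc j)
  k = p ℕ./ 6
  2<p : ∀ j → Odd (+ suc (suc j)) → 2 ℕ.< suc (suc j)
  2<p zero ()
  2<p (suc j) _ = ℕ.s≤s (ℕ.s≤s (ℕ.s≤s ℕ.z≤n))
  div-mod : ∀ r → p ℕ.% 6 ≡ r → p ≡ r ℕ.+ k ℕ.* 6
  div-mod r e = ℕD.m≡m%n+[m/n]*n p 6 ∙ cong (ℕ._+ k ℕ.* 6) e
  k*6 : ∀ k → k ℕ.* 6 ≡ k ℕ.* 3 ℕ.* 2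
  k*6 k = sym (ℕP.*-assoc k 3 2)
  3<p : ¬ (p ∣ 3)
  3<p d = ¬3 (cong (ℕ._% 3) (ℕP.≤-antisym (ℕV.∣⇒≤ d) (2<p j o)))
  split : (+ p) %ℕ 6 ≡ 1 ⊎ (+ p) %ℕ 6 ≡ 5 → legendre 3 j ≡ χ12 (+ p)
  split (inj₁ r) = legendre-of j (k ℕ.* 3) (alt (+ k)) (alt-sign (+ k)) (ℕP.suc-injective (div-mod 1 r) ∙ k*6 k) (2<p j o) divs
      ∙ sym (cong χ12 P≡ ∙ χ12-6₊ (+ k))
    where
    P≡ : + p ≡ + 6 * + k + 1ℤ
    P≡ = cong +_ (div-mod 1 r) ∙ cong (λ t → 1ℤ + t) (ℤP.pos-* k 6) ∙ i (+ k)
      where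
      i : ∀ k → 1ℤ + k * + 6 ≡ + 6 * k + 1ℤ
      i = solve-∀
    F Y : ℤ
    F = fact (k ℕ.* 3)
    Y = alt (+ k) * + (3 ^ (k ℕ.* 3))
    divs : p ∣ ∣ Y - 1ℤ ∣
    divs = let (q , e) = gauss₊ k (+ p) P≡ in euclid pp (Y - 1ℤ) F (subst (λ t → p ∣ ∣ t ∣) (i Y F) (divides-of {a = Y * F} {b = F} (- q) (lc (- 1ℤ) e (i′ Y F q (+ p)))))
      (fact-coprime pp (k ℕ.* 3) (ℕP.≤-trans (ℕ.s≤s (ℕP.≤-trans (ℕP.m≤m*n (k ℕ.* 3) 2) (ℕP.≤-reflexive (sym (k*6 k))))) (ℕP.≤-reflexive (sym (div-mod 1 r)))))
      where
      i : ∀ Y F → Y * F - F ≡ (Y - 1ℤ) * F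
      i = solve-∀
      i′ : ∀ Y F q P → Y * F - (F + - q * P) ≡ - 1ℤ * (F - (Y * F + q * P))
      i′ = solve-∀
  split (inj₂ r) = legendre-of j h (alt (+ suc k)) (alt-sign (+ suc k)) (ℕP.suc-injective (div-mod 5 r) ∙ cong (λ t → suc (suc (suc (suc t)))) (k*6 k)) (2<p j o) divs
      ∙ sym (cong χ12 P≡ ∙ χ12-6₋ (+ suc k))
    where
    h : ℕ
    h = suc (suc (k ℕ.* 3))
    P≡ : + p ≡ + 6 * + suc k - 1ℤ
    P≡ = cong +_ (div-mod 5 r) ∙ cong (λ t → + 5 + t) (ℤP.pos-* k 6) ∙ i (+ k)
      where
      i : ∀ k → + 5 + k * + 6 ≡ + 6 * (1ℤ + k) - 1ℤ
      i = solve-∀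
    F Y : ℤ
    F = fact (suc k ℕ.* 3)
    Y = alt (+ suc k) * + (3 ^ h)
    ¬3F : ¬ (p ∣ ∣ + 3 * F ∣)
    ¬3F d = fact-coprime pp (suc k ℕ.* 3)
      (ℕP.≤-trans (ℕ.s≤s (ℕ.s≤s (ℕ.s≤s (ℕ.s≤s (ℕP.≤-trans (ℕP.m≤m*n (k ℕ.* 3) 2) (ℕP.≤-trans (ℕP.≤-reflexive (sym (k*6 k))) (ℕP.n≤1+n (k ℕ.* 6)))))))) (ℕP.≤-reflexive (sym (div-mod 5 r))))
      (euclid pp F (+ 3) (subst (λ t → p ∣ ∣ t ∣) (ℤP.*-comm (+ 3) F) d) 3<p)
    divs : p ∣ ∣ Y - 1ℤ ∣
    divs = let (q , e) = gauss₋ k (+ p) P≡ in euclid pp (Y - 1ℤ) (+ 3 * F)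
      (subst (λ t → p ∣ ∣ t ∣) (i Y F) (divides-of {a = Y * + 3 * F} {b = + 3 * F} (- q)
        (lc (- 1ℤ) (e ∙ cong (λ t → alt (+ suc k) * t * F + q * + p) (ℤP.pos-* 3 (3 ^ h))) (i′ (alt (+ suc k)) (+ (3 ^ h)) F q (+ p))))) ¬3F
      where
      i : ∀ Y F → Y * + 3 * F - + 3 * F ≡ (Y - 1ℤ) * (+ 3 * F)
      i = solve-∀
      i′ : ∀ a h F q P → a * h * + 3 * F - (+ 3 * F + - q * P) ≡ - 1ℤ * (+ 3 * F - (a * (+ 3 * h) * F + q * P))
      i′ = solve-∀

-- The Kronecker symbol (3/m) for m prime to 6

private
  -- The invariant m ≤ f + j + 1 contradicts 2 + j ≤ m once the fuel is spent, so the search stops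
  -- at a divisor. Roughness of m below that divisor makes it prime.
  minDiv-spec : ∀ f j m → suc (suc j) Rough m → suc (suc j) ℕ.≤ m → m ℕ.≤ suc (f ℕ.+ j) →
    suc (suc (minDivAux f j m)) ∣ m × suc (suc (minDivAux f j m)) Rough m
  minDiv-spec zero j m r lo hi = ⊥-elim (ℕP.<⇒≱ lo hi)
  minDiv-spec (suc f) j m r lo hi = step (m ℕ.% suc (suc j)) refl
    where
    step : ∀ x → m ℕ.% suc (suc j) ≡ x → let z = if x ℕ.≡ᵇ 0 then j else minDivAux f (suc j) m in suc (suc z) ∣ m × suc (suc z) Rough m
    step zero e = ℕV.m%n≡0⇒n∣m m (suc (suc j)) e , r
    step (suc x) e = minDiv-spec f (suc j) m (∤⇒rough-suc ndiv r)
        (ℕP.≤∧≢⇒< lo (λ eq → ndiv (subst (suc (suc j) ∣_) eq ℕV.∣-refl)))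
        (ℕP.≤-trans hi (ℕP.≤-reflexive (cong suc (sym (ℕP.+-suc f j)))))
      where
      ndiv : ¬ (suc (suc j) ∣ m)
      ndiv d = case sym e ∙ ℕV.n∣m⇒m%n≡0 m (suc (suc j)) d of λ ()

coprime6 : ∀ x y → Odd (x * y) → ¬ Div 2 (x * y) → (Odd x × ¬ Div 2 x) × (Odd y × ¬ Div 2 y)
coprime6 x y = by-residues 6 (v0 ⊗ v1 mod 2 ∷ v0 ⊗ v1 mod 3 ∷ v0 mod 2 ∷ v0 mod 3 ∷ v1 mod 2 ∷ v1 mod 3 ∷ [])
  {λ { (a ∷ b ∷ c ∷ d ∷ e ∷ f ∷ []) → a ≡ 1 → b ≢ 0 → (c ≡ 1 × d ≢ 0) × (e ≡ 1 × f ≢ 0) }}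
  (λ { (a ∷ b ∷ c ∷ d ∷ e ∷ f ∷ []) → (a ℕ.≟ 1) →-dec (¬? (b ℕ.≟ 0) →-dec (((c ℕ.≟ 1) ×-dec ¬? (d ℕ.≟ 0)) ×-dec ((e ℕ.≟ 1) ×-dec ¬? (f ℕ.≟ 0)))) }) (x ∷ y ∷ [])

χ12-* : ∀ x y → χ12 (x * y) ≡ χ12 x * χ12 y
χ12-* x y = res≡ 12 (v0 ⊗ v1 mod 12 ∷ v0 mod 12 ∷ v1 mod 12 ∷ []) (λ { (a ∷ _) → t12 a }) (λ { (_ ∷ b ∷ c ∷ []) → t12 b * t12 c }) (x ∷ y ∷ [])

-- `kronAux` splits off the least prime factor and χ₁₂ is multiplicative. The prime 2 cannot occur
-- because m is odd, so every local factor is given by `legendre-3`.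
kronecker-χ12 : ∀ m → 1 ℕ.≤ m → Odd (+ m) → ¬ Div 2 (+ m) → kronecker 3 m ≡ χ12 (+ m)
kronecker-χ12 m = go m m ℕP.≤-refl
  where
  go : ∀ f m → m ℕ.≤ f → 1 ℕ.≤ m → Odd (+ m) → ¬ Div 2 (+ m) → kronAux 3 f m ≡ χ12 (+ m)
  go zero zero _ ()
  go (suc f) (suc zero) _ _ _ _ = refl
  go (suc f) m@(suc (suc m₀)) (ℕ.s≤s le) _ o ¬3 = factor (minDiv m) (minDiv-spec m 0 m 2-rough (ℕ.s≤s (ℕ.s≤s ℕ.z≤n)) (ℕP.≤-trans (ℕP.n≤1+n m) (ℕP.≤-reflexive (cong suc (sym (ℕP.+-identityʳ m))))))
    where
    factor : ∀ j → suc (suc j) ∣ m × suc (suc j) Rough m →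
      (if j ℕ.≡ᵇ 0 then kron2 3 else legendre 3 j) * kronAux 3 f (m ℕ./ suc (suc j)) ≡ χ12 (+ m)
    factor j (d@(ℕV.divides q eq) , r) = cong₂ _*_ (sym-part j (rough∧∣⇒prime r d) (proj₁ copr)) (cong (kronAux 3 f) (cong (ℕ._/ p) eq ∙ ℕD.m*n/n≡m q p)
        ∙ go f q q≤f 1≤q (proj₁ (proj₂ copr)) (proj₂ (proj₂ copr)))
      ∙ sym (cong χ12 m≡ ∙ χ12-* (+ p) (+ q))
      where
      p = suc (suc j)
      m≡ : + m ≡ + p * + q
      m≡ = cong +_ (eq ∙ ℕP.*-comm q p) ∙ ℤP.pos-* p q
      copr = coprime6 (+ p) (+ q) (cong (_%ℕ 2) (sym m≡) ∙ o) (λ e → ¬3 (cong (_%ℕ 3) m≡ ∙ e))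
      1≤q : 1 ℕ.≤ q
      1≤q = pos-q q eq
        where
        pos-q : ∀ q → m ≡ q ℕ.* p → 1 ℕ.≤ q
        pos-q zero ()
        pos-q (suc q) _ = ℕ.s≤s ℕ.z≤n
      q≤f : q ℕ.≤ f
      q≤f = ℕP.≤-pred (ℕP.≤-trans (ℕP.≤-trans (grow q 1≤q) (ℕP.≤-reflexive (sym eq))) (ℕ.s≤s le))
        where
        grow : ∀ q → 1 ℕ.≤ q → q ℕ.< q ℕ.* p
        grow (suc q) _ = ℕP.m<m*n (suc q) p (ℕ.s≤s (ℕ.s≤s ℕ.z≤n))
      sym-part : ∀ j → Prime (suc (suc j)) → Odd (+ suc (suc j)) × ¬ Div 2 (+ suc (suc j)) → (if j ℕ.≡ᵇ 0 then kron2 3 else legendre 3 j) ≡ χ12 (+ suc (suc j))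
      sym-part zero _ (() , _)
      sym-part (suc j) pp (o , ¬3) = legendre-3 (suc j) pp o ¬3

-- Divisor sums, representation sums and triangular numbers as in the statement

private
  range-enum : ∀ M → Enum (λ a → 1 ℕ.≤ a × a ℕ.≤ M)
  range-enum M = record
    { list = range1 M
    ; unique = UP.applyUpTo⁺₁ suc M (λ i<j _ e → ℕP.<⇒≢ i<j (ℕP.suc-injective e))
    ; sound = λ a∈ → case ∈-applyUpTo⁻ suc a∈ of λ { (i , i<M , refl) → ℕ.s≤s ℕ.z≤n , i<M }
    ; complete = λ { {suc a} (_ , a≤M) → ∈-applyUpTo⁺ suc a≤M }
    }

  divisor-enum : ∀ m → 1 ℕ.≤ m → Enum (λ d → d ∣ m)
  divisor-enum m 1≤m = record
    { list = filter (λ d → d ℕV.∣? m) (range1 m)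
    ; unique = UP.filter⁺ (λ d → d ℕV.∣? m) (unique (range-enum m))
    ; sound = λ d∈ → proj₂ (∈-filter⁻ (λ d → d ℕV.∣? m) {xs = range1 m} d∈)
    ; complete = λ {d} d∣m → ∈-filter⁺ (λ d → d ℕV.∣? m) (complete (range-enum m) (pos d d∣m , ℕV.∣⇒≤ {{ℕ.>-nonZero 1≤m}} d∣m)) d∣m
    }
    where
    pos : ∀ d → d ∣ m → 1 ℕ.≤ d
    pos zero d = ⊥-elim (ℕP.<⇒≢ 1≤m (sym (ℕV.0∣⇒≡0 d)))
    pos (suc d) _ = ℕ.s≤s ℕ.z≤n

  ¬3⇒¬Div : ∀ m → ¬ (3 ∣ m) → ¬ Div 2 (+ m)
  ¬3⇒¬Div m h e = h (ℕV.m%n≡0⇒n∣m m 3 e)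

  E₁-divisors : ∀ m → 1 ℕ.≤ m → Odd (+ m) → ¬ Div 2 (+ m) → E₁ (+ m) ≡ sumDivisors m (λ d → + d * kronecker 3 d)
  E₁-divisors m 1≤m o ¬3 = sym (sym (∑-list (divisor-enum m 1≤m) (λ d → + d * kronecker 3 d))
    ∙ sym (∑-bij (Dv-enum 1+ (+ m)) (divisor-enum m 1≤m) (λ (e , D) → ∣ D ∣) (λ d → + quot d , + d)
        (λ { (e , D) ((pe , pD) , eq) → ℕV.divides ∣ e ∣ (cong ∣_∣ (sym eq ∙ ℤP.*-identityˡ (e * D)) ∙ ℤP.abs-* e D) })
        (λ d d∣m → (pos-of (quot d) (λ z → m≢0 (sym (quot-eq d d∣m) ∙ cong (ℕ._* d) z)) , pos-of d (λ z → m≢0 (sym (quot-eq d d∣m) ∙ cong (quot d ℕ.*_) z ∙ ℕP.*-zeroʳ (quot d)))) ,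
          (ℤP.*-identityˡ (+ quot d * + d) ∙ sym (ℤP.pos-* (quot d) d) ∙ cong +_ (quot-eq d d∣m)))
        (λ { (e , D) ((pe , pD) , eq) → back e D pe pD eq })
        (λ _ _ → refl)
        (λ { (e , D) ((pe , pD) , eq) → term e D pD eq })))
    where
    m≢0 : m ≢ 0
    m≢0 e = ℕP.<⇒≢ 1≤m (sym e)
    quot : ℕ → ℕ
    quot zero = 0
    quot d@(suc _) = m ℕ./ d
    quot-eq : ∀ d → d ∣ m → quot d ℕ.* d ≡ m
    quot-eq zero d = sym (ℕV.0∣⇒≡0 d)
    quot-eq d@(suc _) (ℕV.divides q eq) = cong (ℕ._* d) (cong (ℕ._/ d) eq ∙ ℕD.m*n/n≡m q d) ∙ sym eq
    pos-of : ∀ k → k ≢ 0 → Pos (+ k)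
    pos-of zero h = ⊥-elim (h refl)
    pos-of (suc k) _ = pos-ℕ k
    back : ∀ e D → Pos e → Pos D → 1ℤ * (e * D) ≡ + m → (+ quot ∣ D ∣ , + ∣ D ∣) ≡ (e , D)
    back (+ e) (+ suc D) _ _ eq = cong (λ q → + q , + suc D) (cong (ℕ._/ suc D) (ℤP.+-injective (sym eq ∙ ℤP.*-identityˡ (+ e * + suc D) ∙ sym (ℤP.pos-* e (suc D)))) ∙ ℕD.m*n/n≡m e (suc D))
    back (+ e) (+ zero) _ (ℤ.+<+ ())
    term : ∀ e D → Pos D → 1ℤ * (e * D) ≡ + m → D * χ12 D ≡ + ∣ D ∣ * kronecker 3 ∣ D ∣
    term e (+ zero) (ℤ.+<+ ())
    term e (+ suc D) _ eq = cong (+ suc D *_) (sym (kronecker-χ12 (suc D) (ℕ.s≤s ℕ.z≤n) (proj₁ (proj₂ copr)) (proj₂ (proj₂ copr))))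
      where
      eD : e * + suc D ≡ + m
      eD = sym (ℤP.*-identityˡ (e * + suc D)) ∙ eq
      copr = coprime6 e (+ suc D) (cong (_%ℕ 2) eD ∙ o) (λ z → ¬3 (cong (_%ℕ 3) (sym eD) ∙ z))

  -- If d D = m is prime to 6, then χ₁₂(D)² = 1 and hence χ₁₂(d) = χ₁₂(m) χ₁₂(D).
  E₂-χ12 : ∀ m → Odd m → ¬ Div 2 m → E₂ m ≡ χ12 m * E₁ m
  E₂-χ12 m o ¬3 = ∑-cong (Dv-enum 1+ m) (λ (d , D) (_ , eq) → term d D (sym (ℤP.*-identityˡ (d * D)) ∙ eq)) ∙ ∑-* (Dv-enum 1+ m) (χ12 m) (λ (d , D) → D * χ12 D)
    where
    term : ∀ d D → d * D ≡ m → D * χ12 d ≡ χ12 m * (D * χ12 D)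
    term d D refl = cong (D *_) (sym (ℤP.*-identityʳ (χ12 d)) ∙ cong (χ12 d *_) (sym (unit (proj₁ (proj₂ copr)) (proj₂ (proj₂ copr)))))
        ∙ i D (χ12 d) (χ12 D) ∙ cong (_* (D * χ12 D)) (sym (χ12-* d D))
      where
      copr = coprime6 d D o ¬3
      unit : Odd D → ¬ Div 2 D → χ12 D * χ12 D ≡ 1ℤ
      unit = by-residues 12 (v0 mod 12 ∷ v0 mod 2 ∷ v0 mod 3 ∷ []) {λ { (a ∷ b ∷ c ∷ []) → b ≡ 1 → c ≢ 0 → t12 a * t12 a ≡ 1ℤ }}
        (λ { (a ∷ b ∷ c ∷ []) → (b ℕ.≟ 1) →-dec (¬? (c ℕ.≟ 0) →-dec (t12 a * t12 a ℤ.≟ 1ℤ)) }) (D ∷ [])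
      i : ∀ D x y → D * (x * (y * y)) ≡ x * y * (D * y)
      i = solve-∀

  3^-step : ∀ β m → + (3 ^ suc β ℕ.* m) ≡ + 3 * + (3 ^ β ℕ.* m)
  3^-step β m = cong +_ (ℕP.*-assoc 3 (3 ^ β) m) ∙ ℤP.pos-* 3 (3 ^ β ℕ.* m)

  E₁-3^ : ∀ β m → E₁ (+ (3 ^ β ℕ.* m)) ≡ E₁ (+ m)
  E₁-3^ zero m = cong (λ k → E₁ (+ k)) (ℕP.*-identityˡ m)
  E₁-3^ (suc β) m = cong E₁ (3^-step β m) ∙ E₁-3· (+ (3 ^ β ℕ.* m)) ∙ E₁-3^ β m

  E₂-3^ : ∀ β m → E₂ (+ (3 ^ β ℕ.* m)) ≡ + (3 ^ β) * E₂ (+ m)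
  E₂-3^ zero m = cong (λ k → E₂ (+ k)) (ℕP.*-identityˡ m) ∙ sym (ℤP.*-identityˡ (E₂ (+ m)))
  E₂-3^ (suc β) m = cong E₂ (3^-step β m) ∙ E₂-3· (+ (3 ^ β ℕ.* m)) ∙ cong (+ 3 *_) (E₂-3^ β m) ∙ sym (ℤP.*-assoc (+ 3) (+ (3 ^ β)) (E₂ (+ m)))
    ∙ cong (_* E₂ (+ m)) (sym (ℤP.pos-* 3 (3 ^ β)))

  sgnPow-alt : ∀ k → sgnPow k ≡ alt (+ k)
  sgnPow-alt zero = refl
  sgnPow-alt (suc k) = cong -_ (sgnPow-alt k) ∙ sym (alt-suc (+ k))

  sgnPow-χ4 : ∀ a → Odd (+ a) → sgnPow ((a ℕ.∸ 1) ℕ./ 2) ≡ χ4 (+ a)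
  sgnPow-χ4 a o = cong (λ t → sgnPow ((t ℕ.∸ 1) ℕ./ 2)) a≡ ∙ cong sgnPow (ℕD.m*n/n≡m k 2) ∙ sgnPow-alt k ∙ key (+ k) ∙ cong χ4 (sym (cong +_ a≡ ∙ cong (λ t → 1ℤ + t) (ℤP.pos-* k 2)))
    where
    k : ℕ
    k = a ℕ./ 2
    a≡ : a ≡ suc (k ℕ.* 2)
    a≡ = ℕD.m≡m%n+[m/n]*n a 2 ∙ cong (ℕ._+ k ℕ.* 2) o
    key : ∀ k → alt k ≡ χ4 (1ℤ + k * + 2)
    key k = res≡ 4 (v0 mod 2 ∷ κ 1ℤ ⊕ v0 ⊗ κ (+ 2) mod 4 ∷ []) (λ { (a ∷ _) → t± a }) (λ { (_ ∷ b ∷ []) → t4 b }) (k ∷ [])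

  sum-concat : {B : Set} (h : B → List ℤ) (L : List B) → sumℤ (List.concatMap h L) ≡ sumℤ (map (sumℤ ∘ h) L)
  sum-concat h [] = refl
  sum-concat h (b ∷ L) = app (h b) (List.concatMap h L) ∙ +-congˡ {sumℤ (h b)} (sum-concat h L)
    where
    app : ∀ (xs ys : List ℤ) → sumℤ (xs ++ ys) ≡ sumℤ xs + sumℤ ys
    app [] ys = sym (ℤP.+-identityˡ (sumℤ ys))
    app (x ∷ xs) ys = +-congˡ {x} (app xs ys) ∙ sym (ℤP.+-assoc x (sumℤ xs) (sumℤ ys))

  -- `repSum` asks only for a to be odd; divisibility of a² + 3b² by 4 then makes b odd as well.
  -- Pairs that fail the test contribute 0, and positive solutions do not exceed the bound 4m.
  repSum-K⁺ : ∀ m → repSum (4 ℕ.* m) ≡ ∑ (K⁺-enum (+ m)) (λ (y , _) → y * χ4 y)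
  repSum-K⁺ m = sum-concat (λ a → map (λ b → F (a , b)) (range1 M)) (range1 M)
    ∙ sym (∑-dep R (λ _ → R) F ∙ ∑-cong R (λ a _ → ∑-list R (λ b → F (a , b))) ∙ ∑-list R (λ a → sumℤ (map (λ b → F (a , b)) (range1 M))))
    ∙ ∑-supp (depEnum R (λ _ → R)) G? F (λ (a , b) _ h → off (G? (a , b)) h)
    ∙ ∑-bij (restrict (depEnum R (λ _ → R)) G?) (K⁺-enum (+ m)) (λ (a , b) → + a , + b) (λ (y , z) → ∣ y ∣ , ∣ z ∣)
        (λ (a , b) (((1≤a , _) , (1≤b , _)) , (o , eq)) → (((o , odd-b a b o (eqℤ a b eq)) , eqℤ a b eq) , pos-of a 1≤a) , pos-of b 1≤b)
        (λ { (y , z) ((((oy , oz) , eq) , py) , pz) → to y z oy eq py pz })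
        (λ _ _ → refl)
        (λ { (y , z) ((_ , py) , pz) → cong₂ _,_ (ℤP.0≤i⇒+∣i∣≡i (pos⇒nn py)) (ℤP.0≤i⇒+∣i∣≡i (pos⇒nn pz)) })
        (λ (a , b) (_ , (o , eq)) → on (G? (a , b)) (o , eq) ∙ cong (_* + a) (sgnPow-χ4 a o) ∙ ℤP.*-comm (χ4 (+ a)) (+ a))
    where
    M : ℕ
    M = 4 ℕ.* m
    R = range-enum M
    F : ℕ × ℕ → ℤ
    F (a , b) = if (a ℕ.% 2 ℕ.≡ᵇ 1) ∧ (M ℕ.≡ᵇ a ℕ.* a ℕ.+ 3 ℕ.* (b ℕ.* b)) then sgnPow ((a ℕ.∸ 1) ℕ./ 2) * + a else + 0
    Good : ℕ × ℕ → Set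
    Good (a , b) = (a ℕ.% 2 ≡ 1) × (M ≡ a ℕ.* a ℕ.+ 3 ℕ.* (b ℕ.* b))
    G? : ∀ t → Dec (Good t)
    G? (a , b) = (a ℕ.% 2 ℕ.≟ 1) ×-dec (M ℕ.≟ a ℕ.* a ℕ.+ 3 ℕ.* (b ℕ.* b))
    on : ∀ {X : Set} {x y : ℤ} (d : Dec X) → X → (if does d then x else y) ≡ x
    on (yes _) _ = refl
    on (no h) x = ⊥-elim (h x)
    off : ∀ {X : Set} {x y : ℤ} (d : Dec X) → ¬ X → (if does d then x else y) ≡ y
    off (yes x) h = ⊥-elim (h x)
    off (no _) _ = refl
    pos-of : ∀ k → 1 ℕ.≤ k → Pos (+ k)
    pos-of (suc k) _ = pos-ℕ k
    eqℤ : ∀ a b → M ≡ a ℕ.* a ℕ.+ 3 ℕ.* (b ℕ.* b) → + a * + a + + 3 * (+ b * + b) ≡ + 4 * + m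
    eqℤ a b eq = cong₂ _+_ (sym (ℤP.pos-* a a)) (cong (+ 3 *_) (sym (ℤP.pos-* b b)) ∙ sym (ℤP.pos-* 3 (b ℕ.* b))) ∙ cong +_ (sym eq) ∙ ℤP.pos-* 4 m
    odd-b : ∀ a b → Odd (+ a) → + a * + a + + 3 * (+ b * + b) ≡ + 4 * + m → Odd (+ b)
    odd-b a b o eq = by-residues 4 (v0 ⊗ v0 ⊕ κ (+ 3) ⊗ (v1 ⊗ v1) mod 4 ∷ v0 mod 2 ∷ v1 mod 2 ∷ []) {λ { (a ∷ b ∷ c ∷ []) → a ≡ 0 → b ≡ 1 → c ≡ 1 }}
      (λ { (a ∷ b ∷ c ∷ []) → (a ℕ.≟ 0) →-dec ((b ℕ.≟ 1) →-dec (c ℕ.≟ 1)) }) (+ a ∷ + b ∷ []) (cong (_%ℕ 4) eq ∙ mul-Div 3 (+ m)) o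
    to : ∀ y z → Odd y → y * y + + 3 * (z * z) ≡ + 4 * + m → Pos y → Pos z →
      ((1 ℕ.≤ ∣ y ∣ × ∣ y ∣ ℕ.≤ M) × (1 ℕ.≤ ∣ z ∣ × ∣ z ∣ ℕ.≤ M)) × Good (∣ y ∣ , ∣ z ∣)
    to (+ zero) z _ _ (ℤ.+<+ ())
    to (+ suc a) (+ zero) _ _ _ (ℤ.+<+ ())
    to (+ suc a) (+ suc b) o eq _ _ = ((ℕ.s≤s ℕ.z≤n , le (suc a) (ℕP.m≤m+n _ _)) , (ℕ.s≤s ℕ.z≤n , le (suc b) (ℕP.≤-trans (ℕP.m≤n*m (suc b ℕ.* suc b) 3) (ℕP.m≤n+m _ (suc a ℕ.* suc a))))) , (o , eqℕ)
      where
      eqℕ : M ≡ suc a ℕ.* suc a ℕ.+ 3 ℕ.* (suc b ℕ.* suc b)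
      eqℕ = ℤP.+-injective (ℤP.pos-* 4 m ∙ sym eq)
      le : ∀ c → c ℕ.* c ℕ.≤ suc a ℕ.* suc a ℕ.+ 3 ℕ.* (suc b ℕ.* suc b) → c ℕ.≤ M
      le zero _ = ℕ.z≤n
      le (suc c) h = ℕP.≤-trans (ℕP.m≤m*n (suc c) (suc c)) (ℕP.≤-trans h (ℕP.≤-reflexive (sym eqℕ)))

  half-exact : ∀ m → (+ 2 * m) ℤ./ + 2 ≡ m
  half-exact m = div-pos-is-/ℕ (+ 2 * m) 2 ∙ mul-div 1 m

  tri-eq : ∀ x → + 2 * tri x ≡ x * (x - 1ℤ)
  tri-eq x = cong (+ 2 *_) (div-pos-is-/ℕ (x * (x - 1ℤ)) 2) ∙ div-eq 1 (x * (x - 1ℤ))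
    (by-residues 2 (v0 ⊗ (v0 ⊖ κ 1ℤ) mod 2 ∷ []) {λ { (a ∷ []) → a ≡ 0 }} (λ { (a ∷ []) → a ℕ.≟ 0 }) (x ∷ []))

  -- Completing the square: 8 times a(a - 1)/2 is (2a - 1)² - 1, and for the coefficient 4 the
  -- square becomes (4d - 2)². Conversely, x, z, w odd and N ≡ 1 (mod 8) force y ≡ 2 (mod 4), so
  -- every solution in `T` arises.
  module Triangular (n : ℕ) (N : ℤ) (N≡ : N ≡ + 8 * + n + + 9) (N≡1 : N %ℕ 8 ≡ 1) where
    φ ψ : ℤ⁴ → ℤ⁴
    φ (x , y , z , w) = (x + 1ℤ) /ℕ 2 , (z + 1ℤ) /ℕ 2 , (w + 1ℤ) /ℕ 2 , (y + + 2) /ℕ 4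
    ψ (a , b , c , d) = + 2 * a - 1ℤ , + 4 * d - + 2 , + 2 * b - 1ℤ , + 2 * c - 1ℤ

    poly : ∀ a b c d → R1 N (ψ (a , b , c , d)) → TSol 1 1 3 4 n (a , b , c , d)
    poly a b c d eq = *-cancel (+ 8) 8+ (lc2 (- 1ℤ) (eq ∙ N≡) (- + 4) (cong₂ _+_ (cong₂ _+_ (cong₂ _+_ (tri-eq a) (tri-eq b)) (cong (+ 3 *_) (tri-eq c))) (cong (+ 4 *_) (tri-eq d)))
        (i a b c d (tri a) (tri b) (tri c) (tri d) (+ n)))
      where
      i : ∀ a b c d ta tb tc td n → + 8 * n - + 8 * (1ℤ * ta + 1ℤ * tb + + 3 * tc + + 4 * td)
        ≡ - 1ℤ * ((+ 2 * a - 1ℤ) * (+ 2 * a - 1ℤ) + (+ 4 * d - + 2) * (+ 4 * d - + 2) + (+ 2 * b - 1ℤ) * (+ 2 * b - 1ℤ) + + 3 * ((+ 2 * c - 1ℤ) * (+ 2 * c - 1ℤ)) - (+ 8 * n + + 9))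
          + - + 4 * (+ 2 * ta + + 2 * tb + + 3 * (+ 2 * tc) + + 4 * (+ 2 * td) - (a * (a - 1ℤ) + b * (b - 1ℤ) + + 3 * (c * (c - 1ℤ)) + + 4 * (d * (d - 1ℤ))))
      i = solve-∀

    poly⁻ : ∀ a b c d → TSol 1 1 3 4 n (a , b , c , d) → R1 N (ψ (a , b , c , d))
    poly⁻ a b c d eq = lc2 (+ 8) (sym eq) (- + 4) (cong₂ _+_ (cong₂ _+_ (cong₂ _+_ (tri-eq a) (tri-eq b)) (cong (+ 3 *_) (tri-eq c))) (cong (+ 4 *_) (tri-eq d)))
        (i a b c d (tri a) (tri b) (tri c) (tri d) (+ n)) ∙ sym N≡
      where
      i : ∀ a b c d ta tb tc td n →
        (+ 2 * a - 1ℤ) * (+ 2 * a - 1ℤ) + (+ 4 * d - + 2) * (+ 4 * d - + 2) + (+ 2 * b - 1ℤ) * (+ 2 * b - 1ℤ) + + 3 * ((+ 2 * c - 1ℤ) * (+ 2 * c - 1ℤ)) - (+ 8 * n + + 9)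
        ≡ + 8 * (1ℤ * ta + 1ℤ * tb + + 3 * tc + + 4 * td - n)
          + - + 4 * (+ 2 * ta + + 2 * tb + + 3 * (+ 2 * tc) + + 4 * (+ 2 * td) - (a * (a - 1ℤ) + b * (b - 1ℤ) + + 3 * (c * (c - 1ℤ)) + + 4 * (d * (d - 1ℤ))))
      i = solve-∀

    odd-succ : ∀ x → Odd x → + 2 * ((x + 1ℤ) /ℕ 2) - 1ℤ ≡ x
    odd-succ x o = cong (_- 1ℤ) (div-eq 1 (x + 1ℤ) (by-residues 2 (v0 mod 2 ∷ v0 ⊕ κ 1ℤ mod 2 ∷ []) {λ { (a ∷ b ∷ []) → a ≡ 1 → b ≡ 0 }} (λ { (a ∷ b ∷ []) → (a ℕ.≟ 1) →-dec (b ℕ.≟ 0) }) (x ∷ []) o)) ∙ i x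
      where
      i : ∀ x → x + 1ℤ - 1ℤ ≡ x
      i = solve-∀

    ψφ : ∀ t → T N t → ψ (φ t) ≡ t
    ψφ (x , y , z , w) (eq , ox , oz , ow) = four (odd-succ x ox) y≡ (odd-succ z oz) (odd-succ w ow)
      where
      four : ∀ {a a′ b b′ c c′ d d′ : ℤ} → a ≡ a′ → b ≡ b′ → c ≡ c′ → d ≡ d′ → (a , b , c , d) ≡ (a′ , b′ , c′ , d′)
      four refl refl refl refl = refl
      y≡ : + 4 * ((y + + 2) /ℕ 4) - + 2 ≡ y
      y≡ = cong (_- + 2) (div-eq 3 (y + + 2) (by-residues 8 (v0 ⊗ v0 ⊕ v1 ⊗ v1 ⊕ v2 ⊗ v2 ⊕ κ (+ 3) ⊗ (v3 ⊗ v3) mod 8 ∷ v0 mod 2 ∷ v2 mod 2 ∷ v3 mod 2 ∷ v1 ⊕ κ (+ 2) mod 4 ∷ [])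
          {λ { (a ∷ x ∷ z ∷ w ∷ y ∷ []) → a ≡ 1 → x ≡ 1 → z ≡ 1 → w ≡ 1 → y ≡ 0 }}
          (λ { (a ∷ x ∷ z ∷ w ∷ y ∷ []) → (a ℕ.≟ 1) →-dec ((x ℕ.≟ 1) →-dec ((z ℕ.≟ 1) →-dec ((w ℕ.≟ 1) →-dec (y ℕ.≟ 0)))) }) (x ∷ y ∷ z ∷ w ∷ []) (cong (_%ℕ 8) eq ∙ N≡1) ox oz ow)) ∙ i y
        where
        i : ∀ y → y + + 2 - + 2 ≡ y
        i = solve-∀

    φψ : ∀ t → TSol 1 1 3 4 n t → φ (ψ t) ≡ t
    φψ (a , b , c , d) _ = four (h a) (h b) (h c) (cong (_/ℕ 4) (i d) ∙ mul-div 3 d)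
      where
      four : ∀ {a a′ b b′ c c′ d d′ : ℤ} → a ≡ a′ → b ≡ b′ → c ≡ c′ → d ≡ d′ → (a , b , c , d) ≡ (a′ , b′ , c′ , d′)
      four refl refl refl refl = refl
      j : ∀ x → + 2 * x - 1ℤ + 1ℤ ≡ + 2 * x
      j = solve-∀
      i : ∀ x → + 4 * x - + 2 + + 2 ≡ + 4 * x
      i = solve-∀
      h : ∀ x → (+ 2 * x - 1ℤ + 1ℤ) /ℕ 2 ≡ x
      h x = cong (_/ℕ 2) (j x) ∙ mul-div 1 x

    odd-2x-1 : ∀ x → Odd (+ 2 * x - 1ℤ)
    odd-2x-1 x = by-residues 2 (κ (+ 2) ⊗ v0 ⊖ κ 1ℤ mod 2 ∷ []) {λ { (a ∷ []) → a ≡ 1 }} (λ { (a ∷ []) → a ℕ.≟ 1 }) (x ∷ [])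

    φ-ok : ∀ t → T N t → TSol 1 1 3 4 n (φ t)
    φ-ok t@(x , y , z , w) p@(eq , _) = poly ((x + 1ℤ) /ℕ 2) ((z + 1ℤ) /ℕ 2) ((w + 1ℤ) /ℕ 2) ((y + + 2) /ℕ 4) (subst (R1 N) (sym (ψφ t p)) eq)

    ψ-ok : ∀ t → TSol 1 1 3 4 n t → T N (ψ t)
    ψ-ok (a , b , c , d) eq = poly⁻ a b c d eq , odd-2x-1 a , odd-2x-1 b , odd-2x-1 c

    solutions : Enum (TSol 1 1 3 4 n)
    solutions = mapEnum φ ψ φ-ok ψ-ok ψφ φψ (T-enum N)

    has-count : ∀ {V} → count (T-enum N) ≡ V → tIs 1 1 3 4 n V
    has-count h = list solutions , unique solutions , (λ q → mk⇔ (sound solutions) (complete solutions)) ,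
      (sym (∑-count solutions) ∙ sym (∑-bij (T-enum N) solutions φ ψ φ-ok ψ-ok ψφ φψ (λ _ _ → refl)) ∙ h)

theorem4p1 : (n : ℕ) → 1 ℕ.≤ n → (β n₁ : ℕ) → 1 ℕ.≤ n₁ →
    8 ℕ.* n ℕ.+ 9 ≡ 3 ^ β ℕ.* n₁ → ¬ (3 ∣ n₁) →
    tIs 1 1 3 4 n
    (((+ (3 ^ suc β) ℤ.* kronecker 3 n₁ - + 1)
    ℤ.* sumDivisors n₁ (λ d → + d ℤ.* kronecker 3 d))
    ℤ./ + 2
    - repSum (4 ℕ.* (8 ℕ.* n ℕ.+ 9)))
theorem4p1 n _ β n₁ 1≤n₁ eq 3∤n₁ = Triangular.has-count n N N≡ N≡1 value
  where
  m : ℕ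
  m = 8 ℕ.* n ℕ.+ 9
  N : ℤ
  N = + m
  N≡ : N ≡ + 8 * + n + + 9
  N≡ = cong (λ t → t + + 9) (ℤP.pos-* 8 n)
  N≡1 : N %ℕ 8 ≡ 1
  N≡1 = cong (_%ℕ 8) N≡ ∙ by-residues 8 (κ (+ 8) ⊗ v0 ⊕ κ (+ 9) mod 8 ∷ []) {λ { (a ∷ []) → a ≡ 1 }} (λ { (a ∷ []) → a ℕ.≟ 1 }) (+ n ∷ [])
  pN : Pos N
  pN = pos≡ (cong +_ (ℕP.+-comm 9 (8 ℕ.* n))) (pos-ℕ (8 ℕ.+ 8 ℕ.* n))
  odd-n₁ : Odd (+ n₁)
  odd-n₁ = by-residues 8 (v0 ⊗ v1 mod 8 ∷ v1 mod 2 ∷ []) {λ { (a ∷ b ∷ []) → a ≡ 1 → b ≡ 1 }} (λ { (a ∷ b ∷ []) → (a ℕ.≟ 1) →-dec (b ℕ.≟ 1) })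
    (+ (3 ^ β) ∷ + n₁ ∷ []) (cong (_%ℕ 8) (sym (ℤP.pos-* (3 ^ β) n₁) ∙ cong +_ (sym eq)) ∙ N≡1)
  ¬3 : ¬ Div 2 (+ n₁)
  ¬3 = ¬3⇒¬Div n₁ 3∤n₁
  s κ₁ r c : ℤ
  s = sumDivisors n₁ (λ d → + d * kronecker 3 d)
  κ₁ = kronecker 3 n₁
  r = repSum (4 ℕ.* m)
  c = count (T-enum N)
  e₁ : E₁ N ≡ s
  e₁ = cong (λ k → E₁ (+ k)) eq ∙ E₁-3^ β n₁ ∙ E₁-divisors n₁ 1≤n₁ odd-n₁ ¬3
  e₂ : E₂ N ≡ + (3 ^ β) * (κ₁ * s)
  e₂ = cong (λ k → E₂ (+ k)) eq ∙ E₂-3^ β n₁ ∙ cong (+ (3 ^ β) *_) (E₂-χ12 (+ n₁) odd-n₁ ¬3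
    ∙ cong₂ _*_ (sym (kronecker-χ12 n₁ 1≤n₁ odd-n₁ ¬3)) (E₁-divisors n₁ 1≤n₁ odd-n₁ ¬3))
  double : (+ (3 ^ suc β) * κ₁ - + 1) * s ≡ + 2 * (c + r)
  double = cong (λ t → (t * κ₁ - + 1) * s) (ℤP.pos-* 3 (3 ^ β))
    ∙ fin (+ (3 ^ β)) κ₁ s c r (AtOneModEight.T-count N N≡1 pN) e₁ e₂ (repSum-K⁺ m)
    where
    fin : ∀ p k s c r {E e r′} → + 2 * c ≡ + 3 * E - e - + 2 * r′ → e ≡ s → E ≡ p * (k * s) → r ≡ r′ → (+ 3 * p * k - + 1) * s ≡ + 2 * (c + r)
    fin p k s c r h refl refl refl = lc (- 1ℤ) h (i p k s c r)
      where
      i : ∀ p k s c r → (+ 3 * p * k - + 1) * s - + 2 * (c + r) ≡ - 1ℤ * (+ 2 * c - (+ 3 * (p * (k * s)) - s - + 2 * r))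
      i = solve-∀
  value : c ≡ ((+ (3 ^ suc β) * κ₁ - + 1) * s) ℤ./ + 2 - r
  -- The integer division is exact, because by `double` the dividend is twice `c + r`.
  value = sym (cong (λ t → t ℤ./ + 2 - r) double ∙ cong (_- r) (half-exact (c + r)) ∙ i c r)
    where
    i : ∀ c r → c + r - r ≡ c
    i = solve-∀
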